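{- Let $\mathrm{per}$ be the permanent, regarded as a graded p-family, and let $C$ be the graded p-family of parity-alternating elementary symmetric polynomials $$C_{n,d}=\sum_{\substack{1\le i_1<i_2<\cdots<i_d\le n\\ i_j\equiv j\ (\mathrm{mod}\ 2)\ \forall j}}x_{i_1}x_{i_2}\cdots x_{i_d}.$$ Then: (1) $\mathsf{VNP}\subseteq\overline{\mathsf{V3F}}$ implies $\mathrm{per}\trianglelefteq_{\text{p-homlin}}C$; (2) $\mathrm{per}\trianglelefteq_{\text{p-homlin}}C$ implies $\mathsf{VNP}\subseteq\overline{\mathsf{VF}}$; (3) $\mathsf{VNP}\subseteq\overline{\mathsf{VQP}}$ if and only if $\mathrm{per}\trianglelefteq_{\text{qp-homlin}}C$.
   Context: All polynomials are over $\mathbb{C}$ in the variables $x_1,x_2,\ldots$ (renamed as convenient); $\mathbb{S}=\mathbb{C}[x_1,x_2,\ldots]$. Bounds. A sequence $(m_n)_{n\in\mathbb N}$ of natural numbers is polynomially bounded if $m_n\le t(n)$ for all $n$, for some univariate polynomial $t$; it is quasipolynomially bounded if there is a polynomial $q$ with $m_n\le n^{q(\log_2 n)}$ for all $n\ge 2$. A function $m:\mathbb N\times\mathbb N\to\mathbb N$ is bivariately polynomially bounded if $m_{n,d}\le t(n,d)$ for some bivariate polynomial $t$ and all $n,d$. p-families. A p-family (ungraded) is a sequence $(g_n)_{n\in\mathbb N}$ of polynomials whose degree and number of occurring variables are polynomially bounded in $n$. A graded p-family is a map $f:\mathbb N\times\mathbb N\to\mathbb S$ such that the number of variables of $f_{n,d}$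 is bivariately polynomially bounded and each $f_{n,d}$ is zero or homogeneous of degree $d$. An ungraded p-family $g$ is regarded as a graded p-family by letting $g_{n,d}$ be the homogeneous degree $d$ component of $g_n$. In particular $\mathrm{per}_n=\sum_{\sigma\in\mathfrak S_n}\prod_{i=1}^n x_{i,\sigma(i)}$ becomes a graded p-family. Classes. An algebraic formula is a directed tree with a unique sink, sources labelled by affine linear polynomials, and internal nodes (of arity 2) labelled $+$ or $\times$; its size is its number of vertices. $\mathsf{VF}$ is the class of p-families $(f_n)$ whose minimal formula size is polynomially bounded. The permanental complexity of $f$ is the least $n$ such that $f$ is the permanent of an $n\times n$ matrix of affine linear polynomials; $\mathsf{VNP}$ is the class of p-families with polynomially bounded permanental complexity. $\mathsf{VQP}$ is the class of p-families with quasipolynomially bounded formula size (using circuit size instead gives the same class). An input-homogeneous-linear (IHL) formula over the arity 3 basis is a formula all of whose leaves are labelled by homogeneous linear polynomials (no constants), whose addition gates have arity 2 and whose product gates have arity exactly 3. A graded IHL formula over the arity 3 basis for a polynomial $f$ in $x_1,\ldots,x_m$ with homogeneous components $f_d$ is a formula of the syntactic form $$f=f(0)+\sum_{d\text{ odd}}f_d+\sum_{d\ge2\text{ even}}\tfrac1d\sum_{i=1}^m x_i\cdot\partial f_d/\partial x_i,$$ where each $f_d$ ($d$ odd) and each $\partial f_d/\partial x_i$ ($d$ even) is computed by an IHL formula over the arity 3 basis. $\mathsf{V3F}$ is the class of p-families for which the size of the smallest graded IHL formula over the arity 3 basis is polynomially bounded. For a complexity measure, the border complexity of $f$ is at most $k$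 if $f$ is a limit (in the Euclidean topology on coefficient vectors) of polynomials of complexity at most $k$. $\overline{\mathsf{VF}}$, $\overline{\mathsf{V3F}}$ are the classes of p-families whose border formula size, respectively border graded-IHL-arity-3 formula size, is polynomially bounded; $\overline{\mathsf{VQP}}$ is the class of p-families with quasipolynomially bounded border formula size. Reductions. For finite dimensional complex vector spaces $U,W$, $d>0$ and homogeneous degree $d$ polynomials $p\in\mathbb C[U]_d$, $q\in\mathbb C[W]_d$ (zero allowed), write $p\trianglelefteq_{\text{homlin}}q$ if $p\in\overline{\{q\circ A\mid A:U\to W\text{ linear}\}}$. For $d=0$, $p\trianglelefteq_{\text{homlin}}q$ holds for every nonzero $q$. For graded p-families $f,h$, write $f\trianglelefteq_{\text{p-homlin}}h$ if there is a polynomially bounded sequence $m$ with $f_{n,d}\trianglelefteq_{\text{homlin}}h_{m_n,d}$ for all $n,d$; $\trianglelefteq_{\text{qp-homlin}}$ is defined in the same way with $m$ only required to be quasipolynomially bounded. -}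

module Defs where

open import Data.Nat using (ℕ; zero; suc; _≤_; _<_; _<?_; _⊔_; _%_; z≤n; s≤s)
  renaming (_+_ to _+ⁿ_; _*_ to _*ⁿ_; _^_ to _^ⁿ_; _≟_ to _≟ⁿ_)
import Data.Nat.Properties as ℕₚ
open import Data.Nat.ListAction using (sum)
open import Data.Nat.Logarithm using (⌊log₂_⌋)
open import Data.Integer using (+_)
open import Data.Rational using (ℚ; 0ℚ; 1ℚ; ½; _/_; ∣_∣; 1/_; Positive; positive)
  renaming (_+_ to _+ʳ_; _*_ to _*ʳ_; _-_ to _-ʳ_; -_ to -ʳ_; _<_ to _<ʳ_; _≤_ to _≤ʳ_)
import Data.Rational.Properties as ℚₚ
open import Data.Rational.Solver using (module +-*-Solver)
open import Data.Fin using (Fin; toℕ; fromℕ<; combine)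
import Data.Fin.Properties as Finₚ
open import Data.List using (List; []; _∷_; [_]; _++_; map; foldr; filter; length; tabulate; allFin; upTo; cartesianProductWith)
import Data.List.Properties as Listₚ
open import Data.List.Membership.Propositional using (_∈_)
open import Data.List.Membership.Propositional.Properties using (∈-∃++; ∈-upTo⁺)
open import Data.List.Membership.DecPropositional _≟ⁿ_ using (_∈?_)
open import Data.List.Relation.Unary.All as All using (All; []; _∷_)
import Data.List.Relation.Unary.All.Properties as Allₚ
open import Data.List.Relation.Unary.Any using (here)
open import Data.List.Relation.Binary.Permutation.Propositional using (_↭_; ↭-refl; ↭-sym; ↭-trans; prep)
open import Data.List.Relation.Binary.Permutation.Propositional.Properties using (∈-resp-↭; shift; drop-∷; ↭-length; ¬x∷xs↭[]; All-resp-↭)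
open import Data.Vec as Vec using (Vec; lookup)
import Data.Vec.Relation.Unary.AllPairs as AllPairs
open import Data.Product using (∃; _×_; _,_; proj₁; proj₂)
open import Function using (_∘_)
open import Function.Definitions using (Injective)
open import Level using (0ℓ)
open import Relation.Nullary using (¬_; Dec; yes; no; ¬?; contradiction)
open import Relation.Nullary.Decidable using (_×-dec_; decidable-stable)
open import Relation.Unary using (Pred)
open import Relation.Binary.PropositionalEquality using (_≡_; refl; sym; trans; cong; cong₂; subst; setoid)

------------------------------------------------------------------------
-- Real numbers, as Cauchy sequences of rationals up to _≈ʳ_

Cauchy : (ℕ → ℚ) → Set
Cauchy x = ∀ ε → 0ℚ <ʳ ε → ∃ λ N → ∀ m n → N ≤ m → N ≤ n → ∣ x m -ʳ x n ∣ <ʳ ε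

record ℝ : Set where
  constructor mkℝ
  field
    seq    : ℕ → ℚ
    cauchy : Cauchy seq

open ℝ public

abs-split : ∀ a b {c} → c ≡ a +ʳ b → ∣ c ∣ ≤ʳ ∣ a ∣ +ʳ ∣ b ∣
abs-split a b refl = ℚₚ.∣p+q∣≤∣p∣+∣q∣ a b

half-pos : ∀ {ε} → 0ℚ <ʳ ε → 0ℚ <ʳ ½ *ʳ ε
half-pos {ε} p = subst (_<ʳ ½ *ʳ ε) (ℚₚ.*-zeroʳ ½) (ℚₚ.*-monoʳ-<-pos ½ p)

halves : ∀ ε → ½ *ʳ ε +ʳ ½ *ʳ ε ≡ ε
halves ε = trans (sym (ℚₚ.*-distribʳ-+ ε ½ ½)) (ℚₚ.*-identityˡ ε)

open +-*-Solver using (solve; _:=_; _:+_; _:-_; _:*_; :-_)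

interchange : ∀ a b c d → (a +ʳ c) -ʳ (b +ʳ d) ≡ (a -ʳ b) +ʳ (c -ʳ d)
interchange = solve 4 (λ a b c d → (a :+ c) :- (b :+ d) := (a :- b) :+ (c :- d)) refl

product-diff : ∀ a b c d → a *ʳ c -ʳ b *ʳ d ≡ a *ʳ (c -ʳ d) +ʳ d *ʳ (a -ʳ b)
product-diff = solve 4 (λ a b c d → a :* c :- b :* d := a :* (c :- d) :+ d :* (a :- b)) refl

neg-diff : ∀ a b → (-ʳ a) -ʳ (-ʳ b) ≡ -ʳ (a -ʳ b)
neg-diff = solve 2 (λ a b → (:- a) :- (:- b) := :- (a :- b)) refl

add-back : ∀ a b → a ≡ (a -ʳ b) +ʳ b
add-back = solve 2 (λ a b → a := (a :- b) :+ b) refl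

regroup : ∀ b c i ε → b *ʳ (i *ʳ ε) +ʳ c *ʳ (i *ʳ ε) ≡ (b +ʳ c) *ʳ i *ʳ ε
regroup = solve 4 (λ b c i ε → b :* (i :* ε) :+ c :* (i :* ε) := (b :+ c) :* i :* ε) refl

0<1 : 0ℚ <ʳ 1ℚ
0<1 = ℚₚ.positive⁻¹ 1ℚ

bounded : ∀ x → Cauchy x → ∃ λ B → 0ℚ <ʳ B × ∃ λ N → ∀ n → N ≤ n → ∣ x n ∣ ≤ʳ B
bounded x cx with cx 1ℚ 0<1
... | N , h = 1ℚ +ʳ ∣ x N ∣
            , ℚₚ.<-≤-trans 0<1 (subst (_≤ʳ 1ℚ +ʳ ∣ x N ∣) (ℚₚ.+-identityʳ 1ℚ)
                                      (ℚₚ.+-monoʳ-≤ 1ℚ (ℚₚ.0≤∣p∣ (x N))))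
            , N
            , λ n N≤n → ℚₚ.≤-trans (abs-split (x n -ʳ x N) (x N) (add-back (x n) (x N)))
                                   (ℚₚ.+-monoˡ-≤ ∣ x N ∣ (ℚₚ.<⇒≤ (h n N N≤n ℕₚ.≤-refl)))

const-cauchy : ∀ q → Cauchy (λ _ → q)
const-cauchy q ε 0<ε = 0 , λ _ _ _ _ → subst (λ z → ∣ z ∣ <ʳ ε) (sym (ℚₚ.+-inverseʳ q)) 0<ε

+-cauchy : ∀ x y → Cauchy x → Cauchy y → Cauchy (λ n → x n +ʳ y n)
+-cauchy x y cx cy ε 0<ε with cx (½ *ʳ ε) (half-pos 0<ε) | cy (½ *ʳ ε) (half-pos 0<ε)
... | M , f | N , g = M ⊔ N , λ m n p q →
  ℚₚ.≤-<-trans (abs-split (x m -ʳ x n) (y m -ʳ y n) (interchange (x m) (x n) (y m) (y n)))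
    (subst (∣ x m -ʳ x n ∣ +ʳ ∣ y m -ʳ y n ∣ <ʳ_) (halves ε)
      (ℚₚ.+-mono-< (f m n (ℕₚ.m⊔n≤o⇒m≤o M N p) (ℕₚ.m⊔n≤o⇒m≤o M N q))
                   (g m n (ℕₚ.m⊔n≤o⇒n≤o M N p) (ℕₚ.m⊔n≤o⇒n≤o M N q))))

neg-cauchy : ∀ x → Cauchy x → Cauchy (λ n → -ʳ x n)
neg-cauchy x cx ε 0<ε with cx ε 0<ε
... | N , f = N , λ m n p q →
  subst (_<ʳ ε) (sym (trans (cong ∣_∣ (neg-diff (x m) (x n))) (ℚₚ.∣-p∣≡∣p∣ (x m -ʳ x n)))) (f m n p q)

scaled : ∀ a b B δ → 0ℚ <ʳ B → ∣ a ∣ ≤ʳ B → ∣ b ∣ <ʳ δ → ∣ a *ʳ b ∣ <ʳ B *ʳ δ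
scaled a b B δ 0<B a≤B b<δ = ℚₚ.≤-<-trans
  (subst (_≤ʳ B *ʳ ∣ b ∣) (sym (ℚₚ.∣p*q∣≡∣p∣*∣q∣ a b))
     (ℚₚ.*-monoʳ-≤-nonNeg ∣ b ∣ {{ℚₚ.∣-∣-nonNeg b}} a≤B))
  (ℚₚ.*-monoʳ-<-pos B {{positive 0<B}} b<δ)

share : ∀ B C ε → 0ℚ <ʳ B → 0ℚ <ʳ C → 0ℚ <ʳ ε → ∃ λ δ → 0ℚ <ʳ δ × B *ʳ δ +ʳ C *ʳ δ ≡ ε
share B C ε 0<B 0<C 0<ε = divide (B +ʳ C) (positive (ℚₚ.+-mono-< 0<B 0<C)) refl
  where
  divide : ∀ D → Positive D → B +ʳ C ≡ D → ∃ λ δ → 0ℚ <ʳ δ × B *ʳ δ +ʳ C *ʳ δ ≡ ε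
  divide D D>0 eq = invert (1/ D) (ℚₚ.1/pos⇒pos D) (ℚₚ.*-inverseʳ D)
    where
    instance
      _ = D>0
      _ = ℚₚ.pos⇒nonZero D
    invert : ∀ i → Positive i → D *ʳ i ≡ 1ℚ → ∃ λ δ → 0ℚ <ʳ δ × B *ʳ δ +ʳ C *ʳ δ ≡ ε
    invert i i>0 Di≡1 = i *ʳ ε
      , subst (_<ʳ i *ʳ ε) (ℚₚ.*-zeroʳ i) (ℚₚ.*-monoʳ-<-pos i {{i>0}} 0<ε)
      , trans (regroup B C i ε) (trans (cong (λ z → z *ʳ i *ʳ ε) eq)
          (trans (cong (_*ʳ ε) Di≡1) (ℚₚ.*-identityˡ ε)))

product-close : ∀ a b c d B C δ ε → 0ℚ <ʳ B → 0ℚ <ʳ C → B *ʳ δ +ʳ C *ʳ δ ≡ ε →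
                ∣ a ∣ ≤ʳ B → ∣ d ∣ ≤ʳ C → ∣ a -ʳ b ∣ <ʳ δ → ∣ c -ʳ d ∣ <ʳ δ →
                ∣ a *ʳ c -ʳ b *ʳ d ∣ <ʳ ε
product-close a b c d B C δ ε 0<B 0<C total a≤B d≤C a~b c~d =
  ℚₚ.≤-<-trans (abs-split (a *ʳ (c -ʳ d)) (d *ʳ (a -ʳ b)) (product-diff a b c d))
    (subst (∣ a *ʳ (c -ʳ d) ∣ +ʳ ∣ d *ʳ (a -ʳ b) ∣ <ʳ_) total
      (ℚₚ.+-mono-< (scaled a (c -ʳ d) B δ 0<B a≤B c~d) (scaled d (a -ʳ b) C δ 0<C d≤C a~b)))

*-cauchy : ∀ x y → Cauchy x → Cauchy y → Cauchy (λ n → x n *ʳ y n)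
*-cauchy x y cx cy ε 0<ε =
  let B , 0<B , M , f = bounded x cx
      C , 0<C , N , g = bounded y cy
      δ , 0<δ , total = share B C ε 0<B 0<C 0<ε
      M′ , f′ = cx δ 0<δ
      N′ , g′ = cy δ 0<δ
  in (M ⊔ N) ⊔ (M′ ⊔ N′) , λ m n p q →
  let pˡ = ℕₚ.m⊔n≤o⇒m≤o (M ⊔ N) (M′ ⊔ N′) p
      pʳ = ℕₚ.m⊔n≤o⇒n≤o (M ⊔ N) (M′ ⊔ N′) p
      qˡ = ℕₚ.m⊔n≤o⇒m≤o (M ⊔ N) (M′ ⊔ N′) q
      qʳ = ℕₚ.m⊔n≤o⇒n≤o (M ⊔ N) (M′ ⊔ N′) q
  in product-close (x m) (x n) (y m) (y n) B C δ ε 0<B 0<C total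
       (f m (ℕₚ.m⊔n≤o⇒m≤o M N pˡ)) (g n (ℕₚ.m⊔n≤o⇒n≤o M N qˡ))
       (f′ m n (ℕₚ.m⊔n≤o⇒m≤o M′ N′ pʳ) (ℕₚ.m⊔n≤o⇒m≤o M′ N′ qʳ))
       (g′ m n (ℕₚ.m⊔n≤o⇒n≤o M′ N′ pʳ) (ℕₚ.m⊔n≤o⇒n≤o M′ N′ qʳ))

ratʳ : ℚ → ℝ
ratʳ q = mkℝ (λ _ → q) (const-cauchy q)

infixl 6 _⊕ʳ_
infixl 7 _⊗ʳ_

_⊕ʳ_ _⊗ʳ_ : ℝ → ℝ → ℝ
x ⊕ʳ y = mkℝ (λ n → seq x n +ʳ seq y n) (+-cauchy (seq x) (seq y) (cauchy x) (cauchy y))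
x ⊗ʳ y = mkℝ (λ n → seq x n *ʳ seq y n) (*-cauchy (seq x) (seq y) (cauchy x) (cauchy y))

⊖ʳ_ : ℝ → ℝ
⊖ʳ x = mkℝ (λ n → -ʳ seq x n) (neg-cauchy (seq x) (cauchy x))

-- Implied by |x - y| < ε and implying |x - y| ≤ ε; the two differ only by
-- an arbitrarily small change of ε, which every use below quantifies over.
Close : ℚ → ℝ → ℝ → Set
Close ε x y = ∃ λ N → ∀ n → N ≤ n → ∣ seq x n -ʳ seq y n ∣ <ʳ ε

infix 4 _≈ʳ_ _⟶ʳ_

_≈ʳ_ : ℝ → ℝ → Set
x ≈ʳ y = ∀ ε → 0ℚ <ʳ ε → Close ε x y

_⟶ʳ_ : (ℕ → ℝ) → ℝ → Set
x ⟶ʳ y = ∀ ε → 0ℚ <ʳ ε → ∃ λ J → ∀ j → J ≤ j → Close ε (x j) y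

------------------------------------------------------------------------
-- Complex numbers

record ℂ : Set where
  constructor _+i_
  field
    re im : ℝ

open ℂ public

rat : ℚ → ℂ
rat q = ratʳ q +i ratʳ 0ℚ

0ℂ 1ℂ : ℂ
0ℂ = rat 0ℚ
1ℂ = rat 1ℚ

infixl 6 _+ᶜ_
infixl 7 _*ᶜ_
infix 4 _≈ᶜ_ _⟶ᶜ_

_+ᶜ_ _*ᶜ_ : ℂ → ℂ → ℂ
(a +i b) +ᶜ (c +i d) = (a ⊕ʳ c) +i (b ⊕ʳ d)
(a +i b) *ᶜ (c +i d) = (a ⊗ʳ c ⊕ʳ ⊖ʳ (b ⊗ʳ d)) +i (a ⊗ʳ d ⊕ʳ b ⊗ʳ c)

_≈ᶜ_ : ℂ → ℂ → Set
z ≈ᶜ w = re z ≈ʳ re w × im z ≈ʳ im w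

_⟶ᶜ_ : (ℕ → ℂ) → ℂ → Set
z ⟶ᶜ w = (re ∘ z ⟶ʳ re w) × (im ∘ z ⟶ʳ im w)

------------------------------------------------------------------------
-- Polynomials in the variables x₀, x₁, x₂, …

-- The word i₁ … i_d stands for x_{i₁} ⋯ x_{i_d}; monomials are words up to _↭_.
Monomial : Set
Monomial = List ℕ

infix 4 _↭?_

_↭?_ : (m m′ : Monomial) → Dec (m ↭ m′)
[]      ↭? []       = yes ↭-refl
[]      ↭? (_ ∷ _)  = no (λ p → ¬x∷xs↭[] (↭-sym p))
(x ∷ m) ↭? m′ with x ∈? m′
... | no x∉m′ = no (λ p → x∉m′ (∈-resp-↭ p (here refl)))
... | yes x∈m′ with ∈-∃++ x∈m′
...   | l , r , refl with m ↭? (l ++ r)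
...     | yes p = yes (↭-trans (prep x p) (↭-sym (shift x l r)))
...     | no ¬p = no (λ p → ¬p (drop-∷ (↭-trans p (shift x l r))))

-- A formal sum of terms, possibly with repeated monomials and zero
-- coefficients; equality is equality of all coefficients.
Poly : Set
Poly = List (ℂ × Monomial)

coeff : Poly → Monomial → ℂ
coeff p m = foldr _+ᶜ_ 0ℂ (map proj₁ (filter (λ t → proj₂ t ↭? m) p))

infix 4 _≈_

_≈_ : Poly → Poly → Set
p ≈ q = ∀ m → coeff p m ≈ᶜ coeff q m

Occurs : Monomial → Poly → Set
Occurs m p = ¬ (coeff p m ≈ᶜ 0ℂ)

infixl 6 _+ᵖ_
infixl 7 _*ᵖ_

const : ℂ → Poly
const c = [ (c , []) ]

var : ℕ → Poly
var i = [ (1ℂ , [ i ]) ]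

_+ᵖ_ : Poly → Poly → Poly
_+ᵖ_ = _++_

_*ᵗ_ : ℂ × Monomial → ℂ × Monomial → ℂ × Monomial
(c , m) *ᵗ (c′ , m′) = c *ᶜ c′ , m ++ m′

_*ᵖ_ : Poly → Poly → Poly
_*ᵖ_ = cartesianProductWith _*ᵗ_

sumᵖ productᵖ : List Poly → Poly
sumᵖ     = foldr _+ᵖ_ []
productᵖ = foldr _*ᵖ_ (const 1ℂ)

_⟨_⟩ : Poly → (ℕ → Poly) → Poly
p ⟨ s ⟩ = sumᵖ (map (λ t → const (proj₁ t) *ᵖ productᵖ (map s (proj₂ t))) p)

component : ℕ → Poly → Poly
component d = filter (λ t → length (proj₂ t) ≟ⁿ d)

∂ᵐ : ℕ → Monomial → Poly
∂ᵐ i [] = []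
∂ᵐ i (j ∷ m) with i ≟ⁿ j
... | yes _ = [ (1ℂ , m) ] +ᵖ var j *ᵖ ∂ᵐ i m
... | no  _ = var j *ᵖ ∂ᵐ i m

∂ : ℕ → Poly → Poly
∂ i p = sumᵖ (map (λ t → const (proj₁ t) *ᵖ ∂ᵐ i (proj₂ t)) p)

Degree≤ : ℕ → Poly → Set
Degree≤ D p = ∀ m → Occurs m p → length m ≤ D

-- The zero polynomial counts as homogeneous of every degree.
Homogeneous : ℕ → Poly → Set
Homogeneous d p = ∀ m → Occurs m p → length m ≡ d

VariablesIn : List ℕ → Poly → Set
VariablesIn V p = ∀ m → Occurs m p → All (_∈ V) m

#Variables≤ : ℕ → Poly → Set
#Variables≤ k p = ∃ λ V → length V ≤ k × VariablesIn V p

-- p ∈ ℂ[x₀, …, x_{N-1}]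
InFirst : ℕ → Poly → Set
InFirst N = VariablesIn (upTo N)

-- Euclidean convergence inside one of the finite dimensional spaces
-- ℂ[x₀, …, x_{N-1}]_{≤ D}, whose union is the polynomial ring.
infix 4 _⟶_

_⟶_ : (ℕ → Poly) → Poly → Set
g ⟶ p = (∃ λ N → ∃ λ D → (∀ j → InFirst N (g j) × Degree≤ D (g j)) × InFirst N p × Degree≤ D p)
      × (∀ m → (λ j → coeff (g j) m) ⟶ᶜ coeff p m)

------------------------------------------------------------------------
-- Growth

-- Natural coefficients, lowest degree first: rounding the coefficients of a
-- real polynomial up to natural numbers only increases its values on ℕ.
evalⁿ : List ℕ → ℕ → ℕ
evalⁿ t n = foldr (λ c r → c +ⁿ n *ⁿ r) 0 t

evalⁿ² : List (List ℕ) → ℕ → ℕ → ℕ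
evalⁿ² t n d = evalⁿ (map (λ c → evalⁿ c d) t) n

PolyBounded : (ℕ → ℕ) → Set
PolyBounded m = ∃ λ t → ∀ n → m n ≤ evalⁿ t n

BiPolyBounded : (ℕ → ℕ → ℕ) → Set
BiPolyBounded m = ∃ λ t → ∀ n d → m n d ≤ evalⁿ² t n d

-- Rounding log₂ n down is harmless: log₂ n ≤ 2 ⌊log₂ n⌋ for n ≥ 2, and the
-- factor 2 can be absorbed into q.
QuasiPolyBounded : (ℕ → ℕ) → Set
QuasiPolyBounded m = ∃ λ q → ∀ n → 2 ≤ n → m n ≤ n ^ⁿ evalⁿ q ⌊log₂ n ⌋

------------------------------------------------------------------------
-- p-families

record PFamily : Set where
  field
    poly      : ℕ → Poly
    degree    : ∃ λ b → PolyBounded b × ∀ n → Degree≤ (b n) (poly n)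
    variables : ∃ λ b → PolyBounded b × ∀ n → #Variables≤ (b n) (poly n)

record GradedPFamily : Set where
  field
    poly        : ℕ → ℕ → Poly
    homogeneous : ∀ n d → Homogeneous d (poly n d)
    variables   : ∃ λ b → BiPolyBounded b × ∀ n d → #Variables≤ (b n d) (poly n d)

AllTerms : (Monomial → Set) → Poly → Set
AllTerms P = All (P ∘ proj₂)

0≈0 : 0ℂ ≈ᶜ 0ℂ
0≈0 = r , r
  where
  r : ratʳ 0ℚ ≈ʳ ratʳ 0ℚ
  r ε 0<ε = 0 , λ _ _ → 0<ε

no-match : ∀ {m p} → AllTerms (λ m′ → ¬ (m′ ↭ m)) p → coeff p m ≡ 0ℂ
no-match {m} none = cong (λ ts → foldr _+ᶜ_ 0ℂ (map proj₁ ts)) (Listₚ.filter-none _ none)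

occurs⇒ : ∀ {P : Monomial → Set} → (∀ m → Dec (P m)) → (∀ {m m′} → m ↭ m′ → P m → P m′) →
          ∀ {p} → AllTerms P p → ∀ m → Occurs m p → P m
occurs⇒ P? resp all m occ = decidable-stable (P? m) λ ¬Pm →
  occ (subst (_≈ᶜ 0ℂ) (sym (no-match (All.map (λ Pm′ eq → ¬Pm (resp eq Pm′)) all))) 0≈0)

terms-degree : ∀ {d p} → AllTerms (λ m → length m ≡ d) p → Homogeneous d p
terms-degree {d} = occurs⇒ (λ m → length m ≟ⁿ d) (λ eq → trans (sym (↭-length eq)))

terms-variables : ∀ {V p} → AllTerms (All (_∈ V)) p → VariablesIn V p
terms-variables {V} = occurs⇒ (All.all? (_∈? V)) All-resp-↭

coeff-component : ∀ d p m → length m ≡ d → coeff (component d p) m ≡ coeff p m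
coeff-component d p m len = cong (λ ts → foldr _+ᶜ_ 0ℂ (map proj₁ ts)) (go p)
  where
  M? = λ (t : ℂ × Monomial) → proj₂ t ↭? m
  D? = λ (t : ℂ × Monomial) → length (proj₂ t) ≟ⁿ d
  go : ∀ p → filter M? (filter D? p) ≡ filter M? p
  go [] = refl
  go (t ∷ p) = step (D? t) (M? t)
    where
    step : Dec (length (proj₂ t) ≡ d) → Dec (proj₂ t ↭ m) → filter M? (filter D? (t ∷ p)) ≡ filter M? (t ∷ p)
    step (yes l) (yes e) = trans (cong (filter M?) (Listₚ.filter-accept D? {t} {p} l))
      (trans (Listₚ.filter-accept M? {t} {filter D? p} e)
        (trans (cong (t ∷_) (go p)) (sym (Listₚ.filter-accept M? {t} {p} e))))
    step (yes l) (no ¬e) = trans (cong (filter M?) (Listₚ.filter-accept D? {t} {p} l))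
      (trans (Listₚ.filter-reject M? {t} {filter D? p} ¬e)
        (trans (go p) (sym (Listₚ.filter-reject M? {t} {p} ¬e))))
    step (no ¬l) (yes e) = contradiction (trans (↭-length e) len) ¬l
    step (no ¬l) (no ¬e) = trans (cong (filter M?) (Listₚ.filter-reject D? {t} {p} ¬l))
      (trans (go p) (sym (Listₚ.filter-reject M? {t} {p} ¬e)))

component-homogeneous : ∀ d p → Homogeneous d (component d p)
component-homogeneous d p = terms-degree (Allₚ.all-filter _ p)

component-variables : ∀ {V} d p → VariablesIn V p → VariablesIn V (component d p)
component-variables d p h m occ =
  h m (subst (λ c → ¬ (c ≈ᶜ 0ℂ)) (coeff-component d p m (component-homogeneous d p m occ)) occ)

evalⁿ²-const : ∀ t n d → evalⁿ² (map [_] t) n d ≡ evalⁿ t n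
evalⁿ²-const []      n d = refl
evalⁿ²-const (c ∷ t) n d = cong₂ (λ a r → a +ⁿ n *ⁿ r)
  (trans (cong (c +ⁿ_) (ℕₚ.*-zeroʳ d)) (ℕₚ.+-identityʳ c)) (evalⁿ²-const t n d)

graded : PFamily → GradedPFamily
graded g = record
  { poly        = λ n d → component d (poly n)
  ; homogeneous = λ n d → component-homogeneous d (poly n)
  ; variables   = let b , (t , b≤t) , few = variables in
      (λ n _ → b n)
    , (map [_] t , λ n d → ℕₚ.≤-trans (b≤t n) (ℕₚ.≤-reflexive (sym (evalⁿ²-const t n d))))
    , (λ n d → let V , V≤ , V⊇ = few n in V , V≤ , component-variables d (poly n) V⊇)
  }
  where open PFamily g

------------------------------------------------------------------------
-- The permanent

words : ∀ {A : Set} d → List A → List (Vec A d)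
words zero    as = [ Vec.[] ]
words (suc d) as = cartesianProductWith Vec._∷_ as (words d as)

-- σ is listed as σ(0), …, σ(n-1); these must be pairwise distinct.
permutations : ∀ n → List (Vec (Fin n) n)
permutations n = filter (AllPairs.allPairs? (λ i j → ¬? (i Finₚ.≟ j))) (words n (allFin n))

permanent : ∀ {n} → (Fin n → Fin n → Poly) → Poly
permanent {n} M = sumᵖ (map (λ σ → productᵖ (tabulate λ i → M i (lookup σ i))) (permutations n))

-- combine : Fin n → Fin n → Fin (n * n) is a bijection on pairs.
generic : ∀ n → Fin n → Fin n → Poly
generic n i j = var (toℕ (combine i j))

+-terms : ∀ {P} ps → All (AllTerms P) ps → AllTerms P (sumᵖ ps)
+-terms []       []       = []
+-terms (p ∷ ps) (a ∷ as) = Allₚ.++⁺ a (+-terms ps as)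

*-terms : ∀ {P Q R : Monomial → Set} → (∀ {m m′} → P m → Q m′ → R (m ++ m′)) →
          ∀ {p q} → AllTerms P p → AllTerms Q q → AllTerms R (p *ᵖ q)
*-terms f []       bs = []
*-terms f {q = q} (a ∷ as) bs = Allₚ.++⁺ (Allₚ.map⁺ (All.map (f a) bs)) (*-terms f as bs)

product-degree : ∀ {n} (f : Fin n → Poly) → (∀ i → AllTerms (λ m → length m ≡ 1) (f i)) →
                 AllTerms (λ m → length m ≡ n) (productᵖ (tabulate f))
product-degree {zero}  f h = refl ∷ []
product-degree {suc n} f h = *-terms (λ {m} {m′} p q → trans (Listₚ.length-++ m) (cong₂ _+ⁿ_ p q))
  (h Fin.zero) (product-degree (f ∘ Fin.suc) (h ∘ Fin.suc))

product-variables : ∀ {n V} (f : Fin n → Poly) → (∀ i → AllTerms (All (_∈ V)) (f i)) →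
                    AllTerms (All (_∈ V)) (productᵖ (tabulate f))
product-variables {zero}  f h = [] ∷ []
product-variables {suc n} f h = *-terms Allₚ.++⁺
  (h Fin.zero) (product-variables (f ∘ Fin.suc) (h ∘ Fin.suc))

per : PFamily
per = record
  { poly      = λ n → permanent (generic n)
  ; degree    = (λ n → n) , (0 ∷ 1 ∷ [] , λ n → ℕₚ.≤-reflexive (sym (lin n))) , λ n m occ →
      ℕₚ.≤-reflexive (terms-degree
        (+-terms _ (Allₚ.map⁺ (All.universal (λ σ → product-degree _ λ i → refl ∷ []) (permutations n)))) m occ)
  ; variables = (λ n → n *ⁿ n) , (0 ∷ 0 ∷ 1 ∷ [] , λ n → ℕₚ.≤-reflexive (cong (n *ⁿ_) (sym (lin n)))) , λ n →
      upTo (n *ⁿ n) , ℕₚ.≤-reflexive (Listₚ.length-upTo (n *ⁿ n)) ,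
      terms-variables (+-terms _ (Allₚ.map⁺ (All.universal
        (λ σ → product-variables _ λ i → (∈-upTo⁺ (Finₚ.toℕ<n (combine i (lookup σ i))) ∷ []) ∷ []) (permutations n))))
  }
  where
  lin : ∀ n → n *ⁿ (1 +ⁿ n *ⁿ 0) ≡ n
  lin n = trans (cong (λ k → n *ⁿ (1 +ⁿ k)) (ℕₚ.*-zeroʳ n)) (ℕₚ.*-identityʳ n)

------------------------------------------------------------------------
-- The parity-alternating elementary symmetric polynomials

alternating : ∀ n d → List (Vec ℕ d)
alternating n d = filter
  (λ w → AllPairs.allPairs? _<?_ w ×-dec Finₚ.all? (λ j → lookup w j % 2 ≟ⁿ suc (toℕ j) % 2))
  (words d (map suc (upTo n)))

words-entries : ∀ {A : Set} d (as : List A) → All (λ w → ∀ j → lookup w j ∈ as) (words d as)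
words-entries zero    as = (λ ()) ∷ []
words-entries (suc d) as = Allₚ.cartesianProductWith⁺ (setoid _) (setoid _) Vec._∷_ as (words d as)
  λ a∈as w∈ws → λ where
    Fin.zero    → a∈as
    (Fin.suc j) → All.lookup (words-entries d as) w∈ws j

C : GradedPFamily
C = record
  { poly        = λ n d → sumᵖ (map (λ w → productᵖ (tabulate λ j → var (lookup w j))) (alternating n d))
  ; homogeneous = λ n d → terms-degree
      (+-terms _ (Allₚ.map⁺ (All.universal (λ w → product-degree _ λ j → refl ∷ []) (alternating n d))))
  ; variables   = (λ n d → n) , ([] ∷ [ 1 ] ∷ [] , λ n d → ℕₚ.≤-reflexive (sym (lin n d))) , λ n d →
      map suc (upTo n) , ℕₚ.≤-reflexive (trans (Listₚ.length-map suc (upTo n)) (Listₚ.length-upTo n)) ,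
      terms-variables (+-terms _ (Allₚ.map⁺ (All.map
        (λ h → product-variables _ λ j → (h j ∷ []) ∷ [])
        (Allₚ.filter⁺ _ (words-entries d (map suc (upTo n)))))))
  }
  where
  lin : ∀ n d → n *ⁿ ((1 +ⁿ d *ⁿ 0) +ⁿ n *ⁿ 0) ≡ n
  lin n d = trans (cong₂ (λ a b → n *ⁿ ((1 +ⁿ a) +ⁿ b)) (ℕₚ.*-zeroʳ d) (ℕₚ.*-zeroʳ n)) (ℕₚ.*-identityʳ n)

------------------------------------------------------------------------
-- Complexity measures: μ p k says that the μ-complexity of p is at most k

Measure : Set₁
Measure = Poly → ℕ → Set

LinearForm : Set
LinearForm = List (ℂ × ℕ)

linear : LinearForm → Poly
linear = map (λ (c , i) → c , [ i ])

Affine : Set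
Affine = ℂ × LinearForm

affine : Affine → Poly
affine (c , ℓ) = const c +ᵖ linear ℓ

data Formula : Set where
  leaf    : Affine → Formula
  add mul : Formula → Formula → Formula

valueᶠ : Formula → Poly
valueᶠ (leaf a)  = affine a
valueᶠ (add F G) = valueᶠ F +ᵖ valueᶠ G
valueᶠ (mul F G) = valueᶠ F *ᵖ valueᶠ G

sizeᶠ : Formula → ℕ
sizeᶠ (leaf _)  = 1
sizeᶠ (add F G) = 1 +ⁿ sizeᶠ F +ⁿ sizeᶠ G
sizeᶠ (mul F G) = 1 +ⁿ sizeᶠ F +ⁿ sizeᶠ G

formulaSize : Measure
formulaSize p k = ∃ λ F → sizeᶠ F ≤ k × valueᶠ F ≈ p

permanentalComplexity : Measure
permanentalComplexity p k = ∃ λ n → n ≤ k ×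
  ∃ λ (M : Fin n → Fin n → Affine) → permanent (λ i j → affine (M i j)) ≈ p

data IHL : Set where
  leaf : LinearForm → IHL
  add  : IHL → IHL → IHL
  mul₃ : IHL → IHL → IHL → IHL

valueⁱ : IHL → Poly
valueⁱ (leaf ℓ)     = linear ℓ
valueⁱ (add F G)    = valueⁱ F +ᵖ valueⁱ G
valueⁱ (mul₃ F G H) = valueⁱ F *ᵖ valueⁱ G *ᵖ valueⁱ H

sizeⁱ : IHL → ℕ
sizeⁱ (leaf _)     = 1
sizeⁱ (add F G)    = 1 +ⁿ sizeⁱ F +ⁿ sizeⁱ G
sizeⁱ (mul₃ F G H) = 1 +ⁿ sizeⁱ F +ⁿ sizeⁱ G +ⁿ sizeⁱ H

-- The k-th odd degree is 2k+1 and the k-th even degree is 2(k+1); only k < K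
-- is used, i.e. degrees up to 2K.
oddDegree evenDegree : ∀ {K} → Fin K → ℕ
oddDegree  k = suc (2 *ⁿ toℕ k)
evenDegree k = 2 *ⁿ suc (toℕ k)

record GradedIHL : Set where
  field
    constant : ℂ
    m        : ℕ
    x        : Fin m → ℕ
    distinct : Injective _≡_ _≡_ x
    K        : ℕ
    odd      : Fin K → IHL
    even     : Fin K → Fin m → IHL

  value : Poly
  value = const constant
       +ᵖ sumᵖ (tabulate λ k → valueⁱ (odd k))
       +ᵖ sumᵖ (tabulate λ k → const (rat (+ 1 / evenDegree k)) *ᵖ
                               sumᵖ (tabulate λ i → var (x i) *ᵖ valueⁱ (even k i)))

  -- The number of vertices of `value` written as a formula.  The outer sum
  -- starts with the leaf `constant`, and each summand costs one addition gate.
  -- For an even degree there are also the leaf 1/d, its multiplication gate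
  -- and an inner sum that starts with a leaf 0, where each summand costs an
  -- addition gate, a multiplication gate and the leaf xᵢ.
  size : ℕ
  size = 1 +ⁿ sum (tabulate λ k → 1 +ⁿ sizeⁱ (odd k))
           +ⁿ sum (tabulate λ k → 4 +ⁿ sum (tabulate λ i → 3 +ⁿ sizeⁱ (even k i)))

  -- The odd and even parts must be the homogeneous components of f and the
  -- partial derivatives of its components; f = value alone would not force this.
  Computes : Poly → Set
  Computes f = value ≈ f
             × const constant ≈ component 0 f
             × (∀ k → valueⁱ (odd k) ≈ component (oddDegree k) f)
             × (∀ k i → valueⁱ (even k i) ≈ ∂ (x i) (component (evenDegree k) f))

gradedIHLSize : Measure
gradedIHLSize f k = ∃ λ F → GradedIHL.size F ≤ k × GradedIHL.Computes F f

border : Measure → Measure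
border μ p k = ∃ λ g → (∀ j → μ (g j) k) × g ⟶ p

------------------------------------------------------------------------
-- Classes

Class : Set₁
Class = Pred PFamily 0ℓ

polyClass quasiPolyClass : Measure → Class
polyClass      μ f = ∃ λ b → PolyBounded b × ∀ n → μ (PFamily.poly f n) (b n)
quasiPolyClass μ f = ∃ λ b → QuasiPolyBounded b × ∀ n → μ (PFamily.poly f n) (b n)

VNP VF‾ V3F‾ VQP‾ : Class
VNP = polyClass permanentalComplexity
VF‾  = polyClass (border formulaSize)
V3F‾ = polyClass (border gradedIHLSize)
VQP‾ = quasiPolyClass (border formulaSize)

------------------------------------------------------------------------
-- Reductions

-- q ∘ A for A : ℂᵃ → ℂᵇ linear and q ∈ ℂ[x₀, …, x_{b-1}]; variables xⱼ with
-- j ≥ b, which do not occur in q, are sent to 0.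
pullback : ∀ {a b} → Poly → (Fin b → Fin a → ℂ) → Poly
pullback {a} {b} q A = q ⟨ image ⟩
  where
  image : ℕ → Poly
  image j with j <? b
  ... | yes j<b = linear (tabulate λ i → A (fromℕ< j<b) i , toℕ i)
  ... | no  _   = []

-- p and q are read as polynomials on U = ℂᵃ and W = ℂᵇ.
_⊴homlin[_]_ : Poly → ℕ → Poly → Set
p ⊴homlin[ zero ]  q = ¬ (q ≈ [])
p ⊴homlin[ suc _ ] q = ∃ λ a → ∃ λ b → InFirst a p × InFirst b q ×
  ∃ λ (A : ℕ → Fin b → Fin a → ℂ) → (λ j → pullback q (A j)) ⟶ p

reducible : ((ℕ → ℕ) → Set) → GradedPFamily → GradedPFamily → Set
reducible Bounded f h = ∃ λ m → Bounded m ×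
  ∀ n d → GradedPFamily.poly f n d ⊴homlin[ d ] GradedPFamily.poly h (m n) d

infix 4 _⊴p-homlin_ _⊴qp-homlin_

_⊴p-homlin_ _⊴qp-homlin_ : GradedPFamily → GradedPFamily → Set
_⊴p-homlin_  = reducible PolyBounded
_⊴qp-homlin_ = reducible QuasiPolyBounded

-- The polynomial C_{N,d} is the part of degree d of an entry of ∏ (1 + ℓᵢ Eᵢ) with Eᵢ alternating between
-- e₁₂ and e₂₁, so linear images of C are words in elementary matrices of SL₂.  If two words have the values
-- 1 + εᵖX + O(εᵖ⁺¹) and 1 + ε^q Y + O(ε^(q+1)), their commutator is 1 + ε^(p+q)[X,Y] + O(ε^(p+q+1)); since
-- [f e₁₂, g e₂₁] = fg h and [f h, g e₁₂] = 2fg e₁₂, sums and products of three factors can be followed up to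
-- leading order, and balancing the formula first keeps the words polynomially long.  The part of degree d of
-- the leading term is isolated by rescaling the letters by ε^(-p/d), for an exponent p divisible by d.
-- An arbitrary formula has a linear representation λ μᵈ γ of its part of degree d, and splitting the power
-- μᵈ into three odd powers repeatedly turns it into such products of three factors, at quasipolynomial cost.
-- Conversely, C_{N,d} is a combination of the matrix products at ℓᵢ, 2ℓᵢ, 4ℓᵢ, …, which have small formulas
-- by repeated halving, and limits survive the affine substitutions that turn per into any member of VNP.

module Submission where

-- Commutators are the only source of products, and they switch between the diagonal and the
-- off-diagonal of a 2×2 matrix: an off-diagonal entry collects products of an odd number of
-- factors, a diagonal one products of an even number. This is where arity 3 comes from, and why an
-- even degree is treated as a sum of products of a linear form with an odd formula. The factor 2 of
-- the second commutator is cancelled in advance by powers of 1/2 on the leaves. A commutator of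
-- words of lengths m and n has length 2(m + n), so length is exponential in depth; a product gate
-- on a path leaves behind a pair of factors, hence balancing must treat formulas (off-diagonal) and
-- products of such pairs (diagonal) simultaneously. Here ε is the sequence 1/(j+1) in the ring of
-- convergent sequences of polynomials, and O(ε) means divisible by ε in that ring, so that
-- remainders vanish in the limit. Two limits are nested: ε → 0 for each approximating formula, and
-- the border limit of these formulas. They are merged by working with approximation up to every
-- precision in place of sequences.

-- Approximation and the ring structure of the complex numbers.

module Reals where

  open import Defs
  open import Data.Nat using (ℕ; _⊔_; _≤_)
  import Data.Nat.Properties as ℕₚ
  open import Data.Rational as ℚ using (ℚ; 0ℚ; 1ℚ; ½; ∣_∣; _⊓_)
  import Data.Rational.Properties as ℚₚ
  open import Data.Rational.Solver using (module +-*-Solver)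
  open import Data.Product using (∃; _×_; _,_; proj₁; proj₂)
  open import Data.Sum using (inj₁; inj₂)
  open import Relation.Nullary using (¬_; Dec; yes; no; contradiction)
  open import Relation.Binary using (IsEquivalence; Setoid)
  open import Relation.Binary.PropositionalEquality using (_≡_; refl; sym; trans; cong; cong₂; subst)
  open import Algebra.Bundles using (CommutativeRing)
  open import Level using (0ℓ)

  open +-*-Solver using (solve; _:=_; _:+_; _:-_; _:*_; :-_)

  infix 4 _<′_
  _<′_ : ℚ → ℚ → Set
  _<′_ = ℚ._<_

  -- Records, so that unification sees the numbers themselves and not their unfolded approximations.
  record Near (ε : ℚ) (x y : ℝ) : Set where
    constructor near
    field close : Close ε x y

  record Nearᶜ (ε : ℚ) (z w : ℂ) : Set where
    constructor _,ᶜ_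
    field
      re-near : Near ε (re z) (re w)
      im-near : Near ε (im z) (im w)

  open Near
  open Nearᶜ

  near-sym : ∀ {ε x y} → Near ε x y → Near ε y x
  near-sym {ε} {x} {y} (near (N , h)) = near (N , λ n le → subst (_<′ ε) (flip (seq x n) (seq y n)) (h n le))
    where
    flip : ∀ a b → ∣ a ℚ.- b ∣ ≡ ∣ b ℚ.- a ∣
    flip a b = trans (sym (ℚₚ.∣-p∣≡∣p∣ (a ℚ.- b)))
      (cong ∣_∣ (solve 2 (λ a b → :- (a :- b) := b :- a) refl a b))

  near-mono : ∀ {δ ε x y} → δ ℚ.≤ ε → Near δ x y → Near ε x y
  near-mono δ≤ε (near (N , h)) = near (N , λ n le → ℚₚ.<-≤-trans (h n le) δ≤ε)

  near-halves : ∀ {ε x y z} → Near (½ ℚ.* ε) x y → Near (½ ℚ.* ε) y z → Near ε x z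
  near-halves {ε} {x} {y} {z} (near (M , f)) (near (N , g)) = near (M ⊔ N , λ n le →
    subst (∣ seq x n ℚ.- seq z n ∣ <′_) (halves ε) (ℚₚ.≤-<-trans
      (abs-split (seq x n ℚ.- seq y n) (seq y n ℚ.- seq z n) (telescope (seq x n) (seq y n) (seq z n)))
      (ℚₚ.+-mono-< (f n (ℕₚ.m⊔n≤o⇒m≤o M N le)) (g n (ℕₚ.m⊔n≤o⇒n≤o M N le)))))
    where
    telescope : ∀ a b c → a ℚ.- c ≡ (a ℚ.- b) ℚ.+ (b ℚ.- c)
    telescope = solve 3 (λ a b c → a :- c := (a :- b) :+ (b :- c)) refl

  pointwise⇒near : ∀ {ε x y} → 0ℚ <′ ε → (∀ n → seq x n ≡ seq y n) → Near ε x y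
  pointwise⇒near {ε} {x} {y} 0<ε eq = near (0 , λ n _ →
    subst (λ z → ∣ z ∣ <′ ε) (sym (trans (cong (ℚ._- seq y n) (eq n)) (ℚₚ.+-inverseʳ (seq y n)))) 0<ε)

  ⊕-near : ∀ {ε x y u v} → Near (½ ℚ.* ε) x y → Near (½ ℚ.* ε) u v → Near ε (x ⊕ʳ u) (y ⊕ʳ v)
  ⊕-near {ε} {x} {y} {u} {v} (near (M , f)) (near (N , g)) = near (M ⊔ N , λ n le →
    subst (∣ seq (x ⊕ʳ u) n ℚ.- seq (y ⊕ʳ v) n ∣ <′_) (halves ε) (ℚₚ.≤-<-trans
      (abs-split (seq x n ℚ.- seq y n) (seq u n ℚ.- seq v n) (interchange (seq x n) (seq y n) (seq u n) (seq v n)))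
      (ℚₚ.+-mono-< (f n (ℕₚ.m⊔n≤o⇒m≤o M N le)) (g n (ℕₚ.m⊔n≤o⇒n≤o M N le)))))

  ⊖-near : ∀ {ε x y} → Near ε x y → Near ε (⊖ʳ x) (⊖ʳ y)
  ⊖-near {ε} {x} {y} (near (N , h)) = near (N , λ n le →
    subst (_<′ ε) (sym (trans (cong ∣_∣ (neg-diff (seq x n) (seq y n))) (ℚₚ.∣-p∣≡∣p∣ _))) (h n le))

  ⊓-pos : ∀ {p q} → 0ℚ <′ p → 0ℚ <′ q → 0ℚ <′ p ⊓ q
  ⊓-pos {p} {q} 0<p 0<q with ℚₚ.⊓-sel p q
  ... | inj₁ eq = subst (0ℚ <′_) (sym eq) 0<p
  ... | inj₂ eq = subst (0ℚ <′_) (sym eq) 0<q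

  -- The estimate needs a bound on the moving factor `x`, of which only closeness to `y` is known.
  -- Capping δ at 1 bounds `x` by 1 + B, where B bounds `y`.
  ⊗-near : ∀ y v ε → 0ℚ <′ ε → ∃ λ δ → 0ℚ <′ δ ×
            (∀ {x u} → Near δ x y → Near δ u v → Near ε (x ⊗ʳ u) (y ⊗ʳ v))
  ⊗-near y v ε 0<ε =
    let B , 0<B , M , f = bounded (seq y) (cauchy y)
        D , 0<D , N , g = bounded (seq v) (cauchy v)
        0<1+B = ℚₚ.+-mono-< 0<1 0<B
        δ , 0<δ , total = share (1ℚ ℚ.+ B) D ε 0<1+B 0<D 0<ε
    in δ ⊓ 1ℚ , ⊓-pos 0<δ 0<1 , λ {x} {u} (near (P , p)) (near (Q , q)) → near (
       (M ⊔ N) ⊔ (P ⊔ Q) , λ n le →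
       let leˡ = ℕₚ.m⊔n≤o⇒m≤o (M ⊔ N) (P ⊔ Q) le
           leʳ = ℕₚ.m⊔n≤o⇒n≤o (M ⊔ N) (P ⊔ Q) le
           x~y = p n (ℕₚ.m⊔n≤o⇒m≤o P Q leʳ)
           u~v = q n (ℕₚ.m⊔n≤o⇒n≤o P Q leʳ)
       in product-close (seq x n) (seq y n) (seq u n) (seq v n) (1ℚ ℚ.+ B) D δ ε 0<1+B 0<D total
            (ℚₚ.≤-trans (abs-split (seq x n ℚ.- seq y n) (seq y n) (add-back (seq x n) (seq y n)))
              (ℚₚ.+-mono-≤ (ℚₚ.≤-trans (ℚₚ.<⇒≤ x~y) (ℚₚ.p⊓q≤q δ 1ℚ)) (f n (ℕₚ.m⊔n≤o⇒m≤o M N leˡ))))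
            (g n (ℕₚ.m⊔n≤o⇒n≤o M N leˡ))
            (ℚₚ.<-≤-trans x~y (ℚₚ.p⊓q≤p δ 1ℚ))
            (ℚₚ.<-≤-trans u~v (ℚₚ.p⊓q≤p δ 1ℚ)))

  -- Equality of reals is undecidable, but comparing a single rational term of the difference with
  -- ε/2 is not. `Occurs` is a negated equality, so facts about supports arrive doubly negated and
  -- are recovered by this lemma.
  ≈ʳ-stable : ∀ {x y} → ¬ ¬ (x ≈ʳ y) → x ≈ʳ y
  ≈ʳ-stable {x} {y} ¬¬x≈y ε 0<ε = decide (∣ seq z N ∣ ℚₚ.<? ½ ℚ.* ε)
    where
    z = x ⊕ʳ ⊖ʳ y
    -- A quarter of ε: if `x ≈ʳ y`, the term at N is within η of a term that is itself below η,
    -- hence below ε/2, which contradicts the negative answer of the comparison.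
    η = ½ ℚ.* (½ ℚ.* ε)
    0<η = half-pos (half-pos 0<ε)
    N = proj₁ (cauchy z η 0<η)
    steady = proj₂ (cauchy z η 0<η)
    η≤ : η ℚ.≤ ½ ℚ.* ε
    η≤ = ℚₚ.<⇒≤ (subst₂′ (ℚₚ.+-monoʳ-< η 0<η))
      where
      subst₂′ : η ℚ.+ 0ℚ <′ η ℚ.+ η → η <′ ½ ℚ.* ε
      subst₂′ p = subst (_<′ ½ ℚ.* ε) (ℚₚ.+-identityʳ η) (subst (η ℚ.+ 0ℚ <′_) (halves (½ ℚ.* ε)) p)
    decide : Dec (∣ seq z N ∣ <′ ½ ℚ.* ε) → Close ε x y
    decide (yes small) = N , λ n le → subst (∣ seq z n ∣ <′_) (halves ε) (ℚₚ.≤-<-trans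
      (abs-split (seq z n ℚ.- seq z N) (seq z N) (add-back (seq z n) (seq z N)))
      (ℚₚ.+-mono-< (ℚₚ.<-≤-trans (steady n N le ℕₚ.≤-refl) η≤) small))
    decide (no large) = contradiction (λ x≈y → large (small x≈y)) ¬¬x≈y
      where
      small : x ≈ʳ y → ∣ seq z N ∣ <′ ½ ℚ.* ε
      small x≈y = let M , h = x≈y η 0<η ; n = M ⊔ N in
        subst (∣ seq z N ∣ <′_) (halves (½ ℚ.* ε)) (ℚₚ.≤-<-trans
          (abs-split (seq z N ℚ.- seq z n) (seq z n) (add-back (seq z N) (seq z n)))
          (ℚₚ.+-mono-< (steady N n ℕₚ.≤-refl (ℕₚ.m≤n⊔m M N)) (h n (ℕₚ.m≤m⊔n M N))))

  nearᶜ-sym : ∀ {ε z w} → Nearᶜ ε z w → Nearᶜ ε w z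
  nearᶜ-sym (p ,ᶜ q) = near-sym p ,ᶜ near-sym q

  nearᶜ-mono : ∀ {δ ε z w} → δ ℚ.≤ ε → Nearᶜ δ z w → Nearᶜ ε z w
  nearᶜ-mono le (p ,ᶜ q) = near-mono le p ,ᶜ near-mono le q

  nearᶜ-halves : ∀ {ε x y z} → Nearᶜ (½ ℚ.* ε) x y → Nearᶜ (½ ℚ.* ε) y z → Nearᶜ ε x z
  nearᶜ-halves (p ,ᶜ q) (r ,ᶜ s) = near-halves p r ,ᶜ near-halves q s

  half-pos² : ∀ {ε} → 0ℚ <′ ε → 0ℚ <′ ½ ℚ.* (½ ℚ.* ε)
  half-pos² 0<ε = half-pos (half-pos 0<ε)

  infix 4 _≃_
  record _≃_ (z w : ℂ) : Set where
    constructor mk≃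
    field nears : ∀ {ε} → 0ℚ <′ ε → Nearᶜ ε z w

  open _≃_ public

  ≃⇒≈ᶜ : ∀ {z w} → z ≃ w → z ≈ᶜ w
  ≃⇒≈ᶜ h = (λ ε 0<ε → close (re-near (nears h 0<ε))) , (λ ε 0<ε → close (im-near (nears h 0<ε)))

  ≈ᶜ⇒≃ : ∀ {z w} → z ≈ᶜ w → z ≃ w
  ≈ᶜ⇒≃ (p , q) = mk≃ λ 0<ε → near (p _ 0<ε) ,ᶜ near (q _ 0<ε)

  -- One modulus at a point serves twice: `continuous⇒cong` draws the congruence laws of the ring
  -- from it and `continuous⇒limit` the limit laws.
  Continuous₂ : (ℂ → ℂ → ℂ) → Set
  Continuous₂ _∙_ = ∀ y v ε → 0ℚ <′ ε → ∃ λ δ → 0ℚ <′ δ ×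
    (∀ {x u} → Nearᶜ δ x y → Nearᶜ δ u v → Nearᶜ ε (x ∙ u) (y ∙ v))

  +ᶜ-continuous : Continuous₂ _+ᶜ_
  +ᶜ-continuous y v ε 0<ε = ½ ℚ.* ε , half-pos 0<ε , λ (p ,ᶜ q) (r ,ᶜ s) → ⊕-near p r ,ᶜ ⊕-near q s

  Joint : ℚ → ℚ → ℝ → ℝ → Set
  Joint δ ε y v = ∀ {x u} → Near δ x y → Near δ u v → Near ε (x ⊗ʳ u) (y ⊗ʳ v)

  *ᶜ-continuous : Continuous₂ _*ᶜ_
  *ᶜ-continuous (a +i b) (c +i d) ε 0<ε = combine
    (⊗-near a c _ (half-pos 0<ε)) (⊗-near b d _ (half-pos 0<ε)) (⊗-near a d _ (half-pos 0<ε)) (⊗-near b c _ (half-pos 0<ε))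
    where
    Modulus : ℝ → ℝ → Set
    Modulus y v = ∃ λ δ → 0ℚ <′ δ × Joint δ (½ ℚ.* ε) y v
    combine : Modulus a c → Modulus b d → Modulus a d → Modulus b c → ∃ λ δ → 0ℚ <′ δ ×
      (∀ {x u} → Nearᶜ δ x (a +i b) → Nearᶜ δ u (c +i d) → Nearᶜ ε (x *ᶜ u) ((a +i b) *ᶜ (c +i d)))
    combine (δ₁ , 0<δ₁ , h₁) (δ₂ , 0<δ₂ , h₂) (δ₃ , 0<δ₃ , h₃) (δ₄ , 0<δ₄ , h₄) =
      (δ₁ ⊓ δ₂) ⊓ (δ₃ ⊓ δ₄) , ⊓-pos (⊓-pos 0<δ₁ 0<δ₂) (⊓-pos 0<δ₃ 0<δ₄) , λ {z} {w} (p ,ᶜ q) (r ,ᶜ s) →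
        ⊕-near {x = re z ⊗ʳ re w} {a ⊗ʳ c} {⊖ʳ (im z ⊗ʳ im w)} {⊖ʳ (b ⊗ʳ d)}
          (h₁ {re z} {re w} (near-mono le₁ p) (near-mono le₁ r))
          (⊖-near {x = im z ⊗ʳ im w} {b ⊗ʳ d} (h₂ {im z} {im w} (near-mono le₂ q) (near-mono le₂ s))) ,ᶜ
        ⊕-near {x = re z ⊗ʳ im w} {a ⊗ʳ d} {im z ⊗ʳ re w} {b ⊗ʳ c}
          (h₃ {re z} {im w} (near-mono le₃ p) (near-mono le₃ s)) (h₄ {im z} {re w} (near-mono le₄ q) (near-mono le₄ r))
      where
      le₁ : (δ₁ ⊓ δ₂) ⊓ (δ₃ ⊓ δ₄) ℚ.≤ δ₁
      le₁ = ℚₚ.≤-trans (ℚₚ.p⊓q≤p (δ₁ ⊓ δ₂) (δ₃ ⊓ δ₄)) (ℚₚ.p⊓q≤p δ₁ δ₂)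
      le₂ : (δ₁ ⊓ δ₂) ⊓ (δ₃ ⊓ δ₄) ℚ.≤ δ₂
      le₂ = ℚₚ.≤-trans (ℚₚ.p⊓q≤p (δ₁ ⊓ δ₂) (δ₃ ⊓ δ₄)) (ℚₚ.p⊓q≤q δ₁ δ₂)
      le₃ : (δ₁ ⊓ δ₂) ⊓ (δ₃ ⊓ δ₄) ℚ.≤ δ₃
      le₃ = ℚₚ.≤-trans (ℚₚ.p⊓q≤q (δ₁ ⊓ δ₂) (δ₃ ⊓ δ₄)) (ℚₚ.p⊓q≤p δ₃ δ₄)
      le₄ : (δ₁ ⊓ δ₂) ⊓ (δ₃ ⊓ δ₄) ℚ.≤ δ₄
      le₄ = ℚₚ.≤-trans (ℚₚ.p⊓q≤q (δ₁ ⊓ δ₂) (δ₃ ⊓ δ₄)) (ℚₚ.p⊓q≤q δ₃ δ₄)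

  -- Opaque copies of the operations keep the ring laws below from being checked by unfolding to ℚ.
  opaque
    infixl 6 _+_
    infixl 7 _*_
    infix 8 -_
    _+_ _*_ : ℂ → ℂ → ℂ
    _+_ = _+ᶜ_
    _*_ = _*ᶜ_

    -_ : ℂ → ℂ
    -_ z = (⊖ʳ re z) +i (⊖ʳ im z)

    +-def : ∀ z w → z +ᶜ w ≡ z + w
    +-def z w = refl

    *-def : ∀ z w → z *ᶜ w ≡ z * w
    *-def z w = refl

    +-continuous : Continuous₂ _+_
    +-continuous = +ᶜ-continuous

    *-continuous : Continuous₂ _*_
    *-continuous = *ᶜ-continuous

    near-+ : ∀ {ε x y u v} → Nearᶜ (½ ℚ.* ε) x y → Nearᶜ (½ ℚ.* ε) u v → Nearᶜ ε (x + u) (y + v)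
    near-+ (p ,ᶜ q) (r ,ᶜ s) = ⊕-near p r ,ᶜ ⊕-near q s

    neg-continuous : ∀ {ε z w} → Nearᶜ ε z w → Nearᶜ ε (- z) (- w)
    neg-continuous (p ,ᶜ q) = ⊖-near p ,ᶜ ⊖-near q

  continuous⇒cong : ∀ {_∙_ : ℂ → ℂ → ℂ} → Continuous₂ _∙_ → ∀ {x y u v} → x ≃ y → u ≃ v → (x ∙ u) ≃ (y ∙ v)
  continuous⇒cong cont {y = y} {v = v} x≈y u≈v = mk≃ λ 0<ε →
    let δ , 0<δ , h = cont y v _ 0<ε in h (nears x≈y 0<δ) (nears u≈v 0<δ)

  pointwise⇒≃ : ∀ {z w} → (∀ n → seq (re z) n ≡ seq (re w) n) → (∀ n → seq (im z) n ≡ seq (im w) n) → z ≃ w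
  pointwise⇒≃ p q = mk≃ λ 0<ε → pointwise⇒near 0<ε p ,ᶜ pointwise⇒near 0<ε q

  ≃-isEquivalence : IsEquivalence _≃_
  ≃-isEquivalence = record
    { refl  = pointwise⇒≃ (λ _ → refl) (λ _ → refl)
    ; sym   = λ p → mk≃ λ 0<ε → nearᶜ-sym (nears p 0<ε)
    ; trans = λ p q → mk≃ λ 0<ε → nearᶜ-halves (nears p (half-pos 0<ε)) (nears q (half-pos 0<ε))
    }

  open IsEquivalence ≃-isEquivalence public using () renaming (refl to ≃-refl; sym to ≃-sym; trans to ≃-trans)

  opaque
    unfolding _+_

    +-assoc : ∀ x y z → x + y + z ≃ x + (y + z)
    +-assoc x y z = pointwise⇒≃
      (λ n → ℚₚ.+-assoc (seq (re x) n) (seq (re y) n) (seq (re z) n))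
      (λ n → ℚₚ.+-assoc (seq (im x) n) (seq (im y) n) (seq (im z) n))

    +-identityˡ : ∀ x → 0ℂ + x ≃ x
    +-identityˡ x = pointwise⇒≃ (λ n → ℚₚ.+-identityˡ (seq (re x) n)) (λ n → ℚₚ.+-identityˡ (seq (im x) n))

    +-inverseˡ : ∀ x → - x + x ≃ 0ℂ
    +-inverseˡ x = pointwise⇒≃ (λ n → ℚₚ.+-inverseˡ (seq (re x) n)) (λ n → ℚₚ.+-inverseˡ (seq (im x) n))

    +-comm : ∀ x y → x + y ≃ y + x
    +-comm x y = pointwise⇒≃
      (λ n → ℚₚ.+-comm (seq (re x) n) (seq (re y) n)) (λ n → ℚₚ.+-comm (seq (im x) n) (seq (im y) n))

    *-assoc : ∀ x y z → x * y * z ≃ x * (y * z)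
    *-assoc x y z = pointwise⇒≃
      (λ n → eq-re (seq (re x) n) (seq (im x) n) (seq (re y) n) (seq (im y) n) (seq (re z) n) (seq (im z) n))
      (λ n → eq-im (seq (re x) n) (seq (im x) n) (seq (re y) n) (seq (im y) n) (seq (re z) n) (seq (im z) n))
      where
      eq-re : ∀ a b c d e f → (a ℚ.* c ℚ.+ ℚ.- (b ℚ.* d)) ℚ.* e ℚ.+ ℚ.- ((a ℚ.* d ℚ.+ b ℚ.* c) ℚ.* f)
            ≡ a ℚ.* (c ℚ.* e ℚ.+ ℚ.- (d ℚ.* f)) ℚ.+ ℚ.- (b ℚ.* (c ℚ.* f ℚ.+ d ℚ.* e))
      eq-re = solve 6 (λ a b c d e f → (a :* c :+ :- (b :* d)) :* e :+ :- ((a :* d :+ b :* c) :* f)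
            := a :* (c :* e :+ :- (d :* f)) :+ :- (b :* (c :* f :+ d :* e))) refl
      eq-im : ∀ a b c d e f → (a ℚ.* c ℚ.+ ℚ.- (b ℚ.* d)) ℚ.* f ℚ.+ (a ℚ.* d ℚ.+ b ℚ.* c) ℚ.* e
            ≡ a ℚ.* (c ℚ.* f ℚ.+ d ℚ.* e) ℚ.+ b ℚ.* (c ℚ.* e ℚ.+ ℚ.- (d ℚ.* f))
      eq-im = solve 6 (λ a b c d e f → (a :* c :+ :- (b :* d)) :* f :+ (a :* d :+ b :* c) :* e
            := a :* (c :* f :+ d :* e) :+ b :* (c :* e :+ :- (d :* f))) refl

    *-identityˡ : ∀ x → 1ℂ * x ≃ x
    *-identityˡ x = pointwise⇒≃
      (λ n → trans (cong₂ (λ u v → u ℚ.+ ℚ.- v) (ℚₚ.*-identityˡ (seq (re x) n)) (ℚₚ.*-zeroˡ (seq (im x) n)))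
                   (ℚₚ.+-identityʳ (seq (re x) n)))
      (λ n → trans (cong₂ ℚ._+_ (ℚₚ.*-identityˡ (seq (im x) n)) (ℚₚ.*-zeroˡ (seq (re x) n)))
                   (ℚₚ.+-identityʳ (seq (im x) n)))

    *-comm : ∀ x y → x * y ≃ y * x
    *-comm x y = pointwise⇒≃
      (λ n → cong₂ (λ u v → u ℚ.+ ℚ.- v)
        (ℚₚ.*-comm (seq (re x) n) (seq (re y) n)) (ℚₚ.*-comm (seq (im x) n) (seq (im y) n)))
      (λ n → trans (ℚₚ.+-comm (seq (re x) n ℚ.* seq (im y) n) (seq (im x) n ℚ.* seq (re y) n))
        (cong₂ ℚ._+_ (ℚₚ.*-comm (seq (im x) n) (seq (re y) n)) (ℚₚ.*-comm (seq (re x) n) (seq (im y) n))))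

    *-distribˡ-+ : ∀ x y z → x * (y + z) ≃ x * y + x * z
    *-distribˡ-+ x y z = pointwise⇒≃
      (λ n → eq-re (seq (re x) n) (seq (im x) n) (seq (re y) n) (seq (im y) n) (seq (re z) n) (seq (im z) n))
      (λ n → eq-im (seq (re x) n) (seq (im x) n) (seq (re y) n) (seq (im y) n) (seq (re z) n) (seq (im z) n))
      where
      eq-re : ∀ a b c d e f → a ℚ.* (c ℚ.+ e) ℚ.+ ℚ.- (b ℚ.* (d ℚ.+ f))
            ≡ (a ℚ.* c ℚ.+ ℚ.- (b ℚ.* d)) ℚ.+ (a ℚ.* e ℚ.+ ℚ.- (b ℚ.* f))
      eq-re = solve 6 (λ a b c d e f → a :* (c :+ e) :+ :- (b :* (d :+ f))
            := (a :* c :+ :- (b :* d)) :+ (a :* e :+ :- (b :* f))) refl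
      eq-im : ∀ a b c d e f → a ℚ.* (d ℚ.+ f) ℚ.+ b ℚ.* (c ℚ.+ e)
            ≡ (a ℚ.* d ℚ.+ b ℚ.* c) ℚ.+ (a ℚ.* f ℚ.+ b ℚ.* e)
      eq-im = solve 6 (λ a b c d e f → a :* (d :+ f) :+ b :* (c :+ e)
            := (a :* d :+ b :* c) :+ (a :* f :+ b :* e)) refl

    rat-+ : ∀ p q → rat p + rat q ≃ rat (p ℚ.+ q)
    rat-+ p q = pointwise⇒≃ (λ _ → refl) (λ _ → ℚₚ.+-identityʳ 0ℚ)

    rat-* : ∀ p q → rat p * rat q ≃ rat (p ℚ.* q)
    rat-* p q = pointwise⇒≃
      (λ _ → trans (cong (λ v → p ℚ.* q ℚ.+ ℚ.- v) (ℚₚ.*-zeroʳ 0ℚ)) (ℚₚ.+-identityʳ (p ℚ.* q)))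
      (λ _ → trans (cong₂ ℚ._+_ (ℚₚ.*-zeroʳ p) (ℚₚ.*-zeroˡ q)) (ℚₚ.+-identityʳ 0ℚ))

  ≃-setoid : Setoid 0ℓ 0ℓ
  ≃-setoid = record { isEquivalence = ≃-isEquivalence }

  ℂ-ring : CommutativeRing 0ℓ 0ℓ
  ℂ-ring = record
    { Carrier = ℂ ; _≈_ = _≃_ ; _+_ = _+_ ; _*_ = _*_ ; -_ = -_ ; 0# = 0ℂ ; 1# = 1ℂ
    ; isCommutativeRing = record
      { isRing = record
        { +-isAbelianGroup = record
          { isGroup = record
            { isMonoid = record
              { isSemigroup = record
                { isMagma = record { isEquivalence = ≃-isEquivalence ; ∙-cong = continuous⇒cong +-continuous }
                ; assoc = +-assoc
                }
              ; identity = comm∧idˡ⇒id +-comm +-identityˡ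
              }
            ; inverse = comm∧invˡ⇒inv +-comm +-inverseˡ
            ; ⁻¹-cong = λ p → mk≃ λ 0<ε → neg-continuous (nears p 0<ε)
            }
          ; comm = +-comm
          }
        ; *-cong = continuous⇒cong *-continuous
        ; *-assoc = *-assoc
        ; *-identity = comm∧idˡ⇒id *-comm *-identityˡ
        ; distrib = comm∧distrˡ⇒distr (continuous⇒cong +-continuous) *-comm *-distribˡ-+
        }
      ; *-comm = *-comm
      }
    }
    where
    open import Algebra.Consequences.Setoid ≃-setoid

  nearᶜ-resp : ∀ {ε z z′ w w′} → z ≃ z′ → w ≃ w′ → 0ℚ <′ ε → Nearᶜ (½ ℚ.* (½ ℚ.* ε)) z w → Nearᶜ ε z′ w′
  nearᶜ-resp z≈ w≈ 0<ε c =
    nearᶜ-halves (nearᶜ-halves (nears (≃-sym z≈) (half-pos (half-pos 0<ε))) c) (nears w≈ (half-pos 0<ε))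

  ≃-stable : ∀ {z w} → ¬ ¬ (z ≃ w) → z ≃ w
  ≃-stable {z} {w} h = ≈ᶜ⇒≃
    ( ≈ʳ-stable {re z} {re w} (λ ¬p → h (λ z≈w → ¬p (proj₁ (≃⇒≈ᶜ z≈w))))
    , ≈ʳ-stable {im z} {im w} (λ ¬p → h (λ z≈w → ¬p (proj₂ (≃⇒≈ᶜ z≈w)))))

  1≉0 : ¬ (1ℂ ≃ 0ℂ)
  1≉0 p = let N , h = close (re-near (nears p 0<1)) in ℚₚ.<-irrefl refl (h N ℕₚ.≤-refl)

  record Limit (z : ℕ → ℂ) (w : ℂ) : Set where
    constructor limit
    field approach : ∀ {ε} → 0ℚ <′ ε → ∃ λ J → ∀ j → J ≤ j → Nearᶜ ε (z j) w

  open Limit public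

  limit⇒⟶ᶜ : ∀ {z w} → Limit z w → z ⟶ᶜ w
  limit⇒⟶ᶜ h = (λ ε 0<ε → let J , c = approach h 0<ε in J , λ j le → close (re-near (c j le)))
             , (λ ε 0<ε → let J , c = approach h 0<ε in J , λ j le → close (im-near (c j le)))

  ⟶ᶜ⇒limit : ∀ {z w} → z ⟶ᶜ w → Limit z w
  ⟶ᶜ⇒limit (f , g) = limit λ 0<ε → let I , c = f _ 0<ε ; J , d = g _ 0<ε in
    I ⊔ J , λ j le → near (c j (ℕₚ.m⊔n≤o⇒m≤o I J le)) ,ᶜ near (d j (ℕₚ.m⊔n≤o⇒n≤o I J le))

  limit-resp : ∀ {z z′ w w′} → (∀ j → z j ≃ z′ j) → w ≃ w′ → Limit z w → Limit z′ w′
  limit-resp z≈ w≈ h = limit λ 0<ε → let J , c = approach h (half-pos (half-pos 0<ε)) in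
    J , λ j le → nearᶜ-resp (z≈ j) w≈ 0<ε (c j le)

  limit-const : ∀ c → Limit (λ _ → c) c
  limit-const c = limit λ 0<ε → 0 , λ _ _ → nears ≃-refl 0<ε

  continuous⇒limit : ∀ {_∙_ : ℂ → ℂ → ℂ} → Continuous₂ _∙_ →
                     ∀ {x y u v} → Limit x y → Limit u v → Limit (λ j → x j ∙ u j) (y ∙ v)
  continuous⇒limit cont {y = y} {v = v} f g = limit λ 0<ε →
    let δ , 0<δ , h = cont y v _ 0<ε
        I , c = approach f 0<δ
        J , d = approach g 0<δ
    in I ⊔ J , λ j le → h (c j (ℕₚ.m⊔n≤o⇒m≤o I J le)) (d j (ℕₚ.m⊔n≤o⇒n≤o I J le))

  limit-* : ∀ {x y u v} → Limit x y → Limit u v → Limit (λ j → x j * u j) (y * v)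
  limit-* = continuous⇒limit *-continuous

-- Finite sums in a commutative ring.

module Sums where

  open import Algebra.Bundles using (CommutativeRing)
  open import Level using (0ℓ)
  open import Data.List using (List; []; _∷_; _++_; map; cartesianProductWith)

  module RingSums (R : CommutativeRing 0ℓ 0ℓ) where
    open CommutativeRing R hiding (zero)
    open import Algebra.Properties.CommutativeSemigroup +-commutativeSemigroup using (interchange)
    open import Relation.Binary.Reasoning.Setoid setoid

    private variable
      A B D : Set

    ∑ : List A → (A → Carrier) → Carrier
    ∑ []       f = 0#
    ∑ (x ∷ xs) f = f x + ∑ xs f

    ∑-cong : ∀ (xs : List A) {f g : A → Carrier} → (∀ x → f x ≈ g x) → ∑ xs f ≈ ∑ xs g
    ∑-cong []       eq = refl
    ∑-cong (x ∷ xs) eq = +-cong (eq x) (∑-cong xs eq)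

    ∑-zero : ∀ (xs : List A) {f : A → Carrier} → (∀ x → f x ≈ 0#) → ∑ xs f ≈ 0#
    ∑-zero []       eq = refl
    ∑-zero (x ∷ xs) eq = trans (+-cong (eq x) (∑-zero xs eq)) (+-identityˡ 0#)

    ∑-+ : ∀ (xs : List A) (f g : A → Carrier) → ∑ xs (λ x → f x + g x) ≈ ∑ xs f + ∑ xs g
    ∑-+ []       f g = sym (+-identityˡ 0#)
    ∑-+ (x ∷ xs) f g = trans (+-congˡ (∑-+ xs f g)) (interchange (f x) (g x) (∑ xs f) (∑ xs g))

    ∑-*ˡ : ∀ (xs : List A) c (f : A → Carrier) → c * ∑ xs f ≈ ∑ xs (λ x → c * f x)
    ∑-*ˡ []       c f = zeroʳ c
    ∑-*ˡ (x ∷ xs) c f = trans (distribˡ c (f x) (∑ xs f)) (+-congˡ (∑-*ˡ xs c f))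

    ∑-*ʳ : ∀ (xs : List A) (f : A → Carrier) c → ∑ xs f * c ≈ ∑ xs (λ x → f x * c)
    ∑-*ʳ xs f c = trans (*-comm (∑ xs f) c) (trans (∑-*ˡ xs c f) (∑-cong xs λ x → *-comm c (f x)))

    ∑-++ : ∀ (xs ys : List A) (f : A → Carrier) → ∑ (xs ++ ys) f ≈ ∑ xs f + ∑ ys f
    ∑-++ []       ys f = sym (+-identityˡ _)
    ∑-++ (x ∷ xs) ys f = trans (+-congˡ (∑-++ xs ys f)) (sym (+-assoc (f x) (∑ xs f) (∑ ys f)))

    ∑-map : ∀ (g : A → B) (xs : List A) (f : B → Carrier) → ∑ (map g xs) f ≈ ∑ xs (λ x → f (g x))
    ∑-map g []       f = refl
    ∑-map g (x ∷ xs) f = +-congˡ (∑-map g xs f)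

    ∑-swap : ∀ (xs : List A) (ys : List B) (f : A → B → Carrier) →
             ∑ xs (λ x → ∑ ys (f x)) ≈ ∑ ys (λ y → ∑ xs (λ x → f x y))
    ∑-swap []       ys f = sym (∑-zero ys (λ _ → refl))
    ∑-swap (x ∷ xs) ys f = trans (+-congˡ (∑-swap xs ys f)) (sym (∑-+ ys (f x) (λ y → ∑ xs (λ x′ → f x′ y))))

    ∑-product : ∀ (g : A → B → D) (xs : List A) (ys : List B) (f : D → Carrier) →
                ∑ (cartesianProductWith g xs ys) f ≈ ∑ xs (λ x → ∑ ys (λ y → f (g x y)))
    ∑-product g []       ys f = refl
    ∑-product g (x ∷ xs) ys f = trans (∑-++ (map (g x) ys) _ f)
      (+-cong (∑-map (g x) ys f) (∑-product g xs ys f))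

-- The polynomial ring and substitution.

module Polynomials where

  open import Defs hiding (interchange)
  open Reals using (_≃_; ≃-refl; ≃-sym; ≃-trans; ≃⇒≈ᶜ; ≈ᶜ⇒≃; ℂ-ring)
  open Sums
  open import Data.Nat using (ℕ)
  open import Data.List using (List; []; _∷_; _++_; map)
  import Data.List.Properties as Listₚ
  open import Data.List.Relation.Unary.Any as Any using (Any; here; there; any?)
  import Data.List.Relation.Unary.Any.Properties as Anyₚ
  open import Data.List.Relation.Unary.All as All using (All; []; _∷_)
  open import Data.List.Relation.Binary.Permutation.Propositional as Perm using (_↭_; ↭-refl; ↭-sym; ↭-trans)
  import Data.List.Relation.Binary.Permutation.Propositional.Properties as Permₚ
  open import Data.Product using (_×_; _,_; proj₁; proj₂)
  open import Data.Bool using (Bool; if_then_else_)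
  open import Relation.Nullary using (¬_; Dec; yes; no; does; contradiction)
  open import Relation.Nullary.Decidable using (dec-true; dec-false)
  open import Relation.Binary using (IsEquivalence; Setoid)
  open import Relation.Binary.PropositionalEquality as ≡ using (_≡_; refl; cong; cong₂; subst)
  open import Algebra.Bundles using (CommutativeRing)
  open import Level using (0ℓ)

  private
    module K = CommutativeRing ℂ-ring
    module KR where
      open import Relation.Binary.Reasoning.Setoid K.setoid public
  open RingSums ℂ-ring

  Invariant : (Monomial → ℂ) → Set
  Invariant φ = ∀ {m m′} → m ↭ m′ → φ m ≃ φ m′

  eval : (Monomial → ℂ) → Poly → ℂ
  eval φ p = ∑ p λ t → proj₁ t K.* φ (proj₂ t)

  eval-cong : ∀ {φ ψ} p → (∀ m → φ m ≃ ψ m) → eval φ p ≃ eval ψ p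
  eval-cong p eq = ∑-cong p λ t → K.*-congˡ (eq (proj₂ t))

  eval-+ : ∀ φ ψ p → eval (λ m → φ m K.+ ψ m) p ≃ eval φ p K.+ eval ψ p
  eval-+ φ ψ p = ≃-trans (∑-cong p λ t → K.distribˡ (proj₁ t) (φ (proj₂ t)) (ψ (proj₂ t))) (∑-+ p _ _)

  eval-scale : ∀ c φ p → eval (λ m → c K.* φ m) p ≃ c K.* eval φ p
  eval-scale c φ p = ≃-trans (∑-cong p λ t → x∙yz≈y∙xz (proj₁ t) c (φ (proj₂ t))) (≃-sym (∑-*ˡ p c _))
    where open import Algebra.Properties.CommutativeSemigroup K.*-commutativeSemigroup using (x∙yz≈y∙xz)

  eval-swap : ∀ (f : Monomial → Monomial → ℂ) p q →
              eval (λ m → eval (f m) q) p ≃ eval (λ m′ → eval (λ m → f m m′) p) q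
  eval-swap f p q = begin
    ∑ p (λ t → proj₁ t K.* eval (f (proj₂ t)) q)
      ≈⟨ ∑-cong p (λ t → ∑-*ˡ q (proj₁ t) _) ⟩
    ∑ p (λ t → ∑ q λ u → proj₁ t K.* (proj₁ u K.* f (proj₂ t) (proj₂ u)))
      ≈⟨ ∑-swap p q _ ⟩
    ∑ q (λ u → ∑ p λ t → proj₁ t K.* (proj₁ u K.* f (proj₂ t) (proj₂ u)))
      ≈⟨ ∑-cong q (λ u → eval-scale (proj₁ u) (λ m → f m (proj₂ u)) p) ⟩
    ∑ q (λ u → proj₁ u K.* eval (λ m → f m (proj₂ u)) p) ∎
    where open KR

  -- Testing equality against all ↭-invariant functionals turns the ring laws into statements
  -- about double sums; ≃⇒≋ and ≋⇒≃ show that it is equality of coefficients.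
  record _≋_ (p q : Poly) : Set where
    constructor mk≋
    field evals : ∀ φ → Invariant φ → eval φ p ≃ eval φ q

  open _≋_ public
  infix 4 _≋_

  δ : Monomial → Monomial → ℂ
  δ m w = if does (w ↭? m) then 1ℂ else 0ℂ

  δ-yes : ∀ {m w} → w ↭ m → δ m w ≡ 1ℂ
  δ-yes {m} {w} p rewrite dec-true (w ↭? m) p = refl

  δ-no : ∀ {m w} → ¬ (w ↭ m) → δ m w ≡ 0ℂ
  δ-no {m} {w} p rewrite dec-false (w ↭? m) p = refl

  δ-invariant : ∀ m → Invariant (δ m)
  δ-invariant m {w} {w′} w↭w′ with w ↭? m
  ... | yes p rewrite δ-yes {m} {w′} (↭-trans (↭-sym w↭w′) p) = ≃-refl
  ... | no ¬p rewrite δ-no {m} {w′} (λ p → ¬p (↭-trans w↭w′ p)) = ≃-refl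

  coeff≃eval : ∀ p m → coeff p m ≃ eval (δ m) p
  coeff≃eval []            m = ≃-refl
  coeff≃eval ((c , w) ∷ p) m with w ↭? m
  ... | yes e = ≃-trans (K.reflexive (Reals.+-def c _)) (K.+-cong (≃-sym (K.*-identityʳ c)) (coeff≃eval p m))
  ... | no ¬e = ≃-trans (coeff≃eval p m)
    (≃-sym (≃-trans (K.+-congʳ (K.zeroʳ c)) (K.+-identityˡ _)))

  ≋⇒≃ : ∀ {p q} → p ≋ q → ∀ m → coeff p m ≃ coeff q m
  ≋⇒≃ {p} {q} e m = ≃-trans (coeff≃eval p m) (≃-trans (evals e (δ m) (δ-invariant m)) (≃-sym (coeff≃eval q m)))

  ≋⇒≈ : ∀ {p q} → p ≋ q → p ≈ q
  ≋⇒≈ e m = ≃⇒≈ᶜ (≋⇒≃ e m)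

  infix 4 _∈~_
  _∈~_ : Monomial → List Monomial → Set
  m ∈~ ms = Any (m ↭_) ms

  _∈~?_ : ∀ m ms → Dec (m ∈~ ms)
  m ∈~? ms = any? (m ↭?_) ms

  ∈~-resp : ∀ {m m′ ms} → m ↭ m′ → m ∈~ ms → m′ ∈~ ms
  ∈~-resp e = Any.map (↭-trans (↭-sym e))

  once : (Monomial → ℂ) → Monomial → List Monomial → ℂ
  once γ m ms = if does (m ∈~? ms) then 0ℂ else γ m

  -- The polynomial with coefficients γ supported on ms; only the last copy of
  -- a monomial that is listed repeatedly receives its coefficient.
  collect : (Monomial → ℂ) → List Monomial → Poly
  collect γ []       = []
  collect γ (m ∷ ms) = (once γ m ms , m) ∷ collect γ ms

  collect-cong : ∀ {γ γ′} → (∀ m → γ m ≃ γ′ m) → ∀ φ ms → eval φ (collect γ ms) ≃ eval φ (collect γ′ ms)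
  collect-cong         eq φ []       = ≃-refl
  collect-cong {γ} {γ′} eq φ (m ∷ ms) = K.+-cong (K.*-congʳ step) (collect-cong eq φ ms)
    where
    step : once γ m ms ≃ once γ′ m ms
    step with m ∈~? ms
    ... | yes _ = ≃-refl
    ... | no  _ = eq m

  collect-+ : ∀ γ γ′ φ ms → eval φ (collect (λ m → γ m K.+ γ′ m) ms) ≃
                            eval φ (collect γ ms) K.+ eval φ (collect γ′ ms)
  collect-+ γ γ′ φ []       = ≃-sym (K.+-identityˡ 0ℂ)
  collect-+ γ γ′ φ (m ∷ ms) = ≃-trans
    (K.+-cong (≃-trans (K.*-congʳ step) (K.distribʳ (φ m) _ _)) (collect-+ γ γ′ φ ms)) (interchange _ _ _ _)
    where
    open import Algebra.Properties.CommutativeSemigroup K.+-commutativeSemigroup using (interchange)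
    step : once (λ m → γ m K.+ γ′ m) m ms ≃ once γ m ms K.+ once γ′ m ms
    step with m ∈~? ms
    ... | yes _ = ≃-sym (K.+-identityˡ 0ℂ)
    ... | no  _ = ≃-refl

  collect-zero : ∀ φ ms → eval φ (collect (λ _ → 0ℂ) ms) ≃ 0ℂ
  collect-zero φ []       = ≃-refl
  collect-zero φ (m ∷ ms) = ≃-trans (K.+-cong (≃-trans (K.*-congʳ step) (K.zeroˡ (φ m))) (collect-zero φ ms))
                                     (K.+-identityˡ 0ℂ)
    where
    step : once (λ _ → 0ℂ) m ms ≃ 0ℂ
    step with m ∈~? ms
    ... | yes _ = ≃-refl
    ... | no  _ = ≃-refl

  collect-δ-∉ : ∀ φ c w ms → ¬ (w ∈~ ms) → eval φ (collect (λ m → c K.* δ m w) ms) ≃ 0ℂ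
  collect-δ-∉ φ c w []       _   = ≃-refl
  collect-δ-∉ φ c w (m ∷ ms) w∉ = ≃-trans
    (K.+-cong (≃-trans (K.*-congʳ step) (K.zeroˡ (φ m))) (collect-δ-∉ φ c w ms (λ w∈ → w∉ (there w∈))))
    (K.+-identityˡ 0ℂ)
    where
    step : once (λ m → c K.* δ m w) m ms ≃ 0ℂ
    step with m ∈~? ms
    ... | yes _ = ≃-refl
    ... | no  _ = ≃-trans (K.*-congˡ (K.reflexive (δ-no λ e → w∉ (here e)))) (K.zeroʳ c)

  collect-δ-∈ : ∀ φ → Invariant φ → ∀ c w ms → w ∈~ ms → eval φ (collect (λ m → c K.* δ m w) ms) ≃ c K.* φ w
  collect-δ-∈ φ inv c w (m ∷ ms) w∈ with m ∈~? ms
  ... | yes m∈ = ≃-trans (K.+-cong (K.zeroˡ (φ m)) (collect-δ-∈ φ inv c w ms (later w∈))) (K.+-identityˡ _)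
    where
    later : w ∈~ (m ∷ ms) → w ∈~ ms
    later (here e)  = ∈~-resp (↭-sym e) m∈
    later (there i) = i
  ... | no m∉ with w ↭? m
  ...   | yes e = ≃-trans (K.+-cong (K.*-cong (K.*-identityʳ c) (inv (↭-sym e)))
                                    (collect-δ-∉ φ c w ms (λ w∈ms → m∉ (∈~-resp e w∈ms)))) (K.+-identityʳ _)
  ...   | no ¬e = ≃-trans (K.+-cong (≃-trans (K.*-congʳ (K.zeroʳ c)) (K.zeroˡ (φ m)))
                                    (collect-δ-∈ φ inv c w ms (later w∈))) (K.+-identityˡ _)
    where
    later : w ∈~ (m ∷ ms) → w ∈~ ms
    later (here e)  = contradiction e ¬e
    later (there i) = i

  -- This is the step from coefficients to functionals. A term c·w adds c·δ to the coefficient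
  -- function, and `collect` places it at exactly one of the copies of `w` in `ms`, so induction on
  -- the terms of `p` recovers `p` up to cancellation and reordering.
  eval-collect : ∀ φ → Invariant φ → ∀ p ms → All (λ t → proj₂ t ∈~ ms) p → eval φ (collect (coeff p) ms) ≃ eval φ p
  eval-collect φ inv []            ms []         = collect-zero φ ms
  eval-collect φ inv ((c , w) ∷ p) ms (w∈ ∷ p⊆) = ≃-trans
    (collect-cong step φ ms) (≃-trans (collect-+ (λ m → c K.* δ m w) (coeff p) φ ms)
      (K.+-cong (collect-δ-∈ φ inv c w ms w∈) (eval-collect φ inv p ms p⊆)))
    where
    step : ∀ m → coeff ((c , w) ∷ p) m ≃ (c K.* δ m w) K.+ coeff p m
    step m = ≃-trans (coeff≃eval ((c , w) ∷ p) m) (K.+-congˡ (≃-sym (coeff≃eval p m)))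

  collect-prune : ∀ φ γ ms′ ms → (∀ m → ¬ (m ∈~ ms) → γ m ≃ 0ℂ) →
                  eval φ (collect γ (ms′ ++ ms)) ≃ eval φ (collect γ ms)
  collect-prune φ γ []        ms out = ≃-refl
  collect-prune φ γ (m ∷ ms′) ms out = ≃-trans
    (K.+-cong (≃-trans (K.*-congʳ step) (K.zeroˡ (φ m))) (collect-prune φ γ ms′ ms out)) (K.+-identityˡ _)
    where
    step : once γ m (ms′ ++ ms) ≃ 0ℂ
    step with m ∈~? (ms′ ++ ms)
    ... | yes _ = ≃-refl
    ... | no m∉ = out m (λ m∈ → m∉ (Anyₚ.++⁺ʳ ms′ m∈))

  monomials : Poly → List Monomial
  monomials = map proj₂

  monomials-⊇ : ∀ p ms → All (λ t → proj₂ t ∈~ (monomials p ++ ms)) p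
  monomials-⊇ []      ms = []
  monomials-⊇ (t ∷ p) ms = here ↭-refl ∷ All.map there (monomials-⊇ p ms)

  -- The list `p` may contain monomials outside `ms` whose coefficients cancel. Its own monomials
  -- are prepended so that `eval-collect` applies, and pruned afterwards: each of them recurs in the
  -- list or has coefficient zero.
  collect-supported : ∀ p ms → (∀ m → ¬ (m ∈~ ms) → coeff p m ≃ 0ℂ) → collect (coeff p) ms ≋ p
  collect-supported p ms out = mk≋ λ φ inv → ≃-trans
    (≃-sym (collect-prune φ (coeff p) (monomials p) ms out))
    (eval-collect φ inv p (monomials p ++ ms) (monomials-⊇ p ms))

  ≃⇒≋ : ∀ {p q} → (∀ m → coeff p m ≃ coeff q m) → p ≋ q
  ≃⇒≋ {p} {q} eq = mk≋ λ φ inv → ≃-trans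
    (≃-sym (eval-collect φ inv p (monomials p ++ monomials q) (monomials-⊇ p (monomials q))))
    (≃-trans (collect-cong eq φ (monomials p ++ monomials q))
      (eval-collect φ inv q (monomials p ++ monomials q)
        (All.map (Anyₚ.++⁺ʳ (monomials p)) (subst (λ ms → All (λ t → proj₂ t ∈~ ms) q)
          (Listₚ.++-identityʳ (monomials q)) (monomials-⊇ q [])))))

  ≈⇒≋ : ∀ {p q} → p ≈ q → p ≋ q
  ≈⇒≋ e = ≃⇒≋ λ m → ≈ᶜ⇒≃ (e m)

  opaque
    infixl 6 _+_
    infixl 7 _*_
    _+_ _*_ : Poly → Poly → Poly
    _+_ = _+ᵖ_
    _*_ = _*ᵖ_

    +-def : ∀ p q → p +ᵖ q ≡ p + q
    +-def p q = refl

    *-def : ∀ p q → p *ᵖ q ≡ p * q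
    *-def p q = refl

    eval-sum : ∀ φ p q → eval φ (p + q) ≃ eval φ p K.+ eval φ q
    eval-sum φ p q = ∑-++ p q _

    eval-product : ∀ φ p q → eval φ (p * q) ≃ eval (λ m → eval (λ m′ → φ (m ++ m′)) q) p
    eval-product φ p q = begin
      ∑ (p *ᵖ q) (λ t → proj₁ t K.* φ (proj₂ t))
        ≈⟨ ∑-product _*ᵗ_ p q _ ⟩
      ∑ p (λ t → ∑ q λ u → (proj₁ t *ᶜ proj₁ u) K.* φ (proj₂ t ++ proj₂ u))
        ≈⟨ ∑-cong p (λ t → ∑-cong q λ u → ≃-trans (K.*-congʳ (K.reflexive (Reals.*-def (proj₁ t) (proj₁ u))))
                                                  (K.*-assoc (proj₁ t) (proj₁ u) _)) ⟩
      ∑ p (λ t → ∑ q λ u → proj₁ t K.* (proj₁ u K.* φ (proj₂ t ++ proj₂ u)))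
        ≈⟨ ∑-cong p (λ t → ≃-sym (∑-*ˡ q (proj₁ t) _)) ⟩
      ∑ p (λ t → proj₁ t K.* eval (λ m′ → φ (proj₂ t ++ m′)) q) ∎
      where open KR

  infix 8 -_
  -_ : Poly → Poly
  - p = const (K.- 1ℂ) * p

  eval-const : ∀ φ c → eval φ (const c) ≃ c K.* φ []
  eval-const φ c = K.+-identityʳ (c K.* φ [])

  eval-const-* : ∀ φ c p → eval φ (const c * p) ≃ c K.* eval φ p
  eval-const-* φ c p = ≃-trans (eval-product φ (const c) p) (eval-const (λ m → eval (λ m′ → φ (m ++ m′)) p) c)

  eval-- : ∀ φ p → eval φ (- p) ≃ K.- eval φ p
  eval-- φ p = ≃-trans (eval-const-* φ (K.- 1ℂ) p) (-1*x≈-x (eval φ p))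
    where open import Algebra.Properties.Ring K.ring using (-1*x≈-x)

  shift-invariant : ∀ {φ} → Invariant φ → ∀ m → Invariant (λ m′ → φ (m ++ m′))
  shift-invariant inv m e = inv (Permₚ.++⁺ˡ m e)

  fibre-invariant : ∀ {φ} → Invariant φ → ∀ q → Invariant (λ m → eval (λ m′ → φ (m ++ m′)) q)
  fibre-invariant inv q e = eval-cong q λ m′ → inv (Permₚ.++⁺ʳ m′ e)

  ≋-isEquivalence : IsEquivalence _≋_
  ≋-isEquivalence = record
    { refl  = mk≋ λ _ _ → ≃-refl
    ; sym   = λ e → mk≋ λ φ inv → ≃-sym (evals e φ inv)
    ; trans = λ e f → mk≋ λ φ inv → ≃-trans (evals e φ inv) (evals f φ inv)
    }

  ≋-setoid : Setoid 0ℓ 0ℓ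
  ≋-setoid = record { isEquivalence = ≋-isEquivalence }

  open IsEquivalence ≋-isEquivalence public using () renaming (refl to ≋-refl; sym to ≋-sym; trans to ≋-trans; reflexive to ≋-reflexive)

  +-cong : ∀ {p p′ q q′} → p ≋ p′ → q ≋ q′ → p + q ≋ p′ + q′
  +-cong {p} {p′} {q} {q′} e f = mk≋ λ φ inv → ≃-trans (eval-sum φ p q)
    (≃-trans (K.+-cong (evals e φ inv) (evals f φ inv)) (≃-sym (eval-sum φ p′ q′)))

  *-cong : ∀ {p p′ q q′} → p ≋ p′ → q ≋ q′ → p * q ≋ p′ * q′
  *-cong {p} {p′} {q} {q′} e f = mk≋ λ φ inv → begin
    eval φ (p * q)                                  ≈⟨ eval-product φ p q ⟩
    eval (λ m → eval (λ m′ → φ (m ++ m′)) q) p      ≈⟨ eval-cong p (λ m → evals f _ (shift-invariant inv m)) ⟩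
    eval (λ m → eval (λ m′ → φ (m ++ m′)) q′) p     ≈⟨ evals e _ (fibre-invariant inv q′) ⟩
    eval (λ m → eval (λ m′ → φ (m ++ m′)) q′) p′    ≈⟨ eval-product φ p′ q′ ⟨
    eval φ (p′ * q′)                                ∎
    where open KR

  *-assoc : ∀ p q r → p * q * r ≋ p * (q * r)
  *-assoc p q r = mk≋ λ φ inv → begin
    eval φ (p * q * r)
      ≈⟨ eval-product φ (p * q) r ⟩
    eval (λ m → eval (λ m′ → φ (m ++ m′)) r) (p * q)
      ≈⟨ eval-product _ p q ⟩
    eval (λ m → eval (λ m′ → eval (λ m″ → φ ((m ++ m′) ++ m″)) r) q) p
      ≈⟨ eval-cong p (λ m → eval-cong q λ m′ → eval-cong r λ m″ → K.reflexive (cong φ (Listₚ.++-assoc m m′ m″))) ⟩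
    eval (λ m → eval (λ m′ → eval (λ m″ → φ (m ++ (m′ ++ m″))) r) q) p
      ≈⟨ eval-cong p (λ m → eval-product _ q r) ⟨
    eval (λ m → eval (λ m′ → φ (m ++ m′)) (q * r)) p
      ≈⟨ eval-product φ p (q * r) ⟨
    eval φ (p * (q * r)) ∎
    where open KR

  *-comm : ∀ p q → p * q ≋ q * p
  *-comm p q = mk≋ λ φ inv → begin
    eval φ (p * q)                                ≈⟨ eval-product φ p q ⟩
    eval (λ m → eval (λ m′ → φ (m ++ m′)) q) p    ≈⟨ eval-swap (λ m m′ → φ (m ++ m′)) p q ⟩
    eval (λ m′ → eval (λ m → φ (m ++ m′)) p) q    ≈⟨ eval-cong q (λ m′ → eval-cong p λ m → inv (Permₚ.++-comm m m′)) ⟩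
    eval (λ m′ → eval (λ m → φ (m′ ++ m)) p) q    ≈⟨ eval-product φ q p ⟨
    eval φ (q * p)                                ∎
    where open KR

  Poly-ring : CommutativeRing 0ℓ 0ℓ
  Poly-ring = record
    { Carrier = Poly ; _≈_ = _≋_ ; _+_ = _+_ ; _*_ = _*_ ; -_ = -_ ; 0# = [] ; 1# = const 1ℂ
    ; isCommutativeRing = record
      { isRing = record
        { +-isAbelianGroup = record
          { isGroup = record
            { isMonoid = record
              { isSemigroup = record
                { isMagma = record { isEquivalence = ≋-isEquivalence ; ∙-cong = +-cong }
                ; assoc = λ p q r → mk≋ λ φ inv → ≃-trans (eval-sum φ (p + q) r)
                    (≃-trans (K.+-congʳ (eval-sum φ p q)) (≃-trans (K.+-assoc _ _ _)
                      (≃-sym (≃-trans (eval-sum φ p (q + r)) (K.+-congˡ (eval-sum φ q r))))))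
                }
              ; identity = comm∧idˡ⇒id comm (λ p → mk≋ λ φ inv → ≃-trans (eval-sum φ [] p) (K.+-identityˡ _))
              }
            ; inverse = comm∧invˡ⇒inv comm (λ p → mk≋ λ φ inv → ≃-trans (eval-sum φ (- p) p)
                (≃-trans (K.+-congʳ (eval-- φ p)) (K.-‿inverseˡ _)))
            ; ⁻¹-cong = λ {p} {q} e → mk≋ λ φ inv → ≃-trans (eval-- φ p)
                (≃-trans (K.-‿cong (evals e φ inv)) (≃-sym (eval-- φ q)))
            }
          ; comm = comm
          }
        ; *-cong = *-cong
        ; *-assoc = *-assoc
        ; *-identity = comm∧idˡ⇒id *-comm (λ p → mk≋ λ φ inv → ≃-trans (eval-const-* φ 1ℂ p) (K.*-identityˡ _))
        ; distrib = comm∧distrˡ⇒distr +-cong *-comm λ p q r → mk≋ λ φ inv →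
            ≃-trans (eval-product φ p (q + r)) (≃-trans (eval-cong p λ m → eval-sum _ q r)
              (≃-trans (eval-+ _ _ p) (≃-sym (≃-trans (eval-sum φ (p * q) (p * r))
                (K.+-cong (eval-product φ p q) (eval-product φ p r))))))
        }
      ; *-comm = *-comm
      }
    }
    where
    open import Algebra.Consequences.Setoid ≋-setoid
    comm : ∀ p q → p + q ≋ q + p
    comm p q = mk≋ λ φ inv → ≃-trans (eval-sum φ p q) (≃-trans (K.+-comm _ _) (≃-sym (eval-sum φ q p)))

  private module P = CommutativeRing Poly-ring
  open RingSums Poly-ring using () renaming (∑ to ∑ᵖ; ∑-cong to ∑ᵖ-cong; ∑-++ to ∑ᵖ-++; ∑-product to ∑ᵖ-product; ∑-*ˡ to ∑ᵖ-*ˡ; ∑-*ʳ to ∑ᵖ-*ʳ)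

  const-cong : ∀ {c d} → c ≃ d → const c ≋ const d
  const-cong e = mk≋ λ φ inv → K.+-congʳ (K.*-congʳ e)

  const-+ : ∀ c d → const (c K.+ d) ≋ const c + const d
  const-+ c d = mk≋ λ φ inv → ≃-trans (eval-const φ (c K.+ d)) (≃-trans (K.distribʳ (φ []) c d)
    (≃-sym (≃-trans (eval-sum φ (const c) (const d)) (K.+-cong (eval-const φ c) (eval-const φ d)))))

  const-* : ∀ c d → const (c K.* d) ≋ const c * const d
  const-* c d = mk≋ λ φ inv → ≃-trans (eval-const φ (c K.* d)) (≃-trans (K.*-assoc c d (φ []))
    (≃-sym (≃-trans (eval-const-* φ c (const d)) (K.*-congˡ (eval-const φ d)))))

  const-0 : const 0ℂ ≋ []
  const-0 = mk≋ λ φ inv → ≃-trans (eval-const φ 0ℂ) (K.zeroˡ (φ []))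

  mono : (ℕ → Poly) → Monomial → Poly
  mono s []      = const 1ℂ
  mono s (i ∷ m) = s i * mono s m

  opaque
    unfolding _*_
    mono-def : ∀ s m → productᵖ (map s m) ≡ mono s m
    mono-def s []      = refl
    mono-def s (i ∷ m) = cong (s i *ᵖ_) (mono-def s m)

  opaque
    unfolding _+_
    sumᵖ-map : ∀ {A : Set} (f : A → Poly) xs → sumᵖ (map f xs) ≡ ∑ᵖ xs f
    sumᵖ-map f []       = refl
    sumᵖ-map f (x ∷ xs) = cong (f x +ᵖ_) (sumᵖ-map f xs)

  ∑ᵖ-≡ : ∀ {A : Set} (xs : List A) {f g : A → Poly} → (∀ x → f x ≡ g x) → ∑ᵖ xs f ≡ ∑ᵖ xs g
  ∑ᵖ-≡ []       eq = refl
  ∑ᵖ-≡ (x ∷ xs) eq = cong₂ _+_ (eq x) (∑ᵖ-≡ xs eq)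

  ⟨⟩-def : ∀ p s → p ⟨ s ⟩ ≡ ∑ᵖ p (λ t → const (proj₁ t) * mono s (proj₂ t))
  ⟨⟩-def p s = ≡.trans (sumᵖ-map _ p) (∑ᵖ-≡ p λ t →
    ≡.trans (*-def (const (proj₁ t)) _) (cong (const (proj₁ t) *_) (mono-def s (proj₂ t))))

  eval-∑ : ∀ {A : Set} φ xs (f : A → Poly) → eval φ (∑ᵖ xs f) ≃ ∑ xs (λ x → eval φ (f x))
  eval-∑ φ []       f = ≃-refl
  eval-∑ φ (x ∷ xs) f = ≃-trans (eval-sum φ (f x) (∑ᵖ xs f)) (K.+-congˡ (eval-∑ φ xs f))

  eval-⟨⟩ : ∀ φ p s → eval φ (p ⟨ s ⟩) ≃ eval (λ m → eval φ (mono s m)) p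
  eval-⟨⟩ φ p s = ≃-trans (K.reflexive (cong (eval φ) (⟨⟩-def p s)))
    (≃-trans (eval-∑ φ p _) (∑-cong p λ t → eval-const-* φ (proj₁ t) (mono s (proj₂ t))))

  mono-↭ : ∀ s {m m′} → m ↭ m′ → mono s m ≋ mono s m′
  mono-↭ s Perm.refl              = ≋-refl
  mono-↭ s (Perm.prep i e)        = *-cong ≋-refl (mono-↭ s e)
  mono-↭ s (Perm.swap {xs} i j e) = ≋-trans (≋-sym (*-assoc (s i) (s j) _))
    (≋-trans (*-cong (*-comm (s i) (s j)) (mono-↭ s e)) (*-assoc (s j) (s i) _))
  mono-↭ s (Perm.trans e f)       = ≋-trans (mono-↭ s e) (mono-↭ s f)

  mono-++ : ∀ s m m′ → mono s (m ++ m′) ≋ mono s m * mono s m′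
  mono-++ s []      m′ = ≋-sym (P.*-identityˡ _)
  mono-++ s (i ∷ m) m′ = ≋-trans (*-cong ≋-refl (mono-++ s m m′)) (≋-sym (*-assoc (s i) _ _))

  mono-cong : ∀ {s s′} → (∀ i → s i ≋ s′ i) → ∀ m → mono s m ≋ mono s′ m
  mono-cong eq []      = ≋-refl
  mono-cong eq (i ∷ m) = *-cong (eq i) (mono-cong eq m)

  ⟨⟩-cong : ∀ {p q s s′} → p ≋ q → (∀ i → s i ≋ s′ i) → p ⟨ s ⟩ ≋ q ⟨ s′ ⟩
  ⟨⟩-cong {p} {q} {s} {s′} e eq = mk≋ λ φ inv → ≃-trans (eval-⟨⟩ φ p s) (≃-trans
    (evals e _ (λ m↭ → evals (mono-↭ s m↭) φ inv)) (≃-trans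
      (eval-cong q λ m → evals (mono-cong eq m) φ inv) (≃-sym (eval-⟨⟩ φ q s′))))

  ⟨⟩-[] : ∀ s → [] ⟨ s ⟩ ≡ []
  ⟨⟩-[] s = refl

  opaque
    unfolding _+_ _*_
    ∑ᵖ-terms-+ : ∀ p q (f : ℂ × Monomial → Poly) → ∑ᵖ (p + q) f ≋ P._+_ (∑ᵖ p f) (∑ᵖ q f)
    ∑ᵖ-terms-+ p q f = ∑ᵖ-++ p q f

    ∑ᵖ-terms-* : ∀ p q (f : ℂ × Monomial → Poly) → ∑ᵖ (p * q) f ≋ ∑ᵖ p (λ t → ∑ᵖ q λ u → f (t *ᵗ u))
    ∑ᵖ-terms-* p q f = ∑ᵖ-product _*ᵗ_ p q f

  ⟨⟩-+ : ∀ p q s → (p + q) ⟨ s ⟩ ≋ p ⟨ s ⟩ + q ⟨ s ⟩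
  ⟨⟩-+ p q s = ≋-trans (≋-reflexive (⟨⟩-def (p + q) s)) (≋-trans (∑ᵖ-terms-+ p q _)
    (≋-reflexive (≡.sym (cong₂ _+_ (⟨⟩-def p s) (⟨⟩-def q s)))))

  ⟨⟩-* : ∀ p q s → (p * q) ⟨ s ⟩ ≋ p ⟨ s ⟩ * q ⟨ s ⟩
  ⟨⟩-* p q s = begin
    (p * q) ⟨ s ⟩
      ≈⟨ ≋-reflexive (⟨⟩-def (p * q) s) ⟩
    ∑ᵖ (p * q) (λ t → const (proj₁ t) * mono s (proj₂ t))
      ≈⟨ ∑ᵖ-terms-* p q _ ⟩
    ∑ᵖ p (λ t → ∑ᵖ q λ u → const (proj₁ t *ᶜ proj₁ u) * mono s (proj₂ t ++ proj₂ u))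
      ≈⟨ ∑ᵖ-cong p (λ t → ∑ᵖ-cong q λ u → ≋-trans
           (*-cong (≋-trans (≋-reflexive (cong const (Reals.*-def (proj₁ t) (proj₁ u)))) (const-* (proj₁ t) (proj₁ u)))
                   (mono-++ s (proj₂ t) (proj₂ u)))
           (interchange (const (proj₁ t)) (const (proj₁ u)) (mono s (proj₂ t)) (mono s (proj₂ u)))) ⟩
    ∑ᵖ p (λ t → ∑ᵖ q λ u → (const (proj₁ t) * mono s (proj₂ t)) * (const (proj₁ u) * mono s (proj₂ u)))
      ≈⟨ ∑ᵖ-cong p (λ t → ∑ᵖ-*ˡ q _ _) ⟨
    ∑ᵖ p (λ t → (const (proj₁ t) * mono s (proj₂ t)) * ∑ᵖ q λ u → const (proj₁ u) * mono s (proj₂ u))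
      ≈⟨ ∑ᵖ-*ʳ p _ _ ⟨
    ∑ᵖ p (λ t → const (proj₁ t) * mono s (proj₂ t)) * ∑ᵖ q (λ u → const (proj₁ u) * mono s (proj₂ u))
      ≈⟨ ≋-reflexive (≡.sym (cong₂ _*_ (⟨⟩-def p s) (⟨⟩-def q s))) ⟩
    p ⟨ s ⟩ * q ⟨ s ⟩ ∎
    where
    open import Relation.Binary.Reasoning.Setoid ≋-setoid
    open import Algebra.Properties.CommutativeSemigroup P.*-commutativeSemigroup using (interchange)

  ⟨⟩-const : ∀ c s → const c ⟨ s ⟩ ≋ const c
  ⟨⟩-const c s = ≋-trans (≋-reflexive (⟨⟩-def (const c) s)) (≋-trans (P.+-identityʳ _) (P.*-identityʳ _))

  ⟨⟩-var : ∀ i s → var i ⟨ s ⟩ ≋ s i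
  ⟨⟩-var i s = ≋-trans (≋-reflexive (⟨⟩-def (var i) s))
    (≋-trans (P.+-identityʳ _) (≋-trans (P.*-identityˡ _) (P.*-identityʳ _)))

-- Convergence of sequences of polynomials.

module Convergence where

  open import Defs hiding (interchange)
  open Reals using (_≃_; ≃-refl; ≃-sym; ≃-trans; ≃⇒≈ᶜ; ≈ᶜ⇒≃; ≃-stable; ℂ-ring; Limit; limit-*; limit-const; limit-resp; limit⇒⟶ᶜ; ⟶ᶜ⇒limit; approach; Nearᶜ; nears; nearᶜ-resp; _<′_)
  open Sums
  open Polynomials
  open import Data.Nat as ℕ using (ℕ; zero; suc; _⊔_)
  import Data.Nat.Properties as ℕₚ
  open import Data.Rational as ℚ using (ℚ; 0ℚ; ½)
  open import Data.List using (List; []; _∷_; _++_; map; length; upTo; cartesianProductWith)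
  import Data.List.Properties as Listₚ
  open import Data.List.Membership.Propositional using (_∈_)
  open import Data.List.Membership.Propositional.Properties using (∈-upTo⁺; ∈-cartesianProductWith⁺)
  open import Data.List.Relation.Unary.Any as Any using (Any; here; there)
  open import Data.List.Relation.Unary.All as All using (All; []; _∷_)
  open import Data.List.Relation.Binary.Permutation.Propositional using (↭-reflexive)
  open import Data.Product using (∃; _×_; _,_; proj₁; proj₂)
  open import Relation.Nullary using (¬_; yes; no)
  open import Relation.Binary.PropositionalEquality as ≡ using (_≡_; refl; cong; cong₂; subst)
  open import Algebra.Bundles using (CommutativeRing)

  private
    module K = CommutativeRing ℂ-ring
  open RingSums Poly-ring using (∑)

  record Term : Set where
    field
      at        : ℕ → ℂ
      lim       : ℂ
      converges : Limit at lim
      word      : Monomial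

  open Term

  -- A sequence of polynomials given by a fixed list of monomials with convergent coefficients.
  Family : Set
  Family = List Term

  atᶠ : Family → ℕ → Poly
  atᶠ F j = map (λ T → at T j , word T) F

  limᶠ : Family → Poly
  limᶠ F = map (λ T → lim T , word T) F

  infix 4 _⇝_
  record _⇝_ (g : ℕ → Poly) (p : Poly) : Set where
    constructor via
    field
      family : Family
      at-≋   : ∀ j → atᶠ family j ≋ g j
      lim-≋  : limᶠ family ≋ p

  ⇝-resp : ∀ {g g′ p p′} → (∀ j → g j ≋ g′ j) → p ≋ p′ → g ⇝ p → g′ ⇝ p′
  ⇝-resp g≋ p≋ (via F a l) = via F (λ j → ≋-trans (a j) (g≋ j)) (≋-trans l p≋)

  ⇝-const : ∀ p → (λ _ → p) ⇝ p
  ⇝-const p = via (map fixed p) (λ j → ≋-reflexive (back (λ T → at T j) (λ _ → refl) p))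
    (≋-reflexive (back lim (λ _ → refl) p))
    where
    fixed : ℂ × Monomial → Term
    fixed (c , m) = record { at = λ _ → c ; lim = c ; converges = limit-const c ; word = m }
    back : ∀ (c : Term → ℂ) → (∀ t → c (fixed t) ≡ proj₁ t) → ∀ p → map (λ T → c T , word T) (map fixed p) ≡ p
    back c eq []      = refl
    back c eq (t ∷ p) = cong₂ _∷_ (cong (_, proj₂ t) (eq t)) (back c eq p)

  ⇝-scalar : ∀ {z w} → Limit z w → (λ j → const (z j)) ⇝ const w
  ⇝-scalar {z} {w} h = via (record { at = z ; lim = w ; converges = h ; word = [] } ∷ []) (λ _ → ≋-refl) ≋-refl

  ⇝-+ : ∀ {f g p q} → f ⇝ p → g ⇝ q → (λ j → f j + g j) ⇝ (p + q)
  ⇝-+ (via F a l) (via G b k) = via (F ++ G)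
    (λ j → ≋-trans (≋-reflexive (≡.trans (Listₚ.map-++ _ F G) (+-def (atᶠ F j) (atᶠ G j)))) (+-cong (a j) (b j)))
    (≋-trans (≋-reflexive (≡.trans (Listₚ.map-++ _ F G) (+-def (limᶠ F) (limᶠ G)))) (+-cong l k))

  _⊛_ : Term → Term → Term
  T ⊛ U = record
    { at        = λ j → at T j *ᶜ at U j
    ; lim       = lim T *ᶜ lim U
    ; converges = limit-resp (λ j → K.reflexive (≡.sym (Reals.*-def (at T j) (at U j))))
                    (K.reflexive (≡.sym (Reals.*-def (lim T) (lim U)))) (limit-* (converges T) (converges U))
    ; word      = word T ++ word U
    }

  map-product : ∀ {A B : Set} (f : A → B) (g : A → A → A) (h : B → B → B) → (∀ x y → f (g x y) ≡ h (f x) (f y)) →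
                ∀ xs ys → map f (cartesianProductWith g xs ys) ≡ cartesianProductWith h (map f xs) (map f ys)
  map-product f g h eq []       ys = refl
  map-product f g h eq (x ∷ xs) ys = ≡.trans (Listₚ.map-++ f (map (g x) ys) _) (cong₂ _++_ (row ys) (map-product f g h eq xs ys))
    where
    row : ∀ ys → map f (map (g x) ys) ≡ map (h (f x)) (map f ys)
    row []       = refl
    row (y ∷ ys) = cong₂ _∷_ (eq x y) (row ys)

  ⇝-* : ∀ {f g p q} → f ⇝ p → g ⇝ q → (λ j → f j * g j) ⇝ (p * q)
  ⇝-* (via F a l) (via G b k) = via (cartesianProductWith _⊛_ F G)
    (λ j → ≋-trans (≋-reflexive (≡.trans (map-product _ _⊛_ _*ᵗ_ (λ T U → refl) F G) (*-def (atᶠ F j) (atᶠ G j))))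
                   (*-cong (a j) (b j)))
    (≋-trans (≋-reflexive (≡.trans (map-product _ _⊛_ _*ᵗ_ (λ T U → refl) F G) (*-def (limᶠ F) (limᶠ G)))) (*-cong l k))

  ⇝-⟨⟩ : ∀ {g p} s → g ⇝ p → (λ j → g j ⟨ s ⟩) ⇝ (p ⟨ s ⟩)
  ⇝-⟨⟩ s (via F a l) = ⇝-resp (λ j → ⟨⟩-cong (a j) (λ _ → ≋-refl)) (⟨⟩-cong l (λ _ → ≋-refl)) (go F)
    where
    go : ∀ F → (λ j → atᶠ F j ⟨ s ⟩) ⇝ (limᶠ F ⟨ s ⟩)
    go F = ⇝-resp (λ j → ≋-reflexive (≡.sym (⟨⟩-def (atᶠ F j) s))) (≋-reflexive (≡.sym (⟨⟩-def (limᶠ F) s))) (sums F)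
      where
      sums : ∀ F → (λ j → ∑ (atᶠ F j) (λ t → const (proj₁ t) * mono s (proj₂ t))) ⇝
                   ∑ (limᶠ F) (λ t → const (proj₁ t) * mono s (proj₂ t))
      sums []      = ⇝-const []
      sums (T ∷ F) = ⇝-+ (⇝-* (⇝-scalar (converges T)) (⇝-const (mono s (word T)))) (sums F)

  Approximates : ℚ → Poly → Poly → Set
  Approximates ε p q = ∀ m → Nearᶜ ε (coeff p m) (coeff q m)

  -- One index works for all of the infinitely many monomials, because only the finitely many terms
  -- of the family have to converge. This allows a single member of the sequence to be picked as an
  -- approximation of the limit.
  ⇝-uniform : ∀ {g p} → g ⇝ p → ∀ {ε} → 0ℚ <′ ε → ∃ λ J → ∀ j → J ℕ.≤ j → Approximates ε (g j) p
  ⇝-uniform (via F a l) {ε} 0<ε = let J , h = go F (Reals.half-pos² 0<ε) in J , λ j J≤j m →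
    nearᶜ-resp (≃-trans (≃-sym (coeff≃eval (atᶠ F j) m)) (≋⇒≃ (a j) m))
               (≃-trans (≃-sym (coeff≃eval (limᶠ F) m)) (≋⇒≃ l m)) 0<ε (h j J≤j m)
    where
    go : ∀ F {ε} → 0ℚ <′ ε → ∃ λ J → ∀ j → J ℕ.≤ j → ∀ m → Nearᶜ ε (eval (δ m) (atᶠ F j)) (eval (δ m) (limᶠ F))
    go []      0<ε = 0 , λ _ _ _ → nears ≃-refl 0<ε
    go (T ∷ F) {ε} 0<ε =
      let I , f = approach (converges T) (half-pos (Reals.half-pos² 0<ε))
          J , g = go F (half-pos 0<ε)
      in I ⊔ J , λ j le m → Reals.near-+ (term f j (ℕₚ.m⊔n≤o⇒m≤o I J le) m) (g j (ℕₚ.m⊔n≤o⇒n≤o I J le) m)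
      where
      term : ∀ {I} → (∀ j → I ℕ.≤ j → Nearᶜ (½ ℚ.* (½ ℚ.* (½ ℚ.* ε))) (at T j) (lim T)) →
             ∀ j → I ℕ.≤ j → ∀ m → Nearᶜ (½ ℚ.* ε) (at T j K.* δ m (word T)) (lim T K.* δ m (word T))
      term f j le m with word T ↭? m
      ... | yes _ = nearᶜ-resp (≃-sym (K.*-identityʳ _)) (≃-sym (K.*-identityʳ _)) (half-pos 0<ε) (f j le)
      ... | no  _ = nears (≃-trans (K.zeroʳ _) (≃-sym (K.zeroʳ _))) (half-pos 0<ε)

  ⇝-coeff : ∀ {g p} → g ⇝ p → ∀ m → Limit (λ j → coeff (g j) m) (coeff p m)
  ⇝-coeff h m = Reals.limit λ 0<ε → let J , c = ⇝-uniform h 0<ε in J , λ j le → c j le m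

  record Supported (N D : ℕ) (p : Poly) : Set where
    constructor supported
    field
      inFirst : InFirst N p
      degree≤ : Degree≤ D p

  open Supported public

  supported-resp : ∀ {N D p q} → p ≋ q → Supported N D p → Supported N D q
  supported-resp {p = p} {q} e (supported v d) = supported (λ m occ → v m (back m occ)) (λ m occ → d m (back m occ))
    where
    back : ∀ m → Occurs m q → Occurs m p
    back m occ p≈0 = occ (≃⇒≈ᶜ (≃-trans (≃-sym (≋⇒≃ e m)) (≈ᶜ⇒≃ {coeff p m} {0ℂ} p≈0)))

  terms-supported : ∀ {N D p} → All (λ t → All (ℕ._< N) (proj₂ t)) p → All (λ t → length (proj₂ t) ℕ.≤ D) p → Supported N D p
  terms-supported {N} {D} {p} v d = supported (terms-variables {upTo N} {p} (All.map (All.map ∈-upTo⁺) v))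
    (occurs⇒ (λ m → length m ℕ.≤? D) (λ e → subst (ℕ._≤ D) (↭-length e)) {p} d)
    where open import Data.List.Relation.Binary.Permutation.Propositional.Properties using (↭-length)

  -- The words of a family are fixed, so they provide the bounds on variables and degree that `_⟶_`
  -- asks for all members at once.
  ⇝⇒⟶ : ∀ {g p} → g ⇝ p → g ⟶ p
  ⇝⇒⟶ {g} {p} h@(via F a l) =
    (bound F , top F , (λ j → inFirst (at-supported j) , degree≤ (at-supported j))
                     , inFirst lim-supported , degree≤ lim-supported)
    , λ m → limit⇒⟶ᶜ (⇝-coeff h m)
    where
    above : Monomial → ℕ
    above []      = 0
    above (i ∷ m) = suc i ⊔ above m
    above-bound : ∀ m {N} → above m ℕ.≤ N → All (ℕ._< N) m
    above-bound []      _  = []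
    above-bound (i ∷ m) le = ℕₚ.m⊔n≤o⇒m≤o (suc i) (above m) le ∷ above-bound m (ℕₚ.m⊔n≤o⇒n≤o (suc i) (above m) le)
    bound top : Family → ℕ
    bound []      = 0
    bound (T ∷ F) = above (word T) ⊔ bound F
    top []      = 0
    top (T ∷ F) = length (word T) ⊔ top F
    vars′ : ∀ (c : Term → ℂ) F {N} → bound F ℕ.≤ N → All (λ t → All (ℕ._< N) (proj₂ t)) (map (λ T → c T , word T) F)
    vars′ c []      le = []
    vars′ c (T ∷ F) le = above-bound (word T) (ℕₚ.m⊔n≤o⇒m≤o (above (word T)) (bound F) le)
                       ∷ vars′ c F (ℕₚ.m⊔n≤o⇒n≤o (above (word T)) (bound F) le)
    vars : ∀ (c : Term → ℂ) F → All (λ t → All (ℕ._< bound F) (proj₂ t)) (map (λ T → c T , word T) F)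
    vars c F = vars′ c F ℕₚ.≤-refl
    degs′ : ∀ (c : Term → ℂ) F {D} → top F ℕ.≤ D → All (λ t → length (proj₂ t) ℕ.≤ D) (map (λ T → c T , word T) F)
    degs′ c []      le = []
    degs′ c (T ∷ F) le = ℕₚ.m⊔n≤o⇒m≤o (length (word T)) (top F) le ∷ degs′ c F (ℕₚ.m⊔n≤o⇒n≤o (length (word T)) (top F) le)
    degs : ∀ (c : Term → ℂ) F → All (λ t → length (proj₂ t) ℕ.≤ top F) (map (λ T → c T , word T) F)
    degs c F = degs′ c F ℕₚ.≤-refl
    at-supported : ∀ j → Supported (bound F) (top F) (g j)
    at-supported j = supported-resp (a j) (terms-supported (vars (λ T → at T j) F) (degs (λ T → at T j) F))
    lim-supported : Supported (bound F) (top F) p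
    lim-supported = supported-resp l (terms-supported (vars lim F) (degs lim F))

  wordsUpTo : ℕ → ℕ → List Monomial
  wordsUpTo N zero    = [] ∷ []
  wordsUpTo N (suc D) = [] ∷ cartesianProductWith _∷_ (upTo N) (wordsUpTo N D)

  wordsUpTo-complete : ∀ {N} D m → All (_∈ upTo N) m → length m ℕ.≤ D → m ∈ wordsUpTo N D
  wordsUpTo-complete zero    []      _        _            = here refl
  wordsUpTo-complete (suc D) []      _        _            = here refl
  wordsUpTo-complete (suc D) (i ∷ m) (i∈ ∷ m⊆) (ℕ.s≤s le) =
    there (∈-cartesianProductWith⁺ _∷_ i∈ (wordsUpTo-complete D m m⊆ le))

  -- A support condition constrains only monomials with coefficient different from zero, so the
  -- vanishing is first obtained doubly negated and then extracted with `≃-stable`.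
  supported-outside : ∀ {N D p} → Supported N D p → ∀ m → ¬ (m ∈~ wordsUpTo N D) → coeff p m ≃ 0ℂ
  supported-outside {N} {D} {p} (supported v d) m m∉ = ≃-stable λ c≄0 → m∉ (within λ c≈0 → c≄0 (≈ᶜ⇒≃ c≈0))
    where
    within : Occurs m p → m ∈~ wordsUpTo N D
    within occ = Any.map ↭-reflexive (wordsUpTo-complete D m (v m occ) (d m occ))

  -- The common bounds on variables and degree confine every member to the finite list
  -- `wordsUpTo N D`; on a fixed list, coefficientwise convergence is a family.
  ⟶⇒⇝ : ∀ {g p} → g ⟶ p → g ⇝ p
  ⟶⇒⇝ {g} {p} ((N , D , gs , ps) , conv) = via (terms (wordsUpTo N D))
    (λ j → ≋-trans (≋-reflexive (atTerms j (wordsUpTo N D))) (collect-supported (g j) (wordsUpTo N D) (supported-outside {p = g j} (supported (proj₁ (gs j)) (proj₂ (gs j))))))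
    (≋-trans (≋-reflexive (limTerms (wordsUpTo N D))) (collect-supported p (wordsUpTo N D) (supported-outside {p = p} (supported (proj₁ ps) (proj₂ ps)))))
    where
    once-limit : ∀ m ms → Limit (λ j → once (coeff (g j)) m ms) (once (coeff p) m ms)
    once-limit m ms with m ∈~? ms
    ... | yes _ = limit-const 0ℂ
    ... | no  _ = ⟶ᶜ⇒limit (conv m)
    terms : List Monomial → Family
    terms []       = []
    terms (m ∷ ms) = record { at = λ j → once (coeff (g j)) m ms ; lim = once (coeff p) m ms
                            ; converges = once-limit m ms ; word = m } ∷ terms ms
    atTerms : ∀ j ms → atᶠ (terms ms) j ≡ collect (coeff (g j)) ms
    atTerms j []       = refl
    atTerms j (m ∷ ms) = cong (_ ∷_) (atTerms j ms)
    limTerms : ∀ ms → limᶠ (terms ms) ≡ collect (coeff p) ms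
    limTerms []       = refl
    limTerms (m ∷ ms) = cong (_ ∷_) (limTerms ms)

  ⟶-resp : ∀ {g g′ p p′} → (∀ j → g j ≋ g′ j) → p ≋ p′ → g ⟶ p → g′ ⟶ p′
  ⟶-resp g≋ p≋ h = ⇝⇒⟶ (⇝-resp g≋ p≋ (⟶⇒⇝ h))

-- Homogeneous components and linear forms.

module Components where

  open import Defs hiding (interchange)
  open Reals using (_≃_; ≃-refl; ≃-sym; ≃-trans; ℂ-ring)
  open Sums
  open Polynomials
  open import Data.Nat as ℕ using (ℕ; zero; suc)
  open import Data.Bool using (true; false; if_then_else_)
  open import Data.List using (List; []; _∷_; _++_; map; length)
  import Data.List.Properties as Listₚ
  open import Data.List.Relation.Unary.All using (All; []; _∷_)
  open import Data.List.Relation.Binary.Permutation.Propositional.Properties using (↭-length)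
  open import Data.Product using (_,_; proj₁; proj₂)
  open import Function using (_∘_)
  open import Relation.Nullary using (¬_; yes; no; does)
  open import Relation.Nullary.Decidable using (dec-true; dec-false)
  open import Relation.Binary.PropositionalEquality as ≡ using (_≡_)
  open import Algebra.Bundles using (CommutativeRing)

  private
    module K = CommutativeRing ℂ-ring
    module P = CommutativeRing Poly-ring
  open RingSums ℂ-ring

  mask : ℕ → (Monomial → ℂ) → Monomial → ℂ
  mask d φ m = if does (length m ℕ.≟ d) then φ m else 0ℂ

  mask-invariant : ∀ d {φ} → Invariant φ → Invariant (mask d φ)
  mask-invariant d {φ} inv {m} {m′} e rewrite ↭-length e with does (length m′ ℕ.≟ d)
  ... | true  = inv e
  ... | false = ≃-refl

  -- Moving the choice of the degree from the polynomial to the functional makes congruence,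
  -- additivity and linearity of components instances of the laws of `eval`.
  eval-component : ∀ φ d p → eval φ (component d p) ≃ eval (mask d φ) p
  eval-component φ d []            = ≃-refl
  eval-component φ d ((c , m) ∷ p) with length m ℕ.≟ d
  ... | yes l rewrite Listₚ.filter-accept (λ t → length (proj₂ t) ℕ.≟ d) {c , m} {p} l | dec-true (length m ℕ.≟ d) l =
    K.+-congˡ (eval-component φ d p)
  ... | no ¬l rewrite Listₚ.filter-reject (λ t → length (proj₂ t) ℕ.≟ d) {c , m} {p} ¬l | dec-false (length m ℕ.≟ d) ¬l =
    ≃-trans (eval-component φ d p) (≃-sym (≃-trans (K.+-congʳ (K.zeroʳ c)) (K.+-identityˡ _)))

  component-cong : ∀ d {p q} → p ≋ q → component d p ≋ component d q
  component-cong d {p} {q} e = mk≋ λ φ inv → ≃-trans (eval-component φ d p)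
    (≃-trans (evals e (mask d φ) (mask-invariant d inv)) (≃-sym (eval-component φ d q)))

  component-+ : ∀ d p q → component d (p + q) ≋ component d p + component d q
  component-+ d p q = mk≋ λ φ inv → ≃-trans (eval-component φ d (p + q)) (≃-trans (eval-sum (mask d φ) p q)
    (≃-sym (≃-trans (eval-sum φ (component d p) (component d q)) (K.+-cong (eval-component φ d p) (eval-component φ d q)))))

  component-const-* : ∀ d c p → component d (const c * p) ≋ const c * component d p
  component-const-* d c p = mk≋ λ φ inv → ≃-trans (eval-component φ d (const c * p))
    (≃-trans (eval-const-* (mask d φ) c p)
      (≃-sym (≃-trans (eval-const-* φ c (component d p)) (K.*-congˡ (eval-component φ d p)))))

  component-none : ∀ {d p} → All (λ t → ¬ (length (proj₂ t) ≡ d)) p → component d p ≡ []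
  component-none = Listₚ.filter-none _

  component-all : ∀ {d p} → All (λ t → length (proj₂ t) ≡ d) p → component d p ≡ p
  component-all = Listₚ.filter-all _

  eval-zero : ∀ {φ} p → (∀ m → φ m ≃ 0ℂ) → eval φ p ≃ 0ℂ
  eval-zero p z = ∑-zero p λ t → ≃-trans (K.*-congˡ (z (proj₂ t))) (K.zeroʳ (proj₁ t))

  eval-linear-cong : ∀ {φ ψ} ℓ → (∀ i → φ (i ∷ []) ≃ ψ (i ∷ [])) → eval φ (linear ℓ) ≃ eval ψ (linear ℓ)
  eval-linear-cong []            eq = ≃-refl
  eval-linear-cong ((c , i) ∷ ℓ) eq = K.+-cong (K.*-congˡ (eq i)) (eval-linear-cong ℓ eq)

  component-linear-* : ∀ d ℓ p → component (suc d) (linear ℓ * p) ≋ linear ℓ * component d p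
  component-linear-* d ℓ p = mk≋ λ φ inv → ≃-trans (eval-component φ (suc d) (linear ℓ * p))
    (≃-trans (eval-product _ (linear ℓ) p)
      (≃-trans (eval-linear-cong ℓ λ i → ≃-sym (eval-component (λ m → φ (i ∷ m)) d p))
        (≃-sym (eval-product φ (linear ℓ) (component d p)))))

  component-linear-*-0 : ∀ ℓ p → component 0 (linear ℓ * p) ≋ []
  component-linear-*-0 ℓ p = mk≋ λ φ inv → ≃-trans (eval-component φ 0 (linear ℓ * p))
    (≃-trans (eval-product _ (linear ℓ) p)
      (≃-trans (eval-linear-cong {ψ = λ _ → 0ℂ} ℓ λ i → eval-zero p (λ _ → ≃-refl)) (eval-zero (linear ℓ) (λ _ → ≃-refl))))

  convolution : (ℕ → Poly) → (ℕ → Poly) → ℕ → Poly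
  convolution u v zero    = u 0 * v 0
  convolution u v (suc d) = u 0 * v (suc d) + convolution (u ∘ suc) v d

  convolution-cong : ∀ {u u′ v v′} → (∀ a → u a ≋ u′ a) → (∀ b → v b ≋ v′ b) → ∀ d → convolution u v d ≋ convolution u′ v′ d
  convolution-cong e f zero    = *-cong (e 0) (f 0)
  convolution-cong e f (suc d) = +-cong (*-cong (e 0) (f (suc d))) (convolution-cong (λ a → e (suc a)) f d)

  convolution-+ : ∀ u u′ v d → convolution (λ a → u a + u′ a) v d ≋ convolution u v d + convolution u′ v d
  convolution-+ u u′ v zero    = P.distribʳ (v 0) (u 0) (u′ 0)
  convolution-+ u u′ v (suc d) = ≋-trans
    (+-cong (P.distribʳ (v (suc d)) (u 0) (u′ 0)) (convolution-+ (u ∘ suc) (u′ ∘ suc) v d)) (exchange _ _ _ _)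
    where open import Algebra.Properties.CommutativeSemigroup P.+-commutativeSemigroup using () renaming (interchange to exchange)

  convolution-0 : ∀ v d → convolution (λ _ → []) v d ≋ []
  convolution-0 v zero    = P.zeroˡ _
  convolution-0 v (suc d) = ≋-trans (+-cong (P.zeroˡ _) (convolution-0 v d)) (P.+-identityˡ [])

  single : ℕ → Poly → ℕ → Poly
  single l t a = if does (l ℕ.≟ a) then t else []

  -- The component of degree d - l, and zero when l > d, where truncated subtraction would wrongly
  -- give the constant term.
  shifted : ℕ → ℕ → Poly → Poly
  shifted zero    d       q = component d q
  shifted (suc l) zero    q = []
  shifted (suc l) (suc d) q = shifted l d q

  convolution-single : ∀ l t q d → convolution (single l t) (λ b → component b q) d ≋ t * shifted l d q
  convolution-single zero    t q zero    = ≋-refl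
  convolution-single zero    t q (suc d) = ≋-trans (P.+-congˡ {t * component (suc d) q} (convolution-0 _ d)) (P.+-identityʳ _)
  convolution-single (suc l) t q zero    = ≋-trans (P.zeroˡ _) (≋-sym (P.zeroʳ t))
  convolution-single (suc l) t q (suc d) = ≋-trans (P.+-congʳ (P.zeroˡ (component (suc d) q)))
    (≋-trans (P.+-identityˡ _) (convolution-single l t q d))

  eval-shifted : ∀ φ w d q → eval (λ m → φ (w ++ m)) (shifted (length w) d q) ≃ eval (λ m → mask d φ (w ++ m)) q
  eval-shifted φ []      d       q = eval-component φ d q
  eval-shifted φ (i ∷ w) zero    q = ≃-sym (eval-zero q λ _ → ≃-refl)
  eval-shifted φ (i ∷ w) (suc d) q = eval-shifted (λ m → φ (i ∷ m)) w d q

  -- A single term of word length l only shifts degrees by l, so its convolution with the components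
  -- of `q` has one summand; induction on the terms of `p` does the rest.
  component-* : ∀ p q d → component d (p * q) ≋ convolution (λ a → component a p) (λ b → component b q) d
  component-* []            q d = ≋-trans (component-cong d (P.zeroˡ q)) (≋-sym (convolution-0 _ d))
  component-* ((c , w) ∷ p) q d = begin
    component d (((c , w) ∷ p) * q)
      ≈⟨ component-cong d (≋-trans (P.*-congʳ (≋-reflexive (+-def term p))) (P.distribʳ q term p)) ⟩
    component d (term * q + p * q)
      ≈⟨ component-+ d (term * q) (p * q) ⟩
    component d (term * q) + component d (p * q)
      ≈⟨ +-cong head (component-* p q d) ⟩
    convolution (single (length w) term) Q d + convolution (λ a → component a p) Q d
      ≈⟨ convolution-+ _ _ Q d ⟨
    convolution (λ a → single (length w) term a + component a p) Q d
      ≈⟨ convolution-cong split (λ b → ≋-refl) d ⟩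
    convolution (λ a → component a ((c , w) ∷ p)) Q d ∎
    where
    open import Relation.Binary.Reasoning.Setoid ≋-setoid
    term = (c , w) ∷ []
    Q : ℕ → Poly
    Q b = component b q
    eval-term-* : ∀ φ r → eval φ (term * r) ≃ c K.* eval (λ m → φ (w ++ m)) r
    eval-term-* φ r = ≃-trans (eval-product φ term r) (K.+-identityʳ _)
    head : component d (term * q) ≋ convolution (single (length w) term) Q d
    head = ≋-trans (mk≋ λ φ inv → ≃-trans (eval-component φ d (term * q)) (≃-trans (eval-term-* (mask d φ) q)
      (≃-trans (K.*-congˡ (≃-sym (eval-shifted φ w d q))) (≃-sym (eval-term-* φ (shifted (length w) d q))))))
      (≋-sym (convolution-single (length w) term q d))
    split : ∀ a → single (length w) term a + component a p ≋ component a ((c , w) ∷ p)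
    split a with length w ℕ.≟ a
    ... | yes l rewrite Listₚ.filter-accept (λ t → length (proj₂ t) ℕ.≟ a) {c , w} {p} l | dec-true (length w ℕ.≟ a) l =
      ≋-reflexive (≡.sym (+-def term (component a p)))
    ... | no ¬l rewrite Listₚ.filter-reject (λ t → length (proj₂ t) ℕ.≟ a) {c , w} {p} ¬l | dec-false (length w ℕ.≟ a) ¬l =
      P.+-identityˡ _

  scaleˡ : ℂ → LinearForm → LinearForm
  scaleˡ a = map (λ (c , i) → a K.* c , i)

  linear-scale : ∀ a ℓ → linear (scaleˡ a ℓ) ≋ const a * linear ℓ
  linear-scale a ℓ = mk≋ λ φ inv → ≃-trans (go φ ℓ) (≃-sym (eval-const-* φ a (linear ℓ)))
    where
    go : ∀ φ ℓ → eval φ (linear (scaleˡ a ℓ)) ≃ a K.* eval φ (linear ℓ)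
    go φ []            = ≃-sym (K.zeroʳ a)
    go φ ((c , i) ∷ ℓ) = ≃-trans (K.+-cong (K.*-assoc a c _) (go φ ℓ)) (≃-sym (K.distribˡ a _ _))

  linear-++ : ∀ ℓ ℓ′ → linear (ℓ ++ ℓ′) ≋ linear ℓ + linear ℓ′
  linear-++ ℓ ℓ′ = ≋-reflexive (≡.trans (Listₚ.map-++ _ ℓ ℓ′) (+-def (linear ℓ) (linear ℓ′)))

-- Two by two matrices, elementary matrices and their commutators.

module Matrices where

  open import Algebra.Bundles using (CommutativeRing; Ring)
  open import Level using (0ℓ)
  open import Data.Bool using (Bool; true; false; not; if_then_else_)
  open import Data.Bool.Properties using (_≟_)
  open import Relation.Nullary using (does)
  open import Data.Product using (_,_)

  module TwoByTwo (R : CommutativeRing 0ℓ 0ℓ) where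
    open CommutativeRing R hiding (zero)
    open import Algebra.Solver.Ring.NaturalCoefficients.Default commutativeSemiring
      using (solve; _:=_; _:+_; _:*_; con)
    open import Algebra.Properties.Ring ring using (-‿distribʳ-*; -‿+-comm; -‿involutive)

    Matrix : Set
    Matrix = Bool → Bool → Carrier

    infix 4 _≈ᴹ_
    record _≈ᴹ_ (M N : Matrix) : Set where
      constructor entries
      field entry : ∀ i j → M i j ≈ N i j

    open _≈ᴹ_ public

    _+ᴹ_ _*ᴹ_ : Matrix → Matrix → Matrix
    (M +ᴹ N) i j = M i j + N i j
    (M *ᴹ N) i j = M i true * N true j + M i false * N false j

    -ᴹ_ : Matrix → Matrix
    (-ᴹ M) i j = - M i j

    scalar : Carrier → Matrix
    scalar x true  true  = x
    scalar x true  false = 0#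
    scalar x false true  = 0#
    scalar x false false = x

    0ᴹ : Matrix
    0ᴹ i j = 0#

    private
      assoc : ∀ a b c d e f g h → (a * c + b * d) * g + (a * e + b * f) * h ≈ a * (c * g + e * h) + b * (d * g + f * h)
      assoc = solve 8 (λ a b c d e f g h →
        (a :* c :+ b :* d) :* g :+ (a :* e :+ b :* f) :* h := a :* (c :* g :+ e :* h) :+ b :* (d :* g :+ f :* h)) refl
      distˡ : ∀ a b c d e f → a * (c + e) + b * (d + f) ≈ (a * c + b * d) + (a * e + b * f)
      distˡ = solve 6 (λ a b c d e f → a :* (c :+ e) :+ b :* (d :+ f) := (a :* c :+ b :* d) :+ (a :* e :+ b :* f)) refl
      distʳ : ∀ a b c d e f → (c + e) * a + (d + f) * b ≈ (c * a + d * b) + (e * a + f * b)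
      distʳ = solve 6 (λ a b c d e f → (c :+ e) :* a :+ (d :+ f) :* b := (c :* a :+ d :* b) :+ (e :* a :+ f :* b)) refl
      first : ∀ c x y → c * x + 0# * y ≈ c * x
      first = solve 3 (λ c x y → c :* x :+ con 0 :* y := c :* x) refl
      second : ∀ c x y → 0# * y + c * x ≈ c * x
      second = solve 3 (λ c x y → con 0 :* y :+ c :* x := c :* x) refl

    scalar-*ˡ : ∀ c M i j → (scalar c *ᴹ M) i j ≈ c * M i j
    scalar-*ˡ c M true  j = first c (M true j) (M false j)
    scalar-*ˡ c M false j = second c (M false j) (M true j)

    scalar-*ʳ : ∀ c M i j → (M *ᴹ scalar c) i j ≈ c * M i j
    scalar-*ʳ c M i true  = trans (+-cong (*-comm _ _) (*-comm _ _)) (first c (M i true) (M i false))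
    scalar-*ʳ c M i false = trans (+-cong (*-comm _ _) (*-comm _ _)) (second c (M i false) (M i true))

    Matrix-ring : Ring 0ℓ 0ℓ
    Matrix-ring = record
      { Carrier = Matrix ; _≈_ = _≈ᴹ_ ; _+_ = _+ᴹ_ ; _*_ = _*ᴹ_ ; -_ = -ᴹ_ ; 0# = 0ᴹ ; 1# = scalar 1#
      ; isRing = record
        { +-isAbelianGroup = record
          { isGroup = record
            { isMonoid = record
              { isSemigroup = record
                { isMagma = record
                  { isEquivalence = record
                    { refl  = entries λ _ _ → refl
                    ; sym   = λ e → entries λ i j → sym (entry e i j)
                    ; trans = λ e f → entries λ i j → trans (entry e i j) (entry f i j)
                    }
                  ; ∙-cong = λ e f → entries λ i j → +-cong (entry e i j) (entry f i j)
                  }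
                ; assoc = λ L M N → entries λ i j → +-assoc (L i j) (M i j) (N i j)
                }
              ; identity = (λ M → entries λ i j → +-identityˡ _) , (λ M → entries λ i j → +-identityʳ _)
              }
            ; inverse = (λ M → entries λ i j → -‿inverseˡ _) , (λ M → entries λ i j → -‿inverseʳ _)
            ; ⁻¹-cong = λ e → entries λ i j → -‿cong (entry e i j)
            }
          ; comm = λ M N → entries λ i j → +-comm _ _
          }
        ; *-cong = λ e f → entries λ i j → +-cong (*-cong (entry e i true) (entry f true j)) (*-cong (entry e i false) (entry f false j))
        ; *-assoc = λ L M N → entries λ i j →
            assoc (L i true) (L i false) (M true true) (M false true) (M true false) (M false false) (N true j) (N false j)
        ; *-identity = (λ M → entries λ i j → trans (scalar-*ˡ 1# M i j) (*-identityˡ _))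
                     , (λ M → entries λ i j → trans (scalar-*ʳ 1# M i j) (*-identityˡ _))
        ; distrib = (λ L M N → entries λ i j → distˡ (L i true) (L i false) (M true j) (M false j) (N true j) (N false j))
                  , (λ L M N → entries λ i j → distʳ (L true j) (L false j) (M i true) (M i false) (N i true) (N i false))
        }
      }

    scalar-central : ∀ c M → (scalar c *ᴹ M) ≈ᴹ (M *ᴹ scalar c)
    scalar-central c M = entries λ i j → trans (scalar-*ˡ c M i j) (sym (scalar-*ʳ c M i j))

    -- E true x and E false x are the multiples by x of e₁₂ and e₂₁, and
    -- H b is the commutator [ E b , E (not b) ].
    E H : Bool → Carrier → Matrix
    E true  x true  false = x
    E false x false true  = x
    E _     x _     _     = 0#
    H true  x true  true  = x
    H true  x false false = - x
    H false x true  true  = - x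
    H false x false false = x
    H _     x _     _     = 0#

    private
      zz : ∀ x y → 0# * x + y * 0# ≈ 0#
      zz = solve 2 (λ x y → con 0 :* x :+ y :* con 0 := con 0) refl
      z0 : ∀ x → 0# * x + 0# * 0# ≈ 0#
      z0 = solve 1 (λ x → con 0 :* x :+ con 0 :* con 0 := con 0) refl
      z1 : ∀ x → 0# * 0# + 0# * x ≈ 0#
      z1 = solve 1 (λ x → con 0 :* con 0 :+ con 0 :* x := con 0) refl
      z2 : ∀ x → 0# * 0# + x * 0# ≈ 0#
      z2 = solve 1 (λ x → con 0 :* con 0 :+ x :* con 0 := con 0) refl
      z3 : ∀ x → x * 0# + 0# * 0# ≈ 0#
      z3 = solve 1 (λ x → x :* con 0 :+ con 0 :* con 0 := con 0) refl
      z4 : ∀ x y → x * 0# + 0# * y ≈ 0#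
      z4 = solve 2 (λ x y → x :* con 0 :+ con 0 :* y := con 0) refl
      z5 : 0# * 0# + 0# * 0# ≈ 0#
      z5 = solve 0 (con 0 :* con 0 :+ con 0 :* con 0 := con 0) refl
      p1 : ∀ x y → x * y + 0# * 0# ≈ x * y
      p1 = solve 2 (λ x y → x :* y :+ con 0 :* con 0 := x :* y) refl
      p2 : ∀ x y → 0# * 0# + x * y ≈ x * y
      p2 = solve 2 (λ x y → con 0 :* con 0 :+ x :* y := x :* y) refl
      minus0 : ∀ {a b c} → a ≈ c → b ≈ 0# → a + - b ≈ c
      minus0 e f = trans (+-cong e (trans (-‿cong f) (trans (sym (+-identityˡ _)) (-‿inverseʳ 0#)))) (+-identityʳ _)
      0minus : ∀ {a b c} → a ≈ 0# → b ≈ c → a + - b ≈ - c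
      0minus e f = trans (+-cong e (-‿cong f)) (+-identityˡ _)
      double : ∀ {a b} x y → a ≈ x * y → b ≈ y * (- x) → a + - b ≈ x * y + x * y
      double x y e f = +-cong e (trans (-‿cong (trans f (trans (sym (-‿distribʳ-* y x)) (-‿cong (*-comm y x))))) (-‿involutive (x * y)))

    [_,_]ᴹ : Matrix → Matrix → Matrix
    [ M , N ]ᴹ = (M *ᴹ N) +ᴹ (-ᴹ (N *ᴹ M))

    EE-commutator : ∀ b x y → [ E b x , E (not b) y ]ᴹ ≈ᴹ H b (x * y)
    EE-commutator true x y = entries λ where
      true  true  → minus0 (p2 x y) z5
      true  false → minus0 (z2 x) (z0 x)
      false true  → minus0 (z1 y) (z3 y)
      false false → 0minus z5 (trans (p1 y x) (*-comm y x))
    EE-commutator false x y = entries λ where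
      true  true  → 0minus z5 (trans (p2 y x) (*-comm y x))
      true  false → minus0 (z0 y) (z2 y)
      false true  → minus0 (z3 x) (z1 x)
      false false → minus0 (p1 x y) z5

    HE-commutator : ∀ b x y → [ H b x , E b y ]ᴹ ≈ᴹ E b (x * y + x * y)
    HE-commutator true x y = entries λ where
      true  true  → minus0 (z3 x) (zz x y)
      true  false → double x y (p1 x y) (p2 y (- x))
      false true  → minus0 (z2 (- x)) (z0 x)
      false false → minus0 (zz y (- x)) (z1 (- x))
    HE-commutator false x y = entries λ where
      true  true  → minus0 (z4 (- x) y) (z0 (- x))
      true  false → minus0 (z3 (- x)) (z1 x)
      false true  → double x y (p2 x y) (p1 y (- x))
      false false → minus0 (z2 x) (z4 y x)

    H-cong : ∀ b {x y} → x ≈ y → H b x ≈ᴹ H b y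
    H-cong true  e = entries λ { true true → e ; true false → refl ; false true → refl ; false false → -‿cong e }
    H-cong false e = entries λ { true true → -‿cong e ; true false → refl ; false true → refl ; false false → e }

    E-cong : ∀ b {x y} → x ≈ y → E b x ≈ᴹ E b y
    E-cong true  e = entries λ { true true → refl ; true false → e ; false true → refl ; false false → refl }
    E-cong false e = entries λ { true true → refl ; true false → refl ; false true → e ; false false → refl }

    E-+ : ∀ b x y → (E b x +ᴹ E b y) ≈ᴹ E b (x + y)
    E-+ true  x y = entries λ { true true → +-identityˡ 0# ; true false → refl ; false true → +-identityˡ 0# ; false false → +-identityˡ 0# }
    E-+ false x y = entries λ { true true → +-identityˡ 0# ; true false → +-identityˡ 0# ; false true → refl ; false false → +-identityˡ 0# }

    E-0 : ∀ b → 0ᴹ ≈ᴹ E b 0#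
    E-0 true  = entries λ { true true → refl ; true false → refl ; false true → refl ; false false → refl }
    E-0 false = entries λ { true true → refl ; true false → refl ; false true → refl ; false false → refl }

    H-true-+ : ∀ x y → (H true x +ᴹ H true y) ≈ᴹ H true (x + y)
    H-true-+ x y = entries λ where
      true  true  → refl
      true  false → +-identityˡ 0#
      false true  → +-identityˡ 0#
      false false → -‿+-comm x y

    H-true-0 : 0ᴹ ≈ᴹ H true 0#
    H-true-0 = entries λ where
      true  true  → refl
      true  false → refl
      false true  → refl
      false false → sym (trans (sym (+-identityˡ _)) (-‿inverseʳ 0#))

    scalar-E : ∀ c b x → (scalar c *ᴹ E b x) ≈ᴹ E b (c * x)
    scalar-E c true x = entries λ where
      true  true  → trans (scalar-*ˡ c (E true x) true true) (zeroʳ c)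
      true  false → scalar-*ˡ c (E true x) true false
      false true  → trans (scalar-*ˡ c (E true x) false true) (zeroʳ c)
      false false → trans (scalar-*ˡ c (E true x) false false) (zeroʳ c)
    scalar-E c false x = entries λ where
      true  true  → trans (scalar-*ˡ c (E false x) true true) (zeroʳ c)
      true  false → trans (scalar-*ˡ c (E false x) true false) (zeroʳ c)
      false true  → scalar-*ˡ c (E false x) false true
      false false → trans (scalar-*ˡ c (E false x) false false) (zeroʳ c)

    elementary : Bool → Carrier → Matrix
    elementary b x = scalar 1# +ᴹ E b x

    elementary-* : ∀ b x y → (elementary b x *ᴹ elementary b y) ≈ᴹ elementary b (x + y)
    elementary-* b x y = M.trans (product b)
      (M.+-congˡ {scalar 1#} (E-+ b x y))
      where
      module M = Ring Matrix-ring
      product : ∀ b → (elementary b x *ᴹ elementary b y) ≈ᴹ (scalar 1# +ᴹ (E b x +ᴹ E b y))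
      product true = entries λ where
        true  true  → solve 1 (λ x → (con 1 :+ con 0) :* (con 1 :+ con 0) :+ (con 0 :+ x) :* (con 0 :+ con 0) := con 1 :+ (con 0 :+ con 0)) refl x
        true  false → solve 2 (λ x y → (con 1 :+ con 0) :* (con 0 :+ y) :+ (con 0 :+ x) :* (con 1 :+ con 0) := con 0 :+ (x :+ y)) refl x y
        false true  → solve 0 ((con 0 :+ con 0) :* (con 1 :+ con 0) :+ (con 1 :+ con 0) :* (con 0 :+ con 0) := con 0 :+ (con 0 :+ con 0)) refl
        false false → solve 1 (λ y → (con 0 :+ con 0) :* (con 0 :+ y) :+ (con 1 :+ con 0) :* (con 1 :+ con 0) := con 1 :+ (con 0 :+ con 0)) refl y
      product false = entries λ where
        true  true  → solve 1 (λ y → (con 1 :+ con 0) :* (con 1 :+ con 0) :+ (con 0 :+ con 0) :* (con 0 :+ y) := con 1 :+ (con 0 :+ con 0)) refl y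
        true  false → solve 0 ((con 1 :+ con 0) :* (con 0 :+ con 0) :+ (con 0 :+ con 0) :* (con 1 :+ con 0) := con 0 :+ (con 0 :+ con 0)) refl
        false true  → solve 2 (λ x y → (con 0 :+ x) :* (con 1 :+ con 0) :+ (con 1 :+ con 0) :* (con 0 :+ y) := con 0 :+ (x :+ y)) refl x y
        false false → solve 1 (λ x → (con 0 :+ x) :* (con 0 :+ con 0) :+ (con 1 :+ con 0) :* (con 1 :+ con 0) := con 1 :+ (con 0 :+ con 0)) refl x

    elementary-inverse : ∀ b {x y} → x + y ≈ 0# → (elementary b x *ᴹ elementary b y) ≈ᴹ scalar 1#
    elementary-inverse b e = M.trans (elementary-* b _ _)
      (M.trans (M.+-congˡ {scalar 1#} (M.trans (E-cong b e) (M.sym (E-0 b)))) (M.+-identityʳ (scalar 1#)))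
      where module M = Ring Matrix-ring

    -- Left multiplication changes only row `b`, which receives x times the opposite row. This is
    -- the recursion of `alt`: the first letter is either used, if its side is the required one, or
    -- skipped.
    elementary-row : ∀ b x M π σ → (elementary b x *ᴹ M) π σ ≈ (if does (b ≟ π) then x * M (not π) σ else 0#) + M π σ
    elementary-row true  x M true  σ = solve 3 (λ x m n → (con 1 :+ con 0) :* m :+ (con 0 :+ x) :* n := x :* n :+ m) refl x (M true σ) (M false σ)
    elementary-row true  x M false σ = solve 2 (λ m n → (con 0 :+ con 0) :* m :+ (con 1 :+ con 0) :* n := con 0 :+ n) refl (M true σ) (M false σ)
    elementary-row false x M true  σ = solve 2 (λ m n → (con 1 :+ con 0) :* m :+ (con 0 :+ con 0) :* n := con 0 :+ m) refl (M true σ) (M false σ)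
    elementary-row false x M false σ = solve 3 (λ x m n → (con 0 :+ x) :* m :+ (con 1 :+ con 0) :* n := x :* m :+ n) refl x (M true σ) (M false σ)

-- Words followed up to their leading term.

module Gadgets where

  open import Algebra.Bundles using (Ring)
  open import Level using (0ℓ)
  open import Data.Nat as ℕ using (ℕ; zero; suc)
  import Data.Nat.Properties as ℕₚ
  open import Data.List using (List; []; _∷_; _++_; length)
  import Data.List.Properties as Listₚ
  open import Data.Product using (∃; _,_)
  open import Relation.Binary.PropositionalEquality as ≡ using (_≡_; cong; cong₂; subst)

  record Letters (𝓜 : Ring 0ℓ 0ℓ) : Set₁ where
    open Ring 𝓜
    field
      Letter : Set
      value  : Letter → Carrier
      invert : Letter → Letter
      rightInverse : ∀ a → value a * value (invert a) ≈ 1#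
      leftInverse  : ∀ a → value (invert a) * value a ≈ 1#

  record Central (𝓜 : Ring 0ℓ 0ℓ) : Set where
    open Ring 𝓜
    field
      ε       : Carrier
      central : ∀ x → ε * x ≈ x * ε

  module Words (𝓜 : Ring 0ℓ 0ℓ) (𝓛 : Letters 𝓜) (𝓒 : Central 𝓜) where
    open Ring 𝓜 hiding (zero)
    open Letters 𝓛
    open Central 𝓒
    open import Relation.Binary.Reasoning.Setoid setoid
    open import Algebra.Properties.Ring 𝓜 using (-‿distribʳ-*; -‿+-comm)
    open import Algebra.Properties.CommutativeSemigroup +-commutativeSemigroup using (interchange; x∙yz≈y∙xz)

    infix 4 _~_
    -- The form that O(ε) takes here: congruence modulo the ideal of multiples of `ε`, which is
    -- two-sided since `ε` is central.
    _~_ : Carrier → Carrier → Set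
    a ~ b = ∃ λ N → a ≈ b + ε * N

    ≈⇒~ : ∀ {a b} → a ≈ b → a ~ b
    ≈⇒~ {a} {b} e = 0# , trans e (sym (trans (+-congˡ (zeroʳ ε)) (+-identityʳ b)))

    ~-trans : ∀ {a b c} → a ~ b → b ~ c → a ~ c
    ~-trans {a} {b} {c} (N , e) (N′ , e′) = N′ + N , (begin
      a                         ≈⟨ e ⟩
      b + ε * N                 ≈⟨ +-congʳ e′ ⟩
      (c + ε * N′) + ε * N      ≈⟨ +-assoc c _ _ ⟩
      c + (ε * N′ + ε * N)      ≈⟨ +-congˡ (distribˡ ε N′ N) ⟨
      c + ε * (N′ + N)          ∎)

    ~-+ : ∀ {a b c d} → a ~ b → c ~ d → a + c ~ b + d
    ~-+ {a} {b} {c} {d} (N , e) (N′ , e′) = N + N′ ,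
      trans (+-cong e e′) (trans (interchange b _ d _) (+-congˡ (sym (distribˡ ε N N′))))

    ~-neg : ∀ {a b} → a ~ b → - a ~ - b
    ~-neg {a} {b} (N , e) = - N ,
      trans (-‿cong e) (trans (sym (-‿+-comm b (ε * N))) (+-congˡ (-‿distribʳ-* ε N)))

    ~-*ˡ : ∀ {a b} c → a ~ b → c * a ~ c * b
    ~-*ˡ {a} {b} c (N , e) = c * N , (begin
      c * a                 ≈⟨ *-congˡ e ⟩
      c * (b + ε * N)       ≈⟨ distribˡ c b _ ⟩
      c * b + c * (ε * N)   ≈⟨ +-congˡ (*-assoc c ε N) ⟨
      c * b + (c * ε) * N   ≈⟨ +-congˡ (*-congʳ (central c)) ⟨
      c * b + (ε * c) * N   ≈⟨ +-congˡ (*-assoc ε c N) ⟩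
      c * b + ε * (c * N)   ∎)

    ~-*ʳ : ∀ {a b} c → a ~ b → a * c ~ b * c
    ~-*ʳ {a} {b} c (N , e) = N * c ,
      trans (*-congʳ e) (trans (distribʳ c b _) (+-congˡ (*-assoc ε N c)))

    ~-* : ∀ {a b c d} → a ~ b → c ~ d → a * c ~ b * d
    ~-* {b = b} {c = c} f g = ~-trans (~-*ʳ c f) (~-*ˡ b g)

    power : ℕ → Carrier
    power zero    = 1#
    power (suc n) = ε * power n

    power-central : ∀ n x → power n * x ≈ x * power n
    power-central zero    x = trans (*-identityˡ x) (sym (*-identityʳ x))
    power-central (suc n) x = begin
      (ε * power n) * x   ≈⟨ *-assoc ε _ x ⟩
      ε * (power n * x)   ≈⟨ *-congˡ (power-central n x) ⟩
      ε * (x * power n)   ≈⟨ *-assoc ε x _ ⟨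
      (ε * x) * power n   ≈⟨ *-congʳ (central x) ⟩
      (x * ε) * power n   ≈⟨ *-assoc x ε _ ⟩
      x * (ε * power n)   ∎

    power-+ : ∀ m n → power m * power n ≈ power (m ℕ.+ n)
    power-+ zero    n = *-identityˡ _
    power-+ (suc m) n = trans (*-assoc ε _ _) (*-congˡ (power-+ m n))

    ⟦_⟧ : List Letter → Carrier
    ⟦ [] ⟧    = 1#
    ⟦ a ∷ w ⟧ = value a * ⟦ w ⟧

    ⟦⟧-++ : ∀ v w → ⟦ v ++ w ⟧ ≈ ⟦ v ⟧ * ⟦ w ⟧
    ⟦⟧-++ []      w = sym (*-identityˡ _)
    ⟦⟧-++ (a ∷ v) w = trans (*-congˡ (⟦⟧-++ v w)) (sym (*-assoc _ _ _))

    inverse : List Letter → List Letter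
    inverse []      = []
    inverse (a ∷ w) = inverse w ++ (invert a ∷ [])

    inverse-length : ∀ w → length (inverse w) ≡ length w
    inverse-length []      = ≡.refl
    inverse-length (a ∷ w) = ≡.trans (Listₚ.length-++ (inverse w))
      (≡.trans (ℕₚ.+-comm (length (inverse w)) 1) (cong suc (inverse-length w)))

    inverse-∷ : ∀ a w → ⟦ inverse (a ∷ w) ⟧ ≈ ⟦ inverse w ⟧ * value (invert a)
    inverse-∷ a w = trans (⟦⟧-++ (inverse w) (invert a ∷ [])) (*-congˡ (*-identityʳ _))

    cancel-middle : ∀ {x y} z w → x * y ≈ 1# → (z * x) * (y * w) ≈ z * w
    cancel-middle {x} {y} z w e = begin
      (z * x) * (y * w)   ≈⟨ *-assoc z x _ ⟩
      z * (x * (y * w))   ≈⟨ *-congˡ (*-assoc x y w) ⟨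
      z * ((x * y) * w)   ≈⟨ *-congˡ (trans (*-congʳ e) (*-identityˡ w)) ⟩
      z * w               ∎

    inverseʳ : ∀ w → ⟦ w ⟧ * ⟦ inverse w ⟧ ≈ 1#
    inverseʳ []      = *-identityˡ 1#
    inverseʳ (a ∷ w) = trans (*-congˡ (inverse-∷ a w))
      (trans (cancel-middle (value a) _ (inverseʳ w)) (rightInverse a))

    inverseˡ : ∀ w → ⟦ inverse w ⟧ * ⟦ w ⟧ ≈ 1#
    inverseˡ []      = *-identityˡ 1#
    inverseˡ (a ∷ w) = trans (*-congʳ (inverse-∷ a w))
      (trans (cancel-middle ⟦ inverse w ⟧ ⟦ w ⟧ (leftInverse a)) (inverseˡ w))

    -- A word of length at most n with value 1 + ε^(p+1) (X + O(ε)).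
    record Realizes (p : ℕ) (X : Carrier) (n : ℕ) : Set where
      field
        word    : List Letter
        short   : length word ℕ.≤ n
        leading : Carrier
        expand  : ⟦ word ⟧ ≈ 1# + power (suc p) * leading
        leads   : leading ~ X

    open Realizes

    near-one : ∀ {p X n} (r : Realizes p X n) → ⟦ word r ⟧ ~ 1#
    near-one {p} r = power p * leading r , trans (expand r) (+-congˡ (*-assoc ε _ _))

    -- Multiplying `⟦ word ⟧ ~ 1#` by the inverse gives this without any expansion of the inverted
    -- letters.
    inverse-near-one : ∀ {p X n} (r : Realizes p X n) → ⟦ inverse (word r) ⟧ ~ 1#
    inverse-near-one r = ~-trans (~-sym (~-trans (~-*ˡ ⟦ inverse (word r) ⟧ (near-one r)) (≈⇒~ (*-identityʳ _)))) (≈⇒~ (inverseˡ (word r)))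
      where
      ~-sym : ∀ {a b} → a ~ b → b ~ a
      ~-sym {a} {b} (N , e) = - N , sym (begin
        a + ε * (- N)               ≈⟨ +-cong e (sym (-‿distribʳ-* ε N)) ⟩
        (b + ε * N) + - (ε * N)     ≈⟨ +-assoc b _ _ ⟩
        b + (ε * N + - (ε * N))     ≈⟨ +-congˡ (-‿inverseʳ _) ⟩
        b + 0#                      ≈⟨ +-identityʳ b ⟩
        b                           ∎)

    pull-powers : ∀ {u v} x y → (∀ z → v * z ≈ z * v) → (u * x) * (v * y) ≈ (u * v) * (x * y)
    pull-powers {u} {v} x y c = begin
      (u * x) * (v * y)   ≈⟨ *-assoc u x _ ⟩
      u * (x * (v * y))   ≈⟨ *-congˡ (*-assoc x v y) ⟨
      u * ((x * v) * y)   ≈⟨ *-congˡ (*-congʳ (c x)) ⟨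
      u * ((v * x) * y)   ≈⟨ *-congˡ (*-assoc v x y) ⟩
      u * (v * (x * y))   ≈⟨ *-assoc u v _ ⟨
      (u * v) * (x * y)   ∎

    product-expand : ∀ U V → (1# + U) * (1# + V) ≈ 1# + ((U + V) + U * V)
    product-expand U V = begin
      (1# + U) * (1# + V)               ≈⟨ distribʳ (1# + V) 1# U ⟩
      1# * (1# + V) + U * (1# + V)      ≈⟨ +-cong (*-identityˡ _) (trans (distribˡ U 1# V) (+-congʳ (*-identityʳ U))) ⟩
      (1# + V) + (U + U * V)            ≈⟨ +-assoc 1# V _ ⟩
      1# + (V + (U + U * V))            ≈⟨ +-congˡ (trans (x∙yz≈y∙xz V U _) (sym (+-assoc U V _))) ⟩
      1# + ((U + V) + U * V)            ∎

    [_,_] : Carrier → Carrier → Carrier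
    [ X , Y ] = X * Y + - (Y * X)

    -- The identity is exact. In the group commutator all terms of higher order therefore come from
    -- the leading terms of the two words and from the two inverses at the end.
    swap-factors : ∀ U V → (1# + U) * (1# + V) ≈ (1# + V) * (1# + U) + [ U , V ]
    swap-factors U V = begin
      (1# + U) * (1# + V)                          ≈⟨ product-expand U V ⟩
      1# + ((U + V) + U * V)                       ≈⟨ +-congˡ (+-cong (+-comm U V) (sym (trans (+-congˡ (+-comm _ _)) (trans (sym (+-assoc (V * U) _ _)) (trans (+-congʳ (-‿inverseʳ _)) (+-identityˡ _)))))) ⟩
      1# + ((V + U) + (V * U + [ U , V ]))         ≈⟨ +-congˡ (+-assoc (V + U) _ _) ⟨
      1# + (((V + U) + V * U) + [ U , V ])         ≈⟨ +-assoc 1# _ _ ⟨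
      (1# + ((V + U) + V * U)) + [ U , V ]         ≈⟨ +-congʳ (product-expand V U) ⟨
      (1# + V) * (1# + U) + [ U , V ]              ∎

    -- Exchanging the two words costs exactly [U, V], and the exchanged product cancels against the
    -- inverses Z, leaving 1 + [U, V] Z. Here [U, V] carries both powers of ε, and Z is 1 + O(ε).
    -- Exponents are stored as predecessors, so p + 1 and q + 1 add up to the successor of
    -- `suc p + q`.
    realize-commutator : ∀ {p q X Y m n} → Realizes p X m → Realizes q Y n →
                         Realizes (suc p ℕ.+ q) [ X , Y ] (2 ℕ.* (m ℕ.+ n))
    realize-commutator {p} {q} {X} {Y} {m} {n} r s = record
      { word    = (word r ++ word s) ++ (inverse (word r) ++ inverse (word s))
      ; short   = bound
      ; leading = [ A , B ] * Z
      ; expand  = begin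
          ⟦ (word r ++ word s) ++ (inverse (word r) ++ inverse (word s)) ⟧
            ≈⟨ trans (⟦⟧-++ (word r ++ word s) _) (*-cong (⟦⟧-++ (word r) (word s)) (⟦⟧-++ (inverse (word r)) _)) ⟩
          (⟦ word r ⟧ * ⟦ word s ⟧) * Z
            ≈⟨ *-congʳ (trans (*-cong (expand r) (expand s)) (swap-factors U V)) ⟩
          ((1# + V) * (1# + U) + [ U , V ]) * Z
            ≈⟨ distribʳ Z _ _ ⟩
          ((1# + V) * (1# + U)) * Z + [ U , V ] * Z
            ≈⟨ +-cong (trans (*-congʳ (*-cong (sym (expand s)) (sym (expand r))))
                             (trans (cancel-middle ⟦ word s ⟧ _ (inverseʳ (word r))) (inverseʳ (word s))))
                      (trans (*-congʳ bracket) (*-assoc _ _ _)) ⟩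
          1# + power (suc (suc p ℕ.+ q)) * ([ A , B ] * Z) ∎
      ; leads   = ~-trans (~-* (~-+ (~-* (leads r) (leads s)) (~-neg (~-* (leads s) (leads r))))
                               (~-trans (~-* (inverse-near-one r) (inverse-near-one s)) (≈⇒~ (*-identityˡ 1#))))
                          (≈⇒~ (*-identityʳ _))
      }
      where
      A = leading r
      B = leading s
      U = power (suc p) * A
      V = power (suc q) * B
      Z = ⟦ inverse (word r) ⟧ * ⟦ inverse (word s) ⟧
      powers : power (suc p) * power (suc q) ≈ power (suc (suc p ℕ.+ q))
      powers = trans (power-+ (suc p) (suc q)) (reflexive (cong power (cong suc (ℕₚ.+-suc p q))))
      bracket : [ U , V ] ≈ power (suc (suc p ℕ.+ q)) * [ A , B ]
      bracket = begin
        U * V + - (V * U)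
          ≈⟨ +-cong (pull-powers A B (power-central (suc q))) (-‿cong (pull-powers B A (power-central (suc p)))) ⟩
        (power (suc p) * power (suc q)) * (A * B) + - ((power (suc q) * power (suc p)) * (B * A))
          ≈⟨ +-cong (*-congʳ powers) (-‿cong (*-congʳ (trans (power-central (suc q) _) powers))) ⟩
        power (suc (suc p ℕ.+ q)) * (A * B) + - (power (suc (suc p ℕ.+ q)) * (B * A))
          ≈⟨ +-congˡ (-‿distribʳ-* _ _) ⟩
        power (suc (suc p ℕ.+ q)) * (A * B) + power (suc (suc p ℕ.+ q)) * (- (B * A))
          ≈⟨ distribˡ _ _ _ ⟨
        power (suc (suc p ℕ.+ q)) * [ A , B ] ∎
      bound : length ((word r ++ word s) ++ (inverse (word r) ++ inverse (word s))) ℕ.≤ 2 ℕ.* (m ℕ.+ n)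
      bound = ℕₚ.≤-trans (ℕₚ.≤-reflexive (≡.trans (Listₚ.length-++ (word r ++ word s))
        (cong₂ ℕ._+_ (Listₚ.length-++ (word r)) (≡.trans (Listₚ.length-++ (inverse (word r)))
          (≡.trans (cong₂ ℕ._+_ (inverse-length (word r)) (inverse-length (word s))) (≡.sym (ℕₚ.+-identityʳ _)))))))
        (ℕₚ.*-monoʳ-≤ 2 (ℕₚ.+-mono-≤ (short r) (short s)))

    realize-sum : ∀ {p X Y m n} → Realizes p X m → Realizes p Y n → Realizes p (X + Y) (m ℕ.+ n)
    realize-sum {p} {X} {Y} r s = record
      { word    = word r ++ word s
      ; short   = ℕₚ.≤-trans (ℕₚ.≤-reflexive (Listₚ.length-++ (word r))) (ℕₚ.+-mono-≤ (short r) (short s))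
      ; leading = (A + B) + A * (E * B)
      ; expand  = begin
          ⟦ word r ++ word s ⟧                         ≈⟨ trans (⟦⟧-++ (word r) (word s)) (*-cong (expand r) (expand s)) ⟩
          (1# + E * A) * (1# + E * B)                  ≈⟨ product-expand (E * A) (E * B) ⟩
          1# + ((E * A + E * B) + (E * A) * (E * B))   ≈⟨ +-congˡ (+-cong (sym (distribˡ E A B)) (*-assoc E A _)) ⟩
          1# + (E * (A + B) + E * (A * (E * B)))       ≈⟨ +-congˡ (distribˡ E _ _) ⟨
          1# + E * ((A + B) + A * (E * B))             ∎
      ; leads   = ~-trans (~-+ (~-+ (leads r) (leads s)) (~-*ˡ A small)) (≈⇒~ (trans (+-congˡ (zeroʳ A)) (+-identityʳ _)))
      }
      where
      A = leading r
      B = leading s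
      E = power (suc p)
      small : E * B ~ 0#
      small = power p * B , trans (*-assoc ε _ _) (sym (+-identityˡ _))

    -- Two words can be added only at equal exponents, whereas commutators add exponents. A value is
    -- therefore required at every exponent above a threshold, with a length that does not depend on
    -- the exponent.
    record Realizable (X : Carrier) (n : ℕ) : Set where
      constructor from
      field
        threshold : ℕ
        realizes : ∀ p → threshold ℕ.≤ p → Realizes p X n

    open Realizable public

    realizable-≈ : ∀ {X Y n} → X ≈ Y → Realizable X n → Realizable Y n
    realizable-≈ e (from P h) = from P λ p le → let r = h p le in record
      { word = word r ; short = short r ; leading = leading r ; expand = expand r ; leads = ~-trans (leads r) (≈⇒~ e) }

    realizable-≤ : ∀ {X m n} → m ℕ.≤ n → Realizable X m → Realizable X n
    realizable-≤ m≤n (from P h) = from P λ p le → let r = h p le in record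
      { word = word r ; short = ℕₚ.≤-trans (short r) m≤n ; leading = leading r ; expand = expand r ; leads = leads r }

    realizable-0 : Realizable 0# 0
    realizable-0 = from 0 λ p _ → record
      { word = [] ; short = ℕ.z≤n ; leading = 0# ; leads = ≈⇒~ refl
      ; expand = sym (trans (+-congˡ (zeroʳ _)) (+-identityʳ 1#)) }

    realizable-letter : ∀ {X} (a : ℕ → Letter) → (∀ p → value (a p) ≈ 1# + power (suc p) * X) → Realizable X 1
    realizable-letter {X} a eq = from 0 λ p _ → record
      { word = a p ∷ [] ; short = ℕₚ.≤-refl ; leading = X ; leads = ≈⇒~ refl
      ; expand = trans (*-identityʳ _) (eq p) }

    realizable-+ : ∀ {X Y m n} → Realizable X m → Realizable Y n → Realizable (X + Y) (m ℕ.+ n)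
    realizable-+ (from P h) (from Q k) = from (P ℕ.⊔ Q) λ p le →
      realize-sum (h p (ℕₚ.m⊔n≤o⇒m≤o P Q le)) (k p (ℕₚ.m⊔n≤o⇒n≤o P Q le))

    realizable-[] : ∀ {X Y m n} → Realizable X m → Realizable Y n → Realizable [ X , Y ] (2 ℕ.* (m ℕ.+ n))
    realizable-[] {X} {Y} {m} {n} (from P h) (from Q k) = from (suc P ℕ.+ Q) λ p le →
      subst (λ p → Realizes p [ X , Y ] (2 ℕ.* (m ℕ.+ n))) (ℕₚ.m+[n∸m]≡n (ℕₚ.m+n≤o⇒m≤o (suc P) le))
        -- The first word is taken at its least admissible exponent P, and the second receives the
        -- rest p - (P + 1), which is at least Q because P + 1 + Q ≤ p.
        (realize-commutator (h P ℕₚ.≤-refl) (k (p ℕ.∸ suc P)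
          (subst (ℕ._≤ p ℕ.∸ suc P) (ℕₚ.m+n∸m≡n (suc P) Q) (ℕₚ.∸-monoˡ-≤ (suc P) le))))

-- Balancing formulas of arity 3.

module Balancing where

  open import Defs using (LinearForm; IHL; leaf; add; mul₃; sizeⁱ)
  open Matrices
  open import Algebra.Bundles using (CommutativeRing; Ring)
  open import Level using (0ℓ)
  open import Data.Bool using (Bool; not)
  open import Data.Nat as ℕ using (ℕ; zero; suc; _≤_; _<_; z≤n; s≤s)
  import Data.Nat.Properties as ℕₚ
  open import Data.Nat.Tactic.RingSolver using (solve-∀)
  open import Data.List using (List; []; _∷_; _++_)
  open import Data.Product using (∃; _×_; _,_; proj₁; proj₂)
  open import Relation.Nullary using (yes; no; contradiction)
  open import Relation.Binary.PropositionalEquality as ≡ using (_≡_; cong; subst)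

  -- Multiplication by the product of the pairs: the effect of a gate on the path to it.
  Context : Set
  Context = List (IHL × IHL)

  weight : Context → ℕ
  weight []            = 0
  weight ((x , y) ∷ Γ) = sizeⁱ x ℕ.+ sizeⁱ y ℕ.+ weight Γ

  size-positive : ∀ F → 1 ≤ sizeⁱ F
  size-positive (leaf _)     = ℕₚ.≤-refl
  size-positive (add F G)    = s≤s z≤n
  size-positive (mul₃ F G H) = s≤s z≤n

  data Children≤ (T : ℕ) : IHL → Set where
    add  : ∀ {F G} → sizeⁱ F ≤ T → sizeⁱ G ≤ T → Children≤ T (add F G)
    mul₃ : ∀ {F G H} → sizeⁱ F ≤ T → sizeⁱ G ≤ T → sizeⁱ H ≤ T → Children≤ T (mul₃ F G H)

  module Decomposition (R : CommutativeRing 0ℓ 0ℓ) (⟦_⟧ˡ : LinearForm → CommutativeRing.Carrier R) where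
    open CommutativeRing R hiding (zero)
    open import Algebra.Solver.Ring.NaturalCoefficients.Default commutativeSemiring
      using (solve; _:=_; _:+_; _:*_)

    ⟦_⟧ : IHL → Carrier
    ⟦ leaf ℓ ⟧     = ⟦ ℓ ⟧ˡ
    ⟦ add F G ⟧    = ⟦ F ⟧ + ⟦ G ⟧
    ⟦ mul₃ F G H ⟧ = ⟦ F ⟧ * ⟦ G ⟧ * ⟦ H ⟧

    ∏ : Context → Carrier
    ∏ []            = 1#
    ∏ ((x , y) ∷ Γ) = ⟦ x ⟧ * ⟦ y ⟧ * ∏ Γ

    ∏-++ : ∀ Γ Δ → ∏ (Γ ++ Δ) ≈ ∏ Γ * ∏ Δ
    ∏-++ []            Δ = sym (*-identityˡ _)
    ∏-++ ((x , y) ∷ Γ) Δ = trans (*-congˡ (∏-++ Γ Δ)) (sym (*-assoc _ _ _))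

    module Split (zeroˡᶠ : ⟦ [] ⟧ˡ ≈ 0#) where

      -- F is an affine function of each of its gates; this is the expansion at a lowest gate of size above T.
      record HeavyGate (T : ℕ) (F : IHL) : Set where
        field
          rest      : IHL
          path      : Context
          gate      : IHL
          heavy     : T < sizeⁱ gate
          children  : Children≤ T gate
          rest-size : sizeⁱ rest ℕ.+ sizeⁱ gate ≤ sizeⁱ F ℕ.+ 1
          path-size : weight path ℕ.+ sizeⁱ gate ≤ sizeⁱ F
          value     : ⟦ F ⟧ ≈ ⟦ rest ⟧ + ∏ path * ⟦ gate ⟧

      root : ∀ {T F} → T < sizeⁱ F → Children≤ T F → HeavyGate T F
      root {T} {F} T<F ch = record
        { rest = leaf [] ; path = [] ; gate = F ; heavy = T<F ; children = ch
        ; rest-size = ℕₚ.≤-reflexive (ℕₚ.+-comm 1 (sizeⁱ F)) ; path-size = ℕₚ.≤-refl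
        ; value = sym (trans (+-cong zeroˡᶠ (*-identityˡ _)) (+-identityˡ _)) }

      private
        up : ∀ a v s b → a ℕ.+ v ≤ s ℕ.+ 1 → suc (a ℕ.+ b) ℕ.+ v ≤ suc (s ℕ.+ b) ℕ.+ 1
        up a v s b le = subst₂ (eq₁ a b v) (eq₂ s b) (ℕₚ.+-monoʳ-≤ (suc b) le)
          where
          subst₂ : ∀ {x x′ y y′} → x ≡ x′ → y ≡ y′ → x ≤ y → x′ ≤ y′
          subst₂ ≡.refl ≡.refl h = h
          eq₁ : ∀ a b v → suc b ℕ.+ (a ℕ.+ v) ≡ suc (a ℕ.+ b) ℕ.+ v
          eq₁ = solve-∀
          eq₂ : ∀ s b → suc b ℕ.+ (s ℕ.+ 1) ≡ suc (s ℕ.+ b) ℕ.+ 1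
          eq₂ = solve-∀
        le-≡ : ∀ {x x′ y y′} → x ≡ x′ → y ≡ y′ → x ≤ y → x′ ≤ y′
        le-≡ ≡.refl ≡.refl h = h
        c₂ : ∀ f v g → suc (f ℕ.+ g) ℕ.+ v ≡ suc (g ℕ.+ f) ℕ.+ v
        c₂ = solve-∀
        c₃ : ∀ s g → suc (s ℕ.+ g) ℕ.+ 1 ≡ suc (g ℕ.+ s) ℕ.+ 1
        c₃ = solve-∀
        m₁ : ∀ f g h v → suc (f ℕ.+ (g ℕ.+ h)) ℕ.+ v ≡ suc (f ℕ.+ g ℕ.+ h) ℕ.+ v
        m₁ = solve-∀
        m₂ : ∀ f g h v → suc (f ℕ.+ (g ℕ.+ h)) ℕ.+ v ≡ suc (g ℕ.+ f ℕ.+ h) ℕ.+ v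
        m₂ = solve-∀
        m₃ : ∀ f g h v → suc (f ℕ.+ (g ℕ.+ h)) ℕ.+ v ≡ suc (g ℕ.+ h ℕ.+ f) ℕ.+ v
        m₃ = solve-∀
        w : ∀ b p v → b ℕ.+ (p ℕ.+ v) ≡ (b ℕ.+ p) ℕ.+ v
        w = solve-∀
        x₁ : ∀ f g h → (g ℕ.+ h) ℕ.+ f ≡ f ℕ.+ g ℕ.+ h
        x₁ = solve-∀
        x₂ : ∀ f g h → (g ℕ.+ h) ℕ.+ f ≡ g ℕ.+ f ℕ.+ h
        x₂ = solve-∀

      -- Descends into a child larger than T as long as there is one. A product gate passed on the
      -- way contributes its two other factors to `path`, one reason why contexts consist of pairs;
      -- an addition gate affects `rest` only. The 1 in `rest-size` is the zero leaf that replaces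
      -- the gate.
      heavyGate : ∀ T → 1 ≤ T → ∀ F → T < sizeⁱ F → HeavyGate T F
      heavyGate T 1≤T (leaf ℓ) T<1 = contradiction (ℕₚ.<-≤-trans T<1 1≤T) (ℕₚ.<-irrefl ≡.refl)
      heavyGate T 1≤T (add F G) T<FG with T ℕ.<? sizeⁱ F
      ... | yes T<F = record
        { rest = add rest G ; path = path ; gate = gate ; heavy = heavy ; children = children
        ; rest-size = up (sizeⁱ rest) (sizeⁱ gate) (sizeⁱ F) (sizeⁱ G) rest-size
        ; path-size = ℕₚ.≤-trans path-size (ℕₚ.m≤n⇒m≤1+n (ℕₚ.m≤m+n _ _))
        ; value = trans (+-congʳ value) (solve 3 (λ a b c → (a :+ b) :+ c := (a :+ c) :+ b) refl _ _ _) }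
        where open HeavyGate (heavyGate T 1≤T F T<F)
      ... | no T≮F with T ℕ.<? sizeⁱ G
      ...   | yes T<G = record
        { rest = add F rest ; path = path ; gate = gate ; heavy = heavy ; children = children
        ; rest-size = le-≡ (c₂ (sizeⁱ rest) (sizeⁱ gate) (sizeⁱ F)) (c₃ (sizeⁱ G) (sizeⁱ F)) (up (sizeⁱ rest) (sizeⁱ gate) (sizeⁱ G) (sizeⁱ F) rest-size)
        ; path-size = ℕₚ.≤-trans path-size (ℕₚ.m≤n⇒m≤1+n (ℕₚ.m≤n+m _ _))
        ; value = trans (+-congˡ value) (sym (+-assoc _ _ _)) }
        where open HeavyGate (heavyGate T 1≤T G T<G)
      ...   | no T≮G = root T<FG (add (ℕₚ.≮⇒≥ T≮F) (ℕₚ.≮⇒≥ T≮G))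
      heavyGate T 1≤T (mul₃ F G H) T<FGH with T ℕ.<? sizeⁱ F
      ... | yes T<F = record
        { rest = mul₃ rest G H ; path = (G , H) ∷ path ; gate = gate ; heavy = heavy ; children = children
        ; rest-size = le-≡ (m₁ (sizeⁱ rest) (sizeⁱ G) (sizeⁱ H) (sizeⁱ gate)) (m₁ (sizeⁱ F) (sizeⁱ G) (sizeⁱ H) 1)
                           (up (sizeⁱ rest) (sizeⁱ gate) (sizeⁱ F) (sizeⁱ G ℕ.+ sizeⁱ H) rest-size)
        ; path-size = ℕₚ.m≤n⇒m≤1+n (le-≡ (w (sizeⁱ G ℕ.+ sizeⁱ H) (weight path) (sizeⁱ gate)) (x₁ (sizeⁱ F) (sizeⁱ G) (sizeⁱ H)) (ℕₚ.+-monoʳ-≤ (sizeⁱ G ℕ.+ sizeⁱ H) path-size))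
        ; value = trans (*-congʳ (*-congʳ value)) (solve 5 (λ a p v g h →
            (a :+ p :* v) :* g :* h := a :* g :* h :+ g :* h :* p :* v) refl _ _ _ _ _) }
        where open HeavyGate (heavyGate T 1≤T F T<F)
      ... | no T≮F with T ℕ.<? sizeⁱ G
      ...   | yes T<G = record
        { rest = mul₃ F rest H ; path = (F , H) ∷ path ; gate = gate ; heavy = heavy ; children = children
        ; rest-size = le-≡ (m₂ (sizeⁱ rest) (sizeⁱ F) (sizeⁱ H) (sizeⁱ gate)) (m₂ (sizeⁱ G) (sizeⁱ F) (sizeⁱ H) 1)
                           (up (sizeⁱ rest) (sizeⁱ gate) (sizeⁱ G) (sizeⁱ F ℕ.+ sizeⁱ H) rest-size)
        ; path-size = ℕₚ.m≤n⇒m≤1+n (le-≡ (w (sizeⁱ F ℕ.+ sizeⁱ H) (weight path) (sizeⁱ gate)) (x₂ (sizeⁱ G) (sizeⁱ F) (sizeⁱ H)) (ℕₚ.+-monoʳ-≤ (sizeⁱ F ℕ.+ sizeⁱ H) path-size))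
        ; value = trans (*-congʳ (*-congˡ value)) (solve 5 (λ a p v f h →
            f :* (a :+ p :* v) :* h := f :* a :* h :+ f :* h :* p :* v) refl _ _ _ _ _) }
        where open HeavyGate (heavyGate T 1≤T G T<G)
      ...   | no T≮G with T ℕ.<? sizeⁱ H
      ...     | yes T<H = record
        { rest = mul₃ F G rest ; path = (F , G) ∷ path ; gate = gate ; heavy = heavy ; children = children
        ; rest-size = le-≡ (m₃ (sizeⁱ rest) (sizeⁱ F) (sizeⁱ G) (sizeⁱ gate)) (m₃ (sizeⁱ H) (sizeⁱ F) (sizeⁱ G) 1)
                           (up (sizeⁱ rest) (sizeⁱ gate) (sizeⁱ H) (sizeⁱ F ℕ.+ sizeⁱ G) rest-size)
        ; path-size = ℕₚ.m≤n⇒m≤1+n (le-≡ (w (sizeⁱ F ℕ.+ sizeⁱ G) (weight path) (sizeⁱ gate)) ≡.refl (ℕₚ.+-monoʳ-≤ (sizeⁱ F ℕ.+ sizeⁱ G) path-size))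
        ; value = trans (*-congˡ value) (solve 5 (λ a p v f g →
            f :* g :* (a :+ p :* v) := f :* g :* a :+ f :* g :* p :* v) refl _ _ _ _ _) }
        where open HeavyGate (heavyGate T 1≤T H T<H)
      ...     | no T≮H = root T<FGH (mul₃ (ℕₚ.≮⇒≥ T≮F) (ℕₚ.≮⇒≥ T≮G) (ℕₚ.≮⇒≥ T≮H))

  record MiddlePair (U V : ℕ) (Γ : Context) : Set where
    field
      before : Context
      x y    : IHL
      after  : Context
      before-size : weight before ≤ U
      after-size  : weight after ≤ V
      pair-size   : sizeⁱ x ℕ.+ sizeⁱ y ≤ weight Γ
      joined : Γ ≡ before ++ (x , y) ∷ after

  -- A weighted median: the pair taken is the first one with at most V behind it. If it is not the
  -- first of all, then it and what follows still weigh more than V, so at most U lies before it.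
  -- The pair itself can be as heavy as the whole context and cannot be divided, so its two members
  -- have to be treated as formulas.
  middlePair : ∀ U V x y Γ → weight ((x , y) ∷ Γ) ≤ U ℕ.+ V → MiddlePair U V ((x , y) ∷ Γ)
  middlePair U V x y [] le = record
    { before = [] ; x = x ; y = y ; after = [] ; before-size = z≤n ; after-size = z≤n
    ; pair-size = ℕₚ.m≤m+n _ _ ; joined = ≡.refl }
  middlePair U V x y ((x′ , y′) ∷ Γ) le with weight ((x′ , y′) ∷ Γ) ℕ.≤? V
  ... | yes small = record
    { before = [] ; x = x ; y = y ; after = (x′ , y′) ∷ Γ ; before-size = z≤n ; after-size = small
    ; pair-size = ℕₚ.m≤m+n _ _ ; joined = ≡.refl }
  ... | no large = record
    { before = (x , y) ∷ M.before ; x = M.x ; y = M.y ; after = M.after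
    ; before-size = subst (sizeⁱ x ℕ.+ sizeⁱ y ℕ.+ weight M.before ≤_) (ℕₚ.m+[n∸m]≡n s≤U) (ℕₚ.+-monoʳ-≤ s M.before-size)
    ; after-size = M.after-size
    ; pair-size = ℕₚ.≤-trans M.pair-size (ℕₚ.m≤n+m _ s)
    ; joined = cong ((x , y) ∷_) M.joined }
    where
    s = sizeⁱ x ℕ.+ sizeⁱ y
    s≤U : s ≤ U
    s≤U = ℕₚ.+-cancelʳ-≤ V s U (ℕₚ.≤-trans (ℕₚ.+-monoʳ-≤ s (ℕₚ.<⇒≤ (ℕₚ.≰⇒> large))) le)
    module M = MiddlePair (middlePair (U ℕ.∸ s) V x′ y′ Γ
      (ℕₚ.+-cancelˡ-≤ s _ _ (ℕₚ.≤-trans le (ℕₚ.≤-reflexive (≡.trans (cong (ℕ._+ V) (≡.sym (ℕₚ.m+[n∸m]≡n s≤U))) (ℕₚ.+-assoc s _ V))))))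

  power : ∀ (R : CommutativeRing 0ℓ 0ℓ) → CommutativeRing.Carrier R → ℕ → CommutativeRing.Carrier R
  power R x zero    = CommutativeRing.1# R
  power R x (suc k) = CommutativeRing._*_ R x (power R x k)

  -- Balancing depends only on the lengths charged for sums and commutators, so words do not appear
  -- in it. The power of 1/2 in `leaves` is the supply from which the factors 2 of the commutators
  -- [H, E] are paid.
  record Calculus (R : CommutativeRing 0ℓ 0ℓ) : Set₁ where
    open CommutativeRing R
    open TwoByTwo R
    field
      ⟦_⟧ˡ  : LinearForm → Carrier
      empty : ⟦ [] ⟧ˡ ≈ 0#
      half  : Carrier
      halves′ : half + half ≈ 1#
      Realizable : Matrix → ℕ → Set
      respects   : ∀ {M N n} → M ≈ᴹ N → Realizable M n → Realizable N n
      weaken     : ∀ {M m n} → m ≤ n → Realizable M m → Realizable M n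
      sums       : ∀ {M N m n} → Realizable M m → Realizable N n → Realizable (M +ᴹ N) (m ℕ.+ n)
      commutators : ∀ {M N m n} → Realizable M m → Realizable N n → Realizable [ M , N ]ᴹ (2 ℕ.* (m ℕ.+ n))
      leaves : ∀ b k ℓ → Realizable (E b (power R half k * ⟦ ℓ ⟧ˡ)) 1

  module Balanced (R : CommutativeRing 0ℓ 0ℓ) (𝓒 : Calculus R) where
    open CommutativeRing R hiding (zero)
    open TwoByTwo R
    open Calculus 𝓒
    open Decomposition R ⟦_⟧ˡ
    open Split empty
    open import Algebra.Solver.Ring.NaturalCoefficients.Default commutativeSemiring
      using (solve; _:=_; _:+_; _:*_; con)

    halfPower : ℕ → Carrier
    halfPower = power R half

    halving : ∀ k → halfPower (suc k) + halfPower (suc k) ≈ halfPower k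
    halving k = trans (sym (distribʳ (halfPower k) half half)) (trans (*-congʳ halves′) (*-identityˡ _))

    -- Contexts are nonempty: the leaves are linear forms without constants, so the empty product 1
    -- is no target, and `below` and `extend` handle it separately. Quantifying over k lets a later
    -- commutator [H, E] ask for one more factor 1/2.
    Forms Contexts : ℕ → ℕ → Set
    Forms T n = ∀ F → sizeⁱ F ≤ T → ∀ b k → Realizable (E b (halfPower k * ⟦ F ⟧)) n
    Contexts T n = ∀ p Γ → weight (p ∷ Γ) ≤ T → ∀ b k → Realizable (H b (halfPower k * ∏ (p ∷ Γ))) n

    fromEE : ∀ {m n} b {x y z} → x * y ≈ z → Realizable (E b x) m → Realizable (E (not b) y) n →
             Realizable (H b z) (2 ℕ.* (m ℕ.+ n))
    fromEE b e r s = respects (M.trans (EE-commutator b _ _) (H-cong b e)) (commutators r s)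
      where module M = Ring Matrix-ring

    fromHE : ∀ {m n} b {x y z} → x * y + x * y ≈ z → Realizable (H b x) m → Realizable (E b y) n →
             Realizable (E b z) (2 ℕ.* (m ℕ.+ n))
    fromHE b e r s = respects (M.trans (HE-commutator b _ _) (E-cong b e)) (commutators r s)
      where module M = Ring Matrix-ring

    fromE+E : ∀ {m n} b {x y z} → x + y ≈ z → Realizable (E b x) m → Realizable (E b y) n →
              Realizable (E b z) (m ℕ.+ n)
    fromE+E b e r s = respects (M.trans (E-+ b _ _) (E-cong b e)) (sums r s)
      where module M = Ring Matrix-ring

    module _ {T n : ℕ} (forms : Forms T n) (contexts : Contexts T n) where

      -- The value is [[F, G], H] with one extra factor 1/2 placed on `F`, which cancels the 2 of
      -- the outer commutator.
      triple : ∀ {F G H} → sizeⁱ F ≤ T → sizeⁱ G ≤ T → sizeⁱ H ≤ T → ∀ b k →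
               Realizable (E b (halfPower k * (⟦ F ⟧ * ⟦ G ⟧ * ⟦ H ⟧))) (10 ℕ.* n)
      triple {F} {G} {H} f g h b k = weaken (ℕₚ.≤-reflexive (lengths n))
        (fromHE b {y = halfPower 0 * ⟦ H ⟧} (trans (solve 5 (λ c o x y z → c :* (x :* (o :* y)) :* (o :* z) :+ c :* (x :* (o :* y)) :* (o :* z) :=
             (c :+ c) :* (x :* (o :* y) :* (o :* z))) refl (halfPower (suc k)) 1# ⟦ F ⟧ ⟦ G ⟧ ⟦ H ⟧)
           (*-cong (halving k) (*-cong (*-congˡ (*-identityˡ _)) (*-identityˡ _))))
          (fromEE b {x = halfPower (suc k) * ⟦ F ⟧} {y = halfPower 0 * ⟦ G ⟧} (*-assoc _ _ _) (forms F f b (suc k)) (forms G g (not b) 0)) (forms H h b 0))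
        where
        lengths : ∀ n → 2 ℕ.* (2 ℕ.* (n ℕ.+ n) ℕ.+ n) ≡ 10 ℕ.* n
        lengths = solve-∀

      gate-step : ∀ {F} → Children≤ T F → ∀ b k → Realizable (E b (halfPower k * ⟦ F ⟧)) (10 ℕ.* n)
      gate-step (add {F} {G} f g) b k = weaken (ℕₚ.≤-trans (ℕₚ.≤-reflexive (lengths n)) (ℕₚ.*-monoˡ-≤ n (s≤s (s≤s (z≤n {8})))))
        (fromE+E b (sym (distribˡ _ _ _)) (forms F f b k) (forms G g b k))
        where
        lengths : ∀ n → n ℕ.+ n ≡ 2 ℕ.* n
        lengths = solve-∀
      gate-step (mul₃ {F} {G} {H} f g h) b k = triple {F} {G} {H} f g h b k

      below : ∀ path {F} → weight path ≤ T → Children≤ T F → ∀ b k →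
              Realizable (E b (halfPower k * (∏ path * ⟦ F ⟧))) (22 ℕ.* n)
      below [] p ch b k = weaken (ℕₚ.*-monoˡ-≤ n (ℕₚ.m≤m+n 10 12))
        (respects (E-cong b (*-congˡ (sym (*-identityˡ _)))) (gate-step ch b k))
      below (xy ∷ path) {F} p ch b k = weaken (ℕₚ.≤-reflexive (lengths n))
        (fromHE b {y = halfPower 0 * ⟦ F ⟧} (trans (solve 4 (λ c o x y → c :* x :* (o :* y) :+ c :* x :* (o :* y) :=
              (c :+ c) :* (x :* (o :* y))) refl (halfPower (suc k)) 1# (∏ (xy ∷ path)) ⟦ F ⟧)
            (*-cong (halving k) (*-congˡ (*-identityˡ _))))
          (contexts xy path p b (suc k)) (gate-step ch b 0))
        where
        lengths : ∀ n → 2 ℕ.* (n ℕ.+ 10 ℕ.* n) ≡ 22 ℕ.* n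
        lengths = solve-∀

      -- At a lowest gate larger than T, all remaining pieces have size at most T: the children by
      -- choice of the gate, `rest` and `path` because the gate takes at least T + 1 of the at most
      -- 2T vertices. One copy of n pays for `rest` and 22 for the gate below its path.
      double-forms : 1 ≤ T → Forms (T ℕ.+ T) (23 ℕ.* n)
      double-forms 1≤T F F≤ b k with T ℕ.<? sizeⁱ F
      ... | no T≮F = weaken (ℕₚ.m≤m+n n (22 ℕ.* n)) (forms F (ℕₚ.≮⇒≥ T≮F) b k)
      ... | yes T<F = respects (M.trans (E-+ b _ _) (E-cong b (trans (sym (distribˡ _ _ _)) (*-congˡ (sym value)))))
          (sums (forms rest rest≤T b k) (below path path≤T children b k))
        where
        module M = Ring Matrix-ring
        open HeavyGate (heavyGate T 1≤T F T<F)
        rest≤T : sizeⁱ rest ≤ T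
        rest≤T = ℕₚ.+-cancelʳ-≤ (suc T) _ _ (ℕₚ.≤-trans (ℕₚ.+-monoʳ-≤ (sizeⁱ rest) heavy)
          (ℕₚ.≤-trans rest-size (ℕₚ.≤-trans (ℕₚ.+-monoˡ-≤ 1 F≤) (ℕₚ.≤-reflexive (≡.trans (ℕₚ.+-assoc T T 1) (cong (T ℕ.+_) (ℕₚ.+-comm T 1)))))))
        path≤T : weight path ≤ T
        path≤T = ℕₚ.+-cancelʳ-≤ T _ _ (ℕₚ.≤-trans (ℕₚ.+-monoʳ-≤ (weight path) (ℕₚ.<⇒≤ heavy)) (ℕₚ.≤-trans path-size F≤))

      extend : ∀ {N} b Γ x → weight Γ ≤ T → n ≤ N → (∀ k → Realizable (E b (halfPower k * ⟦ x ⟧)) N) → ∀ k →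
               Realizable (E b (halfPower k * (∏ Γ * ⟦ x ⟧))) (4 ℕ.* N)
      extend {N} b [] x _ n≤N r k = weaken (ℕₚ.m≤m+n N (3 ℕ.* N)) (respects (E-cong b (*-congˡ (sym (*-identityˡ _)))) (r k))
      extend {N} b (p ∷ Γ) x Γ≤ n≤N r k = weaken (ℕₚ.≤-trans (ℕₚ.*-monoʳ-≤ 2 (ℕₚ.+-monoˡ-≤ N n≤N)) (ℕₚ.≤-reflexive (lengths N)))
        (fromHE b {y = halfPower 0 * ⟦ x ⟧} (trans (solve 4 (λ c o x y → c :* x :* (o :* y) :+ c :* x :* (o :* y) :=
              (c :+ c) :* (x :* (o :* y))) refl (halfPower (suc k)) 1# (∏ (p ∷ Γ)) ⟦ x ⟧)
            (*-cong (halving k) (*-congˡ (*-identityˡ _))))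
          (contexts p Γ Γ≤ b (suc k)) (r 0))
        where
        lengths : ∀ n → 2 ℕ.* (n ℕ.+ n) ≡ 4 ℕ.* n
        lengths = solve-∀

      -- The middle pair (x, y) divides the product into (before · x)(after · y), a commutator of
      -- two off-diagonal values. The outer contexts have weight at most T, but x and y can have
      -- size up to 2T, so formulas must be doubled before contexts.
      double-contexts : ∀ {N} → n ≤ N → Forms (T ℕ.+ T) N → Contexts (T ℕ.+ T) (16 ℕ.* N)
      double-contexts {N} n≤N forms′ p Γ Γ≤ b k = weaken (ℕₚ.≤-reflexive (lengths N))
        (fromEE b {x = halfPower k * (∏ before * ⟦ x ⟧)} {y = halfPower 0 * (∏ after * ⟦ y ⟧)}
          (trans (solve 6 (λ c o f g x y → c :* (f :* x) :* (o :* (g :* y)) := c :* (f :* (x :* y :* (o :* g)))) refl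
              (halfPower k) 1# (∏ before) (∏ after) ⟦ x ⟧ ⟦ y ⟧)
            (*-congˡ (trans (*-congˡ (*-congˡ (*-identityˡ _))) (trans (sym (∏-++ before ((x , y) ∷ after))) (reflexive (cong ∏ (≡.sym joined)))))))
          (extend b before x before-size n≤N (λ k → forms′ x (ℕₚ.≤-trans (ℕₚ.m≤m+n _ _) xy≤) b k) k)
          (extend (not b) after y after-size n≤N (λ k → forms′ y (ℕₚ.≤-trans (ℕₚ.m≤n+m _ (sizeⁱ x)) xy≤) (not b) k) 0))
        where
        open MiddlePair (middlePair T T (proj₁ p) (proj₂ p) Γ Γ≤)
        xy≤ : sizeⁱ x ℕ.+ sizeⁱ y ≤ T ℕ.+ T
        xy≤ = ℕₚ.≤-trans pair-size Γ≤
        lengths : ∀ n → 2 ℕ.* (4 ℕ.* n ℕ.+ 4 ℕ.* n) ≡ 16 ℕ.* n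
        lengths = solve-∀

    -- Doubling the size multiplies the length by 23 for formulas and by 16 · 23 = 368 for contexts.
    -- Rounding up to 512, which is the ninth power of 2, makes the length the ninth power of the
    -- size bound. At size 1 formulas are leaves, and there are no contexts since a pair weighs at
    -- least 2.
    balanced : ∀ k → Forms (2 ℕ.^ k) (512 ℕ.^ k) × Contexts (2 ℕ.^ k) (512 ℕ.^ k)
    balanced zero = leaf-forms , λ p Γ le → contradiction le (ℕₚ.<⇒≱ (heavier p Γ))
      where
      leaf-forms : Forms 1 1
      leaf-forms (leaf ℓ)     _ b k = leaves b k ℓ
      leaf-forms (add F G)    (s≤s le) b k = contradiction le (ℕₚ.<⇒≱ (ℕₚ.≤-trans (size-positive F) (ℕₚ.m≤m+n _ _)))
      leaf-forms (mul₃ F G H) (s≤s le) b k = contradiction le (ℕₚ.<⇒≱ (ℕₚ.≤-trans (size-positive F) (ℕₚ.≤-trans (ℕₚ.m≤m+n _ _) (ℕₚ.m≤m+n _ _))))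
      heavier : ∀ p Γ → 1 < weight (p ∷ Γ)
      heavier (x , y) Γ = ℕₚ.≤-trans (ℕₚ.+-mono-≤ (size-positive x) (size-positive y)) (ℕₚ.m≤m+n _ _)
    balanced (suc k) = subst (λ T → Forms T (512 ℕ.^ suc k) × Contexts T (512 ℕ.^ suc k)) (eq (2 ℕ.^ k))
      ( (λ F le b k′ → weaken (ℕₚ.*-monoˡ-≤ N (ℕₚ.m≤m+n 23 489)) (forms′ F le b k′))
      , (λ p Γ le b k′ → weaken (ℕₚ.≤-trans (ℕₚ.≤-reflexive (≡.sym (ℕₚ.*-assoc 16 23 N))) (ℕₚ.*-monoˡ-≤ N (ℕₚ.m≤m+n 368 144)))
          (double-contexts (proj₁ ih) (proj₂ ih) (ℕₚ.m≤m+n N (22 ℕ.* N)) forms′ p Γ le b k′)))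
      where
      N = 512 ℕ.^ k
      ih = balanced k
      forms′ : Forms (2 ℕ.^ k ℕ.+ 2 ℕ.^ k) (23 ℕ.* N)
      forms′ = double-forms (proj₁ ih) (proj₂ ih) (ℕₚ.m^n>0 2 k)
      eq : ∀ n → n ℕ.+ n ≡ 2 ℕ.* n
      eq = solve-∀

  powerAbove : ∀ n → 1 ≤ n → ∃ λ k → n ≤ 2 ℕ.^ k × 2 ℕ.^ k ≤ 2 ℕ.* n
  powerAbove (suc zero)    _ = 0 , ℕₚ.≤-refl , ℕₚ.m≤m+n 1 1
  powerAbove (suc (suc n)) _ with powerAbove (suc n) (s≤s z≤n)
  ... | k , lo , hi with suc (suc n) ℕ.≤? 2 ℕ.^ k
  ...   | yes le = k , le , ℕₚ.≤-trans hi (ℕₚ.*-monoʳ-≤ 2 (ℕₚ.n≤1+n (suc n)))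
  ...   | no ¬le = suc k , ℕₚ.≤-trans (ℕₚ.≤-trans (ℕₚ.+-monoˡ-≤ (suc n) (s≤s (z≤n {n}))) (ℕₚ.≤-reflexive (cong (suc n ℕ.+_) (≡.sym (ℕₚ.+-identityʳ (suc n)))))) (ℕₚ.*-monoʳ-≤ 2 lo)
                     , ℕₚ.*-monoʳ-≤ 2 (ℕₚ.≤-trans (ℕₚ.≤-pred (ℕₚ.≰⇒> ¬le)) (ℕₚ.n≤1+n (suc n)))

  512-power : ∀ k → 512 ℕ.^ k ≡ (2 ℕ.^ k) ℕ.^ 9
  512-power k = ≡.trans (ℕₚ.^-*-assoc 2 9 k) (≡.trans (cong (2 ℕ.^_) (ℕₚ.*-comm 9 k)) (≡.sym (ℕₚ.^-*-assoc 2 k 9)))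

  module Main (R : CommutativeRing 0ℓ 0ℓ) (𝓒 : Calculus R) where
    open CommutativeRing R using (_≈_; _*_; *-identityˡ)
    open TwoByTwo R
    open Calculus 𝓒
    open Decomposition R ⟦_⟧ˡ
    open Balanced R 𝓒

    realizable-IHL : ∀ b F → Realizable (E b ⟦ F ⟧) ((2 ℕ.* sizeⁱ F) ℕ.^ 9)
    realizable-IHL b F with powerAbove (sizeⁱ F) (size-positive F)
    ... | k , lo , hi = weaken (ℕₚ.≤-trans (ℕₚ.≤-reflexive (512-power k)) (ℕₚ.^-monoˡ-≤ 9 hi))
      (respects (E-cong b (*-identityˡ _)) (proj₁ (balanced k) F lo b 0))

-- The polynomials C as sums over alternating subsequences.

module Alternating where

  open import Defs using (Poly; const; 1ℂ; var; productᵖ; _⟨_⟩; words; alternating; GradedPFamily; C)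
  open Sums
  open Polynomials
  open Components
  open import Data.Nat as ℕ using (ℕ; zero; suc; _<_; _<?_; _%_; z≤n; s≤s)
  import Data.Nat.Properties as ℕₚ
  open import Data.Nat.DivMod using ([m+n]%n≡m%n)
  open import Data.Bool using (Bool; true; false; not; if_then_else_)
  import Data.Bool.Properties as Boolₚ
  open import Data.Fin as Fin using (Fin; toℕ)
  import Data.Fin.Properties as Finₚ
  open import Data.List as List using (List; []; _∷_; map; upTo; filter)
  import Data.List.Properties as Listₚ
  open import Data.Vec as Vec using (Vec; lookup)
  open import Data.Vec.Relation.Unary.All as VAll using (All)
  open import Data.Vec.Relation.Unary.AllPairs as AllPairs using (AllPairs; []; _∷_)
  open import Data.Product using (_×_; _,_; proj₁; proj₂)
  open import Data.Unit using (⊤; tt)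
  open import Function using (_∘_)
  open import Relation.Nullary using (Dec; yes; no; does)
  open import Relation.Nullary.Decidable using (_×-dec_; dec-true; dec-false; does-⇔)
  open import Relation.Unary using (Decidable)
  open import Relation.Binary.PropositionalEquality as ≡ using (_≡_; refl; cong; cong₂)
  open import Function.Bundles using (mk⇔)
  open import Algebra.Bundles using (CommutativeRing)

  private
    module P = CommutativeRing Poly-ring
  open RingSums Poly-ring

  when : Bool → Poly → Poly
  when b p = if b then p else []

  when-cong : ∀ b {p q} → p ≋ q → when b p ≋ when b q
  when-cong true  e = e
  when-cong false e = ≋-refl

  -- The sum of ℓ_{i₁} ⋯ ℓ_{i_d} over the subsequences whose labels alternate, starting with π.
  alt : Bool → ℕ → List (Bool × Poly) → Poly
  alt π zero    _             = const 1ℂ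
  alt π (suc d) []            = []
  alt π (suc d) ((b , p) ∷ w) = when (does (b Boolₚ.≟ π)) (p * alt (not π) d w) + alt π (suc d) w

  odd? : ℕ → Bool
  odd? zero    = false
  odd? (suc n) = not (odd? n)

  odd?-%2 : ∀ n → n % 2 ≡ (if odd? n then 1 else 0)
  odd?-%2 zero          = refl
  odd?-%2 (suc zero)    = refl
  odd?-%2 (suc (suc n)) = ≡.trans (≡.trans (cong (_% 2) (ℕₚ.+-comm 2 n)) ([m+n]%n≡m%n n 2))
    (≡.trans (odd?-%2 n) (cong (if_then 1 else 0) (≡.sym (Boolₚ.not-involutive (odd? n)))))

  %2⇒odd? : ∀ m n → m % 2 ≡ n % 2 → odd? m ≡ odd? n
  %2⇒odd? m n e = bit (odd? m) (odd? n) (≡.trans (≡.sym (odd?-%2 m)) (≡.trans e (odd?-%2 n)))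
    where
    bit : ∀ a b → (if a then 1 else 0) ≡ (if b then 1 else 0) → a ≡ b
    bit true  true  _ = refl
    bit false false _ = refl

  odd?⇒%2 : ∀ m n → odd? m ≡ odd? n → m % 2 ≡ n % 2
  odd?⇒%2 m n e = ≡.trans (odd?-%2 m) (≡.trans (cong (if_then 1 else 0) e) (≡.sym (odd?-%2 n)))

  -- Sortedness and parity as one recursion, with the previous entry `lo` and the position `k` as
  -- state, so that summing over the first entry leaves a condition of the same kind, as in the
  -- recursion of `alt`.
  Alternates : ℕ → ℕ → ∀ {d} → Vec ℕ d → Set
  Alternates lo k Vec.[]       = ⊤
  Alternates lo k (x Vec.∷ w) = lo < x × (odd? x ≡ odd? k × Alternates x (suc k) w)

  alternates? : ∀ lo k {d} (w : Vec ℕ d) → Dec (Alternates lo k w)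
  alternates? lo k Vec.[]       = yes tt
  alternates? lo k (x Vec.∷ w) = lo <? x ×-dec ((odd? x Boolₚ.≟ odd? k) ×-dec alternates? x (suc k) w)

  alternates⇒ : ∀ lo k {d} (w : Vec ℕ d) → Alternates lo k w →
                All (lo <_) w × AllPairs _<_ w × (∀ j → lookup w j % 2 ≡ (k ℕ.+ toℕ j) % 2)
  alternates⇒ lo k Vec.[]       _ = VAll.[] , [] , λ ()
  alternates⇒ lo k (x Vec.∷ w) (lo<x , p , alt′) =
    let x<w , sorted , parity = alternates⇒ x (suc k) w alt′ in
    lo<x VAll.∷ VAll.map (ℕₚ.<-trans lo<x) x<w , x<w ∷ sorted , λ where
      Fin.zero    → ≡.trans (odd?⇒%2 x k p) (cong (_% 2) (≡.sym (ℕₚ.+-identityʳ k)))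
      (Fin.suc j) → ≡.trans (parity j) (cong (_% 2) (≡.sym (ℕₚ.+-suc k (toℕ j))))

  ⇒alternates : ∀ lo k {d} (w : Vec ℕ d) → All (lo <_) w → AllPairs _<_ w →
                (∀ j → lookup w j % 2 ≡ (k ℕ.+ toℕ j) % 2) → Alternates lo k w
  ⇒alternates lo k Vec.[]       _              _               _      = tt
  ⇒alternates lo k (x Vec.∷ w) (lo<x VAll.∷ _) (x<w ∷ sorted) parity =
    lo<x , %2⇒odd? x k (≡.trans (parity Fin.zero) (cong (_% 2) (ℕₚ.+-identityʳ k))) ,
    ⇒alternates x (suc k) w x<w sorted (λ j → ≡.trans (parity (Fin.suc j)) (cong (_% 2) (ℕₚ.+-suc k (toℕ j))))

  ∑-filter : ∀ {A : Set} {Q : A → Set} (Q? : ∀ x → Dec (Q x)) xs (f : A → Poly) →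
             ∑ (filter Q? xs) f ≋ ∑ xs (λ x → when (does (Q? x)) (f x))
  ∑-filter Q? []       f = ≋-refl
  ∑-filter Q? (x ∷ xs) f with Q? x
  ... | yes _ = P.+-congˡ (∑-filter Q? xs f)
  ... | no  _ = ≋-trans (∑-filter Q? xs f) (≋-sym (P.+-identityˡ _))

  ⟨⟩-∑ : ∀ {A : Set} xs (f : A → Poly) s → ∑ xs f ⟨ s ⟩ ≋ ∑ xs (λ x → f x ⟨ s ⟩)
  ⟨⟩-∑ []       f s = ≋-reflexive (⟨⟩-[] s)
  ⟨⟩-∑ (x ∷ xs) f s = ≋-trans (⟨⟩-+ (f x) (∑ xs f) s) (P.+-congˡ (⟨⟩-∑ xs f s))

  monoᵛ : (ℕ → Poly) → ∀ {d} → Vec ℕ d → Poly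
  monoᵛ s Vec.[]       = const 1ℂ
  monoᵛ s (x Vec.∷ w) = s x * monoᵛ s w

  ⟨⟩-monoᵛ : ∀ s {d} (w : Vec ℕ d) → productᵖ (List.tabulate λ j → var (lookup w j)) ⟨ s ⟩ ≋ monoᵛ s w
  ⟨⟩-monoᵛ s Vec.[]       = ⟨⟩-const 1ℂ s
  ⟨⟩-monoᵛ s (x Vec.∷ w) = ≋-trans
    (⟨⟩-cong (≋-reflexive (*-def (var x) (productᵖ (List.tabulate λ j → var (lookup w j))))) (λ _ → ≋-refl))
    (≋-trans (⟨⟩-* (var x) _ s) (*-cong (⟨⟩-var x s) (⟨⟩-monoᵛ s w)))

  range : ℕ → ℕ → List ℕ
  range i zero    = []
  range i (suc r) = i ∷ range (suc i) r

  applyUpTo-cong : ∀ {A : Set} (f g : ℕ → A) → (∀ j → f j ≡ g j) → ∀ n → List.applyUpTo f n ≡ List.applyUpTo g n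
  applyUpTo-cong f g eq zero    = refl
  applyUpTo-cong f g eq (suc n) = cong₂ _∷_ (eq 0) (applyUpTo-cong (f ∘ suc) (g ∘ suc) (eq ∘ suc) n)

  applyUpTo-range : ∀ i n → List.applyUpTo (i ℕ.+_) n ≡ range i n
  applyUpTo-range i zero    = refl
  applyUpTo-range i (suc n) = cong₂ _∷_ (ℕₚ.+-identityʳ i)
    (≡.trans (applyUpTo-cong _ _ (ℕₚ.+-suc i) n) (applyUpTo-range (suc i) n))

  suc-upTo : ∀ n → map suc (upTo n) ≡ range 1 n
  suc-upTo n = ≡.trans (Listₚ.map-applyUpTo (λ j → j) suc n) (applyUpTo-range 1 n)

  labelled : (ℕ → Poly) → List ℕ → List (Bool × Poly)
  labelled s = map (λ x → odd? x , s x)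

  -- The hypothesis says that the first j letters are i, ..., lo, which are exactly the ones that
  -- fail the test.
  ∑-skip : ∀ (f : ℕ → Poly) lo i j r → i ℕ.+ j ≡ suc lo →
           ∑ (range i (j ℕ.+ r)) (λ x → when (does (lo <? x)) (f x)) ≋ ∑ (range (suc lo) r) f
  ∑-skip f lo i zero r eq rewrite ≡.trans (≡.sym (ℕₚ.+-identityʳ i)) eq = all-above (suc lo) r ℕₚ.≤-refl
    where
    all-above : ∀ i r → lo < i → ∑ (range i r) (λ x → when (does (lo <? x)) (f x)) ≋ ∑ (range i r) f
    all-above i zero    _    = ≋-refl
    all-above i (suc r) lo<i rewrite dec-true (lo <? i) lo<i = P.+-congˡ (all-above (suc i) r (ℕₚ.m≤n⇒m≤1+n lo<i))
  ∑-skip f lo i (suc j) r eq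
    rewrite dec-false (lo <? i) (λ lo<i → ℕₚ.<-irrefl refl (ℕₚ.<-≤-trans lo<i (ℕₚ.≤-pred (ℕₚ.≤-trans (ℕₚ.m≤m+n (suc i) j) (ℕₚ.≤-reflexive (≡.trans (≡.sym (ℕₚ.+-suc i j)) eq)))))) =
    ≋-trans (P.+-identityˡ _) (∑-skip f lo (suc i) j r (≡.trans (≡.sym (ℕₚ.+-suc i j)) eq))

  ∑-when : ∀ {A : Set} b xs (f : A → Poly) → ∑ xs (λ x → when b (f x)) ≋ when b (∑ xs f)
  ∑-when true  xs f = ≋-refl
  ∑-when false xs f = ∑-zero xs (λ _ → ≋-refl)

  module _ (s : ℕ → Poly) (n : ℕ) where

    from : ℕ → ℕ → ℕ → Poly
    from d lo k = ∑ (words d (range 1 n)) (λ w → when (does (alternates? lo k w)) (monoᵛ s w))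

    when-step : ∀ lo k x {d} (w : Vec ℕ d) →
      when (does (alternates? lo k (x Vec.∷ w))) (monoᵛ s (x Vec.∷ w)) ≋
      when (does (lo <? x)) (when (does (odd? x Boolₚ.≟ odd? k)) (s x * when (does (alternates? x (suc k) w)) (monoᵛ s w)))
    when-step lo k x w with does (lo <? x) | does (odd? x Boolₚ.≟ odd? k) | does (alternates? x (suc k) w)
    ... | false | _     | _     = ≋-refl
    ... | true  | false | _     = ≋-refl
    ... | true  | true  | true  = ≋-refl
    ... | true  | true  | false = ≋-sym (P.zeroʳ (s x))

    from-suc : ∀ d lo k → from (suc d) lo k ≋
      ∑ (range 1 n) (λ x → when (does (lo <? x)) (when (does (odd? x Boolₚ.≟ odd? k)) (s x * from d x (suc k))))
    from-suc d lo k = ≋-trans (∑-product Vec._∷_ (range 1 n) (words d (range 1 n)) _) (∑-cong (range 1 n) λ x →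
      ≋-trans (∑-cong (words d (range 1 n)) λ w → when-step lo k x w)
        (≋-trans (∑-when (does (lo <? x)) (words d (range 1 n)) _) (when-cong (does (lo <? x))
          (≋-trans (∑-when (does (odd? x Boolₚ.≟ odd? k)) (words d (range 1 n)) _) (when-cong (does (odd? x Boolₚ.≟ odd? k))
            (≋-sym (∑-*ˡ (words d (range 1 n)) (s x) _)))))))

    from-alt : ∀ d lo r k → lo ℕ.+ r ≡ n → from d lo k ≋ alt (odd? k) d (labelled s (range (suc lo) r))
    from-alt zero    lo r k eq = P.+-identityʳ (const 1ℂ)
    from-alt (suc d) lo r k eq = ≋-trans (from-suc d lo k)
      (≋-trans (≋-reflexive (cong (λ n′ → ∑ (range 1 n′) (λ x → when (does (lo <? x)) (step x))) (≡.sym eq)))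
        (≋-trans (∑-skip step lo 1 lo r refl) (tail lo r eq)))
      where
      step : ℕ → Poly
      step x = when (does (odd? x Boolₚ.≟ odd? k)) (s x * from d x (suc k))
      tail : ∀ lo r → lo ℕ.+ r ≡ n → ∑ (range (suc lo) r) step ≋ alt (odd? k) (suc d) (labelled s (range (suc lo) r))
      tail lo zero    eq = ≋-refl
      tail lo (suc r) eq = +-cong
        (when-cong (does (odd? (suc lo) Boolₚ.≟ odd? k)) (P.*-congˡ (from-alt d (suc lo) r (suc k) eq′)))
        (tail (suc lo) r eq′)
        where
        eq′ : suc lo ℕ.+ r ≡ n
        eq′ = ≡.trans (≡.sym (ℕₚ.+-suc lo r)) eq

  -- `Alternates 0 1` demands that entries exceed 0, for which the definition of `C` has no
  -- counterpart; it holds because the letters start at 1. The continuation `h` of `go` remembers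
  -- the entries already chosen.
  words-positive : ∀ n d → ∀ i (f : ∀ {d} → Vec ℕ d → Poly) (g : ∀ {d} → Vec ℕ d → Poly) →
                   (∀ {d} (w : Vec ℕ d) → All (0 <_) w → f w ≋ g w) →
                   ∑ (words d (range (suc i) n)) f ≋ ∑ (words d (range (suc i) n)) g
  words-positive n d i f g eq = go d (λ w → w) (λ w p → p)
    where
    go : ∀ d {e} (h : Vec ℕ d → Vec ℕ e) → (∀ w → All (0 <_) w → All (0 <_) (h w)) →
         ∑ (words d (range (suc i) n)) (λ w → f (h w)) ≋ ∑ (words d (range (suc i) n)) (λ w → g (h w))
    go zero    h pos = P.+-congʳ (eq (h Vec.[]) (pos Vec.[] VAll.[]))
    go (suc d) h pos = ≋-trans (∑-product Vec._∷_ (range (suc i) n) (words d (range (suc i) n)) _) (≋-trans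
      (letters i n)
      (≋-sym (∑-product Vec._∷_ (range (suc i) n) (words d (range (suc i) n)) _)))
      where
      letters : ∀ j r → ∑ (range (suc j) r) (λ x → ∑ (words d (range (suc i) n)) (λ w → f (h (x Vec.∷ w)))) ≋
                        ∑ (range (suc j) r) (λ x → ∑ (words d (range (suc i) n)) (λ w → g (h (x Vec.∷ w))))
      letters j zero    = ≋-refl
      letters j (suc r) = +-cong (go d (λ w → h (suc j Vec.∷ w)) (λ w p → pos (suc j Vec.∷ w) (s≤s z≤n VAll.∷ p))) (letters (suc j) r)

  C-alt : ∀ n d s → GradedPFamily.poly C n d ⟨ s ⟩ ≋ alt true d (labelled s (range 1 n))
  C-alt n d s = begin
    GradedPFamily.poly C n d ⟨ s ⟩
      ≈⟨ ⟨⟩-cong (≋-reflexive (sumᵖ-map _ (alternating n d))) (λ _ → ≋-refl) ⟩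
    ∑ (alternating n d) (λ w → productᵖ (List.tabulate λ j → var (lookup w j))) ⟨ s ⟩
      ≈⟨ ⟨⟩-∑ (alternating n d) _ s ⟩
    ∑ (alternating n d) (λ w → productᵖ (List.tabulate λ j → var (lookup w j)) ⟨ s ⟩)
      ≈⟨ ∑-cong (alternating n d) (λ w → ⟨⟩-monoᵛ s w) ⟩
    ∑ (alternating n d) (monoᵛ s)
      ≈⟨ ∑-filter Q? (words d (map suc (upTo n))) (monoᵛ s) ⟩
    ∑ (words d (map suc (upTo n))) (λ w → when (does (Q? w)) (monoᵛ s w))
      ≈⟨ ≋-reflexive (cong (λ L → ∑ (words d L) (λ w → when (does (Q? w)) (monoᵛ s w))) (suc-upTo n)) ⟩
    ∑ (words d (range 1 n)) (λ w → when (does (Q? w)) (monoᵛ s w))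
      ≈⟨ words-positive n d 0 (λ w → when (does (Q? w)) (monoᵛ s w)) (λ w → when (does (alternates? 0 1 w)) (monoᵛ s w))
           (λ w pos → ≋-reflexive (cong (λ b → when b (monoᵛ s w)) (does-⇔ (mk⇔
             (λ (sorted , parity) → ⇒alternates 0 1 w pos sorted parity)
             (λ a → proj₂ (alternates⇒ 0 1 w a))) (Q? w) (alternates? 0 1 w)))) ⟩
    from s n d 0 1
      ≈⟨ from-alt s n d 0 n 1 refl ⟩
    alt true d (labelled s (range 1 n)) ∎
    where
    open import Relation.Binary.Reasoning.Setoid ≋-setoid
    Q? : ∀ {d} (w : Vec ℕ d) → Dec (AllPairs _<_ w × (∀ j → lookup w j % 2 ≡ suc (toℕ j) % 2))
    Q? w = AllPairs.allPairs? _<?_ w ×-dec Finₚ.all? (λ j → lookup w j % 2 ℕ.≟ suc (toℕ j) % 2)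

  alt-cong : ∀ π d {A : Set} (f g : A → Bool × Poly) xs → (∀ x → proj₁ (f x) ≡ proj₁ (g x) × proj₂ (f x) ≋ proj₂ (g x)) →
             alt π d (map f xs) ≋ alt π d (map g xs)
  alt-cong π zero    f g xs       eq = ≋-refl
  alt-cong π (suc d) f g []       eq = ≋-refl
  alt-cong π (suc d) f g (x ∷ xs) eq with f x | g x | eq x
  ... | b , p | .b , q | refl , e = +-cong (when-cong (does (b Boolₚ.≟ π)) (*-cong e (alt-cong (not π) d f g xs eq)))
                                          (alt-cong π (suc d) f g xs eq)

  alt-⟨⟩ : ∀ π d w s → alt π d w ⟨ s ⟩ ≋ alt π d (map (λ (b , p) → b , p ⟨ s ⟩) w)
  alt-⟨⟩ π zero    w             s = ⟨⟩-const 1ℂ s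
  alt-⟨⟩ π (suc d) []            s = ≋-reflexive (⟨⟩-[] s)
  alt-⟨⟩ π (suc d) ((b , p) ∷ w) s = ≋-trans (⟨⟩-+ _ (alt π (suc d) w) s) (+-cong (head (does (b Boolₚ.≟ π))) (alt-⟨⟩ π (suc d) w s))
    where
    head : ∀ t → when t (p * alt (not π) d w) ⟨ s ⟩ ≋ when t (p ⟨ s ⟩ * alt (not π) d (map (λ (b , p) → b , p ⟨ s ⟩) w))
    head true  = ≋-trans (⟨⟩-* p (alt (not π) d w) s) (P.*-congˡ (alt-⟨⟩ (not π) d w s))
    head false = ≋-reflexive (⟨⟩-[] s)

-- The ring of convergent sequences and the words over it.

module Sequences where

  open import Defs using (ℂ; Poly; LinearForm; linear; const; rat; 0ℂ; 1ℂ; IHL; sizeⁱ; valueⁱ; leaf; add; mul₃)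
  open Reals using (≃-trans; ℂ-ring; Limit; limit; near; _,ᶜ_; _<′_; rat-+; rat-*)
  open Sums
  open Polynomials
  open Components
  open Convergence
  open Matrices
  open Gadgets
  open Balancing
  open import Data.Nat as ℕ using (ℕ; zero; suc; _≤_)
  import Data.Nat.Properties as ℕₚ
  open import Data.Nat.Coprimality using (1-coprimeTo)
  open import Data.Integer as ℤ using (+_; +<+)
  import Data.Integer.Properties as ℤₚ
  open import Data.Rational using (ℚ; mkℚ; 0ℚ; ½; ∣_∣; *<*; 1/_)
  import Data.Rational.Properties as ℚₚ
  open import Data.Bool using (Bool; true; false)
  open import Data.List using (List; []; _∷_)
  open import Data.Product using (∃; _×_; _,_)
  open import Relation.Binary.PropositionalEquality as ≡ using (_≡_; refl; cong; cong₂; subst; subst₂)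
  open import Algebra.Bundles using (CommutativeRing; Ring)
  open import Level using (0ℓ)

  private
    module K = CommutativeRing ℂ-ring
    module P = CommutativeRing Poly-ring

  -- Convergence makes remainders harmless: ε times an element of this ring tends to zero. Equality
  -- compares the members and not the limits, so every identity of words holds exactly at each value
  -- of ε and can be divided by powers of ε there.
  record Sequence : Set where
    no-eta-equality
    field
      at        : ℕ → Poly
      end       : Poly
      converges : at ⇝ end

  open Sequence public using (at)
  open Sequence

  infix 4 _≐_
  record _≐_ (x y : Sequence) : Set where
    constructor pointwise
    field same : ∀ j → at x j ≋ at y j

  open _≐_ public

  _+ˢ_ _*ˢ_ : Sequence → Sequence → Sequence
  at        (x +ˢ y) j = at x j + at y j
  end       (x +ˢ y)   = end x + end y
  converges (x +ˢ y)   = ⇝-+ (converges x) (converges y)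
  at        (x *ˢ y) j = at x j * at y j
  end       (x *ˢ y)   = end x * end y
  converges (x *ˢ y)   = ⇝-* (converges x) (converges y)

  constant : Poly → Sequence
  at        (constant p) _ = p
  end       (constant p)   = p
  converges (constant p)   = ⇝-const p

  -ˢ_ : Sequence → Sequence
  -ˢ x = constant (const (K.- 1ℂ)) *ˢ x

  Seq-ring : CommutativeRing 0ℓ 0ℓ
  Seq-ring = record
    { Carrier = Sequence ; _≈_ = _≐_ ; _+_ = _+ˢ_ ; _*_ = _*ˢ_ ; -_ = -ˢ_ ; 0# = constant [] ; 1# = constant (const 1ℂ)
    ; isCommutativeRing = record
      { isRing = record
        { +-isAbelianGroup = record
          { isGroup = record
            { isMonoid = record
              { isSemigroup = record
                { isMagma = record
                  { isEquivalence = record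
                    { refl  = pointwise λ _ → ≋-refl
                    ; sym   = λ e → pointwise λ j → ≋-sym (same e j)
                    ; trans = λ e f → pointwise λ j → ≋-trans (same e j) (same f j)
                    }
                  ; ∙-cong = λ e f → pointwise λ j → +-cong (same e j) (same f j)
                  }
                ; assoc = λ x y z → pointwise λ j → P.+-assoc (at x j) (at y j) (at z j)
                }
              ; identity = (λ x → pointwise λ j → P.+-identityˡ (at x j)) , (λ x → pointwise λ j → P.+-identityʳ (at x j))
              }
            ; inverse = (λ x → pointwise λ j → P.-‿inverseˡ (at x j)) , (λ x → pointwise λ j → P.-‿inverseʳ (at x j))
            ; ⁻¹-cong = λ e → pointwise λ j → P.-‿cong (same e j)
            }
          ; comm = λ x y → pointwise λ j → P.+-comm (at x j) (at y j)
          }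
        ; *-cong = λ e f → pointwise λ j → *-cong (same e j) (same f j)
        ; *-assoc = λ x y z → pointwise λ j → P.*-assoc (at x j) (at y j) (at z j)
        ; *-identity = (λ x → pointwise λ j → P.*-identityˡ (at x j)) , (λ x → pointwise λ j → P.*-identityʳ (at x j))
        ; distrib = (λ x y z → pointwise λ j → P.distribˡ (at x j) (at y j) (at z j))
                  , (λ x y z → pointwise λ j → P.distribʳ (at x j) (at y j) (at z j))
        }
      ; *-comm = λ x y → pointwise λ j → P.*-comm (at x j) (at y j)
      }
    }

  inv : ℕ → ℚ
  inv j = mkℚ (+ 1) j (1-coprimeTo (suc j))

  inv-small : ∀ {ε} → 0ℚ <′ ε → ∃ λ J → ∀ j → J ≤ j → inv j <′ ε
  inv-small {mkℚ (+ zero) d c}    (*<* (+<+ ()))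
  inv-small {mkℚ (+ suc k) d c}   _ = suc (suc d) , λ j le → *<* (subst₂ ℤ._<_ (≡.sym (ℤₚ.*-identityˡ (+ suc d)))
    (ℤₚ.pos-* (suc k) (suc j)) (+<+ (ℕₚ.<-≤-trans (ℕₚ.m≤n⇒m≤1+n le) (ℕₚ.m≤m+n (suc j) (k ℕ.* suc j)))))
  inv-small {mkℚ ℤ.-[1+ k ] d c}  (*<* ())

  inv-limit : Limit (λ j → rat (inv j)) 0ℂ
  inv-limit = limit λ {ε} 0<ε → let J , h = inv-small 0<ε in J , λ j le →
    near (0 , λ _ _ → subst (λ q → ∣ q ∣ <′ ε) (≡.sym (ℚₚ.+-identityʳ (inv j))) (h j le)) ,ᶜ
    near (0 , λ _ _ → 0<ε)

  small large : ℕ → Poly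
  small j = const (rat (inv j))
  large j = const (rat (1/ inv j))

  large*small : ∀ j → large j * small j ≋ const 1ℂ
  large*small j = ≋-trans (≋-sym (const-* (rat (1/ inv j)) (rat (inv j))))
    (const-cong (≃-trans (rat-* (1/ inv j) (inv j)) (K.reflexive (cong rat (ℚₚ.*-inverseˡ (inv j))))))

  ε : Sequence
  at        ε = small
  end       ε = const 0ℂ
  converges ε = ⇝-scalar inv-limit

  open import Algebra.Properties.Semiring.Exp P.semiring using (_^_)

  at-power : ∀ x n j → at (power Seq-ring x n) j ≋ at x j ^ n
  at-power x zero    j = ≋-refl
  at-power x (suc n) j = P.*-congˡ (at-power x n j)

  scales : ℂ → ℕ → LinearForm → LinearForm
  scales a zero    ℓ = ℓ
  scales a (suc n) ℓ = scaleˡ a (scales a n ℓ)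

  linear-scales : ∀ a n ℓ → linear (scales a n ℓ) ≋ const a ^ n * linear ℓ
  linear-scales a zero    ℓ = ≋-sym (P.*-identityˡ _)
  linear-scales a (suc n) ℓ = ≋-trans (linear-scale a (scales a n ℓ))
    (≋-trans (P.*-congˡ (linear-scales a n ℓ)) (≋-sym (P.*-assoc _ _ _)))

  open TwoByTwo Seq-ring
  private
    module S = CommutativeRing Seq-ring
    module M = Ring Matrix-ring

  -- A letter does not depend on the value of ε. A word thus keeps its length and its sides when it
  -- is evaluated at ε = 1/(j+1), and one length bound is valid along the whole sequence.
  record Letter : Set where
    constructor letter
    field
      side : Bool
      exponent : ℕ
      form : LinearForm

  entryOf : Letter → Sequence
  entryOf (letter b p ℓ) = power Seq-ring ε p *ˢ constant (linear ℓ)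

  negate : LinearForm → LinearForm
  negate = scaleˡ (K.- 1ℂ)

  negate-cancel : ∀ ℓ → linear ℓ + linear (negate ℓ) ≋ []
  negate-cancel ℓ = ≋-trans (P.+-congˡ (linear-scale (K.- 1ℂ) ℓ)) (P.-‿inverseʳ (linear ℓ))

  letters : Letters Matrix-ring
  letters = record
    { Letter = Letter
    ; value  = λ a → elementary (Letter.side a) (entryOf a)
    ; invert = λ (letter b p ℓ) → letter b p (negate ℓ)
    ; rightInverse = λ (letter b p ℓ) → elementary-inverse b (inverts (power Seq-ring ε p) (negate-cancel ℓ))
    ; leftInverse  = λ (letter b p ℓ) → elementary-inverse b
        (inverts (power Seq-ring ε p) (≋-trans (P.+-comm _ _) (negate-cancel ℓ)))
    }
    where
    inverts : ∀ x {p q} → p + q ≋ [] → ((x *ˢ constant p) +ˢ (x *ˢ constant q)) ≐ constant []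
    inverts x e = pointwise λ j → ≋-trans (≋-sym (P.distribˡ (at x j) _ _)) (≋-trans (P.*-congˡ e) (P.zeroʳ (at x j)))

  εᴹ : Central Matrix-ring
  εᴹ = record { ε = scalar ε ; central = scalar-central ε }

  open Words Matrix-ring letters εᴹ renaming (power to powerᴹ)

  power-scalar : ∀ n M → (powerᴹ n *ᴹ M) ≈ᴹ (scalar (power Seq-ring ε n) *ᴹ M)
  power-scalar n M = entries λ i j → S.trans (go n M i j) (S.sym (scalar-*ˡ (power Seq-ring ε n) M i j))
    where
    go : ∀ n M i j → (powerᴹ n *ᴹ M) i j ≐ (power Seq-ring ε n *ˢ M i j)
    go zero    M i j = scalar-*ˡ S.1# M i j
    go (suc n) M i j = S.trans (entry (M.*-assoc (scalar ε) (powerᴹ n) M) i j)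
      (S.trans (scalar-*ˡ ε (powerᴹ n *ᴹ M) i j) (S.trans (S.*-congˡ {ε} (go n M i j)) (S.sym (S.*-assoc ε (power Seq-ring ε n) (M i j)))))

  realizable-leaf : ∀ b k ℓ → Realizable (E b (power Seq-ring (constant (const (rat ½))) k *ˢ constant (linear ℓ))) 1
  realizable-leaf b k ℓ = realizable-letter (λ p → letter b (suc p) (scales (rat ½) k ℓ)) λ p →
    M.+-congˡ {scalar S.1#} (M.trans (E-cong b (S.*-congˡ {power Seq-ring ε (suc p)} {y = X} (pointwise λ j →
        ≋-trans (linear-scales (rat ½) k ℓ) (P.*-congʳ (≋-sym (at-power (constant (const (rat ½))) k j))))))
      (M.trans (M.sym (scalar-E (power Seq-ring ε (suc p)) b X)) (M.sym (power-scalar (suc p) (E b X)))))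
    where
    X = power Seq-ring (constant (const (rat ½))) k *ˢ constant (linear ℓ)

  calculus : Calculus Seq-ring
  calculus = record
    { ⟦_⟧ˡ = λ ℓ → constant (linear ℓ)
    ; empty = S.refl
    ; half = constant (const (rat ½))
    ; halves′ = pointwise λ _ → ≋-trans (≋-sym (const-+ (rat ½) (rat ½))) (const-cong (rat-+ ½ ½))
    ; Realizable = Realizable
    ; respects = realizable-≈
    ; weaken = realizable-≤
    ; sums = realizable-+
    ; commutators = realizable-[]
    ; leaves = realizable-leaf
    }

  open Decomposition Seq-ring (λ ℓ → constant (linear ℓ)) using () renaming (⟦_⟧ to ⟦_⟧ⁱ)
  open Main Seq-ring calculus using (realizable-IHL)

  at-⟦⟧ : ∀ F j → at ⟦ F ⟧ⁱ j ≡ valueⁱ F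
  at-⟦⟧ (leaf ℓ)     j = refl
  at-⟦⟧ (add F G)    j = ≡.trans (cong₂ _+_ (at-⟦⟧ F j) (at-⟦⟧ G j)) (≡.sym (+-def (valueⁱ F) (valueⁱ G)))
  at-⟦⟧ (mul₃ F G H) j = ≡.trans (cong₂ _*_ (cong₂ _*_ (at-⟦⟧ F j) (at-⟦⟧ G j)) (at-⟦⟧ H j))
    (≡.trans (cong (_* valueⁱ H) (≡.sym (*-def (valueⁱ F) (valueⁱ G)))) (≡.sym (*-def _ (valueⁱ H))))

  realizable-odd : ∀ F → Realizable (E true (constant (valueⁱ F))) ((2 ℕ.* sizeⁱ F) ℕ.^ 9)
  realizable-odd F = realizable-≈ (E-cong true (pointwise λ j → ≋-reflexive (at-⟦⟧ F j))) (realizable-IHL true F)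

  pairsValue : List (LinearForm × IHL) → Poly
  pairsValue []            = []
  pairsValue ((ℓ , F) ∷ L) = linear ℓ * valueⁱ F + pairsValue L

  -- The summand 512 is (2 · 1)⁹, the length that `realizable-IHL` grants to the leaf `ℓ`.
  pairsLength : List (LinearForm × IHL) → ℕ
  pairsLength []            = 0
  pairsLength ((ℓ , F) ∷ L) = 2 ℕ.* (512 ℕ.+ (2 ℕ.* sizeⁱ F) ℕ.^ 9) ℕ.+ pairsLength L

  -- A product of a linear form and an odd formula is one commutator of opposite sides, and such
  -- diagonal values add up, so even degrees need no product gate of arity 2.
  realizable-even : ∀ L → Realizable (H true (constant (pairsValue L))) (pairsLength L)
  realizable-even []            = realizable-≈ H-true-0 realizable-0
  realizable-even ((ℓ , F) ∷ L) = realizable-≈ (M.trans (M.+-cong head M.refl)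
    (M.trans (H-true-+ (constant (linear ℓ * valueⁱ F)) (constant (pairsValue L))) (H-cong true (pointwise λ _ → ≋-refl))))
    (realizable-+ (realizable-[] (realizable-IHL true (leaf ℓ)) (realizable-IHL false F)) (realizable-even L))
    where
    head : [ E true ⟦ leaf ℓ ⟧ⁱ , E false ⟦ F ⟧ⁱ ]ᴹ ≈ᴹ H true (constant (linear ℓ * valueⁱ F))
    head = M.trans (EE-commutator true _ _) (H-cong true (pointwise λ j → P.*-congˡ (≋-reflexive (at-⟦⟧ F j))))

-- Isolating one degree of the leading term.

module Extraction where

  open import Defs using (ℂ; Poly; LinearForm; linear; const; rat; 0ℂ; 1ℂ; component)
  open Polynomials
  open Components
  open Convergence
  open Matrices
  open Gadgets
  open Balancing using (power)
  open Alternating using (alt; when; alt-cong)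
  open Sequences
  open import Data.Nat as ℕ using (ℕ; zero; suc; _≤_)
  import Data.Nat.Properties as ℕₚ
  open import Data.Bool using (Bool; true; false; not; if_then_else_)
  import Data.Bool.Properties as Boolₚ
  open import Data.Rational using (1/_)
  open import Data.List using (List; []; _∷_; map; length; filter)
  import Data.List.Properties as Listₚ
  open import Data.List.Relation.Unary.All using (All; []; _∷_)
  open import Data.Product using (∃; _×_; _,_; proj₁; proj₂)
  open import Relation.Nullary using (does)
  open import Relation.Binary.PropositionalEquality as ≡ using (_≡_; refl; cong)
  open import Algebra.Bundles using (CommutativeRing)

  private
    module P = CommutativeRing Poly-ring
    module S = CommutativeRing Seq-ring
  open TwoByTwo Seq-ring
  open Words Matrix-ring letters εᴹ renaming (power to powerᴹ)
  open import Algebra.Properties.Semiring.Exp P.semiring using (_^_; ^-congˡ; ^-assocʳ)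
  open import Algebra.Properties.CommutativeSemiring.Exp P.commutativeSemiring using (^-distrib-*)

  -- The column reached from row `π` by d off-diagonal steps; in that column the part of degree d of
  -- a word is found.
  flips : ℕ → Bool → Bool
  flips zero    π = π
  flips (suc d) π = flips d (not π)

  Forms : Set
  Forms = List (Bool × LinearForm)

  polys : Forms → List (Bool × Poly)
  polys = map (λ (b , ℓ) → b , linear ℓ)

  formsAt : ℕ → List Letter → Forms
  formsAt j = map (λ (letter b p ℓ) → b , scales (rat (inv j)) p ℓ)

  component-scalar : ∀ d π σ j → component (suc d) (at (scalar S.1# π σ) j) ≡ []
  component-scalar d true  true  j = refl
  component-scalar d true  false j = refl
  component-scalar d false true  j = refl
  component-scalar d false false j = refl

  entry-letter : ∀ j b p ℓ → at (entryOf (letter b p ℓ)) j ≋ linear (scales (rat (inv j)) p ℓ)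
  entry-letter j b p ℓ = ≋-trans (P.*-congʳ (at-power ε p j)) (≋-sym (linear-scales (rat (inv j)) p ℓ))

  -- Expanding the product of the factors 1 + E selects a subsequence of the letters. Its product
  -- vanishes unless the sides alternate, and d alternating letters lead from row `π` to column
  -- `flips d π`; each letter is linear, so d is also the degree.
  component-word : ∀ j w d π → component d (at (⟦ w ⟧ π (flips d π)) j) ≋ alt π d (polys (formsAt j w))
  component-word j []                 zero    true  = ≋-refl
  component-word j []                 zero    false = ≋-refl
  component-word j []                 (suc d) π     = ≋-reflexive (component-scalar d π (flips d (not π)) j)
  component-word j (letter b p ℓ ∷ w) d       π     = ≋-trans
    (component-cong d (same (elementary-row b (entryOf (letter b p ℓ)) ⟦ w ⟧ π (flips d π)) j))
    (≋-trans (component-+ d (at (if does (b Boolₚ.≟ π) then entryOf (letter b p ℓ) *ˢ ⟦ w ⟧ (not π) (flips d π) else constant []) j) _)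
      (step d (component-word j w d π)))
    where
    ℓ′ = scales (rat (inv j)) p ℓ
    drop : ∀ t (x : Sequence) → component 0 (at (if t then entryOf (letter b p ℓ) *ˢ x else constant []) j) ≋ []
    drop true  x = ≋-trans (component-cong 0 (P.*-congʳ (entry-letter j b p ℓ))) (component-linear-*-0 ℓ′ (at x j))
    drop false x = ≋-refl
    take : ∀ d t (x : Sequence) {q} → component d (at x j) ≋ q →
           component (suc d) (at (if t then entryOf (letter b p ℓ) *ˢ x else constant []) j) ≋ when t (linear ℓ′ * q)
    take d true  x e = ≋-trans (component-cong (suc d) (P.*-congʳ (entry-letter j b p ℓ)))
      (≋-trans (component-linear-* d ℓ′ (at x j)) (P.*-congˡ e))
    take d false x e = ≋-refl
    step : ∀ d → component d (at (⟦ w ⟧ π (flips d π)) j) ≋ alt π d (polys (formsAt j w)) →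
           component d (at (if does (b Boolₚ.≟ π) then entryOf (letter b p ℓ) *ˢ ⟦ w ⟧ (not π) (flips d π) else constant []) j)
             + component d (at (⟦ w ⟧ π (flips d π)) j) ≋ alt π d (polys (formsAt j (letter b p ℓ ∷ w)))
    step zero    e = ≋-trans (+-cong (drop (does (b Boolₚ.≟ π)) (⟦ w ⟧ (not π) π)) e) (P.+-identityˡ _)
    step (suc d) e = +-cong (take d (does (b Boolₚ.≟ π)) (⟦ w ⟧ (not π) (flips d (not π))) (component-word j w d (not π))) e

  alt-scale : ∀ π d t w → alt π d (map (λ (b , p) → b , t * p) w) ≋ t ^ d * alt π d w
  alt-scale π zero    t w             = ≋-sym (P.*-identityˡ _)
  alt-scale π (suc d) t []            = ≋-sym (P.zeroʳ _)
  alt-scale π (suc d) t ((b , p) ∷ w) = ≋-trans (+-cong (head (does (b Boolₚ.≟ π))) (alt-scale π (suc d) t w)) (≋-sym (P.distribˡ _ _ _))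
    where
    open import Algebra.Properties.CommutativeSemigroup P.*-commutativeSemigroup using () renaming (interchange to exchange)
    head : ∀ c → when c (t * p * alt (not π) d (map (λ (b , p) → b , t * p) w)) ≋ t ^ suc d * when c (p * alt (not π) d w)
    head true  = ≋-trans (P.*-congˡ (alt-scale (not π) d t w)) (exchange t p (t ^ d) _)
    head false = ≋-sym (P.zeroʳ _)

  ⇝-component : ∀ {g p} d → g ⇝ p → (λ j → component d (g j)) ⇝ component d p
  ⇝-component d (via F a l) = via (filter (λ T → length (Term.word T) ℕ.≟ d) F)
    (λ j → ≋-trans (≋-reflexive (commute (λ T → Term.at T j) F)) (component-cong d (a j)))
    (≋-trans (≋-reflexive (commute Term.lim F)) (component-cong d l))
    where
    commute : ∀ (c : Term → ℂ) F → map (λ T → c T , Term.word T) (filter (λ T → length (Term.word T) ℕ.≟ d) F) ≡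
              component d (map (λ T → c T , Term.word T) F)
    commute c []      = refl
    commute c (T ∷ F) with does (length (Term.word T) ℕ.≟ d)
    ... | true  = cong (_ ∷_) (commute c F)
    ... | false = commute c F

  scaleForms : ℂ → ℕ → Forms → Forms
  scaleForms c n = map (λ (b , ℓ) → b , scales c n ℓ)

  polys-scale : ∀ π d c n fs → alt π d (polys (scaleForms c n fs)) ≋ (const c ^ n) ^ d * alt π d (polys fs)
  polys-scale π d c n fs = ≋-trans (≋-reflexive (cong (alt π d) (≡.sym (Listₚ.map-∘ fs))))
    (≋-trans (alt-cong π d _ (λ (b , ℓ) → b , const c ^ n * linear ℓ) fs (λ (b , ℓ) → refl , linear-scales c n ℓ))
      (≋-trans (≋-reflexive (cong (alt π d) (Listₚ.map-∘ fs))) (alt-scale π d (const c ^ n) (polys fs))))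

  -- The word is taken at an exponent that is a multiple of d, so that rescaling its letters
  -- multiplies the homogeneous part of degree d by exactly the inverse of the leading power of ε.
  extract : ∀ {X n} → Realizable X n → ∀ π d {f} → (∀ j → at (X π (flips (suc d) π)) j ≋ f) →
            ∃ λ (fs : ℕ → Forms) → (∀ j → length (fs j) ≤ n) ×
              (λ j → alt π (suc d) (polys (fs j))) ⇝ component (suc d) f
  extract {X} {n} r π d {f} X≋f =
      (λ j → scaleForms (rat (1/ inv j)) (suc T) (formsAt j word))
    , (λ j → ℕₚ.≤-trans (ℕₚ.≤-reflexive (≡.trans (Listₚ.length-map _ (formsAt j word)) (Listₚ.length-map _ word))) short)
    , ⇝-resp (λ j → ≋-sym (expansion j)) limit-value
        (⇝-+ (⇝-const (component (suc d) f)) (⇝-* (Sequence.converges ε) (⇝-component (suc d) (Sequence.converges N))))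
    where
    T = threshold r
    -- Then p ≥ T and `suc p` = `suc d` · `suc T`: the degree is `suc d`, and each letter is
    -- rescaled by the power `suc T` of 1/ε.
    p = T ℕ.+ d ℕ.* suc T
    open Realizes (realizes r p (ℕₚ.m≤m+n T _))
    σ = flips (suc d) π
    N = proj₁ leads π σ
    entryAt : ∀ j → at (⟦ word ⟧ π σ) j ≋ at (scalar S.1# π σ) j + small j ^ suc p * (f + small j * at N j)
    entryAt j = ≋-trans (same (entry expand π σ) j) (P.+-congˡ
      (≋-trans (same (entry (power-scalar (suc p) leading) π σ) j) (≋-trans (same (scalar-*ˡ (power Seq-ring ε (suc p)) leading π σ) j)
        (*-cong (at-power ε (suc p) j) (≋-trans (same (entry (proj₂ leads) π σ) j)
          (+-cong (X≋f j) (same (scalar-*ˡ ε (proj₁ leads) π σ) j)))))))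
    pow : ∀ j → component (suc d) (small j ^ suc p * (f + small j * at N j)) ≋
                small j ^ suc p * (component (suc d) f + small j * component (suc d) (at N j))
    pow j = ≋-trans (go (suc p) _) (P.*-congˡ (≋-trans (component-+ (suc d) f (small j * at N j)) (P.+-congˡ (component-const-* (suc d) _ (at N j)))))
      where
      go : ∀ k q → component (suc d) (small j ^ k * q) ≋ small j ^ k * component (suc d) q
      go zero    q = component-const-* (suc d) 1ℂ q
      go (suc k) q = ≋-trans (component-cong (suc d) (*-assoc (small j) (small j ^ k) q))
        (≋-trans (component-const-* (suc d) _ (small j ^ k * q)) (≋-trans (P.*-congˡ (go k q)) (≋-sym (*-assoc (small j) (small j ^ k) _))))
    altAt : ∀ j → alt π (suc d) (polys (formsAt j word)) ≋
                  small j ^ suc p * (component (suc d) f + small j * component (suc d) (at N j))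
    altAt j = ≋-trans (≋-sym (component-word j word (suc d) π)) (≋-trans (component-cong (suc d) (entryAt j))
      (≋-trans (component-+ (suc d) (at (scalar S.1# π σ) j) _)
        (≋-trans (+-cong (≋-reflexive (component-scalar d π σ j)) (pow j)) (P.+-identityˡ _))))
    powers-cancel : ∀ j → (large j ^ suc T) ^ suc d * small j ^ suc p ≋ const 1ℂ
    powers-cancel j = ≋-trans (P.*-congʳ (≋-trans (^-assocʳ (large j) (suc T) (suc d)) (≋-reflexive (cong (large j ^_) (ℕₚ.*-comm (suc T) (suc d))))))
      (≋-trans (≋-sym (^-distrib-* (large j) (small j) (suc p)))
        (≋-trans (^-congˡ (suc p) (large*small j)) (one (suc p))))
      where
      one : ∀ k → const 1ℂ ^ k ≋ const 1ℂ
      one zero    = ≋-refl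
      one (suc k) = ≋-trans (P.*-identityˡ _) (one k)
    expansion : ∀ j → alt π (suc d) (polys (scaleForms (rat (1/ inv j)) (suc T) (formsAt j word))) ≋
                      component (suc d) f + small j * component (suc d) (at N j)
    expansion j = ≋-trans (polys-scale π (suc d) (rat (1/ inv j)) (suc T) (formsAt j word))
      (≋-trans (P.*-congˡ (altAt j)) (≋-trans (≋-sym (*-assoc _ _ _))
        (≋-trans (P.*-congʳ (powers-cancel j)) (P.*-identityˡ _))))
    limit-value : component (suc d) f + const 0ℂ * component (suc d) (Sequence.end N) ≋ component (suc d) f
    limit-value = ≋-trans (P.+-congˡ (≋-trans (P.*-congʳ const-0) (P.zeroˡ _))) (P.+-identityʳ _)

-- From alternating words to linear images of C.

module Reduction where

  open import Defs hiding (interchange)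
  open Reals using (_≃_; ≃-refl; ≃-sym; ≃-trans; ≈ᶜ⇒≃; ≃-stable; ℂ-ring; Limit; limit; limit⇒⟶ᶜ; Nearᶜ; nearᶜ-resp; nearᶜ-mono; nearᶜ-halves; _<′_; half-pos²; limit-resp; limit-const)
  open Sums
  open Polynomials
  open Components
  open Convergence
  open Alternating
  open Sequences using (inv; inv-small)
  open Extraction using (Forms; polys)
  open import Data.Nat as ℕ using (ℕ; zero; suc; _≤_; _<_; _<?_; z≤n; s≤s)
  import Data.Nat.Properties as ℕₚ
  open import Data.Integer using (+<+)
  open import Data.Rational using (0ℚ; *<*)
  import Data.Rational.Properties as ℚₚ
  open import Data.Bool using (Bool; true; false; not; if_then_else_)
  import Data.Bool.Properties as Boolₚ
  open import Data.Fin as Fin using (Fin; toℕ; fromℕ<)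
  import Data.Fin.Properties as Finₚ
  open import Data.List using (List; []; _∷_; map; length; upTo; tabulate)
  import Data.List.Properties as Listₚ
  open import Data.List.Membership.Propositional using (_∈_)
  open import Data.List.Membership.Propositional.Properties using (∈-upTo⁺; ∈-upTo⁻; ∈-map⁻)
  open import Data.List.Relation.Unary.All as All using (All; []; _∷_)
  import Data.List.Relation.Unary.All.Properties as Allₚ
  open import Data.List.Relation.Binary.Permutation.Propositional using (↭-sym)
  open import Data.List.Relation.Binary.Permutation.Propositional.Properties using (All-resp-↭)
  open import Data.Product using (∃; Σ; _×_; _,_; proj₁; proj₂)
  open import Function using (_∘_)
  open import Relation.Nullary using (¬_; Dec; yes; no; does; contradiction)
  open import Relation.Nullary.Decidable using (dec-true; dec-false)
  open import Relation.Binary.PropositionalEquality as ≡ using (_≡_; refl; cong; cong₂; subst)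
  open import Algebra.Bundles using (CommutativeRing)

  private
    module K = CommutativeRing ℂ-ring
    module P = CommutativeRing Poly-ring
  open RingSums ℂ-ring

  pullback-def : ∀ {a b} q (A : Fin b → Fin a → ℂ) → Σ (ℕ → Poly) λ s → (pullback q A ≡ q ⟨ s ⟩)
    × (∀ j (j<b : j < b) → s j ≡ linear (tabulate λ i → A (fromℕ< j<b) i , toℕ i))
    × (∀ j → ¬ (j < b) → s j ≡ [])
  pullback-def {a} {b} q A = image , solved , inside , outside
    where
    image : ℕ → Poly
    image = _
    -- Solves for the substitution that is local to pullback and cannot be named.
    solved : pullback q A ≡ q ⟨ image ⟩
    solved = refl
    inside : ∀ j (j<b : j < b) → image j ≡ linear (tabulate λ i → A (fromℕ< j<b) i , toℕ i)
    inside j j<b with j <? b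
    ... | yes _   = refl
    ... | no  j≮b = contradiction j<b j≮b
    outside : ∀ j → ¬ (j < b) → image j ≡ []
    outside j j≮b with j <? b
    ... | yes j<b = contradiction j<b j≮b
    ... | no  _   = refl

  coefficient : ℕ → LinearForm → ℂ
  coefficient i ℓ = ∑ ℓ λ t → if does (proj₂ t ℕ.≟ i) then proj₁ t else 0ℂ

  -- A matrix with `a` columns only produces forms in the first `a` variables. This substitution has
  -- the same effect on whole polynomials and leaves the coefficients of monomials in those
  -- variables unchanged.
  restriction : ℕ → ℕ → Poly
  restriction a i = if does (i <? a) then var i else []

  tabulate-range : ∀ (g : ℕ → ℂ) φ o a → eval φ (linear (tabulate {n = a} λ i → g (o ℕ.+ toℕ i) , o ℕ.+ toℕ i)) ≃
                                     ∑ (range o a) (λ i → g i K.* φ (i ∷ []))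
  tabulate-range g φ o zero    = ≃-refl
  tabulate-range g φ o (suc a) = K.+-cong (K.reflexive (cong (λ i → g i K.* φ (i ∷ [])) (ℕₚ.+-identityʳ o)))
    (≃-trans (K.reflexive (cong (λ ℓ → eval φ (linear ℓ)) (Listₚ.tabulate-cong {n = a} λ i → cong (λ k → g k , k) (ℕₚ.+-suc o (toℕ i)))))
      (tabulate-range g φ (suc o) a))

  pick-outside : ∀ x k (ψ : ℕ → ℂ) o r → (∀ i → o ≤ i → i < o ℕ.+ r → ¬ (k ≡ i)) →
                 ∑ (range o r) (λ i → (if does (k ℕ.≟ i) then x else 0ℂ) K.* ψ i) ≃ 0ℂ
  pick-outside x k ψ o zero    out = ≃-refl
  pick-outside x k ψ o (suc r) out rewrite dec-false (k ℕ.≟ o) (out o ℕₚ.≤-refl (ℕₚ.m<m+n o (s≤s z≤n))) =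
    ≃-trans (K.+-cong (K.zeroˡ (ψ o)) (pick-outside x k ψ (suc o) r λ i lo hi → out i (ℕₚ.<⇒≤ lo) (ℕₚ.≤-trans hi (ℕₚ.≤-reflexive (≡.sym (ℕₚ.+-suc o r))))))
      (K.+-identityˡ 0ℂ)

  pick-inside : ∀ x k (ψ : ℕ → ℂ) o r → o ≤ k → k < o ℕ.+ r →
                ∑ (range o r) (λ i → (if does (k ℕ.≟ i) then x else 0ℂ) K.* ψ i) ≃ x K.* ψ k
  pick-inside x k ψ o zero    lo hi = contradiction (ℕₚ.≤-trans hi (ℕₚ.≤-reflexive (ℕₚ.+-identityʳ o))) (ℕₚ.≤⇒≯ lo)
  pick-inside x k ψ o (suc r) lo hi with k ℕ.≟ o
  ... | yes refl rewrite dec-true (k ℕ.≟ k) refl = ≃-trans (K.+-congˡ (pick-outside x k ψ (suc k) r λ i k<i _ k≡i → ℕₚ.<-irrefl k≡i k<i)) (K.+-identityʳ _)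
  ... | no  k≢o rewrite dec-false (k ℕ.≟ o) k≢o = ≃-trans (K.+-cong (K.zeroˡ (ψ o)) (pick-inside x k ψ (suc o) r (ℕₚ.≤∧≢⇒< lo (λ e → k≢o (≡.sym e))) (ℕₚ.≤-trans hi (ℕₚ.≤-reflexive (ℕₚ.+-suc o r)))))
                          (K.+-identityˡ _)

  restrict-linear : ∀ a ℓ → linear (tabulate {n = a} λ i → coefficient (toℕ i) ℓ , toℕ i) ≋ linear ℓ ⟨ restriction a ⟩
  restrict-linear a ℓ = mk≋ λ φ inv → ≃-trans (tabulate-range (λ i → coefficient i ℓ) φ 0 a)
    (≃-trans (go φ ℓ) (≃-sym (eval-⟨⟩ φ (linear ℓ) (restriction a))))
    where
    go : ∀ φ ℓ → ∑ (range 0 a) (λ i → coefficient i ℓ K.* φ (i ∷ [])) ≃ eval (λ m → eval φ (mono (restriction a) m)) (linear ℓ)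
    go φ []            = ∑-zero (range 0 a) (λ i → K.zeroˡ (φ (i ∷ [])))
    go φ ((c , k) ∷ ℓ) = ≃-trans (∑-cong (range 0 a) λ i → K.distribʳ (φ (i ∷ [])) _ _)
      (≃-trans (∑-+ (range 0 a) (λ i → (if does (k ℕ.≟ i) then c else 0ℂ) K.* φ (i ∷ [])) _) (K.+-cong term (go φ ℓ)))
      where
      unit : ∀ p → eval φ (p * const 1ℂ) ≃ eval φ p
      unit p = ≃-trans (eval-product φ p (const 1ℂ)) (eval-cong p λ m →
        ≃-trans (K.+-identityʳ _) (≃-trans (K.*-identityˡ _) (K.reflexive (cong φ (Listₚ.++-identityʳ m)))))
      term : ∑ (range 0 a) (λ i → (if does (k ℕ.≟ i) then c else 0ℂ) K.* φ (i ∷ [])) ≃ c K.* eval φ (restriction a k * const 1ℂ)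
      term with k <? a
      ... | yes k<a rewrite dec-true (k <? a) k<a = ≃-trans (pick-inside c k (λ i → φ (i ∷ [])) 0 a z≤n k<a)
        (K.*-congˡ (≃-sym (≃-trans (unit (var k)) (≃-trans (K.+-identityʳ _) (K.*-identityˡ _)))))
      ... | no  k≮a rewrite dec-false (k <? a) k≮a = ≃-trans (pick-outside c k (λ i → φ (i ∷ [])) 0 a (λ i _ i<a k≡i → k≮a (subst (_< a) (≡.sym k≡i) i<a)))
        (≃-sym (≃-trans (K.*-congˡ (unit [])) (K.zeroʳ c)))

  mono-restriction-∈ : ∀ a w → All (_< a) w → mono (restriction a) w ≋ ((1ℂ , w) ∷ [])
  mono-restriction-∈ a []      []         = ≋-refl
  mono-restriction-∈ a (i ∷ w) (i<a ∷ w<a) rewrite dec-true (i <? a) i<a = ≋-trans (P.*-congˡ (mono-restriction-∈ a w w<a))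
    (mk≋ λ φ inv → ≃-trans (eval-product φ (var i) _) (≃-trans (K.+-identityʳ _) (K.*-identityˡ _)))

  mono-restriction-∉ : ∀ a w → ¬ All (_< a) w → mono (restriction a) w ≋ []
  mono-restriction-∉ a []      ¬all = contradiction [] ¬all
  mono-restriction-∉ a (i ∷ w) ¬all with i <? a
  ... | yes i<a rewrite dec-true (i <? a) i<a = ≋-trans (P.*-congˡ (mono-restriction-∉ a w λ w<a → ¬all (i<a ∷ w<a))) (P.zeroʳ _)
  ... | no  i≮a rewrite dec-false (i <? a) i≮a = P.zeroˡ _

  coeff-restriction : ∀ a p m → All (_< a) m → coeff (p ⟨ restriction a ⟩) m ≃ coeff p m
  coeff-restriction a p m m<a = ≃-trans (coeff≃eval (p ⟨ restriction a ⟩) m) (≃-trans (eval-⟨⟩ (δ m) p (restriction a))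
    (≃-trans (eval-cong p step) (≃-sym (coeff≃eval p m))))
    where
    step : ∀ w → eval (δ m) (mono (restriction a) w) ≃ δ m w
    step w with All.all? (_<? a) w
    ... | yes w<a = ≃-trans (evals (mono-restriction-∈ a w w<a) (δ m) (δ-invariant m)) (≃-trans (K.+-identityʳ _) (K.*-identityˡ _))
    ... | no ¬w<a = ≃-trans (evals (mono-restriction-∉ a w ¬w<a) (δ m) (δ-invariant m))
      (K.reflexive (≡.sym (δ-no λ e → ¬w<a (All-resp-↭ (↭-sym e) m<a))))

  -- In `C` the side of a variable is the parity of its index. Every letter is given two consecutive
  -- variables, of which the one with the right parity receives the form and the other is sent to
  -- zero.
  pad : Forms → List LinearForm
  pad []               = []
  pad ((true  , ℓ) ∷ w) = ℓ ∷ [] ∷ pad w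
  pad ((false , ℓ) ∷ w) = [] ∷ ℓ ∷ pad w

  pad-length : ∀ w → length (pad w) ≡ length w ℕ.+ length w
  pad-length []               = refl
  pad-length ((true  , ℓ) ∷ w) = cong suc (≡.trans (cong suc (pad-length w)) (≡.sym (ℕₚ.+-suc _ _)))
  pad-length ((false , ℓ) ∷ w) = cong suc (≡.trans (cong suc (pad-length w)) (≡.sym (ℕₚ.+-suc _ _)))

  nth : List LinearForm → ℕ → LinearForm
  nth []       k       = []
  nth (ℓ ∷ ℓs) zero    = ℓ
  nth (ℓ ∷ ℓs) (suc k) = nth ℓs k

  nth-beyond : ∀ ℓs k → length ℓs ≤ k → nth ℓs k ≡ []
  nth-beyond []       k       _        = refl
  nth-beyond (ℓ ∷ ℓs) (suc k) (s≤s le) = nth-beyond ℓs k le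

  alt-∷-cong : ∀ b {p q w v} → p ≋ q → (∀ π d → alt π d w ≋ alt π d v) → ∀ π d → alt π d ((b , p) ∷ w) ≋ alt π d ((b , q) ∷ v)
  alt-∷-cong b e f π zero    = ≋-refl
  alt-∷-cong b e f π (suc d) = +-cong (when-cong (does (b Boolₚ.≟ π)) (*-cong e (f (not π) d))) (f π (suc d))

  alt-drop : ∀ b {p w v} → p ≋ [] → (∀ π d → alt π d w ≋ alt π d v) → ∀ π d → alt π d ((b , p) ∷ w) ≋ alt π d v
  alt-drop b e f π zero    = ≋-refl
  alt-drop b {p} {w} {v} e f π (suc d) = ≋-trans (+-cong (vanish (does (b Boolₚ.≟ π))) (f π (suc d))) (P.+-identityˡ _)
    where
    vanish : ∀ t → when t (p * alt (not π) d w) ≋ []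
    vanish true  = ≋-trans (P.*-congʳ e) (P.zeroˡ _)
    vanish false = ≋-refl

  alt-pad : ∀ w i r g → odd? i ≡ false → length w ℕ.+ length w ≤ r → (∀ k → g (suc i ℕ.+ k) ≋ linear (nth (pad w) k)) →
            ∀ π d → alt π d (labelled g (range (suc i) r)) ≋ alt π d (polys w)
  alt-pad []            i zero          g e le eq π d = ≋-refl
  alt-pad []            i (suc r)       g e le eq π d = alt-drop _ (at-0 i g eq) (zeros (suc i) r {ℕₚ.≤-refl}) π d
    where
    at-0 : ∀ i (g : ℕ → Poly) → (∀ k → g (suc i ℕ.+ k) ≋ []) → g (suc i) ≋ []
    at-0 i g eq = ≋-trans (≋-reflexive (cong g (≡.sym (ℕₚ.+-identityʳ (suc i))))) (eq 0)
    zeros : ∀ j r → {le : suc i ≤ j} → ∀ π d → alt π d (labelled g (range (suc j) r)) ≋ alt π d []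
    zeros j zero    π d = ≋-refl
    zeros j (suc r) {le} π d = alt-drop _ (≋-trans (≋-reflexive (cong g (≡.sym (≡.trans (ℕₚ.+-suc (suc i) (j ℕ.∸ suc i)) (cong suc (ℕₚ.m+[n∸m]≡n le)))))) (eq (suc (j ℕ.∸ suc i))))
      (zeros (suc j) r {ℕₚ.m≤n⇒m≤1+n le}) π d
  alt-pad ((b , ℓ) ∷ w) i (suc zero)    g e (s≤s le) eq π d = contradiction (ℕₚ.≤-trans (ℕₚ.≤-reflexive (≡.sym (ℕₚ.+-suc (length w) (length w)))) le) (ℕₚ.n≮0 {length w ℕ.+ length w})
  alt-pad ((b , ℓ) ∷ w) i (suc (suc r)) g e (s≤s le) eq π d rewrite e = pair b eq
    where
    next : ∀ b → (∀ k → g (suc i ℕ.+ k) ≋ linear (nth (pad ((b , ℓ) ∷ w)) k)) →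
           ∀ π d → alt π d (labelled g (range (suc (suc (suc i))) r)) ≋ alt π d (polys w)
    next b eq = alt-pad w (suc (suc i)) r g (≡.trans (Boolₚ.not-involutive (odd? i)) e)
      (ℕₚ.≤-pred (ℕₚ.≤-trans (ℕₚ.≤-reflexive (≡.sym (ℕₚ.+-suc (length w) (length w)))) le))
      (λ k → ≋-trans (≋-reflexive (cong g (cong suc (≡.sym (≡.trans (ℕₚ.+-suc i (suc k)) (cong suc (ℕₚ.+-suc i k)))))))
        (≋-trans (eq (suc (suc k))) (≋-reflexive (cong linear (tail b k)))))
      where
      tail : ∀ b k → nth (pad ((b , ℓ) ∷ w)) (suc (suc k)) ≡ nth (pad w) k
      tail true  k = refl
      tail false k = refl
    at-0 : ∀ {q} → g (suc i ℕ.+ 0) ≋ q → g (suc i) ≋ q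
    at-0 = ≋-trans (≋-reflexive (cong g (≡.sym (ℕₚ.+-identityʳ (suc i)))))
    at-1 : ∀ {q} → g (suc i ℕ.+ 1) ≋ q → g (suc (suc i)) ≋ q
    at-1 = ≋-trans (≋-reflexive (cong g (ℕₚ.+-comm 1 (suc i))))
    pair : ∀ b → (∀ k → g (suc i ℕ.+ k) ≋ linear (nth (pad ((b , ℓ) ∷ w)) k)) →
           alt π d ((true , g (suc i)) ∷ (false , g (suc (suc i))) ∷ labelled g (range (suc (suc (suc i))) r)) ≋
           alt π d ((b , linear ℓ) ∷ polys w)
    pair true  eq = alt-∷-cong true {w = (false , g (suc (suc i))) ∷ labelled g (range (suc (suc (suc i))) r)} (at-0 (eq 0)) (alt-drop false (at-1 (eq 1)) (next true eq)) π d
    pair false eq = alt-drop true {w = (false , g (suc (suc i))) ∷ labelled g (range (suc (suc (suc i))) r)} (at-0 (eq 0)) (alt-∷-cong false (at-1 (eq 1)) (next false eq)) π d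

  pullback-forms : ∀ a N d (w : Forms) → length w ℕ.+ length w ≤ N → ∃ λ (A : Fin (suc N) → Fin a → ℂ) →
    ∀ m → All (_< a) m → coeff (pullback (GradedPFamily.poly C N d) A) m ≃ coeff (alt true d (polys w)) m
  pullback-forms a N d w le = A , λ m m<a → ≃-trans (≋⇒≃ pulled m) (coeff-restriction a (alt true d (polys w)) m m<a)
    where
    -- The variables of `C` have the indices 1, ..., N, so the matrix has N + 1 rows and row 0 is
    -- filled with zeros.
    s : ℕ → LinearForm
    s zero    = []
    s (suc k) = nth (pad w) k
    A : Fin (suc N) → Fin a → ℂ
    A k i = coefficient (toℕ i) (s (toℕ k))
    D = pullback-def (GradedPFamily.poly C N d) A
    image = proj₁ D
    image-restricted : ∀ j → image j ≋ linear (s j) ⟨ restriction a ⟩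
    image-restricted j = decide (j <? suc N)
      where
      decide : Dec (j < suc N) → image j ≋ linear (s j) ⟨ restriction a ⟩
      decide (yes j<b) = ≋-trans (≋-reflexive (≡.trans (proj₁ (proj₂ (proj₂ D)) j j<b)
          (cong (λ k → linear (tabulate {n = a} λ i → coefficient (toℕ i) (s k) , toℕ i)) (Finₚ.toℕ-fromℕ< j<b))))
        (restrict-linear a (s j))
      decide (no j≮b) = ≋-trans (≋-reflexive (proj₂ (proj₂ (proj₂ D)) j j≮b)) (vanish j (ℕₚ.≮⇒≥ j≮b))
        where
        vanish : ∀ j → suc N ≤ j → [] ≋ linear (s j) ⟨ restriction a ⟩
        vanish (suc k) (s≤s N≤k) rewrite nth-beyond (pad w) k (ℕₚ.≤-trans (ℕₚ.≤-reflexive (pad-length w)) (ℕₚ.≤-trans le N≤k)) = ≋-refl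
    open import Relation.Binary.Reasoning.Setoid ≋-setoid
    pulled : pullback (GradedPFamily.poly C N d) A ≋ alt true d (polys w) ⟨ restriction a ⟩
    pulled = begin
      pullback (GradedPFamily.poly C N d) A
        ≈⟨ ≋-reflexive (proj₁ (proj₂ D)) ⟩
      GradedPFamily.poly C N d ⟨ image ⟩
        ≈⟨ C-alt N d image ⟩
      alt true d (labelled image (range 1 N))
        ≈⟨ alt-cong true d _ _ (range 1 N) (λ x → refl , image-restricted x) ⟩
      alt true d (map (λ x → odd? x , linear (s x) ⟨ restriction a ⟩) (range 1 N))
        ≈⟨ ≋-reflexive (cong (alt true d) (Listₚ.map-∘ (range 1 N))) ⟩
      alt true d (map (λ (b , p) → b , p ⟨ restriction a ⟩) (labelled (linear ∘ s) (range 1 N)))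
        ≈⟨ alt-⟨⟩ true d (labelled (linear ∘ s) (range 1 N)) (restriction a) ⟨
      alt true d (labelled (linear ∘ s) (range 1 N)) ⟨ restriction a ⟩
        ≈⟨ ⟨⟩-cong (alt-pad w 0 N (linear ∘ s) refl le (λ k → ≋-refl) true d) (λ _ → ≋-refl) ⟩
      alt true d (polys w) ⟨ restriction a ⟩ ∎

  -- Membership in a closure, stated by precisions: one triangle inequality then shows that a limit
  -- of reachable polynomials is reachable, with no diagonal sequence to choose. Precision is
  -- demanded for monomials in the first `a` variables; both sides vanish on the others once
  -- supports are known.
  record Reachable (a N d : ℕ) (p : Poly) : Set where
    field
      approximant : ∀ {ε} → 0ℚ <′ ε → ∃ λ (A : Fin (suc N) → Fin a → ℂ) →
        ∀ m → All (_< a) m → Nearᶜ ε (coeff (pullback (GradedPFamily.poly C N d) A) m) (coeff p m)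

  open Reachable

  reachable-limit : ∀ {a N d g p} → (∀ j → Reachable a N d (g j)) → g ⇝ p → Reachable a N d p
  approximant (reachable-limit {a} {N} {d} {g} {p} reach g⇝p) {ε} 0<ε = A , λ m m<a → nearᶜ-halves (approx m m<a) (proj₂ tail J ℕₚ.≤-refl m)
    where
    tail = ⇝-uniform g⇝p (half-pos 0<ε)
    J = proj₁ tail
    A = proj₁ (approximant (reach J) (half-pos 0<ε))
    approx = proj₂ (approximant (reach J) (half-pos 0<ε))

  reachable-resp : ∀ {a N d p q} → p ≋ q → Reachable a N d p → Reachable a N d q
  approximant (reachable-resp e reach) 0<ε = let A , h = approximant reach (half-pos² 0<ε) in
    A , λ m m<a → nearᶜ-resp ≃-refl (≋⇒≃ e m) 0<ε (h m m<a)

  reachable-forms : ∀ a {N n d p} (fs : ℕ → Forms) → (∀ j → length (fs j) ≤ n) → n ℕ.+ n ≤ N →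
                    (λ j → alt true d (polys (fs j))) ⇝ p → Reachable a N d p
  approximant (reachable-forms a {N} {n} {d} {p} fs short n+n≤N conv) {ε} 0<ε = A , λ m m<a →
    nearᶜ-resp (≃-sym (pulled m m<a)) ≃-refl 0<ε (proj₂ tail J ℕₚ.≤-refl m)
    where
    tail = ⇝-uniform conv (half-pos² 0<ε)
    J = proj₁ tail
    P = pullback-forms a N d (fs J) (ℕₚ.≤-trans (ℕₚ.+-mono-≤ (short J) (short J)) n+n≤N)
    A = proj₁ P
    pulled = proj₂ P

  sumᵖ-terms : ∀ {Q : Monomial → Set} {X : Set} (f : X → Poly) xs → All (λ x → AllTerms Q (f x)) xs → AllTerms Q (sumᵖ (map f xs))
  sumᵖ-terms f []       []       = []
  sumᵖ-terms f (x ∷ xs) (a ∷ as) = Allₚ.++⁺ a (sumᵖ-terms f xs as)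

  ⟨⟩-terms : ∀ a d q s → AllTerms (λ w → length w ≡ d) q → (∀ i → AllTerms (λ m → All (_< a) m × length m ≡ 1) (s i)) →
             AllTerms (λ m → All (_< a) m × length m ≡ d) (q ⟨ s ⟩)
  ⟨⟩-terms a d q s lengths forms = sumᵖ-terms _ q (All.map (λ {t} → term t) lengths)
    where
    product : ∀ w → AllTerms (λ m → All (_< a) m × length m ≡ length w) (productᵖ (map s w))
    product []      = ([] , refl) ∷ []
    product (i ∷ w) = *-terms (λ {m} (v , l) (v′ , l′) → Allₚ.++⁺ v v′ , ≡.trans (Listₚ.length-++ m) (cong₂ ℕ._+_ l l′)) {s i} {productᵖ (map s w)} (forms i) (product w)
    term : ∀ (t : ℂ × Monomial) → length (proj₂ t) ≡ d → AllTerms (λ m → All (_< a) m × length m ≡ d) (const (proj₁ t) *ᵖ productᵖ (map s (proj₂ t)))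
    term (c , w) l = *-terms {P = λ m → m ≡ []} {R = λ m → All (_< a) m × length m ≡ d}
      (λ { refl (v , l′) → v , ≡.trans l′ l }) {const c} {productᵖ (map s w)} (refl ∷ []) (product w)

  C-terms : ∀ n d → AllTerms (λ m → length m ≡ d) (GradedPFamily.poly C n d)
  C-terms n d = +-terms _ (Allₚ.map⁺ (All.universal (λ w → product-degree _ λ j → refl ∷ []) (alternating n d)))

  pullback-supported : ∀ {a N d} (A : Fin (suc N) → Fin a → ℂ) → Supported a d (pullback (GradedPFamily.poly C N d) A)
  pullback-supported {a} {N} {d} A = supported-resp (≋-reflexive (≡.sym (proj₁ (proj₂ D))))
    (terms-supported (All.map proj₁ terms) (All.map (ℕₚ.≤-reflexive ∘ proj₂) terms))
    where
    D = pullback-def (GradedPFamily.poly C N d) A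
    image = proj₁ D
    linear-terms : ∀ {k} (f : Fin k → ℂ × ℕ) → (∀ i → proj₂ (f i) < a) → AllTerms (λ m → All (_< a) m × length m ≡ 1) (linear (tabulate f))
    linear-terms {zero}  f f<a = []
    linear-terms {suc k} f f<a = (f<a Fin.zero ∷ [] , refl) ∷ linear-terms (f ∘ Fin.suc) (f<a ∘ Fin.suc)
    image-terms : ∀ j → AllTerms (λ m → All (_< a) m × length m ≡ 1) (image j)
    image-terms j = decide (j <? suc N)
      where
      decide : Dec (j < suc N) → AllTerms (λ m → All (_< a) m × length m ≡ 1) (image j)
      decide (yes j<b) = subst (AllTerms (λ m → All (_< a) m × length m ≡ 1)) (≡.sym (proj₁ (proj₂ (proj₂ D)) j j<b))
                               (linear-terms (λ i → A (fromℕ< j<b) i , toℕ i) Finₚ.toℕ<n)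
      decide (no j≮b) = subst (AllTerms (λ m → All (_< a) m × length m ≡ 1)) (≡.sym (proj₂ (proj₂ (proj₂ D)) j j≮b)) []
    terms = ⟨⟩-terms a d (GradedPFamily.poly C N d) image (C-terms N d) image-terms

  supported-zero : ∀ {a D p} → Supported a D p → ∀ m → ¬ All (_< a) m → coeff p m ≃ 0ℂ
  supported-zero {a} {p = p} s m ¬m<a = ≃-stable λ c≄0 → ¬m<a (within λ c≈0 → c≄0 (≈ᶜ⇒≃ c≈0))
    where
    within : Occurs m p → All (_< a) m
    within occ = All.map ∈-upTo⁻ (inFirst s m occ)

  C-inFirst : ∀ N d → InFirst (suc N) (GradedPFamily.poly C N d)
  C-inFirst N d m occ = All.map rename (proj₂ (proj₂ (proj₂ (proj₂ (GradedPFamily.variables C)) N d)) m occ)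
    where
    rename : ∀ {i} → i ∈ map suc (upTo N) → i ∈ upTo (suc N)
    rename i∈ with ∈-map⁻ suc i∈
    ... | k , k∈ , refl = ∈-upTo⁺ (s≤s (∈-upTo⁻ k∈))

  inv-positive : ∀ j → 0ℚ <′ inv j
  inv-positive j = *<* (+<+ (s≤s z≤n))

  -- The approximants of precision 1/(j+1) form the sequence of matrices. A monomial with a variable
  -- beyond `a` has coefficient zero in `p` and in every pullback.
  reachable⇒⊴ : ∀ {a N d p} → Supported a (suc d) p → Reachable a N (suc d) p → p ⊴homlin[ suc d ] GradedPFamily.poly C N (suc d)
  reachable⇒⊴ {a} {N} {d} {p} s reach = a , suc N , inFirst s , C-inFirst N (suc d) , (λ j → A j)
    , ( (a , suc d , (λ j → inFirst (pulled j) , degree≤ (pulled j)) , inFirst s , degree≤ s)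
      , λ m → limit⇒⟶ᶜ (converge m (All.all? (_<? a) m)))
    where
    A : ℕ → Fin (suc N) → Fin a → ℂ
    A j = proj₁ (approximant reach (inv-positive j))
    g : ℕ → Poly
    g j = pullback (GradedPFamily.poly C N (suc d)) (A j)
    pulled : ∀ j → Supported a (suc d) (g j)
    pulled j = pullback-supported (A j)
    converge : ∀ m → Dec (All (_< a) m) → Limit (λ j → coeff (g j) m) (coeff p m)
    converge m (yes m<a) = limit λ 0<ε → let J , small = inv-small 0<ε in
      J , λ j le → nearᶜ-mono (ℚₚ.<⇒≤ (small j le)) (proj₂ (approximant reach (inv-positive j)) m m<a)
    converge m (no ¬m<a) = limit-resp (λ j → ≃-sym (supported-zero (pulled j) m ¬m<a)) (≃-sym (supported-zero s m ¬m<a)) (limit-const 0ℂ)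

-- Reachability of the components of graded formulas.

module Sources where

  open import Defs hiding (interchange; scaled)
  open Reals using (≈ᶜ⇒≃; ≃-sym; ≃-trans; 1≉0; ℂ-ring)
  open Polynomials
  open Components
  open Convergence
  open Alternating using (odd?)
  open Matrices
  open Sequences renaming (constant to constantˢ)
  open Extraction
  open Reduction
  open Balancing using (size-positive)
  open Gadgets
  open Sums
  open import Data.Nat as ℕ using (ℕ; zero; suc; _≤_; z≤n)
  import Data.Nat.Properties as ℕₚ
  open import Data.Nat.ListAction using (sum)
  open import Data.Integer using (+_)
  open import Data.Rational using (_/_)
  open import Data.Nat.Tactic.RingSolver using (solve-∀)
  open import Data.Bool using (Bool; true; false; not; _xor_; if_then_else_)
  import Data.Bool.Properties as Boolₚ
  open import Data.Fin as Fin using (Fin)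
  open import Data.List using (List; []; _∷_; _++_; foldr; tabulate; length; concat)
  import Data.List.Properties as Listₚ
  open import Data.List.Relation.Unary.All as All using (All; []; _∷_)
  import Data.List.Relation.Unary.All.Properties as Allₚ
  open import Data.Product using (_×_; _,_; proj₁; proj₂)
  open import Function using (_∘_)
  open import Relation.Nullary using (¬_)
  open import Relation.Binary.PropositionalEquality as ≡ using (_≡_; refl; cong; cong₂; subst)
  open import Algebra.Bundles using (CommutativeRing)

  private
    module P = CommutativeRing Poly-ring
    module K = CommutativeRing ℂ-ring
  open Words (TwoByTwo.Matrix-ring Seq-ring) letters εᴹ using (realizable-≤)
  open TwoByTwo Seq-ring using (E; H)

  flips-odd : ∀ d π → flips d π ≡ (if odd? d then not π else π)
  flips-odd zero    π = refl
  flips-odd (suc d) π = ≡.trans (flips-odd d (not π)) (swap (odd? d) π)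
    where
    swap : ∀ b π → (if b then not (not π) else not π) ≡ (if not b then not π else π)
    swap true  true  = refl
    swap true  false = refl
    swap false π     = refl

  pairsSize : List (LinearForm × IHL) → ℕ
  pairsSize []            = 0
  pairsSize ((ℓ , F) ∷ L) = sizeⁱ F ℕ.+ pairsSize L

  power-superadditive : ∀ x y k → x ℕ.^ suc k ℕ.+ y ℕ.^ suc k ≤ (x ℕ.+ y) ℕ.^ suc k
  power-superadditive x y k = ℕₚ.≤-trans
    (ℕₚ.+-mono-≤ (ℕₚ.*-monoʳ-≤ x (ℕₚ.^-monoˡ-≤ k (ℕₚ.m≤m+n x y))) (ℕₚ.*-monoʳ-≤ y (ℕₚ.^-monoˡ-≤ k (ℕₚ.m≤n+m y x))))
    (ℕₚ.≤-reflexive (≡.sym (ℕₚ.*-distribʳ-+ ((x ℕ.+ y) ℕ.^ k) x y)))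

  *-^ : ∀ a b k → (a ℕ.* b) ℕ.^ k ≡ a ℕ.^ k ℕ.* b ℕ.^ k
  *-^ a b zero    = refl
  *-^ a b (suc k) = ≡.trans (cong (a ℕ.* b ℕ.*_) (*-^ a b k)) (ex a b (a ℕ.^ k) (b ℕ.^ k))
    where
    ex : ∀ a b c d → a ℕ.* b ℕ.* (c ℕ.* d) ≡ a ℕ.* c ℕ.* (b ℕ.* d)
    ex = solve-∀

  -- Ninth powers are superadditive, so the bounds of the pairs can be added inside the power.
  -- Passing from the base 2s to 4s gains a factor 512, more than the factor 4 that the commutator
  -- and the leaf cost together.
  pairsLength-bound : ∀ L → pairsLength L ≤ (4 ℕ.* pairsSize L) ℕ.^ 9
  pairsLength-bound []            = z≤n
  pairsLength-bound ((ℓ , F) ∷ L) = ℕₚ.≤-trans (ℕₚ.+-mono-≤ (head (sizeⁱ F) (size-positive F)) (pairsLength-bound L))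
    (ℕₚ.≤-trans (power-superadditive (4 ℕ.* sizeⁱ F) (4 ℕ.* pairsSize L) 8) (ℕₚ.≤-reflexive (cong (ℕ._^ 9) (≡.sym (ℕₚ.*-distribˡ-+ 4 (sizeⁱ F) (pairsSize L))))))
    where
    head : ∀ s → 1 ≤ s → 2 ℕ.* (512 ℕ.+ (2 ℕ.* s) ℕ.^ 9) ≤ (4 ℕ.* s) ℕ.^ 9
    head s 1≤s = begin
      2 ℕ.* (512 ℕ.+ (2 ℕ.* s) ℕ.^ 9)                ≤⟨ ℕₚ.*-monoʳ-≤ 2 (ℕₚ.+-monoˡ-≤ ((2 ℕ.* s) ℕ.^ 9) 512≤) ⟩
      2 ℕ.* ((2 ℕ.* s) ℕ.^ 9 ℕ.+ (2 ℕ.* s) ℕ.^ 9)    ≡⟨ four ((2 ℕ.* s) ℕ.^ 9) ⟩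
      4 ℕ.* (2 ℕ.* s) ℕ.^ 9                          ≤⟨ ℕₚ.*-monoˡ-≤ ((2 ℕ.* s) ℕ.^ 9) (ℕₚ.m≤m+n 4 508) ⟩
      512 ℕ.* (2 ℕ.* s) ℕ.^ 9                        ≡⟨ *-^ 2 (2 ℕ.* s) 9 ⟨
      (2 ℕ.* (2 ℕ.* s)) ℕ.^ 9                        ≡⟨ cong (ℕ._^ 9) (≡.sym (ℕₚ.*-assoc 2 2 s)) ⟩
      (4 ℕ.* s) ℕ.^ 9                                ∎
      where
      open ℕₚ.≤-Reasoning
      512≤ : 512 ≤ (2 ℕ.* s) ℕ.^ 9
      512≤ = ℕₚ.^-monoˡ-≤ 9 {2} {2 ℕ.* s} (ℕₚ.*-monoʳ-≤ 2 1≤s)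
      four : ∀ x → 2 ℕ.* (x ℕ.+ x) ≡ 4 ℕ.* x
      four = solve-∀

  -- The estimate 4B ≤ (2 + B)³ brings the bound to the base 2 + B, under which polynomial and
  -- quasipolynomial growth are preserved; the remaining factor 2 costs one more power.
  doubledPower-bound : ∀ e B → (4 ℕ.* B) ℕ.^ e ℕ.+ (4 ℕ.* B) ℕ.^ e ≤ (2 ℕ.+ B) ℕ.^ suc (3 ℕ.* e)
  doubledPower-bound e B = begin
    (4 ℕ.* B) ℕ.^ e ℕ.+ (4 ℕ.* B) ℕ.^ e             ≤⟨ ℕₚ.+-mono-≤ (ℕₚ.^-monoˡ-≤ e 4B≤) (ℕₚ.^-monoˡ-≤ e 4B≤) ⟩
    (X ℕ.^ 3) ℕ.^ e ℕ.+ (X ℕ.^ 3) ℕ.^ e             ≡⟨ cong₂ ℕ._+_ (ℕₚ.^-*-assoc X 3 e) (≡.trans (ℕₚ.^-*-assoc X 3 e) (≡.sym (ℕₚ.+-identityʳ _))) ⟩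
    2 ℕ.* X ℕ.^ (3 ℕ.* e)                           ≤⟨ ℕₚ.*-monoˡ-≤ (X ℕ.^ (3 ℕ.* e)) (ℕₚ.m≤m+n 2 B) ⟩
    X ℕ.^ suc (3 ℕ.* e)                             ∎
    where
    open ℕₚ.≤-Reasoning
    X = 2 ℕ.+ B
    cube : ∀ x → x ℕ.* (x ℕ.* 1) ℕ.* x ≡ x ℕ.* (x ℕ.* (x ℕ.* 1))
    cube = solve-∀
    4B≤ : 4 ℕ.* B ≤ X ℕ.^ 3
    4B≤ = ℕₚ.≤-trans (ℕₚ.*-mono-≤ (ℕₚ.^-monoˡ-≤ 2 (ℕₚ.m≤m+n 2 B)) (ℕₚ.m≤n+m B 2)) (ℕₚ.≤-reflexive (cube X))

  -- Opaque, because otherwise the type checker expands powers with a literal exponent.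
  opaque
    lengthExponent : ℕ
    lengthExponent = 9

    lengthExponent-def : lengthExponent ≡ 9
    lengthExponent-def = refl

  -- Twice a word length, because `pad` spends two variables on each letter.
  reachLength : ℕ → ℕ
  reachLength B = (4 ℕ.* B) ℕ.^ lengthExponent ℕ.+ (4 ℕ.* B) ℕ.^ lengthExponent

  reachExponent : ℕ
  reachExponent = suc (3 ℕ.* lengthExponent)

  reachLength-bound : ∀ B → reachLength B ≤ (2 ℕ.+ B) ℕ.^ reachExponent
  reachLength-bound = doubledPower-bound lengthExponent

  reachLength-⊇ : ∀ {N} B → reachLength B ≤ N → (4 ℕ.* B) ℕ.^ 9 ℕ.+ (4 ℕ.* B) ℕ.^ 9 ≤ N
  reachLength-⊇ {N} B = subst (λ e → (4 ℕ.* B) ℕ.^ e ℕ.+ (4 ℕ.* B) ℕ.^ e ≤ N) lengthExponent-def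

  -- An odd number of flips leads from row `true` to column `false`, where `E true` has its entry.
  -- For even degrees the path returns to the corner in which `H true` has its entry with sign +.
  reachable-odd : ∀ a {B N} d F → odd? (suc d) ≡ true → sizeⁱ F ≤ B → reachLength B ≤ N →
                  Reachable a N (suc d) (component (suc d) (valueⁱ F))
  reachable-odd a {B} d F odd size≤ len≤ =
    let fs , short , conv = extract (realizable-≤ bound (realizable-odd F)) true d {valueⁱ F} entry
    in reachable-forms a {d = suc d} {component (suc d) (valueⁱ F)} fs short (reachLength-⊇ B len≤) conv
    where
    bound : (2 ℕ.* sizeⁱ F) ℕ.^ 9 ≤ (4 ℕ.* B) ℕ.^ 9
    bound = ℕₚ.^-monoˡ-≤ 9 (ℕₚ.*-mono-≤ (ℕₚ.m≤m+n 2 2) size≤)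
    entry : ∀ j → at (E true (constantˢ (valueⁱ F)) true (flips (suc d) true)) j ≋ valueⁱ F
    entry j rewrite flips-odd (suc d) true | odd = ≋-refl

  reachable-even : ∀ a {B N} d L → odd? (suc d) ≡ false → pairsSize L ≤ B → reachLength B ≤ N →
                   Reachable a N (suc d) (component (suc d) (pairsValue L))
  reachable-even a {B} d L even size≤ len≤ =
    let fs , short , conv = extract (realizable-≤ bound (realizable-even L)) true d {pairsValue L} entry
    in reachable-forms a {d = suc d} {component (suc d) (pairsValue L)} fs short (reachLength-⊇ B len≤) conv
    where
    bound : pairsLength L ≤ (4 ℕ.* B) ℕ.^ 9
    bound = ℕₚ.≤-trans (pairsLength-bound L) (ℕₚ.^-monoˡ-≤ 9 (ℕₚ.*-monoʳ-≤ 4 size≤))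
    entry : ∀ j → at (H true (constantˢ (pairsValue L)) true (flips (suc d) true)) j ≋ pairsValue L
    entry j rewrite flips-odd (suc d) true | even = ≋-refl

  C-0 : ∀ N → ¬ (GradedPFamily.poly C N 0 ≈ [])
  C-0 N C≈0 = 1≉0 (≃-trans (≃-sym (≃-trans (coeff≃eval (const 1ℂ) []) (≃-trans (K.+-identityʳ _) (K.*-identityʳ 1ℂ)))) (≈ᶜ⇒≃ (C≈0 [])))

  sumIHL : List IHL → IHL
  sumIHL = foldr add (leaf [])

  valueⁱ-sum : ∀ {k} (f : Fin k → IHL) → valueⁱ (sumIHL (tabulate f)) ≡ sumᵖ (tabulate (valueⁱ ∘ f))
  valueⁱ-sum {zero}  f = refl
  valueⁱ-sum {suc k} f = cong (valueⁱ (f Fin.zero) +ᵖ_) (valueⁱ-sum (f ∘ Fin.suc))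

  sizeⁱ-sum : ∀ {k} (f : Fin k → IHL) → sizeⁱ (sumIHL (tabulate f)) ≡ 1 ℕ.+ sum (tabulate λ i → 1 ℕ.+ sizeⁱ (f i))
  sizeⁱ-sum {zero}  f = refl
  sizeⁱ-sum {suc k} f = cong suc (≡.trans (cong (sizeⁱ (f Fin.zero) ℕ.+_) (sizeⁱ-sum (f ∘ Fin.suc))) (ℕₚ.+-suc _ _))

  odd?-+ : ∀ m n → odd? (m ℕ.+ n) ≡ (odd? m xor odd? n)
  odd?-+ zero    n = refl
  odd?-+ (suc m) n = ≡.trans (cong not (odd?-+ m n)) (Boolₚ.not-distribˡ-xor (odd? m) (odd? n))

  Parity : Bool → Monomial → Set
  Parity b m = odd? (length m) ≡ b

  parity-++ : ∀ {b c m m′} → Parity b m → Parity c m′ → Parity (b xor c) (m ++ m′)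
  parity-++ {m = m} {m′} p q = ≡.trans (cong odd? (Listₚ.length-++ m)) (≡.trans (odd?-+ (length m) (length m′)) (cong₂ _xor_ p q))

  linear-parity : ∀ ℓ → AllTerms (Parity true) (linear ℓ)
  linear-parity []      = []
  linear-parity (_ ∷ ℓ) = refl ∷ linear-parity ℓ

  -- Leaves have degree 1, and a product gate adds three odd degrees. This separates the odd part of
  -- a graded formula from its even part by degree alone.
  valueⁱ-parity : ∀ F → AllTerms (Parity true) (valueⁱ F)
  valueⁱ-parity (leaf ℓ)     = linear-parity ℓ
  valueⁱ-parity (add F G)    = Allₚ.++⁺ (valueⁱ-parity F) (valueⁱ-parity G)
  valueⁱ-parity (mul₃ F G H) = *-terms (λ {m} {m′} → parity-++ {m = m} {m′}) {valueⁱ F *ᵖ valueⁱ G} {valueⁱ H}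
    (*-terms (λ {m} {m′} → parity-++ {m = m} {m′}) {valueⁱ F} {valueⁱ G} (valueⁱ-parity F) (valueⁱ-parity G)) (valueⁱ-parity H)

  sumᵖ-tabulate : ∀ {Q k} (f : Fin k → Poly) → (∀ i → AllTerms Q (f i)) → AllTerms Q (sumᵖ (tabulate f))
  sumᵖ-tabulate {k = zero}  f h = []
  sumᵖ-tabulate {k = suc k} f h = Allₚ.++⁺ (h Fin.zero) (sumᵖ-tabulate (f ∘ Fin.suc) (h ∘ Fin.suc))

  component-parity : ∀ {b d} p → AllTerms (Parity b) p → odd? d ≡ not b → component d p ≡ []
  component-parity {b} {d} p h e = component-none (All.map (λ {t} → differ {t}) h)
    where
    differ : ∀ {t : ℂ × Monomial} → Parity b (proj₂ t) → ¬ (length (proj₂ t) ≡ d)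
    differ p l = Boolₚ.not-¬ {b} refl (≡.trans (≡.trans (≡.sym p) (cong odd? l)) e)

  +ᵖ-≋ : ∀ p q → p +ᵖ q ≋ p + q
  +ᵖ-≋ p q = ≋-reflexive (+-def p q)

  component-+ᵖ : ∀ d p q → component d (p +ᵖ q) ≋ component d p + component d q
  component-+ᵖ d p q = ≋-trans (component-cong d {p +ᵖ q} {p + q} (+ᵖ-≋ p q)) (component-+ d p q)

  module _ (F : GradedIHL) where
    open GradedIHL F

    evenPartOf : ∀ {k} → (Fin k → ℂ) → (Fin k → Fin m → IHL) → Poly
    evenPartOf c G = sumᵖ (tabulate λ k → const (c k) *ᵖ sumᵖ (tabulate λ i → var (x i) *ᵖ valueⁱ (G k i)))

    oddPart evenPart : Poly
    oddPart  = sumᵖ (tabulate λ k → valueⁱ (odd k))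
    evenPart = sumᵖ (tabulate λ k → const (rat (+ 1 / evenDegree k)) *ᵖ sumᵖ (tabulate λ i → var (x i) *ᵖ valueⁱ (even k i)))

    oddPart-parity : AllTerms (Parity true) oddPart
    oddPart-parity = sumᵖ-tabulate _ λ k → valueⁱ-parity (odd k)

    evenPart-parity : AllTerms (Parity false) evenPart
    evenPart-parity = sumᵖ-tabulate _ λ k →
      *-terms (λ {m} {m′} → parity-++ {false} {false} {m} {m′}) {const (rat (+ 1 / evenDegree k))} {inner k} (refl ∷ [])
        (sumᵖ-tabulate _ λ i → *-terms (λ {m} {m′} → parity-++ {true} {true} {m} {m′}) {var (x i)} {valueⁱ (even k i)} (refl ∷ []) (valueⁱ-parity (even k i)))
      where
      inner : Fin K → Poly
      inner k = sumᵖ (tabulate λ i → var (x i) *ᵖ valueⁱ (even k i))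

    component-value : ∀ d → component (suc d) value ≋ component (suc d) oddPart + component (suc d) evenPart
    component-value d = ≋-trans (component-+ᵖ (suc d) (const constant +ᵖ oddPart) evenPart)
      (P.+-congʳ (≋-trans (component-+ᵖ (suc d) (const constant) oddPart) (P.+-identityˡ _)))

    pairs : ∀ {k} → ℂ → (Fin k → ℕ × IHL) → List (LinearForm × IHL)
    pairs c f = tabulate λ i → ((c , proj₁ (f i)) ∷ []) , proj₂ (f i)

    pairsValue-++ : ∀ L M → pairsValue (L ++ M) ≋ pairsValue L + pairsValue M
    pairsValue-++ []            M = ≋-sym (P.+-identityˡ _)
    pairsValue-++ ((ℓ , G) ∷ L) M = ≋-trans (P.+-congˡ (pairsValue-++ L M)) (≋-sym (P.+-assoc _ _ _))

    pairsSize-++ : ∀ L M → pairsSize (L ++ M) ≡ pairsSize L ℕ.+ pairsSize M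
    pairsSize-++ []            M = refl
    pairsSize-++ ((ℓ , G) ∷ L) M = ≡.trans (cong (sizeⁱ G ℕ.+_) (pairsSize-++ L M)) (≡.sym (ℕₚ.+-assoc (sizeⁱ G) _ _))

    pairs-value : ∀ {k} c (f : Fin k → ℕ × IHL) →
                  const c *ᵖ sumᵖ (tabulate λ i → var (proj₁ (f i)) *ᵖ valueⁱ (proj₂ (f i))) ≋ pairsValue (pairs c f)
    pairs-value c f = ≋-trans (≋-reflexive (*-def (const c) _)) (go f)
      where
      go : ∀ {k} (f : Fin k → ℕ × IHL) → const c * sumᵖ (tabulate λ i → var (proj₁ (f i)) *ᵖ valueⁱ (proj₂ (f i))) ≋ pairsValue (pairs c f)
      go {zero}  f = P.zeroʳ (const c)
      go {suc k} f = ≋-trans (P.*-congˡ (+ᵖ-≋ _ _)) (≋-trans (P.distribˡ (const c) _ _)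
        (+-cong (≋-trans (P.*-congˡ (≋-reflexive (*-def (var i) G))) (≋-trans (≋-sym (P.*-assoc (const c) (var i) G)) (P.*-congʳ scaled))) (go (f ∘ Fin.suc))))
        where
        i = proj₁ (f Fin.zero)
        G = valueⁱ (proj₂ (f Fin.zero))
        scaled : const c * var i ≋ linear ((c , i) ∷ [])
        scaled = ≋-trans (≋-sym (linear-scale c ((1ℂ , i) ∷ []))) (mk≋ λ φ inv → K.+-congʳ (K.*-congʳ (K.*-identityʳ c)))

    pairs-size : ∀ {k} c (f : Fin k → ℕ × IHL) → pairsSize (pairs c f) ≤ sum (tabulate λ i → 3 ℕ.+ sizeⁱ (proj₂ (f i)))
    pairs-size {zero}  c f = z≤n
    pairs-size {suc k} c f = ℕₚ.+-mono-≤ (ℕₚ.m≤n+m _ 3) (pairs-size c (f ∘ Fin.suc))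

    evenPairs : ∀ {k} → (Fin k → ℂ) → (Fin k → Fin m → IHL) → List (LinearForm × IHL)
    evenPairs c G = concat (tabulate λ k → pairs (c k) (λ i → x i , G k i))

    evenPairs-value : ∀ {k} (c : Fin k → ℂ) (G : Fin k → Fin m → IHL) → evenPartOf c G ≋ pairsValue (evenPairs c G)
    evenPairs-value {zero}  c G = ≋-refl
    evenPairs-value {suc k} c G = ≋-trans (+ᵖ-≋ _ _) (≋-trans
      (+-cong (pairs-value (c Fin.zero) (λ i → x i , G Fin.zero i)) (evenPairs-value (c ∘ Fin.suc) (G ∘ Fin.suc)))
      (≋-sym (pairsValue-++ (pairs (c Fin.zero) (λ i → x i , G Fin.zero i)) _)))

    evenPairs-size : ∀ {k} (c : Fin k → ℂ) (G : Fin k → Fin m → IHL) →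
      pairsSize (evenPairs c G) ≤ sum (tabulate λ k → 4 ℕ.+ sum (tabulate λ i → 3 ℕ.+ sizeⁱ (G k i)))
    evenPairs-size {zero}  c G = z≤n
    evenPairs-size {suc k} c G = ℕₚ.≤-trans (ℕₚ.≤-reflexive (pairsSize-++ (pairs (c Fin.zero) (λ i → x i , G Fin.zero i)) _))
      (ℕₚ.+-mono-≤ (ℕₚ.≤-trans (pairs-size (c Fin.zero) (λ i → x i , G Fin.zero i)) (ℕₚ.m≤n+m _ 4)) (evenPairs-size (c ∘ Fin.suc) (G ∘ Fin.suc)))

    -- In odd degree the even part drops out by parity; all odd subformulas are added into one, and
    -- the extraction picks the degree. In even degree the variables, with the factors 1/d absorbed,
    -- are the linear forms of a list of pairs.
    reachable-graded : ∀ a {B N} d → size ≤ B → reachLength B ≤ N → Reachable a N (suc d) (component (suc d) value)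
    reachable-graded a d size≤ len≤ = decide (odd? (suc d)) refl
      where
      decide : ∀ b → odd? (suc d) ≡ b → Reachable a _ (suc d) (component (suc d) value)
      decide true  e = reachable-resp {a} {_} {suc d} {component (suc d) (valueⁱ G)} {component (suc d) value} (≋-sym eq) (reachable-odd a d G e (ℕₚ.≤-trans G≤ size≤) len≤)
        where
        G = sumIHL (tabulate odd)
        G≤ : sizeⁱ G ≤ size
        G≤ = ℕₚ.≤-trans (ℕₚ.≤-reflexive (sizeⁱ-sum odd)) (ℕₚ.m≤m+n _ _)
        eq : component (suc d) value ≋ component (suc d) (valueⁱ G)
        eq = ≋-trans (component-value d) (≋-trans
          (+-cong {component (suc d) oddPart} {component (suc d) (valueⁱ G)} {component (suc d) evenPart} {[]}
            (≋-reflexive (cong (component (suc d)) (≡.sym (valueⁱ-sum odd)))) (≋-reflexive (component-parity {false} {suc d} evenPart evenPart-parity e)))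
          (P.+-identityʳ _))
      decide false e = reachable-resp {a} {_} {suc d} {component (suc d) (pairsValue L)} {component (suc d) value} (≋-sym eq) (reachable-even a d L e (ℕₚ.≤-trans L≤ size≤) len≤)
        where
        L = evenPairs (λ k → rat (+ 1 / evenDegree k)) even
        even-eq : evenPart ≋ pairsValue L
        even-eq = evenPairs-value (λ k → rat (+ 1 / evenDegree k)) even
        L≤ : pairsSize L ≤ size
        L≤ = ℕₚ.≤-trans (evenPairs-size (λ k → rat (+ 1 / evenDegree k)) even) (ℕₚ.m≤n+m _ _)
        eq : component (suc d) value ≋ component (suc d) (pairsValue L)
        eq = ≋-trans (component-value d) (≋-trans
          (+-cong {component (suc d) oddPart} {[]} (≋-reflexive (component-parity {true} {suc d} oddPart oddPart-parity e)) (component-cong (suc d) {evenPart} {pairsValue L} even-eq))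
          (P.+-identityˡ _))

-- Polynomial and quasipolynomial growth.

module Growth where

  open import Defs using (evalⁿ; PolyBounded; QuasiPolyBounded)
  open import Data.Nat as ℕ using (ℕ; zero; suc; _≤_; _<_; _+_; _*_; _^_; z≤n; s≤s; ⌊_/2⌋)
  import Data.Nat.Properties as ℕₚ
  open import Data.Nat.Logarithm using (⌊log₂_⌋; ⌊log₂⌋-mono-≤; ⌊log₂⌊n/2⌋⌋≡⌊log₂n⌋∸1; ⌊log₂[2^n]⌋≡n)
  open import Data.Nat.Induction using (<-rec)
  open import Data.Nat.Tactic.RingSolver using (solve-∀)
  open import Data.List using (List; []; _∷_)
  open import Data.Product using (∃; _,_)
  open import Relation.Binary.PropositionalEquality as ≡ using (_≡_; refl; cong; subst)

  open ℕₚ.≤-Reasoning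

  1≤^ : ∀ x k → 1 ≤ x → 1 ≤ x ^ k
  1≤^ x k 1≤x = ℕₚ.≤-trans (ℕₚ.≤-reflexive (≡.sym (ℕₚ.^-zeroˡ k))) (ℕₚ.^-monoˡ-≤ k 1≤x)

  n≤2^n : ∀ n → n ≤ 2 ^ n
  n≤2^n zero    = z≤n
  n≤2^n (suc n) = ℕₚ.≤-trans (ℕₚ.+-mono-≤ (1≤^ 2 n (s≤s z≤n)) (n≤2^n n)) (ℕₚ.≤-reflexive (cong (2 ^ n +_) (≡.sym (ℕₚ.+-identityʳ (2 ^ n)))))

  ^-monoʳ : ∀ x {j k} → 1 ≤ x → j ≤ k → x ^ j ≤ x ^ k
  ^-monoʳ (suc x) _ le = ℕₚ.^-monoʳ-≤ (suc x) le

  n≤[2+x]^n : ∀ x n → n ≤ (2 + x) ^ n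
  n≤[2+x]^n x n = ℕₚ.≤-trans (n≤2^n n) (ℕₚ.^-monoˡ-≤ n (ℕₚ.m≤m+n 2 x))

  evalⁿ-below : ∀ t → ∃ λ c → ∀ n → evalⁿ t n ≤ (2 + n) ^ c
  evalⁿ-below []      = 0 , λ n → z≤n
  evalⁿ-below (a ∷ t) = let c , h = evalⁿ-below t in a + suc c , λ n → bound n c (h n)
    where
    bound : ∀ n c → evalⁿ t n ≤ (2 + n) ^ c → a + n * evalⁿ t n ≤ (2 + n) ^ (a + suc c)
    bound n c h = begin
      a + n * evalⁿ t n             ≤⟨ ℕₚ.+-mono-≤ (n≤[2+x]^n n a) (ℕₚ.*-monoʳ-≤ n h) ⟩
      A + n * X                     ≤⟨ ℕₚ.+-mono-≤ (ℕₚ.m≤m*n A X {{ℕ.>-nonZero (1≤^ (2 + n) c (s≤s z≤n))}}) (ℕₚ.m≤n*m (n * X) A {{ℕ.>-nonZero (1≤^ (2 + n) a (s≤s z≤n))}}) ⟩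
      A * X + A * (n * X)           ≤⟨ ℕₚ.m≤m+n _ (A * X) ⟩
      A * X + A * (n * X) + A * X   ≡⟨ regroup′ A X n ⟩
      A * ((2 + n) * X)             ≡⟨ ℕₚ.^-distribˡ-+-* (2 + n) a (suc c) ⟨
      (2 + n) ^ (a + suc c)         ∎
      where
      A = (2 + n) ^ a
      X = (2 + n) ^ c
      regroup′ : ∀ A X n → A * X + A * (n * X) + A * X ≡ A * ((2 + n) * X)
      regroup′ = solve-∀

  times2+n : ℕ → List ℕ → List ℕ
  times2+n k []      = k ∷ []
  times2+n k (a ∷ t) = k + 2 * a ∷ times2+n a t

  evalⁿ-times : ∀ k t n → evalⁿ (times2+n k t) n ≡ k + (2 + n) * evalⁿ t n
  evalⁿ-times k []      n = cong (k +_) (≡.trans (ℕₚ.*-zeroʳ n) (≡.sym (ℕₚ.*-zeroʳ (2 + n))))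
  evalⁿ-times k (a ∷ t) n = ≡.trans (cong (λ e → k + 2 * a + n * e) (evalⁿ-times a t n)) (eq k a n (evalⁿ t n))
    where
    eq : ∀ k a n r → k + 2 * a + n * (a + (2 + n) * r) ≡ k + (2 + n) * (a + n * r)
    eq = solve-∀

  power-list : ∀ c → ∃ λ t → ∀ n → evalⁿ t n ≡ (2 + n) ^ c
  power-list zero    = 1 ∷ [] , λ n → cong suc (ℕₚ.*-zeroʳ n)
  power-list (suc c) = let t , h = power-list c in times2+n 0 t , λ n → ≡.trans (evalⁿ-times 0 t n) (cong ((2 + n) *_) (h n))

  -- Normal forms with a single exponent. The bases are at least 2, so n ≤ 2ⁿ absorbs every constant
  -- into the exponent, and both forms are monotone in n.
  PolyLike QuasiLike : (ℕ → ℕ) → Set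
  PolyLike  m = ∃ λ c → ∀ n → m n ≤ (2 + n) ^ c
  QuasiLike m = ∃ λ c → ∀ n → 2 ≤ n → m n ≤ 2 ^ ((2 + ⌊log₂ n ⌋) ^ c)

  poly⇒like : ∀ {m} → PolyBounded m → PolyLike m
  poly⇒like (t , h) = let c , k = evalⁿ-below t in c , λ n → ℕₚ.≤-trans (h n) (k n)

  like⇒poly : ∀ {m} → PolyLike m → PolyBounded m
  like⇒poly (c , h) = let t , k = power-list c in t , λ n → ℕₚ.≤-trans (h n) (ℕₚ.≤-reflexive (≡.sym (k n)))

  n<2^ : ∀ n → n < 2 ^ (1 + ⌊log₂ n ⌋)
  n<2^ = <-rec _ go
    where
    go : ∀ n → (∀ {m} → m < n → m < 2 ^ (1 + ⌊log₂ m ⌋)) → n < 2 ^ (1 + ⌊log₂ n ⌋)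
    go zero          _   = s≤s z≤n
    go (suc zero)    _   = s≤s (s≤s z≤n)
    go (suc (suc n)) rec = begin-strict
      suc (suc n)                                    <⟨ s≤s (halve (suc (suc n))) ⟩
      suc (suc (2 * ⌊ suc (suc n) /2⌋))              ≡⟨ cong suc (≡.sym (ℕₚ.+-suc ⌊ suc (suc n) /2⌋ _)) ⟩
      2 * suc ⌊ suc (suc n) /2⌋                      ≤⟨ ℕₚ.*-monoʳ-≤ 2 (rec (ℕₚ.⌊n/2⌋<n (suc n))) ⟩
      2 * 2 ^ (1 + ⌊log₂ ⌊ suc (suc n) /2⌋ ⌋)        ≡⟨ cong (λ l → 2 * 2 ^ (1 + l)) (⌊log₂⌊n/2⌋⌋≡⌊log₂n⌋∸1 (suc (suc n))) ⟩
      2 * 2 ^ (1 + (⌊log₂ suc (suc n) ⌋ ℕ.∸ 1))      ≡⟨ cong (λ l → 2 * 2 ^ l) (ℕₚ.m+[n∸m]≡n (⌊log₂⌋-mono-≤ {2} {suc (suc n)} (s≤s (s≤s z≤n)))) ⟩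
      2 ^ (1 + ⌊log₂ suc (suc n) ⌋)                  ∎
      where
      halve : ∀ n → n ≤ suc (2 * ⌊ n /2⌋)
      halve zero          = z≤n
      halve (suc zero)    = s≤s z≤n
      halve (suc (suc n)) = ℕₚ.≤-trans (s≤s (s≤s (halve n))) (ℕₚ.≤-reflexive (cong suc (cong suc (≡.sym (ℕₚ.+-suc ⌊ n /2⌋ _)))))

  2+n≤2^ : ∀ n → 2 + n ≤ 2 ^ (2 + ⌊log₂ n ⌋)
  2+n≤2^ n = ℕₚ.≤-trans (ℕₚ.+-mono-≤ (^-monoʳ 2 (s≤s z≤n) (s≤s (z≤n {⌊log₂ n ⌋}))) (ℕₚ.<⇒≤ (n<2^ n)))
    (ℕₚ.≤-reflexive (cong (2 ^ (1 + ⌊log₂ n ⌋) +_) (≡.sym (ℕₚ.+-identityʳ _))))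

  quasi⇒like : ∀ {m} → QuasiPolyBounded m → QuasiLike m
  quasi⇒like {m} (q , h) = let c , k = evalⁿ-below q in suc c , λ n 2≤n → bound n c (k ⌊log₂ n ⌋) (h n 2≤n)
    where
    bound : ∀ n c → evalⁿ q ⌊log₂ n ⌋ ≤ (2 + ⌊log₂ n ⌋) ^ c → m n ≤ n ^ evalⁿ q ⌊log₂ n ⌋ → m n ≤ 2 ^ ((2 + ⌊log₂ n ⌋) ^ suc c)
    bound n c e≤ m≤ = begin
      m n                                      ≤⟨ m≤ ⟩
      n ^ evalⁿ q ⌊log₂ n ⌋                    ≤⟨ ℕₚ.^-monoˡ-≤ (evalⁿ q ⌊log₂ n ⌋) (ℕₚ.≤-trans (ℕₚ.m≤n+m n 2) (2+n≤2^ n)) ⟩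
      (2 ^ L) ^ evalⁿ q ⌊log₂ n ⌋              ≡⟨ ℕₚ.^-*-assoc 2 L (evalⁿ q ⌊log₂ n ⌋) ⟩
      2 ^ (L * evalⁿ q ⌊log₂ n ⌋)              ≤⟨ ^-monoʳ 2 (s≤s z≤n) (ℕₚ.*-monoʳ-≤ L e≤) ⟩
      2 ^ (L ^ suc c)                          ∎
      where L = 2 + ⌊log₂ n ⌋

  like⇒quasi : ∀ {m} → QuasiLike m → QuasiPolyBounded m
  like⇒quasi {m} (c , h) = let t , k = power-list c in t , λ n 2≤n →
    ℕₚ.≤-trans (h n 2≤n) (ℕₚ.≤-trans (ℕₚ.^-monoˡ-≤ ((2 + ⌊log₂ n ⌋) ^ c) 2≤n) (ℕₚ.≤-reflexive (cong (n ^_) (≡.sym (k ⌊log₂ n ⌋)))))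

  polyLike⇒quasiLike : ∀ {m} → PolyLike m → QuasiLike m
  polyLike⇒quasiLike {m} (c , h) = suc c , λ n _ → begin
    m n                               ≤⟨ h n ⟩
    (2 + n) ^ c                       ≤⟨ ℕₚ.^-monoˡ-≤ c (2+n≤2^ n) ⟩
    (2 ^ (2 + ⌊log₂ n ⌋)) ^ c         ≡⟨ ℕₚ.^-*-assoc 2 (2 + ⌊log₂ n ⌋) c ⟩
    2 ^ ((2 + ⌊log₂ n ⌋) * c)         ≤⟨ ^-monoʳ 2 (s≤s z≤n) (ℕₚ.*-monoʳ-≤ (2 + ⌊log₂ n ⌋) (n≤[2+x]^n ⌊log₂ n ⌋ c)) ⟩
    2 ^ ((2 + ⌊log₂ n ⌋) ^ suc c)     ∎

  polyLike-id : PolyLike (λ n → n)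
  polyLike-id = 1 , λ n → ℕₚ.≤-trans (ℕₚ.m≤n+m n 2) (ℕₚ.≤-reflexive (≡.sym (ℕₚ.*-identityʳ (2 + n))))

  polyLike-mono : ∀ {m m′} → (∀ n → m n ≤ m′ n) → PolyLike m′ → PolyLike m
  polyLike-mono le (c , h) = c , λ n → ℕₚ.≤-trans (le n) (h n)

  quasiLike-mono : ∀ {m m′} → (∀ n → 2 ≤ n → m n ≤ m′ n) → QuasiLike m′ → QuasiLike m
  quasiLike-mono le (c , h) = c , λ n 2≤n → ℕₚ.≤-trans (le n 2≤n) (h n 2≤n)

  2+≤ : ∀ x c → 2 + (2 + x) ^ c ≤ (2 + x) ^ (2 + c)
  2+≤ x c = begin
    2 + X                    ≤⟨ ℕₚ.+-monoˡ-≤ X (ℕₚ.*-monoʳ-≤ 2 (1≤^ (2 + x) c (s≤s z≤n))) ⟩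
    2 * X + X                ≤⟨ ℕₚ.m≤m+n _ (X + (4 * x + x * x) * X) ⟩
    2 * X + X + (X + (4 * x + x * x) * X)      ≡⟨ eq x X ⟩
    (2 + x) * ((2 + x) * X)  ∎
    where
    X = (2 + x) ^ c
    eq : ∀ x X → 2 * X + X + (X + (4 * x + x * x) * X) ≡ (2 + x) * ((2 + x) * X)
    eq = solve-∀

  polyLike-power : ∀ {m} k → PolyLike m → PolyLike (λ n → (2 + m n) ^ k)
  polyLike-power {m} k (c , h) = (2 + c) * k , λ n → begin
    (2 + m n) ^ k               ≤⟨ ℕₚ.^-monoˡ-≤ k (ℕₚ.≤-trans (ℕₚ.+-monoʳ-≤ 2 (h n)) (2+≤ n c)) ⟩
    ((2 + n) ^ (2 + c)) ^ k     ≡⟨ ℕₚ.^-*-assoc (2 + n) (2 + c) k ⟩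
    (2 + n) ^ ((2 + c) * k)     ∎

  2+2^≤ : ∀ y → 1 ≤ y → 2 + 2 ^ y ≤ 2 ^ (2 * y)
  2+2^≤ (suc y) _ = begin
    2 + 2 * 2 ^ y                 ≤⟨ ℕₚ.+-monoˡ-≤ (2 * 2 ^ y) (ℕₚ.*-monoʳ-≤ 2 (1≤^ 2 y (s≤s z≤n))) ⟩
    2 * 2 ^ y + 2 * 2 ^ y         ≡⟨ eq (2 ^ y) ⟩
    2 * (2 * (1 * 2 ^ y))         ≤⟨ ℕₚ.*-monoʳ-≤ 2 (ℕₚ.*-monoʳ-≤ 2 (ℕₚ.*-monoˡ-≤ (2 ^ y) (1≤^ 2 y (s≤s z≤n)))) ⟩
    2 * (2 * (2 ^ y * 2 ^ y))     ≡⟨ cong (λ z → 2 * (2 * z)) (≡.trans (≡.sym (ℕₚ.^-distribˡ-+-* 2 y y)) (cong (2 ^_) (cong (y +_) (≡.sym (ℕₚ.+-identityʳ y))))) ⟩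
    2 ^ (2 + 2 * y)               ≡⟨ cong (2 ^_) (≡.sym (ℕₚ.*-distribˡ-+ 2 1 y)) ⟩
    2 ^ (2 * suc y)               ∎
    where
    eq : ∀ x → 2 * x + 2 * x ≡ 2 * (2 * (1 * x))
    eq = solve-∀

  -- The exponent may be polylogarithmic in n. `sourceSize` needs this, since it is raised to the
  -- logarithmic depth of a recursion.
  quasiLike-power : ∀ {m} k e → QuasiLike m → QuasiLike (λ n → (2 + m n) ^ (k * (2 + ⌊log₂ n ⌋) ^ e))
  quasiLike-power {m} k e (c , h) = suc (c + (k + e)) , λ n 2≤n → let L = 2 + ⌊log₂ n ⌋ ; Lc = L ^ c in begin
    (2 + m n) ^ (k * L ^ e)              ≤⟨ ℕₚ.^-monoˡ-≤ (k * L ^ e) (ℕₚ.≤-trans (ℕₚ.+-monoʳ-≤ 2 (h n 2≤n)) (2+2^≤ Lc (1≤^ L c (s≤s z≤n)))) ⟩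
    (2 ^ (2 * Lc)) ^ (k * L ^ e)         ≡⟨ ℕₚ.^-*-assoc 2 (2 * Lc) (k * L ^ e) ⟩
    2 ^ (2 * Lc * (k * L ^ e))           ≤⟨ ^-monoʳ 2 (s≤s z≤n) (ℕₚ.*-mono-≤ (ℕₚ.*-monoˡ-≤ Lc (ℕₚ.m≤m+n 2 ⌊log₂ n ⌋)) (ℕₚ.*-monoˡ-≤ (L ^ e) (n≤[2+x]^n ⌊log₂ n ⌋ k))) ⟩
    2 ^ (L * Lc * (L ^ k * L ^ e))       ≡⟨ cong (2 ^_) (≡.trans (cong (L * Lc *_) (≡.sym (ℕₚ.^-distribˡ-+-* L k e))) (≡.trans (ℕₚ.*-assoc L Lc _) (cong (L *_) (≡.sym (ℕₚ.^-distribˡ-+-* L c (k + e)))))) ⟩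
    2 ^ (L ^ suc (c + (k + e)))          ∎

  log-of-power : ∀ n k e → 1 ≤ k → k ≤ (2 + n) ^ e → 2 + ⌊log₂ k ⌋ ≤ (2 + ⌊log₂ n ⌋) ^ (2 + suc e)
  log-of-power n k e 1≤k k≤ = ℕₚ.≤-trans (ℕₚ.+-monoʳ-≤ 2 (begin
    ⌊log₂ k ⌋                              ≤⟨ ⌊log₂⌋-mono-≤ (ℕₚ.≤-trans k≤ (ℕₚ.≤-trans (ℕₚ.^-monoˡ-≤ e (2+n≤2^ n)) (ℕₚ.≤-reflexive (ℕₚ.^-*-assoc 2 L e)))) ⟩
    ⌊log₂ 2 ^ (L * e) ⌋                    ≡⟨ ⌊log₂[2^n]⌋≡n (L * e) ⟩
    L * e                                  ≤⟨ ℕₚ.*-monoʳ-≤ L (n≤[2+x]^n ⌊log₂ n ⌋ e) ⟩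
    L ^ suc e                              ∎)) (2+≤ ⌊log₂ n ⌋ (suc e))
    where L = 2 + ⌊log₂ n ⌋

  -- The function `m` itself may fail to be monotone, so k ≤ b is applied to its normal form, which
  -- is monotone.
  polyLike-∘ : ∀ {m k b : ℕ → ℕ} → PolyLike m → PolyLike b → (∀ n → k n ≤ b n) → PolyLike (λ n → m (k n))
  polyLike-∘ {m} {k} {b} (c , h) pb k≤b = polyLike-mono
    (λ n → ℕₚ.≤-trans (h (k n)) (ℕₚ.^-monoˡ-≤ c (ℕₚ.+-monoʳ-≤ 2 (k≤b n)))) (polyLike-power c pb)

  -- The bound on `m` says nothing at 0 and 1, values that k n can take for large n. Adding m 0 + m
  -- 1 to the exponent covers these two arguments.
  quasiLike-∘ : ∀ {m k b : ℕ → ℕ} → QuasiLike m → PolyLike b → (∀ n → k n ≤ b n) → QuasiLike (λ n → m (k n))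
  quasiLike-∘ {m} {k} {b} (c , h) (e , b≤) k≤b = (2 + suc e) * c + (m 0 + m 1) , λ n 2≤n → cases n (k n) refl
    where
    cases : ∀ n i → i ≡ k n → m i ≤ 2 ^ ((2 + ⌊log₂ n ⌋) ^ ((2 + suc e) * c + (m 0 + m 1)))
    small : ∀ n x → x ≤ m 0 + m 1 → x ≤ 2 ^ ((2 + ⌊log₂ n ⌋) ^ ((2 + suc e) * c + (m 0 + m 1)))
    small n x x≤ = ℕₚ.≤-trans x≤ (ℕₚ.≤-trans (ℕₚ.m≤n+m _ ((2 + suc e) * c)) (ℕₚ.≤-trans (n≤[2+x]^n ⌊log₂ n ⌋ ((2 + suc e) * c + (m 0 + m 1))) (n≤2^n ((2 + ⌊log₂ n ⌋) ^ ((2 + suc e) * c + (m 0 + m 1))))))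
    cases n zero          _  = small n (m 0) (ℕₚ.m≤m+n _ _)
    cases n (suc zero)    _  = small n (m 1) (ℕₚ.m≤n+m _ _)
    cases n i@(suc (suc _)) eq = begin
      m i                                        ≤⟨ h i (s≤s (s≤s z≤n)) ⟩
      2 ^ ((2 + ⌊log₂ i ⌋) ^ c)                  ≤⟨ ^-monoʳ 2 (s≤s z≤n) (ℕₚ.^-monoˡ-≤ c (log-of-power n i e (s≤s z≤n) (subst (_≤ (2 + n) ^ e) (≡.sym eq) (ℕₚ.≤-trans (k≤b n) (b≤ n))))) ⟩
      2 ^ ((L ^ (2 + suc e)) ^ c)                ≡⟨ cong (2 ^_) (ℕₚ.^-*-assoc L (2 + suc e) c) ⟩
      2 ^ (L ^ ((2 + suc e) * c))                ≤⟨ ^-monoʳ 2 (s≤s z≤n) (^-monoʳ L (s≤s z≤n) (ℕₚ.m≤m+n ((2 + suc e) * c) (m 0 + m 1))) ⟩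
      2 ^ (L ^ ((2 + suc e) * c + (m 0 + m 1)))  ∎
      where L = 2 + ⌊log₂ n ⌋

-- Separating degrees by Lagrange interpolation.

module Interpolation where

  open import Defs using (Poly; const; rat; 1ℂ)
  open Reals using (ℂ-ring; ≃-sym; rat-+; rat-*; _<′_)
  open Polynomials
  open Alternating using (alt; when; ∑-when; when-cong; range)
  open Extraction using (alt-scale)
  open Matrices
  open Sums
  open import Data.Nat as ℕ using (ℕ; zero; suc; _≤_; _<_; z≤n; s≤s)
  import Data.Nat.Properties as ℕₚ
  open import Data.Rational as ℚ using (ℚ; 0ℚ; 1ℚ; 1/_; ≢-nonZero; positive)
  import Data.Rational.Properties as ℚₚ
  open import Data.Rational.Solver using (module +-*-Solver)
  open import Data.Bool using (Bool; true; false; not)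
  import Data.Bool.Properties as Boolₚ
  open import Data.List using (List; []; _∷_; map; length)
  import Data.List.Properties as Listₚ
  open import Data.Product using (∃; _×_; _,_; proj₁; proj₂)
  open import Data.Sum using (_⊎_; inj₁; inj₂)
  open import Relation.Nullary using (¬_; Dec; yes; no; does; contradiction)
  open import Relation.Binary using (tri<; tri≈; tri>)
  open import Relation.Binary.PropositionalEquality as ≡ using (_≡_; refl; cong; subst)
  open import Algebra.Bundles using (CommutativeRing)

  private
    module P = CommutativeRing Poly-ring
    module K = CommutativeRing ℂ-ring
    module Qᵣ = CommutativeRing ℚₚ.+-*-commutativeRing
  open RingSums Poly-ring
  open import Algebra.Properties.Semiring.Exp P.semiring using (_^_)
  open import Algebra.Properties.Semiring.Exp Qᵣ.semiring using () renaming (_^_ to _^ʳ_; ^-assocʳ to ^ʳ-assocʳ)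

  2ℚ : ℚ
  2ℚ = 1ℚ ℚ.+ 1ℚ

  0<2^ : ∀ n → 0ℚ <′ 2ℚ ^ʳ n
  0<2^ zero    = ℚₚ.positive⁻¹ 1ℚ
  0<2^ (suc n) = subst (_<′ 2ℚ ^ʳ suc n) (ℚₚ.*-zeroʳ 2ℚ) (ℚₚ.*-monoʳ-<-pos 2ℚ (0<2^ n))

  2^-step : ∀ n → 2ℚ ^ʳ n <′ 2ℚ ^ʳ suc n
  2^-step n = ℚₚ.≤-<-trans (ℚₚ.≤-reflexive (≡.sym (ℚₚ.*-identityˡ (2ℚ ^ʳ n))))
    (ℚₚ.*-monoˡ-<-pos (2ℚ ^ʳ n) {{positive (0<2^ n)}} {1ℚ} {2ℚ} (ℚ.*<* (Data.Integer.+<+ (s≤s (s≤s z≤n)))))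
    where import Data.Integer

  2^-mono : ∀ {m n} → m < n → 2ℚ ^ʳ m <′ 2ℚ ^ʳ n
  2^-mono {m} {suc n} (s≤s m≤n) with ℕₚ.m≤n⇒m<n∨m≡n m≤n
  ... | inj₁ m<n  = ℚₚ.<-trans (2^-mono m<n) (2^-step n)
  ... | inj₂ refl = 2^-step m

  2^-injective : ∀ m n → 2ℚ ^ʳ m ≡ 2ℚ ^ʳ n → m ≡ n
  2^-injective m n eq with ℕₚ.<-cmp m n
  ... | tri< m<n _ _ = contradiction (2^-mono m<n) (ℚₚ.<-irrefl eq)
  ... | tri≈ _ m≡n _ = m≡n
  ... | tri> _ _ n<m = contradiction (2^-mono n<m) (ℚₚ.<-irrefl (≡.sym eq))

  horner : List ℚ → ℚ → ℚ
  horner []      x = 0ℚ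
  horner (c ∷ q) x = c ℚ.+ x ℚ.* horner q x

  -- Computes k + (T - r) q in one pass; the accumulator `k` is the coefficient handed on by the
  -- multiplication with T.
  timesRoot : ℚ → ℚ → List ℚ → List ℚ
  timesRoot r k []      = k ∷ []
  timesRoot r k (c ∷ q) = (k ℚ.- r ℚ.* c) ∷ timesRoot r c q

  horner-timesRoot : ∀ r k q x → horner (timesRoot r k q) x ≡ k ℚ.+ (x ℚ.- r) ℚ.* horner q x
  horner-timesRoot r k []      x = ≡.trans (cong (k ℚ.+_) (ℚₚ.*-zeroʳ x)) (cong (k ℚ.+_) (≡.sym (ℚₚ.*-zeroʳ (x ℚ.- r))))
  horner-timesRoot r k (c ∷ q) x = ≡.trans (cong (λ h → (k ℚ.- r ℚ.* c) ℚ.+ x ℚ.* h) (horner-timesRoot r c q x)) (eq k r c x (horner q x))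
    where
    open +-*-Solver
    eq : ∀ k r c x h → (k ℚ.- r ℚ.* c) ℚ.+ x ℚ.* (c ℚ.+ (x ℚ.- r) ℚ.* h) ≡ k ℚ.+ (x ℚ.- r) ℚ.* (c ℚ.+ x ℚ.* h)
    eq = solve 5 (λ k r c x h → (k :- r :* c) :+ x :* (c :+ (x :- r) :* h) := k :+ (x :- r) :* (c :+ x :* h)) refl

  horner-scale : ∀ s q x → horner (map (s ℚ.*_) q) x ≡ s ℚ.* horner q x
  horner-scale s []      x = ≡.sym (ℚₚ.*-zeroʳ s)
  horner-scale s (c ∷ q) x = ≡.trans (cong (λ h → s ℚ.* c ℚ.+ x ℚ.* h) (horner-scale s q x)) (eq s c x (horner q x))
    where
    open +-*-Solver
    eq : ∀ s c x h → s ℚ.* c ℚ.+ x ℚ.* (s ℚ.* h) ≡ s ℚ.* (c ℚ.+ x ℚ.* h)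
    eq = solve 4 (λ s c x h → s :* c :+ x :* (s :* h) := s :* (c :+ x :* h)) refl

  timesRoot-length : ∀ r k q → length (timesRoot r k q) ≡ suc (length q)
  timesRoot-length r k []      = refl
  timesRoot-length r k (c ∷ q) = cong suc (timesRoot-length r c q)

  opaque
    node : ℕ → ℚ
    node n = 2ℚ ^ʳ n

    node-injective : ∀ m n → node m ≡ node n → m ≡ n
    node-injective = 2^-injective

    -- The symmetry behind the choice of nodes. Scaling all letters by 2^k multiplies degree d by
    -- (2^k)^d = (2^d)^k, so the combination with weights q multiplies degree d by the value of q at
    -- 2^d. A polynomial q with value 1 at 2^D and zeros at the other nodes then selects degree D.
    node-powers : ∀ k d → node k ^ʳ d ≡ node d ^ʳ k
    node-powers k d = ≡.trans (^ʳ-assocʳ 2ℚ k d) (≡.trans (cong (2ℚ ^ʳ_) (ℕₚ.*-comm k d)) (≡.sym (^ʳ-assocʳ 2ℚ d k)))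

  addRoot : ∀ y r q → ¬ (y ≡ r) → horner q y ≡ 1ℚ → ∃ λ q′ → length q′ ≡ suc (length q) × horner q′ y ≡ 1ℚ × horner q′ r ≡ 0ℚ
            × (∀ x → horner q x ≡ 0ℚ → horner q′ x ≡ 0ℚ)
  addRoot y r q y≢r peak = map (s ℚ.*_) (timesRoot r 0ℚ q)
    , ≡.trans (Listₚ.length-map (s ℚ.*_) (timesRoot r 0ℚ q)) (timesRoot-length r 0ℚ q)
    , ≡.trans (value y) (≡.trans (cong (λ h → s ℚ.* ((y ℚ.- r) ℚ.* h)) peak)
        (≡.trans (cong (s ℚ.*_) (ℚₚ.*-identityʳ (y ℚ.- r))) (proj₂ inverse)))
    , ≡.trans (value r) (≡.trans (cong (λ g → s ℚ.* (g ℚ.* horner q r)) (ℚₚ.+-inverseʳ r))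
        (≡.trans (cong (s ℚ.*_) (ℚₚ.*-zeroˡ (horner q r))) (ℚₚ.*-zeroʳ s)))
    , λ x root → ≡.trans (value x) (≡.trans (cong (λ h → s ℚ.* ((x ℚ.- r) ℚ.* h)) root)
        (≡.trans (cong (s ℚ.*_) (ℚₚ.*-zeroʳ (x ℚ.- r))) (ℚₚ.*-zeroʳ s)))
    where
    invertible : ∀ g → ¬ (g ≡ 0ℚ) → ∃ λ s → s ℚ.* g ≡ 1ℚ
    invertible g g≢0 = (1/ g) {{≢-nonZero g≢0}} , ℚₚ.*-inverseˡ g {{≢-nonZero g≢0}}
    inverse : ∃ λ s → s ℚ.* (y ℚ.- r) ≡ 1ℚ
    inverse = invertible (y ℚ.- r) λ e → y≢r (≡.trans (add-back y r) (≡.trans (cong (ℚ._+ r) e) (ℚₚ.+-identityˡ r)))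
      where open import Defs using (add-back)
    s = proj₁ inverse
    value : ∀ x → horner (map (s ℚ.*_) (timesRoot r 0ℚ q)) x ≡ s ℚ.* ((x ℚ.- r) ℚ.* horner q x)
    value x = ≡.trans (horner-scale s (timesRoot r 0ℚ q) x)
      (cong (s ℚ.*_) (≡.trans (horner-timesRoot r 0ℚ q x) (ℚₚ.+-identityˡ _)))

  record Lagrange (D n : ℕ) : Set where
    field
      weights : List ℚ
      short   : length weights ≤ suc n
      peak    : horner weights (node D) ≡ 1ℚ
      roots   : ∀ e → e < n → ¬ (e ≡ D) → horner weights (node e) ≡ 0ℚ

  -- The weights are the coefficients of ∏ (T - 2^e) / (2^D - 2^e) over e < n, e ≠ D.
  lagrange : ∀ D n → Lagrange D n
  lagrange D zero = record
    { weights = 1ℚ ∷ [] ; short = s≤s z≤n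
    ; peak = ≡.trans (cong (1ℚ ℚ.+_) (ℚₚ.*-zeroʳ (node D))) (ℚₚ.+-identityʳ 1ℚ) ; roots = λ _ () }
  lagrange D (suc n) = step (n ℕ.≟ D)
    where
    module L = Lagrange (lagrange D n)
    step : Dec (n ≡ D) → Lagrange D (suc n)
    step (yes n≡D) = record
      { weights = L.weights ; short = ℕₚ.m≤n⇒m≤1+n L.short ; peak = L.peak
      ; roots = λ e e<1+n e≢D → L.roots e (ℕₚ.≤∧≢⇒< (ℕₚ.≤-pred e<1+n) (λ e≡n → e≢D (≡.trans e≡n n≡D))) e≢D }
    step (no n≢D) = with-root (addRoot (node D) (node n) L.weights (λ e → n≢D (≡.sym (node-injective D n e))) L.peak)
      where
      with-root : (∃ λ q → length q ≡ suc (length L.weights) × horner q (node D) ≡ 1ℚ × horner q (node n) ≡ 0ℚ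
            × (∀ x → horner L.weights x ≡ 0ℚ → horner q x ≡ 0ℚ)) → Lagrange D (suc n)
      with-root (q , len , peak , root , keep) = record
        { weights = q ; short = ℕₚ.≤-trans (ℕₚ.≤-reflexive len) (s≤s L.short) ; peak = peak
        ; roots = λ e e<1+n e≢D → cases e e≢D (ℕₚ.m≤n⇒m<n∨m≡n (ℕₚ.≤-pred e<1+n)) }
        where
        cases : ∀ e → ¬ (e ≡ D) → e < n ⊎ e ≡ n → horner q (node e) ≡ 0ℚ
        cases e e≢D (inj₁ e<n) = keep (node e) (L.roots e e<n e≢D)
        cases e e≢D (inj₂ e≡n) = ≡.trans (cong (λ i → horner q (node i)) e≡n) root

  q̂ : ℚ → Poly
  q̂ c = const (rat c)

  q̂-+ : ∀ c d → q̂ (c ℚ.+ d) ≋ q̂ c + q̂ d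
  q̂-+ c d = ≋-trans (const-cong (≃-sym (rat-+ c d))) (const-+ (rat c) (rat d))

  q̂-* : ∀ c d → q̂ (c ℚ.* d) ≋ q̂ c * q̂ d
  q̂-* c d = ≋-trans (const-cong (≃-sym (rat-* c d))) (const-* (rat c) (rat d))

  q̂-^ : ∀ c n → q̂ (c ^ʳ n) ≋ q̂ c ^ n
  q̂-^ c zero    = ≋-refl
  q̂-^ c (suc n) = ≋-trans (q̂-* c (c ^ʳ n)) (P.*-congˡ (q̂-^ c n))

  Word : Set
  Word = List (Bool × Poly)

  total : Bool → Word → Poly
  total π []            = const 1ℂ
  total π ((b , p) ∷ w) = when (does (b Boolₚ.≟ π)) (p * total (not π) w) + total π w

  ∑-range-suc : ∀ i n (f : ℕ → Poly) → ∑ (range (suc i) n) f ≋ ∑ (range i n) (λ d → f (suc d))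
  ∑-range-suc i zero    f = ≋-refl
  ∑-range-suc i (suc n) f = P.+-congˡ (∑-range-suc (suc i) n f)

  total-degrees : ∀ π w n → length w < n → total π w ≋ ∑ (range 0 n) (λ d → alt π d w)
  total-degrees π []            (suc n) _ = ≋-sym (≋-trans (P.+-congˡ {const 1ℂ} (≋-trans (∑-range-suc 0 n _) (∑-zero (range 0 n) (λ _ → ≋-refl)))) (P.+-identityʳ _))
  total-degrees π ((b , p) ∷ w) (suc n) (s≤s lt) = begin
    when t (p * total (not π) w) + total π w
      ≈⟨ +-cong (when-cong t (≋-trans (P.*-congˡ (total-degrees (not π) w n lt)) (∑-*ˡ (range 0 n) p _))) (total-degrees π w (suc n) (ℕₚ.m≤n⇒m≤1+n lt)) ⟩
    when t (∑ (range 0 n) (λ d → p * alt (not π) d w)) + (const 1ℂ + ∑ (range 1 n) (λ d → alt π d w))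
      ≈⟨ +-cong (≋-sym (∑-when t (range 0 n) _)) (P.+-congˡ (∑-range-suc 0 n _)) ⟩
    ∑ (range 0 n) (λ d → when t (p * alt (not π) d w)) + (const 1ℂ + ∑ (range 0 n) (λ d → alt π (suc d) w))
      ≈⟨ x∙yz≈y∙xz _ _ _ ⟩
    const 1ℂ + (∑ (range 0 n) (λ d → when t (p * alt (not π) d w)) + ∑ (range 0 n) (λ d → alt π (suc d) w))
      ≈⟨ P.+-congˡ (≋-trans (≋-sym (∑-+ (range 0 n) _ _)) (≋-sym (∑-range-suc 0 n (λ d → alt π d ((b , p) ∷ w))))) ⟩
    const 1ℂ + ∑ (range 1 n) (λ d → alt π d ((b , p) ∷ w)) ∎
    where
    t = does (b Boolₚ.≟ π)
    open import Relation.Binary.Reasoning.Setoid ≋-setoid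
    open import Algebra.Properties.CommutativeSemigroup P.+-commutativeSemigroup using (x∙yz≈y∙xz)

  scaleWord : Poly → Word → Word
  scaleWord t = map (λ (b , p) → b , t * p)

  -- Exchanging the sum over the nodes 2^k with the sum over the degrees.
  combine-nodes : ∀ π w n (q : List ℚ) k → length w < n →
    ∀ (f : ℕ → Poly) → (∀ i → f i ≋ total π (scaleWord (q̂ (node i)) w)) →
    ∀ (g : List ℚ → ℕ → Poly) → (∀ j → g [] j ≋ []) → (∀ c q j → g (c ∷ q) j ≋ q̂ c * f j + g q (suc j)) →
    g q k ≋ ∑ (range 0 n) (λ d → q̂ (node d ^ʳ k ℚ.* horner q (node d)) * alt π d w)
  combine-nodes π w n []      k lt f f≋ g g[] g∷ = ≋-trans (g[] k) (≋-sym (∑-zero (range 0 n) λ d →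
    ≋-trans (P.*-congʳ (≋-trans (≋-reflexive (cong q̂ (ℚₚ.*-zeroʳ (node d ^ʳ k)))) const-0)) (P.zeroˡ _)))
  combine-nodes π w n (c ∷ q) k lt f f≋ g g[] g∷ = ≋-trans (g∷ c q k) (≋-trans
    (+-cong (≋-trans (P.*-congˡ at-node) (∑-*ˡ (range 0 n) (q̂ c) _)) (combine-nodes π w n q (suc k) lt f f≋ g g[] g∷))
    (≋-trans (≋-sym (∑-+ (range 0 n) _ _)) (∑-cong (range 0 n) λ d → merge (node d ^ʳ k) (node d) (horner q (node d)) (alt π d w))))
    where
    at-node : f k ≋ ∑ (range 0 n) (λ d → q̂ (node d ^ʳ k) * alt π d w)
    at-node = ≋-trans (f≋ k) (≋-trans (total-degrees π (scaleWord (q̂ (node k)) w) n (subst (_< n) (≡.sym (Listₚ.length-map _ w)) lt))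
      (∑-cong (range 0 n) λ d → ≋-trans (alt-scale π d (q̂ (node k)) w)
        (P.*-congʳ (≋-trans (≋-sym (q̂-^ (node k) d)) (≋-reflexive (cong q̂ (node-powers k d)))))))
    merge : ∀ x y h a → q̂ c * (q̂ x * a) + q̂ (y ℚ.* x ℚ.* h) * a ≋ q̂ (x ℚ.* (c ℚ.+ y ℚ.* h)) * a
    merge x y h a = ≋-trans (+-cong (≋-trans (≋-sym (P.*-assoc (q̂ c) (q̂ x) a)) (P.*-congʳ (≋-sym (q̂-* c x)))) ≋-refl)
      (≋-trans (≋-sym (P.distribʳ a _ _)) (P.*-congʳ (≋-trans (≋-sym (q̂-+ (c ℚ.* x) (y ℚ.* x ℚ.* h))) (≋-reflexive (cong q̂ (eq c x y h))))))
      where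
      open +-*-Solver
      eq : ∀ c x y h → c ℚ.* x ℚ.+ y ℚ.* x ℚ.* h ≡ x ℚ.* (c ℚ.+ y ℚ.* h)
      eq = solve 4 (λ c x y h → c :* x :+ y :* x :* h := x :* (c :+ y :* h)) refl

  pick-degree : ∀ D n (L : Lagrange D n) → D < n → ∀ (a : ℕ → Poly) →
    ∑ (range 0 n) (λ d → q̂ (node d ^ʳ 0 ℚ.* horner (Lagrange.weights L) (node d)) * a d) ≋ a D
  pick-degree D n L D<n a = go 0 n refl z≤n D<n
    where
    open Lagrange L
    term : ℕ → Poly
    term d = q̂ (node d ^ʳ 0 ℚ.* horner weights (node d)) * a d
    off : ∀ d → d < n → ¬ (d ≡ D) → term d ≋ []
    off d d<n d≢D = ≋-trans (P.*-congʳ (≋-trans (≋-reflexive (cong q̂ (≡.trans (ℚₚ.*-identityˡ _) (roots d d<n d≢D)))) const-0)) (P.zeroˡ (a d))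
    beyond : ∀ i r → i ℕ.+ r ≡ n → D < i → ∑ (range i r) term ≋ []
    beyond i zero    eq D<i = ≋-refl
    beyond i (suc r) eq D<i = ≋-trans (+-cong (off i (ℕₚ.≤-trans (ℕₚ.m<m+n i (s≤s z≤n)) (ℕₚ.≤-reflexive eq)) (λ e → ℕₚ.<-irrefl (≡.sym e) D<i))
      (beyond (suc i) r (≡.trans (≡.sym (ℕₚ.+-suc i r)) eq) (ℕₚ.m≤n⇒m≤1+n D<i))) (P.+-identityˡ [])
    go : ∀ i r → i ℕ.+ r ≡ n → i ≤ D → D < i ℕ.+ r → ∑ (range i r) term ≋ a D
    go i zero    eq i≤D D< = contradiction (ℕₚ.≤-trans D< (ℕₚ.≤-reflexive (ℕₚ.+-identityʳ i))) (ℕₚ.≤⇒≯ i≤D)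
    go i (suc r) eq i≤D D< with i ℕ.≟ D
    ... | yes refl = ≋-trans (+-cong (≋-trans (P.*-congʳ (≋-reflexive (cong q̂ (≡.trans (ℚₚ.*-identityˡ _) peak)))) (P.*-identityˡ (a D)))
        (beyond (suc i) r (≡.trans (≡.sym (ℕₚ.+-suc i r)) eq) ℕₚ.≤-refl)) (P.+-identityʳ (a D))
    ... | no i≢D = ≋-trans (+-cong (off i (ℕₚ.≤-trans (ℕₚ.m<m+n i (s≤s z≤n)) (ℕₚ.≤-reflexive eq)) i≢D)
        (go (suc i) r (≡.trans (≡.sym (ℕₚ.+-suc i r)) eq) (ℕₚ.≤∧≢⇒< i≤D i≢D) (ℕₚ.≤-trans D< (ℕₚ.≤-reflexive (ℕₚ.+-suc i r))))) (P.+-identityˡ (a D))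

-- Small formulas for alternating sums.

module AlternatingFormulas where

  open import Defs using (ℂ; Poly; Formula; Affine; affine; valueᶠ; sizeᶠ; const; linear; rat; 1ℂ; 0ℂ; leaf; add; mul)
  open Reals using (ℂ-ring)
  open Polynomials
  open Components using (scaleˡ; linear-scale)
  open Alternating using (alt; when; when-cong)
  open Balancing using (powerAbove)
  open Interpolation
  open Matrices
  open Sums
  open import Data.Nat as ℕ using (ℕ; zero; suc; _≤_; _<_; z≤n; s≤s)
  import Data.Nat.Properties as ℕₚ
  open import Data.Nat.Tactic.RingSolver using (solve-∀)
  open import Data.Rational using (ℚ)
  open import Data.Bool using (Bool; true; false; not; if_then_else_)
  import Data.Bool.Properties as Boolₚ
  open import Data.List using (List; []; _∷_; _++_; map; length; take; drop)
  import Data.List.Properties as Listₚ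
  open import Data.Product using (∃; _×_; _,_; proj₁; proj₂)
  open import Relation.Nullary using (does)
  open import Relation.Binary.PropositionalEquality as ≡ using (_≡_; refl; cong)
  open import Algebra.Bundles using (CommutativeRing; Ring)

  private
    module P = CommutativeRing Poly-ring
    module K = CommutativeRing ℂ-ring
  open TwoByTwo Poly-ring
  private module M = Ring Matrix-ring

  scaleᵃ : ℂ → Affine → Affine
  scaleᵃ a (c , ℓ) = a K.* c , scaleˡ a ℓ

  affine-def : ∀ c ℓ → affine (c , ℓ) ≋ const c + linear ℓ
  affine-def c ℓ = ≋-reflexive (+-def (const c) (linear ℓ))

  affine-scale : ∀ a x → affine (scaleᵃ a x) ≋ const a * affine x
  affine-scale a (c , ℓ) = ≋-trans (affine-def (a K.* c) (scaleˡ a ℓ)) (≋-trans (+-cong (const-* a c) (linear-scale a ℓ))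
    (≋-trans (≋-sym (P.distribˡ (const a) (const c) (linear ℓ))) (P.*-congˡ (≋-sym (affine-def c ℓ)))))

  AffineWord : Set
  AffineWord = List (Bool × Affine)

  ⟪_⟫ : AffineWord → Word
  ⟪_⟫ = map (λ (b , a) → b , affine a)

  product : Word → Matrix
  product []            = scalar P.1#
  product ((b , p) ∷ w) = elementary b p *ᴹ product w

  product-++ : ∀ v w → product (v ++ w) ≈ᴹ (product v *ᴹ product w)
  product-++ []            w = M.sym (M.*-identityˡ (product w))
  product-++ ((b , p) ∷ v) w = M.trans (M.*-congˡ {elementary b p} (product-++ v w)) (M.sym (M.*-assoc (elementary b p) (product v) (product w)))

  -- Even and odd degrees lie in different columns of row `π`. Their sum carries every degree, so
  -- the same formula can be interpolated for each D.
  product-total : ∀ π w → product w π true + product w π false ≋ total π w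
  product-total true  []            = P.+-identityʳ _
  product-total false []            = P.+-identityˡ _
  product-total π     ((b , p) ∷ w) = ≋-trans (+-cong (elementary-row b p (product w) π true) (elementary-row b p (product w) π false))
    (≋-trans (exchange _ _ _ _) (+-cong (head (does (b Boolₚ.≟ π))) (product-total π w)))
    where
    open import Algebra.Properties.CommutativeSemigroup P.+-commutativeSemigroup using () renaming (interchange to exchange)
    head : ∀ t → (if t then p * product w (not π) true else []) + (if t then p * product w (not π) false else []) ≋ when t (p * total (not π) w)
    head true  = ≋-trans (≋-sym (P.distribˡ p _ _)) (P.*-congˡ (product-total (not π) w))
    head false = P.+-identityˡ []

  identityLeaf : Bool → Bool → Affine
  identityLeaf true  true  = 1ℂ , []
  identityLeaf true  false = 0ℂ , []
  identityLeaf false true  = 0ℂ , []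
  identityLeaf false false = 1ℂ , []

  elementaryLeaf : Bool → Affine → Bool → Bool → Affine
  elementaryLeaf true  a true  false = a
  elementaryLeaf false a false true  = a
  elementaryLeaf _     a i     j     = identityLeaf i j

  -- An entry of a product uses four entries of the two halves, so each level quadruples the size
  -- while it doubles the length: the size is quadratic. Multiplying letter by letter would copy
  -- both entries of a row at each letter and be exponential.
  productFormula : ℕ → AffineWord → Bool → Bool → Formula
  productFormula zero    []            i j = leaf (identityLeaf i j)
  productFormula zero    ((b , a) ∷ w) i j = leaf (elementaryLeaf b a i j)
  productFormula (suc k) w             i j =
    add (mul (productFormula k (take (2 ℕ.^ k) w) i true) (productFormula k (drop (2 ℕ.^ k) w) true j))
        (mul (productFormula k (take (2 ℕ.^ k) w) i false) (productFormula k (drop (2 ℕ.^ k) w) false j))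

  identityLeaf-value : ∀ i j → affine (identityLeaf i j) ≋ scalar P.1# i j
  identityLeaf-value true  true  = ≋-refl
  identityLeaf-value true  false = const-0
  identityLeaf-value false true  = const-0
  identityLeaf-value false false = ≋-refl

  elementaryLeaf-value : ∀ b a i j → affine (elementaryLeaf b a i j) ≋ elementary b (affine a) i j
  elementaryLeaf-value true  a true  true  = ≋-sym (P.+-identityʳ _)
  elementaryLeaf-value true  a true  false = ≋-sym (P.+-identityˡ _)
  elementaryLeaf-value true  a false true  = ≋-trans const-0 (≋-sym (P.+-identityˡ _))
  elementaryLeaf-value true  a false false = ≋-sym (P.+-identityʳ _)
  elementaryLeaf-value false a true  true  = ≋-sym (P.+-identityʳ _)
  elementaryLeaf-value false a true  false = ≋-trans const-0 (≋-sym (P.+-identityˡ _))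
  elementaryLeaf-value false a false true  = ≋-sym (P.+-identityˡ _)
  elementaryLeaf-value false a false false = ≋-sym (P.+-identityʳ _)

  value-add : ∀ F G → valueᶠ (add F G) ≋ valueᶠ F + valueᶠ G
  value-add F G = ≋-reflexive (+-def (valueᶠ F) (valueᶠ G))

  value-mul : ∀ F G → valueᶠ (mul F G) ≋ valueᶠ F * valueᶠ G
  value-mul F G = ≋-reflexive (*-def (valueᶠ F) (valueᶠ G))

  productFormula-value : ∀ k w i j → length w ≤ 2 ℕ.^ k → valueᶠ (productFormula k w i j) ≋ product ⟪ w ⟫ i j
  productFormula-value zero    []            i j _        = identityLeaf-value i j
  productFormula-value zero    ((b , a) ∷ []) i j (s≤s le) = ≋-trans (elementaryLeaf-value b a i j)
    (≋-sym (entry (M.*-identityʳ (elementary b (affine a))) i j))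
  productFormula-value zero    (_ ∷ _ ∷ _)   i j (s≤s ())
  productFormula-value (suc k) w             i j le = begin
    valueᶠ (productFormula (suc k) w i j)
      ≈⟨ ≋-trans (value-add (mul (F i true) (G true j)) (mul (F i false) (G false j))) (+-cong (value-mul (F i true) (G true j)) (value-mul (F i false) (G false j))) ⟩
    valueᶠ (F i true) * valueᶠ (G true j) + valueᶠ (F i false) * valueᶠ (G false j)
      ≈⟨ +-cong (*-cong (left true) (right true)) (*-cong (left false) (right false)) ⟩
    (product ⟪ u ⟫ *ᴹ product ⟪ v ⟫) i j
      ≈⟨ entry (product-++ ⟪ u ⟫ ⟪ v ⟫) i j ⟨
    product (⟪ u ⟫ ++ ⟪ v ⟫) i j
      ≈⟨ ≋-reflexive (cong (λ x → product x i j) (≡.trans (≡.sym (Listₚ.map-++ _ u v)) (cong ⟪_⟫ (Listₚ.take++drop≡id (2 ℕ.^ k) w)))) ⟩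
    product ⟪ w ⟫ i j ∎
    where
    open import Relation.Binary.Reasoning.Setoid ≋-setoid
    u = take (2 ℕ.^ k) w
    v = drop (2 ℕ.^ k) w
    F = productFormula k u
    G = productFormula k v
    left : ∀ t → valueᶠ (F i t) ≋ product ⟪ u ⟫ i t
    left t = productFormula-value k u i t (ℕₚ.≤-trans (ℕₚ.≤-reflexive (Listₚ.length-take (2 ℕ.^ k) w)) (ℕₚ.m⊓n≤m (2 ℕ.^ k) (length w)))
    right : ∀ t → valueᶠ (G t j) ≋ product ⟪ v ⟫ t j
    right t = productFormula-value k v t j (ℕₚ.≤-trans (ℕₚ.≤-reflexive (Listₚ.length-drop (2 ℕ.^ k) w))
      (ℕₚ.m≤n+o⇒m∸n≤o (length w) (2 ℕ.^ k) (ℕₚ.≤-trans le (ℕₚ.≤-reflexive (cong (2 ℕ.^ k ℕ.+_) (ℕₚ.+-identityʳ (2 ℕ.^ k)))))))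

  -- With 1 added the recursion is exact: the three gates of a level together with this 1 supply the
  -- increments of the four subformulas.
  productFormula-size : ∀ k w i j → 1 ℕ.+ sizeᶠ (productFormula k w i j) ≤ 2 ℕ.* (2 ℕ.^ k ℕ.* 2 ℕ.^ k)
  productFormula-size zero    []      i j = ℕₚ.≤-refl
  productFormula-size zero    (x ∷ w) i j = ℕₚ.≤-refl
  productFormula-size (suc k) w       i j = ℕₚ.≤-trans (ℕₚ.≤-reflexive (arrange _ _ _ _))
    (ℕₚ.≤-trans (ℕₚ.+-mono-≤ (ℕₚ.+-mono-≤ (productFormula-size k _ i true) (productFormula-size k _ true j))
                             (ℕₚ.+-mono-≤ (productFormula-size k _ i false) (productFormula-size k _ false j)))
      (ℕₚ.≤-reflexive (collect′ (2 ℕ.^ k))))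
    where
    arrange : ∀ a b c d → 1 ℕ.+ (1 ℕ.+ (1 ℕ.+ a ℕ.+ b) ℕ.+ (1 ℕ.+ c ℕ.+ d)) ≡ (1 ℕ.+ a ℕ.+ (1 ℕ.+ b)) ℕ.+ (1 ℕ.+ c ℕ.+ (1 ℕ.+ d))
    arrange = solve-∀
    collect′ : ∀ x → (2 ℕ.* (x ℕ.* x) ℕ.+ 2 ℕ.* (x ℕ.* x)) ℕ.+ (2 ℕ.* (x ℕ.* x) ℕ.+ 2 ℕ.* (x ℕ.* x)) ≡ 2 ℕ.* (2 ℕ.* x ℕ.* (2 ℕ.* x))
    collect′ = solve-∀

  scaleAffine : ℂ → AffineWord → AffineWord
  scaleAffine c = map (λ (b , a) → b , scaleᵃ c a)

  product-cong : ∀ {A : Set} (f g : A → Bool × Poly) xs → (∀ x → proj₁ (f x) ≡ proj₁ (g x) × proj₂ (f x) ≋ proj₂ (g x)) →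
                 ∀ π → total π (map f xs) ≋ total π (map g xs)
  product-cong f g []       eq π = ≋-refl
  product-cong f g (x ∷ xs) eq π with f x | g x | eq x
  ... | b , p | .b , q | refl , e = +-cong (when-cong (does (b Boolₚ.≟ π)) (*-cong e (product-cong f g xs eq (not π)))) (product-cong f g xs eq π)

  -- Opaque, because otherwise the type checker expands powers with a literal exponent.
  opaque
    formulaExponent : ℕ
    formulaExponent = 8

    formulaExponent-def : formulaExponent ≡ 8
    formulaExponent-def = refl

  formulaBound : ℕ → ℕ
  formulaBound N = (2 ℕ.+ N) ℕ.^ formulaExponent

  alt-formula : ∀ (w : AffineWord) D → ∃ λ F → sizeᶠ F ≤ formulaBound (D ℕ.+ length w) × valueᶠ F ≋ alt true D ⟪ w ⟫
  alt-formula w D = F weights 0 , F-size , ≋-trans (combine-nodes true ⟪ w ⟫ n weights 0 w<n (λ i → valueᶠ (A i)) A-value (λ q j → valueᶠ (F q j))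
      (λ _ → const-0) (λ c q j → ≋-trans (value-add (mul (leaf (rat c , [])) (A j)) (F q (suc j))) (P.+-congʳ (value-mul (leaf (rat c , [])) (A j)))))
      (pick-degree D n L (s≤s (ℕₚ.m≤m+n D _)) (λ d → alt true d ⟪ w ⟫))
    where
    -- The range of degrees has to contain all degrees up to the length of the word, for the sum to
    -- be complete, and D, which may exceed that length.
    n = suc (D ℕ.+ length w)
    w<n : length ⟪ w ⟫ < n
    w<n = s≤s (ℕₚ.≤-trans (ℕₚ.≤-reflexive (Listₚ.length-map _ w)) (ℕₚ.m≤n+m _ D))
    L = lagrange D n
    open Lagrange L
    above = powerAbove n (s≤s z≤n)
    k = proj₁ above
    A : ℕ → Formula
    A i = add (productFormula k (scaleAffine (rat (node i)) w) true true) (productFormula k (scaleAffine (rat (node i)) w) true false)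
    F : List ℚ → ℕ → Formula
    F []      j = leaf (0ℂ , [])
    F (c ∷ q) j = add (mul (leaf (rat c , [])) (A j)) (F q (suc j))
    A-value : ∀ i → valueᶠ (A i) ≋ total true (scaleWord (q̂ (node i)) ⟪ w ⟫)
    A-value i = ≋-trans (value-add (productFormula k v true true) (productFormula k v true false))
      (≋-trans (+-cong (productFormula-value k v true true len) (productFormula-value k v true false len))
        (≋-trans (product-total true ⟪ v ⟫)
          (≋-trans (≋-reflexive (cong (total true) (≡.sym (Listₚ.map-∘ w))))
            (≋-trans (product-cong _ _ w (λ (b , a) → refl , affine-scale (rat (node i)) a) true)
              (≋-reflexive (cong (total true) (Listₚ.map-∘ w)))))))
      where
      v = scaleAffine (rat (node i)) w
      len : length v ≤ 2 ℕ.^ k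
      len = ℕₚ.≤-trans (ℕₚ.≤-reflexive (Listₚ.length-map _ w)) (ℕₚ.≤-trans (ℕₚ.≤-trans (ℕₚ.m≤n+m (length w) D) (ℕₚ.n≤1+n _)) (proj₁ (proj₂ above)))
    cell = 2 ℕ.* (2 ℕ.^ k ℕ.* 2 ℕ.^ k)
    A-size : ∀ i → sizeᶠ (A i) ≤ cell ℕ.+ cell
    A-size i = ℕₚ.≤-trans (ℕₚ.+-monoʳ-≤ (1 ℕ.+ sizeᶠ (productFormula k (scaleAffine (rat (node i)) w) true true)) (ℕₚ.n≤1+n _))
      (ℕₚ.+-mono-≤ (productFormula-size k (scaleAffine (rat (node i)) w) true true) (productFormula-size k (scaleAffine (rat (node i)) w) true false))
    sizes : ∀ q j → sizeᶠ (F q j) ≤ length q ℕ.* (3 ℕ.+ (cell ℕ.+ cell)) ℕ.+ 1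
    sizes []      j = ℕₚ.≤-refl
    sizes (c ∷ q) j = ℕₚ.≤-trans (ℕₚ.+-mono-≤ (ℕₚ.+-monoʳ-≤ 3 (A-size j)) (sizes q (suc j)))
      (ℕₚ.≤-reflexive (≡.sym (ℕₚ.+-assoc (3 ℕ.+ (cell ℕ.+ cell)) (length q ℕ.* (3 ℕ.+ (cell ℕ.+ cell))) 1)))
    cell≤ : cell ≤ 2 ℕ.* ((2 ℕ.* n) ℕ.* (2 ℕ.* n))
    cell≤ = ℕₚ.*-monoʳ-≤ 2 (ℕₚ.*-mono-≤ (proj₂ (proj₂ above)) (proj₂ (proj₂ above)))
    -- The size is at most 16 (1 + n)³, and 16 ≤ (1 + n)⁴ since n ≥ 1; the last of the eight powers
    -- is slack.
    polynomial : ∀ n → 1 ≤ n → suc n ℕ.* (3 ℕ.+ (2 ℕ.* ((2 ℕ.* n) ℕ.* (2 ℕ.* n)) ℕ.+ 2 ℕ.* ((2 ℕ.* n) ℕ.* (2 ℕ.* n)))) ℕ.+ 1 ≤ (1 ℕ.+ n) ℕ.^ formulaExponent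
    polynomial n 1≤n = begin
      suc n ℕ.* (3 ℕ.+ (2 ℕ.* ((2 ℕ.* n) ℕ.* (2 ℕ.* n)) ℕ.+ 2 ℕ.* ((2 ℕ.* n) ℕ.* (2 ℕ.* n)))) ℕ.+ 1
        ≤⟨ ℕₚ.m≤m+n _ _ ⟩
      suc n ℕ.* (3 ℕ.+ (2 ℕ.* ((2 ℕ.* n) ℕ.* (2 ℕ.* n)) ℕ.+ 2 ℕ.* ((2 ℕ.* n) ℕ.* (2 ℕ.* n)))) ℕ.+ 1 ℕ.+ (n ℕ.+ (suc n ℕ.* (12 ℕ.+ 32 ℕ.* n)))
        ≡⟨ expand n ⟩
      16 ℕ.* (suc n ℕ.* suc n ℕ.* suc n)
        ≤⟨ ℕₚ.*-monoˡ-≤ (suc n ℕ.* suc n ℕ.* suc n) (ℕₚ.^-monoˡ-≤ 4 {2} {suc n} (s≤s 1≤n)) ⟩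
      suc n ℕ.^ 4 ℕ.* (suc n ℕ.* suc n ℕ.* suc n)
        ≤⟨ ℕₚ.m≤m*n _ (suc n) ⟩
      suc n ℕ.^ 4 ℕ.* (suc n ℕ.* suc n ℕ.* suc n) ℕ.* suc n
        ≡⟨ eighth (suc n) ⟩
      suc n ℕ.^ 8
        ≡⟨ cong (suc n ℕ.^_) formulaExponent-def ⟨
      suc n ℕ.^ formulaExponent ∎
      where
      open ℕₚ.≤-Reasoning
      expand : ∀ n → suc n ℕ.* (3 ℕ.+ (2 ℕ.* ((2 ℕ.* n) ℕ.* (2 ℕ.* n)) ℕ.+ 2 ℕ.* ((2 ℕ.* n) ℕ.* (2 ℕ.* n)))) ℕ.+ 1 ℕ.+ (n ℕ.+ (suc n ℕ.* (12 ℕ.+ 32 ℕ.* n))) ≡ 16 ℕ.* (suc n ℕ.* suc n ℕ.* suc n)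
      expand = solve-∀
      eighth : ∀ m → m ℕ.* (m ℕ.* (m ℕ.* (m ℕ.* 1))) ℕ.* (m ℕ.* m ℕ.* m) ℕ.* m ≡ m ℕ.* (m ℕ.* (m ℕ.* (m ℕ.* (m ℕ.* (m ℕ.* (m ℕ.* (m ℕ.* 1)))))))
      eighth = solve-∀
    F-size : sizeᶠ (F weights 0) ≤ formulaBound (D ℕ.+ length w)
    F-size = ℕₚ.≤-trans (sizes weights 0) (ℕₚ.≤-trans (ℕₚ.+-monoˡ-≤ 1 (ℕₚ.*-mono-≤ short (ℕₚ.+-monoʳ-≤ 3 (ℕₚ.+-mono-≤ cell≤ cell≤))))
      (polynomial n (s≤s z≤n)))

-- Linear representations of formulas and odd powers of their transition matrices.

module Representations where

  open import Defs hiding (interchange; scaled)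
  open Reals using (ℂ-ring)
  open Polynomials
  open Components
  open Sources using (linear-parity; component-parity)
  open Sums
  open import Data.Nat as ℕ using (ℕ; zero; suc; _≤_; _<_; z≤n; s≤s; ⌊_/2⌋; ⌈_/2⌉)
  import Data.Nat.Properties as ℕₚ
  open import Data.Nat.Tactic.RingSolver using (solve-∀)
  open import Data.Bool using (Bool; true; false)
  open import Data.List using (List; []; _∷_; _++_; map; length)
  import Data.List.Properties as Listₚ
  open import Data.List.Relation.Unary.All using (All; []; _∷_)
  open import Data.Product using (_,_; proj₂)
  open import Data.Sum using (_⊎_; inj₁; inj₂)
  open import Function using (_∘_)
  open import Relation.Nullary using (¬_)
  open import Relation.Binary.PropositionalEquality as ≡ using (_≡_; refl; cong; cong₂)
  open import Algebra.Bundles using (CommutativeRing)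

  private
    module P = CommutativeRing Poly-ring
    module K = CommutativeRing ℂ-ring
  open RingSums Poly-ring

  ∑ˡ : ∀ {A : Set} → List A → (A → LinearForm) → LinearForm
  ∑ˡ []       f = []
  ∑ˡ (x ∷ xs) f = f x ++ ∑ˡ xs f

  linear-∑ : ∀ {A : Set} xs (f : A → LinearForm) → linear (∑ˡ xs f) ≋ ∑ xs (λ x → linear (f x))
  linear-∑ []       f = ≋-refl
  linear-∑ (x ∷ xs) f = ≋-trans (linear-++ (f x) (∑ˡ xs f)) (P.+-congˡ (linear-∑ xs f))

  module _ {I : Set} (indices : List I) (μ : I → I → LinearForm) where

    step : (I → Poly) → I → Poly
    step x i = ∑ indices λ j → linear (μ i j) * x j

    steps : ℕ → (I → Poly) → I → Poly
    steps zero    x = x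
    steps (suc d) x = step (steps d x)

  -- A linear representation: the homogeneous component of degree d is λ μᵈ γ.
  record Representation (p : Poly) : Set₁ where
    field
      I       : Set
      indices : List I
      λ′ γ    : I → ℂ
      μ       : I → I → LinearForm
      represents : ∀ d → component d p ≋ ∑ indices (λ i → const (λ′ i) * steps indices μ d (const ∘ γ) i)

    state : ℕ → I → Poly
    state d = steps indices μ d (const ∘ γ)

  -- An automaton with two states: from `true` a run either stops at once with output c or reads ℓ
  -- and stops in `false` with output 1.
  leaf-representation : ∀ a → Representation (affine a)
  leaf-representation (c , ℓ) = record
    { I = Bool ; indices = true ∷ false ∷ []
    ; λ′ = λ { true → 1ℂ ; false → 0ℂ }
    ; γ  = γ
    ; μ  = μ
    ; represents = λ where
        zero          → ≋-trans (split 0) (≋-trans (+-cong ≋-refl (≋-reflexive (component-parity {true} {0} (linear ℓ) (linear-parity ℓ) refl)))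
                          (≋-trans (P.+-identityʳ _) (≋-sym (read (const c) (const 1ℂ)))))
        (suc zero)    → ≋-trans (split 1) (≋-trans (+-cong ≋-refl (≋-reflexive (component-all (ones ℓ))))
                          (≋-trans (P.+-identityˡ _) (≋-sym (≋-trans (read _ _)
                            (≋-trans (+-cong (P.zeroˡ _) (P.+-identityʳ _)) (≋-trans (P.+-identityˡ _) (P.*-identityʳ _)))))))
        (suc (suc d)) → ≋-trans (split (suc (suc d))) (≋-trans (+-cong {component (suc (suc d)) (const c)} {[]} ≋-refl (≋-reflexive (component-none (not-two ℓ))))
                          (≋-trans (P.+-identityʳ []) (≋-sym (≋-trans (read _ _) (≋-trans (+-cong (P.zeroˡ _) (≋-trans (P.+-congʳ (vanish (steps (true ∷ false ∷ []) μ d (const ∘ γ))))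
                            (P.+-identityʳ []))) (P.+-identityʳ []))))))
    }
    where
    γ : Bool → ℂ
    γ true  = c
    γ false = 1ℂ
    μ : Bool → Bool → LinearForm
    μ true  false = ℓ
    μ _     _     = []
    split : ∀ d → component d (affine (c , ℓ)) ≋ component d (const c) + component d (linear ℓ)
    split d = ≋-trans (component-cong d {affine (c , ℓ)} {const c + linear ℓ} (≋-reflexive (+-def (const c) (linear ℓ)))) (component-+ d (const c) (linear ℓ))
    read : ∀ p q → const 1ℂ * p + (const 0ℂ * q + []) ≋ p
    read p q = ≋-trans (+-cong (P.*-identityˡ p) (≋-trans (P.+-identityʳ _) (≋-trans (P.*-congʳ const-0) (P.zeroˡ q)))) (P.+-identityʳ p)
    ones : ∀ ℓ → All (λ t → length (proj₂ t) ≡ 1) (linear ℓ)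
    ones []      = []
    ones (_ ∷ ℓ) = refl ∷ ones ℓ
    not-two : ∀ {d} ℓ → All (λ t → ¬ (length (proj₂ t) ≡ suc (suc d))) (linear ℓ)
    not-two []      = []
    not-two (_ ∷ ℓ) = (λ ()) ∷ not-two ℓ
    vanish : ∀ (x : Bool → Poly) → linear ℓ * (∑ (true ∷ false ∷ []) λ j → linear (μ false j) * x j) ≋ []
    vanish x = ≋-trans (P.*-congˡ {linear ℓ} (≋-trans (+-cong (P.zeroˡ (x true)) (P.+-congʳ (P.zeroˡ (x false)))) (≋-trans (P.+-identityˡ _) (P.+-identityˡ [])))) (P.zeroʳ (linear ℓ))

  module _ {A B : Set} where
    both : List A → List B → List (A ⊎ B)
    both xs ys = map inj₁ xs ++ map inj₂ ys

    ∑-both : ∀ xs ys (f : A ⊎ B → Poly) → ∑ (both xs ys) f ≋ ∑ xs (f ∘ inj₁) + ∑ ys (f ∘ inj₂)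
    ∑-both xs ys f = ≋-trans (∑-++ (map inj₁ xs) (map inj₂ ys) f) (+-cong (∑-map inj₁ xs f) (∑-map inj₂ ys f))

    both-length : ∀ xs ys → length (both xs ys) ≡ length xs ℕ.+ length ys
    both-length xs ys = ≡.trans (Listₚ.length-++ (map inj₁ xs)) (cong₂ ℕ._+_ (Listₚ.length-map inj₁ xs) (Listₚ.length-map inj₂ ys))

  module Combine {p q : Poly} (R : Representation p) (S : Representation q) where
    private
      module R = Representation R
      module S = Representation S

    sum : Representation (p +ᵖ q)
    sum = record
      { I = R.I ⊎ S.I ; indices = both R.indices S.indices
      ; λ′ = λ { (inj₁ i) → R.λ′ i ; (inj₂ j) → S.λ′ j }
      ; γ  = γ ; μ = μ
      ; represents = λ d → ≋-trans (component-cong d {p +ᵖ q} {p + q} (≋-reflexive (+-def p q))) (≋-trans (component-+ d p q)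
          (≋-trans (+-cong (R.represents d) (S.represents d)) (≋-sym (≋-trans (∑-both R.indices S.indices _)
            (+-cong (∑-cong R.indices λ i → P.*-congˡ (left d i)) (∑-cong S.indices λ j → P.*-congˡ (right d j)))))))
      }
      where
      γ : R.I ⊎ S.I → ℂ
      γ (inj₁ i) = R.γ i
      γ (inj₂ j) = S.γ j
      μ : R.I ⊎ S.I → R.I ⊎ S.I → LinearForm
      μ (inj₁ i) (inj₁ j) = R.μ i j
      μ (inj₂ i) (inj₂ j) = S.μ i j
      μ _        _        = []
      states : ℕ → R.I ⊎ S.I → Poly
      states d = steps (both R.indices S.indices) μ d (const ∘ γ)
      left : ∀ d i → states d (inj₁ i) ≋ R.state d i
      left zero    i = ≋-refl
      left (suc d) i = ≋-trans (∑-both R.indices S.indices _) (≋-trans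
        (+-cong (∑-cong R.indices λ j → P.*-congˡ (left d j)) (∑-zero S.indices λ j → P.zeroˡ _)) (P.+-identityʳ _))
      right : ∀ d j → states d (inj₂ j) ≋ S.state d j
      right zero    i = ≋-refl
      right (suc d) i = ≋-trans (∑-both R.indices S.indices _) (≋-trans
        (+-cong (∑-zero R.indices λ j → P.zeroˡ _) (∑-cong S.indices λ j → P.*-congˡ (right d j))) (P.+-identityˡ _))

    -- Runs of the first automaton followed by runs of the second. Every transition has to read a
    -- linear form, so there is no silent step between the two: a crossing merges the output of the
    -- first and the start weights of the second with the first transition in the second. Runs that
    -- read nothing in the second are accounted for by its constant term, which is multiplied into
    -- `γ`.
    product : Representation (p *ᵖ q)
    product = record
      { I = R.I ⊎ S.I ; indices = both R.indices S.indices
      ; λ′ = λ { (inj₁ i) → R.λ′ i ; (inj₂ j) → 0ℂ }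
      ; γ  = γ ; μ = μ
      ; represents = λ d → ≋-trans (component-cong d {p *ᵖ q} {p * q} (≋-reflexive (*-def p q))) (≋-trans (component-* p q d)
          (≋-trans (convolution-cong R.represents (λ b → ≋-refl) d) (≋-trans (convolution-∑ R.indices (const ∘ R.λ′) (λ i a → R.state a i) d)
            (≋-sym (≋-trans (∑-both R.indices S.indices _) (≋-trans
              (+-cong (∑-cong R.indices λ i → P.*-congˡ (left d i)) (∑-zero S.indices λ j → ≋-trans (P.*-congʳ const-0) (P.zeroˡ _)))
              (P.+-identityʳ _)))))))
      }
      where
      module KS = RingSums ℂ-ring
      Q : ℕ → Poly
      Q b = component b q
      convolution-∑ : ∀ {A : Set} (xs : List A) (c : A → Poly) (u : A → ℕ → Poly) d →
        convolution (λ a → ∑ xs (λ j → c j * u j a)) Q d ≋ ∑ xs (λ j → c j * convolution (u j) Q d)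
      convolution-∑ xs c u zero    = ≋-trans (∑-*ʳ xs _ (Q 0)) (∑-cong xs λ j → P.*-assoc (c j) (u j 0) (Q 0))
      convolution-∑ xs c u (suc d) = ≋-trans (+-cong (≋-trans (∑-*ʳ xs _ (Q (suc d))) (∑-cong xs λ j → P.*-assoc (c j) (u j 0) (Q (suc d))))
                                                     (convolution-∑ xs c (λ j a → u j (suc a)) d))
        (≋-trans (≋-sym (∑-+ xs _ _)) (∑-cong xs λ j → ≋-sym (P.distribˡ (c j) _ _)))
      const-∑ : ∀ {A : Set} xs (f : A → ℂ) → const (KS.∑ xs f) ≋ ∑ xs (const ∘ f)
      const-∑ []       f = const-0
      const-∑ (x ∷ xs) f = ≋-trans (const-+ (f x) (KS.∑ xs f)) (P.+-congˡ (const-∑ xs f))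
      γ : R.I ⊎ S.I → ℂ
      γ (inj₁ i) = R.γ i K.* KS.∑ S.indices λ j → S.λ′ j K.* S.γ j
      γ (inj₂ j) = S.γ j
      μ : R.I ⊎ S.I → R.I ⊎ S.I → LinearForm
      μ (inj₁ i) (inj₁ j) = R.μ i j
      μ (inj₁ i) (inj₂ k) = ∑ˡ S.indices λ l → scaleˡ (R.γ i K.* S.λ′ l) (S.μ l k)
      μ (inj₂ i) (inj₂ j) = S.μ i j
      μ (inj₂ i) (inj₁ j) = []
      states : ℕ → R.I ⊎ S.I → Poly
      states d = steps (both R.indices S.indices) μ d (const ∘ γ)
      right : ∀ d j → states d (inj₂ j) ≋ S.state d j
      right zero    i = ≋-refl
      right (suc d) i = ≋-trans (∑-both R.indices S.indices _) (≋-trans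
        (+-cong (∑-zero R.indices λ j → P.zeroˡ _) (∑-cong S.indices λ j → P.*-congˡ (right d j))) (P.+-identityˡ _))
      initial : ∀ i → const (γ (inj₁ i)) ≋ const (R.γ i) * Q 0
      initial i = ≋-trans (const-* (R.γ i) _) (P.*-congˡ (≋-trans (const-∑ S.indices _)
        (≋-trans (∑-cong S.indices λ j → const-* (S.λ′ j) (S.γ j)) (≋-sym (S.represents 0)))))
      bridge : ∀ d i → ∑ S.indices (λ k → linear (μ (inj₁ i) (inj₂ k)) * S.state d k) ≋ const (R.γ i) * Q (suc d)
      bridge d i = begin
        ∑ S.indices (λ k → linear (μ (inj₁ i) (inj₂ k)) * S.state d k)
          ≈⟨ ∑-cong S.indices (λ k → ≋-trans (P.*-congʳ (linear-∑ S.indices _)) (∑-*ʳ S.indices _ _)) ⟩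
        ∑ S.indices (λ k → ∑ S.indices λ l → linear (scaleˡ (R.γ i K.* S.λ′ l) (S.μ l k)) * S.state d k)
          ≈⟨ ∑-swap S.indices S.indices _ ⟩
        ∑ S.indices (λ l → ∑ S.indices λ k → linear (scaleˡ (R.γ i K.* S.λ′ l) (S.μ l k)) * S.state d k)
          ≈⟨ ∑-cong S.indices (λ l → ≋-trans (∑-cong S.indices λ k → rescale (R.γ i) (S.λ′ l) (S.μ l k) (S.state d k))
               (≋-trans (≋-sym (∑-*ˡ S.indices (const (R.γ i)) _)) (P.*-congˡ (≋-sym (∑-*ˡ S.indices (const (S.λ′ l)) _))))) ⟩
        ∑ S.indices (λ l → const (R.γ i) * (const (S.λ′ l) * S.state (suc d) l))
          ≈⟨ ∑-*ˡ S.indices (const (R.γ i)) _ ⟨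
        const (R.γ i) * ∑ S.indices (λ l → const (S.λ′ l) * S.state (suc d) l)
          ≈⟨ P.*-congˡ (S.represents (suc d)) ⟨
        const (R.γ i) * Q (suc d) ∎
        where
        open import Relation.Binary.Reasoning.Setoid ≋-setoid
        rescale : ∀ a b ℓ x → linear (scaleˡ (a K.* b) ℓ) * x ≋ const a * (const b * (linear ℓ * x))
        rescale a b ℓ x = ≋-trans (P.*-congʳ (≋-trans (linear-scale (a K.* b) ℓ) (P.*-congʳ (const-* a b))))
          (≋-trans (P.*-assoc _ _ _) (P.*-assoc _ _ _))
      left : ∀ d i → states d (inj₁ i) ≋ convolution (λ a → R.state a i) Q d
      left zero    i = initial i
      left (suc d) i = ≋-trans (∑-both R.indices S.indices _) (≋-trans
        (+-cong (≋-trans (∑-cong R.indices λ j → P.*-congˡ (left d j)) (≋-sym (convolution-∑ R.indices (λ j → linear (R.μ i j)) (λ j a → R.state a j) d)))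
                (≋-trans (∑-cong S.indices λ k → P.*-congˡ (right d k)) (bridge d i)))
        (P.+-comm _ _))

  represent : ∀ F → Representation (valueᶠ F)
  represent (leaf a)  = leaf-representation a
  represent (add F G) = Combine.sum (represent F) (represent G)
  represent (mul F G) = Combine.product (represent F) (represent G)

  dimension : ∀ {p} → Representation p → ℕ
  dimension R = length (Representation.indices R)

  represent-dimension : ∀ F → dimension (represent F) ≤ 2 ℕ.* sizeᶠ F
  represent-dimension (leaf a)  = ℕₚ.≤-refl
  represent-dimension (add F G) = ℕₚ.≤-trans (ℕₚ.≤-reflexive (both-length (Representation.indices (represent F)) _))
      (ℕₚ.≤-trans (ℕₚ.+-mono-≤ (represent-dimension F) (represent-dimension G)) (ℕₚ.≤-trans (ℕₚ.≤-reflexive (≡.sym (ℕₚ.*-distribˡ-+ 2 (sizeᶠ F) (sizeᶠ G)))) (ℕₚ.*-monoʳ-≤ 2 (ℕₚ.n≤1+n _))))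
  represent-dimension (mul F G) = ℕₚ.≤-trans (ℕₚ.≤-reflexive (both-length (Representation.indices (represent F)) _))
      (ℕₚ.≤-trans (ℕₚ.+-mono-≤ (represent-dimension F) (represent-dimension G)) (ℕₚ.≤-trans (ℕₚ.≤-reflexive (≡.sym (ℕₚ.*-distribˡ-+ 2 (sizeᶠ F) (sizeᶠ G)))) (ℕₚ.*-monoʳ-≤ 2 (ℕₚ.n≤1+n _))))

  sumOver : ∀ {A : Set} → List A → (A → IHL) → IHL
  sumOver []       f = leaf []
  sumOver (x ∷ xs) f = add (f x) (sumOver xs f)

  sumOver-value : ∀ {A : Set} (xs : List A) f → valueⁱ (sumOver xs f) ≋ ∑ xs (valueⁱ ∘ f)
  sumOver-value []       f = ≋-refl
  sumOver-value (x ∷ xs) f = ≋-trans (≋-reflexive (+-def (valueⁱ (f x)) (valueⁱ (sumOver xs f)))) (P.+-congˡ (sumOver-value xs f))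

  sumOver-size : ∀ {A : Set} (xs : List A) f {S} → (∀ x → sizeⁱ (f x) ≤ S) → sizeⁱ (sumOver xs f) ≤ 1 ℕ.+ length xs ℕ.* (1 ℕ.+ S)
  sumOver-size []       f h = ℕₚ.≤-refl
  sumOver-size (x ∷ xs) f {S} h = s≤s (ℕₚ.≤-trans (ℕₚ.+-mono-≤ (h x) (sumOver-size xs f h)) (ℕₚ.≤-reflexive (ℕₚ.+-suc S (length xs ℕ.* (1 ℕ.+ S)))))

  scaleⁱ : ℂ → IHL → IHL
  scaleⁱ c (leaf ℓ)     = leaf (scaleˡ c ℓ)
  scaleⁱ c (add F G)    = add (scaleⁱ c F) (scaleⁱ c G)
  scaleⁱ c (mul₃ F G H) = mul₃ (scaleⁱ c F) G H

  scaleⁱ-size : ∀ c F → sizeⁱ (scaleⁱ c F) ≡ sizeⁱ F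
  scaleⁱ-size c (leaf ℓ)     = refl
  scaleⁱ-size c (add F G)    = cong₂ (λ a b → suc (a ℕ.+ b)) (scaleⁱ-size c F) (scaleⁱ-size c G)
  scaleⁱ-size c (mul₃ F G H) = cong (λ a → suc (a ℕ.+ sizeⁱ G ℕ.+ sizeⁱ H)) (scaleⁱ-size c F)

  mul₃-value : ∀ F G H → valueⁱ (mul₃ F G H) ≋ valueⁱ F * valueⁱ G * valueⁱ H
  mul₃-value F G H = ≋-reflexive (≡.trans (*-def (valueⁱ F *ᵖ valueⁱ G) (valueⁱ H)) (cong (_* valueⁱ H) (*-def (valueⁱ F) (valueⁱ G))))

  scaleⁱ-value : ∀ c F → valueⁱ (scaleⁱ c F) ≋ const c * valueⁱ F
  scaleⁱ-value c (leaf ℓ)     = linear-scale c ℓ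
  scaleⁱ-value c (add F G)    = ≋-trans (≋-reflexive (+-def (valueⁱ (scaleⁱ c F)) (valueⁱ (scaleⁱ c G))))
    (≋-trans (+-cong (scaleⁱ-value c F) (scaleⁱ-value c G)) (≋-trans (≋-sym (P.distribˡ (const c) _ _))
      (P.*-congˡ (≋-reflexive (≡.sym (+-def (valueⁱ F) (valueⁱ G)))))))
  scaleⁱ-value c (mul₃ F G H) = ≋-trans (mul₃-value (scaleⁱ c F) G H) (≋-trans (P.*-congʳ (P.*-congʳ (scaleⁱ-value c F)))
    (≋-trans (≋-trans (P.*-congʳ (P.*-assoc (const c) _ _)) (P.*-assoc (const c) _ _)) (P.*-congˡ (≋-sym (mul₃-value F G H)))))

  module OddPowers {I : Set} (indices : List I) (μ : I → I → LinearForm) where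

    -- oddPower k r is the matrix μ^(2r+1), where 2r+1 = (2a+1) + (2b+1) + 1 with a + b + 1 = r.
    oddPower : ℕ → ℕ → I → I → IHL
    oddPower k       zero    u z = leaf (μ u z)
    -- A default value: the condition r < 2^k excludes this case, and a leaf respects the size
    -- bound.
    oddPower zero    (suc r) u z = leaf (μ u z)
    oddPower (suc k) (suc r) u z = sumOver indices λ v → sumOver indices λ w →
      mul₃ (oddPower k ⌊ r /2⌋ u v) (oddPower k ⌈ r /2⌉ v w) (leaf (μ w z))

    apply : (I → I → IHL) → (I → Poly) → I → Poly
    apply G x u = ∑ indices λ z → valueⁱ (G u z) * x z

    steps-+ : ∀ m n x → steps indices μ (m ℕ.+ n) x ≡ steps indices μ m (steps indices μ n x)
    steps-+ zero    n x = refl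
    steps-+ (suc m) n x = cong (step indices μ) (steps-+ m n x)

    apply-oddPower : ∀ k r → r < 2 ℕ.^ k → ∀ x u → apply (oddPower k r) x u ≋ steps indices μ (suc (r ℕ.+ r)) x u
    apply-oddPower k       zero    _  x u = ≋-refl
    apply-oddPower zero    (suc r) (s≤s ()) x u
    apply-oddPower (suc k) (suc r) lt x u = begin
      ∑ indices (λ z → valueⁱ (oddPower (suc k) (suc r) u z) * x z)
        ≈⟨ ∑-cong indices (λ z → ≋-trans (P.*-congʳ (≋-trans (sumOver-value indices _) (∑-cong indices λ v → ≋-trans (sumOver-value indices _)
             (∑-cong indices λ w → mul₃-value (A u v) (B v w) (leaf (μ w z)))))) (≋-trans (∑-*ʳ indices _ (x z)) (∑-cong indices λ v → ∑-*ʳ indices _ (x z)))) ⟩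
      ∑ indices (λ z → ∑ indices λ v → ∑ indices λ w → valueⁱ (A u v) * valueⁱ (B v w) * linear (μ w z) * x z)
        ≈⟨ ≋-trans (∑-swap indices indices _) (∑-cong indices λ v → ∑-swap indices indices _) ⟩
      ∑ indices (λ v → ∑ indices λ w → ∑ indices λ z → valueⁱ (A u v) * valueⁱ (B v w) * linear (μ w z) * x z)
        ≈⟨ ∑-cong indices (λ v → ≋-trans (∑-cong indices λ w → ≋-trans (∑-cong indices λ z → P.*-assoc _ (linear (μ w z)) (x z))
             (≋-trans (≋-sym (∑-*ˡ indices _ _)) (P.*-assoc _ _ _))) (≋-sym (∑-*ˡ indices _ _))) ⟩
      apply A (apply B (step indices μ x)) u
        ≈⟨ ∑-cong indices (λ v → P.*-congˡ (apply-oddPower k ⌈ r /2⌉ b< (step indices μ x) v)) ⟩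
      apply A (steps indices μ (suc (⌈ r /2⌉ ℕ.+ ⌈ r /2⌉)) (step indices μ x)) u
        ≈⟨ apply-oddPower k ⌊ r /2⌋ a< _ u ⟩
      steps indices μ (suc (⌊ r /2⌋ ℕ.+ ⌊ r /2⌋)) (steps indices μ (suc (⌈ r /2⌉ ℕ.+ ⌈ r /2⌉)) (steps indices μ 1 x)) u
        ≈⟨ ≋-reflexive (cong (λ y → y u) (≡.sym (≡.trans (steps-+ (suc (a ℕ.+ a)) (suc (b ℕ.+ b) ℕ.+ 1) x) (cong (steps indices μ (suc (a ℕ.+ a))) (steps-+ (suc (b ℕ.+ b)) 1 x))))) ⟩
      steps indices μ (suc (a ℕ.+ a) ℕ.+ (suc (b ℕ.+ b) ℕ.+ 1)) x u
        ≈⟨ ≋-reflexive (cong (λ d → steps indices μ d x u) (≡.trans (count a b) (cong (λ r → suc (suc r ℕ.+ suc r)) (ℕₚ.⌊n/2⌋+⌈n/2⌉≡n r)))) ⟩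
      steps indices μ (suc (suc r ℕ.+ suc r)) x u ∎
      where
      open import Relation.Binary.Reasoning.Setoid ≋-setoid
      a = ⌊ r /2⌋
      b = ⌈ r /2⌉
      A = oddPower k a
      B = oddPower k b
      count : ∀ a b → suc (a ℕ.+ a) ℕ.+ (suc (b ℕ.+ b) ℕ.+ 1) ≡ suc (suc (a ℕ.+ b) ℕ.+ suc (a ℕ.+ b))
      count = solve-∀
      b< : b < 2 ℕ.^ k
      b< = ℕₚ.≤-trans (s≤s (ℕₚ.⌊n/2⌋-mono {suc r} {2 ℕ.^ k ℕ.+ 2 ℕ.^ k ℕ.∸ 1} (ℕₚ.≤-pred (ℕₚ.≤-trans lt (ℕₚ.≤-reflexive (≡.trans (cong (2 ℕ.^ k ℕ.+_) (ℕₚ.+-identityʳ (2 ℕ.^ k))) (≡.sym (ℕₚ.m+[n∸m]≡n (ℕₚ.≤-trans (ℕₚ.m^n>0 2 k) (ℕₚ.m≤m+n _ _)))))))))) (half (2 ℕ.^ k) (ℕₚ.m^n>0 2 k))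
        where
        half : ∀ m → 1 ≤ m → suc ⌊ m ℕ.+ m ℕ.∸ 1 /2⌋ ≤ m
        half (suc m) _ = s≤s (ℕₚ.≤-trans (ℕₚ.≤-reflexive (cong ⌊_/2⌋ (ℕₚ.+-suc m m))) (ℕₚ.≤-reflexive (floor m)))
          where
          floor : ∀ m → ⌊ suc (m ℕ.+ m) /2⌋ ≡ m
          floor zero    = refl
          floor (suc m) = ≡.trans (cong (λ x → ⌊ suc (suc x) /2⌋) (ℕₚ.+-suc m m)) (cong suc (floor m))
      a< : a < 2 ℕ.^ k
      a< = ℕₚ.≤-<-trans (ℕₚ.⌊n/2⌋≤⌈n/2⌉ r) b<

    module _ (y : ℕ) (2≤y : 2 ≤ y) (small : length indices ≤ y) where

      1≤y^ : ∀ e → 1 ≤ y ℕ.^ e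
      1≤y^ e = ℕₚ.≤-trans (ℕₚ.≤-reflexive (≡.sym (ℕₚ.^-zeroˡ e))) (ℕₚ.^-monoˡ-≤ e (ℕₚ.≤-trans (s≤s z≤n) 2≤y))

      -- The left side is the size of a double sum over at most y indices with summands of size at
      -- most 2 + 2S. It is at most 8 y² S, and 8 ≤ y³, so one level of the recursion multiplies the
      -- size by at most y⁵.
      absorb : ∀ S → 1 ≤ S → 1 ℕ.+ y ℕ.* (2 ℕ.+ y ℕ.* (3 ℕ.+ 2 ℕ.* S)) ≤ y ℕ.^ 5 ℕ.* S
      absorb S 1≤S = begin
        1 ℕ.+ y ℕ.* (2 ℕ.+ y ℕ.* (3 ℕ.+ 2 ℕ.* S))
          ≤⟨ ℕₚ.+-mono-≤ (ℕₚ.*-mono-≤ (1≤y^ 2) 1≤S) (ℕₚ.*-monoʳ-≤ y (ℕₚ.+-mono-≤ (ℕₚ.*-monoʳ-≤ 2 (ℕₚ.*-mono-≤ (1≤y^ 1) 1≤S)) (ℕₚ.*-monoʳ-≤ y (ℕₚ.+-monoˡ-≤ (2 ℕ.* S) (ℕₚ.*-monoʳ-≤ 3 1≤S))))) ⟩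
        y ℕ.^ 2 ℕ.* S ℕ.+ y ℕ.* (2 ℕ.* (y ℕ.^ 1 ℕ.* S) ℕ.+ y ℕ.* (3 ℕ.* S ℕ.+ 2 ℕ.* S))
          ≡⟨ eq y S ⟩
        8 ℕ.* (y ℕ.^ 2 ℕ.* S)
          ≤⟨ ℕₚ.*-monoˡ-≤ (y ℕ.^ 2 ℕ.* S) (ℕₚ.^-monoˡ-≤ 3 2≤y) ⟩
        y ℕ.^ 3 ℕ.* (y ℕ.^ 2 ℕ.* S)
          ≡⟨ ≡.trans (≡.sym (ℕₚ.*-assoc (y ℕ.^ 3) (y ℕ.^ 2) S)) (cong (ℕ._* S) (≡.sym (ℕₚ.^-distribˡ-+-* y 3 2))) ⟩
        y ℕ.^ 5 ℕ.* S ∎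
        where
        open ℕₚ.≤-Reasoning
        eq : ∀ y S → y ℕ.* (y ℕ.* 1) ℕ.* S ℕ.+ y ℕ.* (2 ℕ.* (y ℕ.* 1 ℕ.* S) ℕ.+ y ℕ.* (3 ℕ.* S ℕ.+ 2 ℕ.* S)) ≡ 8 ℕ.* (y ℕ.* (y ℕ.* 1) ℕ.* S)
        eq = solve-∀

      bound : ℕ → ℕ
      bound k = (y ℕ.^ 5) ℕ.^ k

      1≤bound : ∀ k → 1 ≤ bound k
      1≤bound k = ℕₚ.≤-trans (1≤y^ (5 ℕ.* k)) (ℕₚ.≤-reflexive (≡.sym (ℕₚ.^-*-assoc y 5 k)))

      double-sum : ∀ {A : Set} (xs : List A) {B : Set} (ys : List B) (f : A → B → IHL) {S} → length xs ≤ y → length ys ≤ y →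
                   (∀ u v → sizeⁱ (f u v) ≤ 2 ℕ.+ 2 ℕ.* S) → sizeⁱ (sumOver xs λ u → sumOver ys (f u)) ≤ 1 ℕ.+ y ℕ.* (2 ℕ.+ y ℕ.* (3 ℕ.+ 2 ℕ.* S))
      double-sum xs ys f {S} xs≤ ys≤ h = ℕₚ.≤-trans (sumOver-size xs _ λ u → ℕₚ.≤-trans (sumOver-size ys (f u) (h u)) (s≤s (ℕₚ.*-monoˡ-≤ (3 ℕ.+ 2 ℕ.* S) ys≤)))
        (s≤s (ℕₚ.*-monoˡ-≤ (2 ℕ.+ y ℕ.* (3 ℕ.+ 2 ℕ.* S)) xs≤))

      oddPower-size : ∀ k r u z → sizeⁱ (oddPower k r u z) ≤ bound k
      oddPower-size k       zero    u z = 1≤bound k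
      oddPower-size zero    (suc r) u z = ℕₚ.≤-refl
      oddPower-size (suc k) (suc r) u z = ℕₚ.≤-trans (double-sum indices indices _ {bound k} small small (λ v w → ℕₚ.≤-trans
          (s≤s (ℕₚ.+-monoˡ-≤ 1 (ℕₚ.+-mono-≤ (oddPower-size k ⌊ r /2⌋ u v) (oddPower-size k ⌈ r /2⌉ v w))))
          (ℕₚ.≤-reflexive (arrange (bound k)))))
        (absorb (bound k) (1≤bound k))
        where
        arrange : ∀ S → suc (S ℕ.+ S ℕ.+ 1) ≡ 2 ℕ.+ 2 ℕ.* S
        arrange = solve-∀

-- Reachability of the components of arbitrary formulas.

module FormulaSources where

  open import Defs hiding (interchange; scaled)
  open Reals using (ℂ-ring)
  open Polynomials
  open Components
  open Alternating using (odd?)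
  open Reduction using (Reachable; reachable-resp; reachable-forms)
  open Convergence using (⇝-const)
  open Sequences using (pairsValue)
  open Sources using (pairsSize; reachLength; reachable-odd; reachable-even; odd?-+)
  open Representations
  open Sums
  open import Data.Nat as ℕ using (ℕ; zero; suc; _≤_; _<_; z≤n; s≤s)
  import Data.Nat.Properties as ℕₚ
  open import Data.Bool using (Bool; true; false; not; _xor_)
  open import Data.List using (List; []; _∷_; map; length)
  open import Data.List.Relation.Unary.All using (All; []; _∷_)
  import Data.List.Relation.Unary.All.Properties as Allₚ
  open import Data.Product using (∃; _×_; _,_)
  open import Data.Sum using (_⊎_; inj₁; inj₂)
  open import Function using (_∘_)
  open import Relation.Binary.PropositionalEquality as ≡ using (_≡_; refl; cong; subst)
  open import Algebra.Bundles using (CommutativeRing)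

  private
    module P = CommutativeRing Poly-ring
    module K = CommutativeRing ℂ-ring
  open RingSums Poly-ring

  evenOrOdd : ∀ d → (∃ λ r → d ≡ r ℕ.+ r) ⊎ (∃ λ r → d ≡ suc (r ℕ.+ r))
  evenOrOdd zero    = inj₁ (0 , refl)
  evenOrOdd (suc d) with evenOrOdd d
  ... | inj₁ (r , eq) = inj₂ (r , cong suc eq)
  ... | inj₂ (r , eq) = inj₁ (suc r , cong suc (≡.trans eq (≡.sym (ℕₚ.+-suc r r))))

  odd?-double : ∀ r → odd? (r ℕ.+ r) ≡ false
  odd?-double r = ≡.trans (odd?-+ r r) (same (odd? r))
    where
    same : ∀ b → (b xor b) ≡ false
    same true  = refl
    same false = refl

  component-idempotent : ∀ d p → component d (component d p) ≡ component d p
  component-idempotent d p = component-all (Allₚ.all-filter _ p)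

  -- The base y = 2 + 2s bounds the dimension of the representation and is at least 2. There is one
  -- factor y⁵ for each of the k levels of `oddPower`, and one more for the contraction with the
  -- outer vectors.
  sourceSize : ℕ → ℕ → ℕ
  sourceSize s k = ((2 ℕ.+ 2 ℕ.* s) ℕ.^ 5) ℕ.^ suc k

  module _ {p : Poly} (R : Representation p) (s k r : ℕ) (dim≤ : length (Representation.indices R) ≤ 2 ℕ.* s) (r< : r < 2 ℕ.^ k) where
    open Representation R
    open OddPowers indices μ
    private
      y = 2 ℕ.+ 2 ℕ.* s
      dim≤y : length indices ≤ y
      dim≤y = ℕₚ.≤-trans dim≤ (ℕₚ.m≤n+m _ 2)
      2≤y : 2 ≤ y
      2≤y = ℕₚ.m≤m+n 2 _
      G = oddPower k r
      S = bound y 2≤y dim≤y k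
      vector : I → Poly
      vector = const ∘ γ
      G-small : ∀ u z c → sizeⁱ (scaleⁱ c (G u z)) ≤ S
      G-small u z c = ℕₚ.≤-trans (ℕₚ.≤-reflexive (scaleⁱ-size c (G u z))) (oddPower-size y 2≤y dim≤y k r u z)
      S≤ : S ≤ 2 ℕ.+ 2 ℕ.* S
      S≤ = ℕₚ.≤-trans (ℕₚ.m≤m+n S (S ℕ.+ 0)) (ℕₚ.m≤n+m _ 2)

    oddSource : IHL
    oddSource = sumOver indices λ u → sumOver indices λ z → scaleⁱ (λ′ u K.* γ z) (G u z)

    oddSource-size : sizeⁱ oddSource ≤ sourceSize s k
    oddSource-size = ℕₚ.≤-trans (double-sum y 2≤y dim≤y indices indices _ {S} dim≤y dim≤y (λ u z → ℕₚ.≤-trans (G-small u z _) S≤))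
      (absorb y 2≤y dim≤y S (1≤bound y 2≤y dim≤y k))

    oddSource-value : valueⁱ oddSource ≋ component (suc (r ℕ.+ r)) p
    oddSource-value = ≋-trans (sumOver-value indices _) (≋-trans (∑-cong indices λ u →
        ≋-trans (sumOver-value indices _) (≋-trans (∑-cong indices λ z → rescale (λ′ u) (γ z) (G u z)) (≋-trans (≋-sym (∑-*ˡ indices (const (λ′ u)) _))
          (P.*-congˡ (apply-oddPower k r r< vector u)))))
      (≋-sym (represents (suc (r ℕ.+ r)))))
      where
      rescale : ∀ a b F → valueⁱ (scaleⁱ (a K.* b) F) ≋ const a * (valueⁱ F * const b)
      rescale a b F = ≋-trans (scaleⁱ-value (a K.* b) F) (≋-trans (P.*-congʳ (const-* a b)) (≋-trans (P.*-assoc _ _ _) (P.*-congˡ (P.*-comm _ _))))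

    column : I → IHL
    column v = sumOver indices λ z → scaleⁱ (γ z) (G v z)

    row : I → LinearForm
    row v = ∑ˡ indices λ u → scaleˡ (λ′ u) (μ u v)

    -- In degree 2r + 2 one transition is split off and contracted with `λ′` into a linear form for
    -- each state; the odd power that remains is contracted with `γ`. This gives the shape, linear
    -- form times odd formula, that an even degree must have.
    evenSource : List I → List (LinearForm × IHL)
    evenSource = map λ v → row v , column v

    column-value : ∀ v → valueⁱ (column v) ≋ steps indices μ (suc (r ℕ.+ r)) vector v
    column-value v = ≋-trans (sumOver-value indices _) (≋-trans (∑-cong indices λ z → ≋-trans (scaleⁱ-value (γ z) (G v z)) (P.*-comm _ _))
      (apply-oddPower k r r< vector v))

    evenSource-pairs : ∀ vs → pairsValue (evenSource vs) ≋ ∑ vs (λ v → linear (row v) * valueⁱ (column v))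
    evenSource-pairs []       = ≋-refl
    evenSource-pairs (v ∷ vs) = P.+-congˡ (evenSource-pairs vs)

    evenSource-value : pairsValue (evenSource indices) ≋ component (suc (suc (r ℕ.+ r))) p
    evenSource-value = begin
      pairsValue (evenSource indices)
        ≈⟨ evenSource-pairs indices ⟩
      ∑ indices (λ v → linear (row v) * valueⁱ (column v))
        ≈⟨ ∑-cong indices (λ v → ≋-trans (*-cong (linear-∑ indices _) (column-value v)) (∑-*ʳ indices _ _)) ⟩
      ∑ indices (λ v → ∑ indices λ u → linear (scaleˡ (λ′ u) (μ u v)) * state (suc (r ℕ.+ r)) v)
        ≈⟨ ∑-swap indices indices _ ⟩
      ∑ indices (λ u → ∑ indices λ v → linear (scaleˡ (λ′ u) (μ u v)) * state (suc (r ℕ.+ r)) v)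
        ≈⟨ ∑-cong indices (λ u → ≋-trans (∑-cong indices λ v → ≋-trans (P.*-congʳ (linear-scale (λ′ u) (μ u v))) (P.*-assoc _ _ _)) (≋-sym (∑-*ˡ indices (const (λ′ u)) _))) ⟩
      ∑ indices (λ u → const (λ′ u) * state (suc (suc (r ℕ.+ r))) u)
        ≈⟨ represents (suc (suc (r ℕ.+ r))) ⟨
      component (suc (suc (r ℕ.+ r))) p ∎
      where open import Relation.Binary.Reasoning.Setoid ≋-setoid

    evenSource-size : pairsSize (evenSource indices) ≤ sourceSize s k
    evenSource-size = ℕₚ.≤-trans (sizes indices) (ℕₚ.≤-trans (ℕₚ.*-mono-≤ dim≤y (ℕₚ.+-mono-≤ (s≤s (z≤n {1})) (ℕₚ.*-monoʳ-≤ y (ℕₚ.+-mono-≤ (s≤s (z≤n {2})) (ℕₚ.m≤m+n S (S ℕ.+ 0))))))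
      (ℕₚ.≤-trans (ℕₚ.n≤1+n _) (absorb y 2≤y dim≤y S (1≤bound y 2≤y dim≤y k))))
      where
      column-size : ∀ v → sizeⁱ (column v) ≤ 1 ℕ.+ y ℕ.* (1 ℕ.+ S)
      column-size v = ℕₚ.≤-trans (sumOver-size indices _ λ z → G-small v z (γ z)) (s≤s (ℕₚ.*-monoˡ-≤ (1 ℕ.+ S) dim≤y))
      sizes : ∀ vs → pairsSize (evenSource vs) ≤ length vs ℕ.* (1 ℕ.+ y ℕ.* (1 ℕ.+ S))
      sizes []       = z≤n
      sizes (v ∷ vs) = ℕₚ.+-mono-≤ (column-size v) (sizes vs)

  reachable-formula : ∀ a {N s} d k F → sizeᶠ F ≤ s → suc d ≤ 2 ℕ.^ k → reachLength (sourceSize s k) ≤ N →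
                      Reachable a N (suc d) (component (suc d) (valueᶠ F))
  reachable-formula a {N} {s} d k F size≤ d≤ len≤ = cases (evenOrOdd d)
    where
    R = represent F
    dim≤ : dimension R ≤ 2 ℕ.* s
    dim≤ = ℕₚ.≤-trans (represent-dimension F) (ℕₚ.*-monoʳ-≤ 2 size≤)
    Goal = Reachable a N (suc d) (component (suc d) (valueᶠ F))
    finish : ∀ q → q ≋ component (suc d) (valueᶠ F) → Reachable a N (suc d) (component (suc d) q) → Goal
    finish q e = reachable-resp {a} {N} {suc d} {component (suc d) q} {component (suc d) (valueᶠ F)}
      (≋-trans (component-cong (suc d) {q} {component (suc d) (valueᶠ F)} e) (≋-reflexive (component-idempotent (suc d) (valueᶠ F))))
    cases : (∃ λ r → d ≡ r ℕ.+ r) ⊎ (∃ λ r → d ≡ suc (r ℕ.+ r)) → Goal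
    cases (inj₁ (r , eq)) = finish (valueⁱ (oddSource R s k r dim≤ r<)) (subst (λ d → valueⁱ (oddSource R s k r dim≤ r<) ≋ component (suc d) (valueᶠ F)) (≡.sym eq) (oddSource-value R s k r dim≤ r<))
        (reachable-odd a {sourceSize s k} d (oddSource R s k r dim≤ r<) (≡.trans (cong (not ∘ odd?) eq) (cong not (odd?-double r))) (oddSource-size R s k r dim≤ r<) len≤)
      where
      r< : r < 2 ℕ.^ k
      r< = ℕₚ.<-≤-trans (s≤s (ℕₚ.≤-trans (ℕₚ.m≤m+n r r) (ℕₚ.≤-reflexive (≡.sym eq)))) d≤
    cases (inj₂ (r , eq)) = finish (pairsValue L) (subst (λ d → pairsValue L ≋ component (suc d) (valueᶠ F)) (≡.sym eq) (evenSource-value R s k r dim≤ r<))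
        (reachable-even a {sourceSize s k} d L (≡.trans (cong (not ∘ odd?) eq) (≡.trans (cong (not ∘ not) (odd?-double r)) refl)) (evenSource-size R s k r dim≤ r<) len≤)
      where
      r< : r < 2 ℕ.^ k
      r< = ℕₚ.<-≤-trans (s≤s (ℕₚ.≤-trans (ℕₚ.m≤m+n r r) (ℕₚ.≤-trans (ℕₚ.n≤1+n _) (ℕₚ.≤-reflexive (≡.sym eq))))) d≤
      L = evenSource R s k r dim≤ r< (Representation.indices R)

  reachable-zero : ∀ a N d → Reachable a N (suc d) []
  reachable-zero a N d = reachable-forms a {n = 0} {d = suc d} {[]} (λ _ → []) (λ _ → z≤n) z≤n (⇝-const [])

-- Permanents, affine substitutions and the comparison of the classes.

open import Defs hiding (interchange; scaled)
open Reals using (ℂ-ring)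
open Polynomials
open Components
open Convergence
open Alternating using (odd?; alt; labelled; range; C-alt; alt-⟨⟩; alt-cong; ⟨⟩-∑)
open Reduction
open Sources
open FormulaSources
open AlternatingFormulas
open Growth
open Extraction using (⇝-component)
open Sums
open import Data.Nat as ℕ using (ℕ; zero; suc; _≤_; _<_; _<?_; z≤n; s≤s)
import Data.Nat.Properties as ℕₚ
open import Data.Nat.Logarithm using (⌊log₂_⌋)
open import Data.Nat.Tactic.RingSolver using (solve-∀)
open import Data.Bool using (Bool; true)
open import Data.Fin as Fin using (Fin; toℕ; fromℕ<; combine; remQuot)
import Data.Fin.Properties as Finₚ
open import Data.List using (List; []; _∷_; _++_; map; length; tabulate)
import Data.List.Properties as Listₚ
open import Data.List.Relation.Unary.All as All using (All; []; _∷_)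
import Data.List.Relation.Unary.All.Properties as Allₚ
open import Data.Vec using (Vec; lookup)
open import Data.Product using (∃; _×_; _,_; proj₁; proj₂)
open import Function using (_∘_)
open import Function.Bundles using (_⇔_; mk⇔)
open import Relation.Nullary using (Dec; yes; no; contradiction)
open import Relation.Unary using (_⊆_)
open import Relation.Binary.PropositionalEquality as ≡ using (_≡_; refl; cong; cong₂; subst)
open import Algebra.Bundles using (CommutativeRing)

private
  module P = CommutativeRing Poly-ring
  module K = CommutativeRing ℂ-ring
open RingSums Poly-ring

tabulate-cong : ∀ {n} (f g : Fin n → Poly) → (∀ i → f i ≋ g i) → productᵖ (tabulate f) ≋ productᵖ (tabulate g)
tabulate-cong {zero}  f g eq = ≋-refl
tabulate-cong {suc n} f g eq = ≋-trans (≋-reflexive (*-def (f Fin.zero) (productᵖ (tabulate (f ∘ Fin.suc)))))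
  (≋-trans (*-cong (eq Fin.zero) (tabulate-cong (f ∘ Fin.suc) (g ∘ Fin.suc) (eq ∘ Fin.suc)))
    (≋-reflexive (≡.sym (*-def (g Fin.zero) (productᵖ (tabulate (g ∘ Fin.suc)))))))

tabulate-⟨⟩ : ∀ {n} (f : Fin n → Poly) s → productᵖ (tabulate f) ⟨ s ⟩ ≋ productᵖ (tabulate λ i → f i ⟨ s ⟩)
tabulate-⟨⟩ {zero}  f s = ⟨⟩-const 1ℂ s
tabulate-⟨⟩ {suc n} f s = ≋-trans (⟨⟩-cong (≋-reflexive (*-def (f Fin.zero) (productᵖ (tabulate (f ∘ Fin.suc))))) (λ _ → ≋-refl))
  (≋-trans (⟨⟩-* (f Fin.zero) _ s) (≋-trans (P.*-congˡ (tabulate-⟨⟩ (f ∘ Fin.suc) s))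
    (≋-reflexive (≡.sym (*-def (f Fin.zero ⟨ s ⟩) (productᵖ (tabulate λ i → f (Fin.suc i) ⟨ s ⟩)))))))

permanent-∑ : ∀ {n} (M : Fin n → Fin n → Poly) → permanent M ≡ ∑ (permutations n) (λ σ → productᵖ (tabulate λ i → M i (lookup σ i)))
permanent-∑ {n} M = sumᵖ-map _ (permutations n)

permanent-cong : ∀ {n} (M N : Fin n → Fin n → Poly) → (∀ i j → M i j ≋ N i j) → permanent M ≋ permanent N
permanent-cong {n} M N eq = ≋-trans (≋-reflexive (permanent-∑ M)) (≋-trans
  (∑-cong (permutations n) λ σ → tabulate-cong (λ i → M i (lookup σ i)) (λ i → N i (lookup σ i)) λ i → eq i (lookup σ i)) (≋-reflexive (≡.sym (permanent-∑ N))))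

permanent-⟨⟩ : ∀ {n} (M : Fin n → Fin n → Poly) s → permanent M ⟨ s ⟩ ≋ permanent (λ i j → M i j ⟨ s ⟩)
permanent-⟨⟩ {n} M s = ≋-trans (⟨⟩-cong (≋-reflexive (permanent-∑ M)) (λ _ → ≋-refl)) (≋-trans
  (⟨⟩-∑ (permutations n) (λ σ → productᵖ (tabulate λ i → M i (lookup σ i))) s)
  (≋-trans (∑-cong (permutations n) λ σ → tabulate-⟨⟩ (λ i → M i (lookup σ i)) s)
    (≋-reflexive (≡.sym (permanent-∑ λ i j → M i j ⟨ s ⟩)))))

per-terms : ∀ n → AllTerms (λ m → length m ≡ n) (permanent (generic n))
per-terms n = +-terms _ (Allₚ.map⁺ (All.universal (λ σ → product-degree _ λ i → refl ∷ []) (permutations n)))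

per∈VNP : VNP per
per∈VNP = (λ n → n) , like⇒poly polyLike-id , λ n → n , ℕₚ.≤-refl , indeterminate n , ≋⇒≈ (permanent-cong _ _ λ i j → entry n i j)
  where
  indeterminate : ∀ n → Fin n → Fin n → Affine
  indeterminate n i j = 0ℂ , ((1ℂ , toℕ (combine i j)) ∷ [])
  entry : ∀ n i j → affine (indeterminate n i j) ≋ generic n i j
  entry n i j = ≋-trans (affine-def 0ℂ ((1ℂ , toℕ (combine i j)) ∷ [])) (≋-trans (P.+-congʳ const-0) (P.+-identityˡ _))

per-supported : ∀ n d → Supported (n ℕ.* n) d (GradedPFamily.poly (graded per) n d)
per-supported n d = supported
  (component-variables d (permanent (generic n)) (proj₂ (proj₂ (proj₂ (proj₂ (PFamily.variables per)) n))))
  (λ m occ → ℕₚ.≤-reflexive (component-homogeneous d (permanent (generic n)) m occ))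

PerReachable : ℕ → ℕ → Set
PerReachable N n = ∀ d → Reachable (n ℕ.* n) N (suc d) (component (suc d) (permanent (generic n)))

per⊴C : ∀ N n → PerReachable N n → ∀ d → GradedPFamily.poly (graded per) n d ⊴homlin[ d ] GradedPFamily.poly C N d
per⊴C N n reach zero    = C-0 N
per⊴C N n reach (suc d) = reachable⇒⊴ (per-supported n (suc d)) (reach d)

reachable-border : ∀ {N n d} (h : ℕ → Poly) {g} → (∀ j → h j ≋ g j) → g ⟶ permanent (generic n) →
                   (∀ j → Reachable (n ℕ.* n) N (suc d) (component (suc d) (h j))) →
                   Reachable (n ℕ.* n) N (suc d) (component (suc d) (permanent (generic n)))
reachable-border {N} {n} {d} h {g} h≋g g⟶per reach = reachable-limit {n ℕ.* n} {N} {suc d} {λ j → component (suc d) (h j)} {component (suc d) (permanent (generic n))}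
  reach (⇝-component {h} {permanent (generic n)} (suc d) (⇝-resp {g} {h} (λ j → ≋-sym (h≋g j)) ≋-refl (⟶⇒⇝ {g} {permanent (generic n)} g⟶per)))

graded-values⇒reachable : ∀ n B (F : ℕ → GradedIHL) {g} → (∀ j → GradedIHL.size (F j) ≤ B) → (∀ j → GradedIHL.value (F j) ≋ g j) →
                          g ⟶ permanent (generic n) → PerReachable (reachLength B) n
graded-values⇒reachable n B F {g} size≤ value≋ g⟶per d = reachable-border {reachLength B} {n} {d} (λ j → GradedIHL.value (F j)) value≋ g⟶per
  (λ j → reachable-graded (F j) (n ℕ.* n) {B} {reachLength B} d (size≤ j) (ℕₚ.≤-refl {reachLength B}))

border-graded⇒reachable : ∀ n B → border gradedIHLSize (permanent (generic n)) B → PerReachable (reachLength B) n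
border-graded⇒reachable n B (g , small , g⟶per) = graded-values⇒reachable n B (λ j → proj₁ (small j)) {g}
  (λ j → proj₁ (proj₂ (small j)))
  (λ j → ≈⇒≋ {GradedIHL.value (proj₁ (small j))} {g j} (proj₁ (proj₂ (proj₂ (small j))))) g⟶per

-- The permanent of size n lives in degree n only, and n < 2^(1 + ⌊log₂ n⌋), so logarithmic depth is
-- enough for its one nonzero component; the other components are zero and are reached by the empty
-- word.
formula-values⇒reachable : ∀ n B (F : ℕ → Formula) {g} → (∀ j → sizeᶠ (F j) ≤ B) → (∀ j → valueᶠ (F j) ≋ g j) →
                           g ⟶ permanent (generic n) → PerReachable (reachLength (sourceSize B (1 ℕ.+ ⌊log₂ n ⌋))) n
formula-values⇒reachable n B F {g} size≤ value≋ g⟶per d = decide (suc d ℕ.≟ n)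
  where
  k = 1 ℕ.+ ⌊log₂ n ⌋
  N = reachLength (sourceSize B k)
  Goal = Reachable (n ℕ.* n) N (suc d) (component (suc d) (permanent (generic n)))
  decide : Dec (suc d ≡ n) → Goal
  decide (yes d≡n) = reachable-border {N} {n} {d} (λ j → valueᶠ (F j)) value≋ g⟶per
    (λ j → reachable-formula (n ℕ.* n) {N} {B} d k (F j) (size≤ j)
      (ℕₚ.≤-trans (ℕₚ.≤-reflexive d≡n) (ℕₚ.<⇒≤ (n<2^ n))) (ℕₚ.≤-refl {N}))
  decide (no d≢n) = reachable-resp {n ℕ.* n} {N} {suc d} {[]} {component (suc d) (permanent (generic n))}
    (≋-reflexive (≡.sym (component-none (All.map (λ l d≡ → d≢n (≡.trans (≡.sym d≡) l)) (per-terms n)))))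
    (reachable-zero (n ℕ.* n) N d)

border-formula⇒reachable : ∀ n B → border formulaSize (permanent (generic n)) B → PerReachable (reachLength (sourceSize B (1 ℕ.+ ⌊log₂ n ⌋))) n
border-formula⇒reachable n B (g , small , g⟶per) = formula-values⇒reachable n B (λ j → proj₁ (small j)) {g}
  (λ j → proj₁ (proj₂ (small j)))
  (λ j → ≈⇒≋ {valueᶠ (proj₁ (small j))} {g j} (proj₂ (proj₂ (small j)))) g⟶per

substituteᵃ : (ℕ → Affine) → LinearForm → Affine
substituteᵃ s []            = 0ℂ , []
substituteᵃ s ((c , i) ∷ ℓ) = c K.* proj₁ (s i) K.+ proj₁ (substituteᵃ s ℓ) , scaleˡ c (proj₂ (s i)) ++ proj₂ (substituteᵃ s ℓ)

substituteᵃ-value : ∀ s ℓ → linear ℓ ⟨ affine ∘ s ⟩ ≋ affine (substituteᵃ s ℓ)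
substituteᵃ-value s []            = ≋-sym const-0
substituteᵃ-value s ((c , i) ∷ ℓ) = begin
  ((c , i ∷ []) ∷ linear ℓ) ⟨ affine ∘ s ⟩
    ≈⟨ ⟨⟩-cong (≋-reflexive (+-def ((c , i ∷ []) ∷ []) (linear ℓ))) (λ _ → ≋-refl) ⟩
  (((c , i ∷ []) ∷ []) + linear ℓ) ⟨ affine ∘ s ⟩
    ≈⟨ ⟨⟩-+ ((c , i ∷ []) ∷ []) (linear ℓ) (affine ∘ s) ⟩
  ((c , i ∷ []) ∷ []) ⟨ affine ∘ s ⟩ + linear ℓ ⟨ affine ∘ s ⟩
    ≈⟨ +-cong (≋-trans (≋-reflexive (⟨⟩-def ((c , i ∷ []) ∷ []) (affine ∘ s))) (≋-trans (P.+-identityʳ _) (P.*-congˡ (P.*-identityʳ _)))) (substituteᵃ-value s ℓ) ⟩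
  const c * affine (s i) + affine (substituteᵃ s ℓ)
    ≈⟨ +-cong (≋-trans (≋-sym (affine-scale c (s i))) (affine-def _ _)) (affine-def _ _) ⟩
  (const (c K.* proj₁ (s i)) + linear (scaleˡ c (proj₂ (s i)))) + (const (proj₁ (substituteᵃ s ℓ)) + linear (proj₂ (substituteᵃ s ℓ)))
    ≈⟨ exchange _ _ _ _ ⟩
  (const (c K.* proj₁ (s i)) + const (proj₁ (substituteᵃ s ℓ))) + (linear (scaleˡ c (proj₂ (s i))) + linear (proj₂ (substituteᵃ s ℓ)))
    ≈⟨ +-cong (≋-sym (const-+ _ _)) (≋-sym (linear-++ _ _)) ⟩
  const (proj₁ (substituteᵃ s ((c , i) ∷ ℓ))) + linear (proj₂ (substituteᵃ s ((c , i) ∷ ℓ)))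
    ≈⟨ affine-def _ _ ⟨
  affine (substituteᵃ s ((c , i) ∷ ℓ)) ∎
  where
  open import Relation.Binary.Reasoning.Setoid ≋-setoid
  open import Algebra.Properties.CommutativeSemigroup P.+-commutativeSemigroup using () renaming (interchange to exchange)

-- A linear image of `C` is an alternating sum along a word of N linear letters, and an affine
-- substitution only turns these letters into affine ones. The formula is built after the
-- substitution, so its size does not depend on how many variables the forms contain.
pullback-formula : ∀ {a b} N D (A : Fin b → Fin a → ℂ) (s : ℕ → Affine) →
  ∃ λ F → sizeᶠ F ≤ formulaBound (D ℕ.+ N) × valueᶠ F ≋ pullback (GradedPFamily.poly C N D) A ⟨ affine ∘ s ⟩
pullback-formula {a} {b} N D A s = proj₁ formula
  , subst (λ l → sizeᶠ (proj₁ formula) ≤ formulaBound (D ℕ.+ l)) (≡.trans (Listₚ.length-map _ (range 1 N)) (range-length 1 N)) (proj₁ (proj₂ formula))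
  , ≋-trans (proj₂ (proj₂ formula)) (≋-sym value)
  where
  Def = pullback-def (GradedPFamily.poly C N D) A
  image = proj₁ Def
  range-length : ∀ i n → length (range i n) ≡ n
  range-length i zero    = refl
  range-length i (suc n) = cong suc (range-length (suc i) n)
  letterOf : ∀ j → ∃ λ x → image j ⟨ affine ∘ s ⟩ ≋ affine x
  letterOf j = decide (j <? b)
    where
    decide : Dec (j < b) → ∃ λ x → image j ⟨ affine ∘ s ⟩ ≋ affine x
    decide (yes j<b) = substituteᵃ s ℓ , ≋-trans (⟨⟩-cong (≋-reflexive (proj₁ (proj₂ (proj₂ Def)) j j<b)) (λ _ → ≋-refl)) (substituteᵃ-value s ℓ)
      where
      ℓ : LinearForm
      ℓ = tabulate λ i → A (fromℕ< j<b) i , toℕ i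
    decide (no j≮b) = substituteᵃ s [] , ≋-trans (⟨⟩-cong (≋-reflexive (proj₂ (proj₂ (proj₂ Def)) j j≮b)) (λ _ → ≋-refl)) (substituteᵃ-value s [])
  word : AffineWord
  word = map (λ j → odd? j , proj₁ (letterOf j)) (range 1 N)
  formula = alt-formula word D
  open import Relation.Binary.Reasoning.Setoid ≋-setoid
  value : pullback (GradedPFamily.poly C N D) A ⟨ affine ∘ s ⟩ ≋ alt true D ⟪ word ⟫
  value = begin
    pullback (GradedPFamily.poly C N D) A ⟨ affine ∘ s ⟩
      ≈⟨ ⟨⟩-cong (≋-trans (≋-reflexive (proj₁ (proj₂ Def))) (C-alt N D image)) (λ _ → ≋-refl) ⟩
    alt true D (labelled image (range 1 N)) ⟨ affine ∘ s ⟩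
      ≈⟨ alt-⟨⟩ true D (labelled image (range 1 N)) (affine ∘ s) ⟩
    alt true D (map (λ (b , p) → b , p ⟨ affine ∘ s ⟩) (labelled image (range 1 N)))
      ≈⟨ ≋-reflexive (cong (alt true D) (≡.sym (Listₚ.map-∘ (range 1 N)))) ⟩
    alt true D (map (λ j → odd? j , image j ⟨ affine ∘ s ⟩) (range 1 N))
      ≈⟨ alt-cong true D _ _ (range 1 N) (λ j → refl , proj₂ (letterOf j)) ⟩
    alt true D (map (λ j → odd? j , affine (proj₁ (letterOf j))) (range 1 N))
      ≈⟨ ≋-reflexive (cong (alt true D) (Listₚ.map-∘ (range 1 N))) ⟩
    alt true D ⟪ word ⟫ ∎

entries : ∀ {k} → (Fin k → Fin k → Affine) → ℕ → Affine
entries {k} M t with t <? k ℕ.* k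
... | yes t<k² = M (proj₁ (remQuot k (fromℕ< t<k²))) (proj₂ (remQuot {k} k (fromℕ< t<k²)))
... | no  _    = 0ℂ , []

entries-combine : ∀ {k} (M : Fin k → Fin k → Affine) i j → entries M (toℕ (combine i j)) ≡ M i j
entries-combine {k} M i j with toℕ (combine i j) <? k ℕ.* k
... | yes t<k² = cong (λ ij → M (proj₁ ij) (proj₂ ij)) (≡.trans (cong (remQuot k) (Finₚ.fromℕ<-toℕ (combine i j) t<k²)) (Finₚ.remQuot-combine i j))
... | no  t≮k² = contradiction (Finₚ.toℕ<n (combine i j)) t≮k²

substituted-permanent : ∀ k (M : Fin k → Fin k → Affine) →
  component k (permanent (generic k)) ⟨ affine ∘ entries M ⟩ ≋ permanent (λ i j → affine (M i j))
substituted-permanent k M = ≋-trans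
  (⟨⟩-cong {component k (permanent (generic k))} {permanent (generic k)} (≋-reflexive (component-all {k} {permanent (generic k)} (per-terms k))) (λ _ → ≋-refl))
  (≋-trans (permanent-⟨⟩ (generic k) (affine ∘ entries M))
    (permanent-cong (λ i j → generic k i j ⟨ affine ∘ entries M ⟩) (λ i j → affine (M i j))
      λ i j → ≋-trans (⟨⟩-var (toℕ (combine i j)) (affine ∘ entries M)) (≋-reflexive (cong affine (entries-combine M i j)))))

border-values : ∀ {B p} (F : ℕ → Formula) → (∀ j → sizeᶠ (F j) ≤ B) → (λ j → valueᶠ (F j)) ⇝ p → border formulaSize p B
border-values F size≤ conv = (λ j → valueᶠ (F j)) , (λ j → F j , size≤ j , ≋⇒≈ {valueᶠ (F j)} ≋-refl) , ⇝⇒⟶ conv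

border-substituted : ∀ {a b} N k (M : Fin k → Fin k → Affine) (A : ℕ → Fin b → Fin a → ℂ) →
  (λ j → pullback (GradedPFamily.poly C N k) (A j)) ⟶ component k (permanent (generic k)) →
  border formulaSize (permanent (λ i j → affine (M i j))) (formulaBound (k ℕ.+ N))
border-substituted N k M A conv = border-values (λ j → proj₁ (formula j)) (λ j → proj₁ (proj₂ (formula j)))
  (⇝-resp (λ j → ≋-sym (proj₂ (proj₂ (formula j)))) (substituted-permanent k M) (⇝-⟨⟩ (affine ∘ entries M) (⟶⇒⇝ {λ j → pullback (GradedPFamily.poly C N k) (A j)} {component k (permanent (generic k))} conv)))
  where
  formula : ∀ j → ∃ λ F → sizeᶠ F ≤ formulaBound (k ℕ.+ N) × valueᶠ F ≋ pullback (GradedPFamily.poly C N k) (A j) ⟨ affine ∘ entries M ⟩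
  formula j = pullback-formula N k (A j) (entries M)

border-permanent : ∀ N k (M : Fin k → Fin k → Affine) →
  GradedPFamily.poly (graded per) k k ⊴homlin[ k ] GradedPFamily.poly C N k →
  border formulaSize (permanent (λ i j → affine (M i j))) (formulaBound (k ℕ.+ N))
-- In degree 0 the reduction provides no approximating sequence, but the empty permanent is the
-- constant 1 and has a leaf as its formula.
border-permanent N zero M _ = border-values (λ _ → leaf (1ℂ , [])) (λ _ → 1≤^ (2 ℕ.+ N) formulaExponent (s≤s z≤n)) (⇝-const (const 1ℂ))
border-permanent N (suc k) M (a , b , _ , _ , A , conv) = border-substituted N (suc k) M A conv

border-resp : ∀ {p q B} → p ≋ q → border formulaSize p B → border formulaSize q B
border-resp {p} {q} p≋q (g , small , g⟶p) = g , small , ⟶-resp {g} {g} {p} {q} (λ _ → ≋-refl) p≋q g⟶p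

-- The permanent of size k is its own component of degree k, so the reduction is invoked at (k, k),
-- and the entries of the matrix are substituted in the approximants.
lower-complexity : ∀ (m : ℕ → ℕ) → (∀ n d → GradedPFamily.poly (graded per) n d ⊴homlin[ d ] GradedPFamily.poly C (m n) d) →
  ∀ p B → permanentalComplexity p B → ∃ λ k → k ≤ B × border formulaSize p (formulaBound (k ℕ.+ m k))
lower-complexity m reduces p B (k , k≤B , M , per≈p) = k , k≤B ,
  border-resp {permanent (λ i j → affine (M i j))} {p} (≈⇒≋ {permanent (λ i j → affine (M i j))} {p} per≈p) (border-permanent (m k) k M (reduces k k))

polyLike-+ : ∀ {m m′ : ℕ → ℕ} → PolyLike m → PolyLike m′ → PolyLike (λ n → m n ℕ.+ m′ n)
polyLike-+ (c , h) (c′ , h′) = suc (c ℕ.+ c′) , λ n → ℕₚ.≤-trans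
  (ℕₚ.+-mono-≤ (ℕₚ.≤-trans (h n) (^-monoʳ (2 ℕ.+ n) (s≤s z≤n) (ℕₚ.m≤m+n c c′))) (ℕₚ.≤-trans (h′ n) (^-monoʳ (2 ℕ.+ n) (s≤s z≤n) (ℕₚ.m≤n+m c′ c))))
  (ℕₚ.≤-trans (ℕₚ.≤-reflexive (double ((2 ℕ.+ n) ℕ.^ (c ℕ.+ c′)))) (ℕₚ.*-monoˡ-≤ ((2 ℕ.+ n) ℕ.^ (c ℕ.+ c′)) (ℕₚ.m≤m+n 2 n)))
  where
  double : ∀ x → x ℕ.+ x ≡ 2 ℕ.* x
  double = solve-∀

quasiLike-+ : ∀ {m m′ : ℕ → ℕ} → QuasiLike m → QuasiLike m′ → QuasiLike (λ n → m n ℕ.+ m′ n)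
quasiLike-+ (c , h) (c′ , h′) = suc (c ℕ.+ c′) , λ n 2≤n → ℕₚ.≤-trans
  (ℕₚ.+-mono-≤ (ℕₚ.≤-trans (h n 2≤n) (^-monoʳ 2 (s≤s z≤n) (^-monoʳ (2 ℕ.+ ⌊log₂ n ⌋) (s≤s z≤n) (ℕₚ.m≤m+n c c′))))
               (ℕₚ.≤-trans (h′ n 2≤n) (^-monoʳ 2 (s≤s z≤n) (^-monoʳ (2 ℕ.+ ⌊log₂ n ⌋) (s≤s z≤n) (ℕₚ.m≤n+m c′ c)))))
  (ℕₚ.≤-trans (ℕₚ.≤-reflexive (double (2 ℕ.^ ((2 ℕ.+ ⌊log₂ n ⌋) ℕ.^ (c ℕ.+ c′))))) (^-monoʳ 2 (s≤s z≤n) (grow ⌊log₂ n ⌋ (c ℕ.+ c′))))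
  where
  double : ∀ x → x ℕ.+ x ≡ 2 ℕ.* x
  double = solve-∀
  grow : ∀ l e → suc ((2 ℕ.+ l) ℕ.^ e) ≤ (2 ℕ.+ l) ℕ.* (2 ℕ.+ l) ℕ.^ e
  grow l e = ℕₚ.≤-trans (ℕₚ.+-monoˡ-≤ ((2 ℕ.+ l) ℕ.^ e) (1≤^ (2 ℕ.+ l) e (s≤s z≤n))) (ℕₚ.≤-trans (ℕₚ.≤-reflexive (double ((2 ℕ.+ l) ℕ.^ e))) (ℕₚ.*-monoˡ-≤ ((2 ℕ.+ l) ℕ.^ e) (ℕₚ.m≤m+n 2 l)))

-- The 1 + log n levels and the additional factor of `sourceSize` give the exponent 5 (2 + log n),
-- so a quasipolynomial base remains quasipolynomial.
sourceSize-quasiLike : ∀ {b} → QuasiLike b → QuasiLike (λ n → sourceSize (b n) (1 ℕ.+ ⌊log₂ n ⌋))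
sourceSize-quasiLike {b} qb = quasiLike-mono bound (quasiLike-power {λ n → b n ℕ.+ b n} 5 1 (quasiLike-+ {b} {b} qb qb))
  where
  bound : ∀ n → 2 ≤ n → sourceSize (b n) (1 ℕ.+ ⌊log₂ n ⌋) ≤ (2 ℕ.+ (b n ℕ.+ b n)) ℕ.^ (5 ℕ.* (2 ℕ.+ ⌊log₂ n ⌋) ℕ.^ 1)
  bound n _ = ℕₚ.≤-reflexive (≡.trans (ℕₚ.^-*-assoc (2 ℕ.+ 2 ℕ.* b n) 5 (2 ℕ.+ ⌊log₂ n ⌋))
    (cong₂ (λ x e → (2 ℕ.+ x) ℕ.^ (5 ℕ.* e)) (cong (b n ℕ.+_) (ℕₚ.+-identityʳ (b n))) (≡.sym (ℕₚ.*-identityʳ (2 ℕ.+ ⌊log₂ n ⌋)))))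

quasiLike-^ : ∀ {m} k → QuasiLike m → QuasiLike (λ n → (2 ℕ.+ m n) ℕ.^ k)
quasiLike-^ {m} k qm = quasiLike-mono (λ n _ → ℕₚ.≤-reflexive (cong ((2 ℕ.+ m n) ℕ.^_) (≡.sym (ℕₚ.*-identityʳ k)))) (quasiLike-power {m} k 0 qm)

theorem3p3 : (VNP ⊆ V3F‾ → graded per ⊴p-homlin C)
    × (graded per ⊴p-homlin C → VNP ⊆ VF‾)
    × ((VNP ⊆ VQP‾) ⇔ (graded per ⊴qp-homlin C))
theorem3p3 = part₁ , part₂ , mk⇔ part₃ part₄
  where
  part₁ : VNP ⊆ V3F‾ → graded per ⊴p-homlin C
  part₁ contained = reduction (contained {per} per∈VNP)
    where
    reduction : V3F‾ per → graded per ⊴p-homlin C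
    reduction (b , poly-b , small) = (λ n → reachLength (b n))
      , like⇒poly (polyLike-mono (λ n → reachLength-bound (b n)) (polyLike-power {b} reachExponent (poly⇒like poly-b)))
      , λ n → per⊴C (reachLength (b n)) n (border-graded⇒reachable n (b n) (small n))

  part₂ : graded per ⊴p-homlin C → VNP ⊆ VF‾
  part₂ (m , poly-m , reduces) {f} (b , poly-b , small) = (λ n → formulaBound (k n ℕ.+ m (k n)))
    , like⇒poly (polyLike-power {λ n → k n ℕ.+ m (k n)} formulaExponent (polyLike-+ {k} {m ∘ k} (polyLike-mono {k} {b} k≤b (poly⇒like poly-b))
        (polyLike-∘ {m} {k} {b} (poly⇒like poly-m) (poly⇒like poly-b) k≤b)))
    , λ n → proj₂ (proj₂ (lower n))
    where
    lower : ∀ n → ∃ λ k → k ≤ b n × border formulaSize (PFamily.poly f n) (formulaBound (k ℕ.+ m k))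
    lower n = lower-complexity m reduces (PFamily.poly f n) (b n) (small n)
    -- The reduction is invoked at the size of the permanent that represents the n-th polynomial,
    -- not at n itself, so its bound `m` enters through a composition.
    k : ℕ → ℕ
    k n = proj₁ (lower n)
    k≤b : ∀ n → k n ≤ b n
    k≤b n = proj₁ (proj₂ (lower n))

  part₃ : VNP ⊆ VQP‾ → graded per ⊴qp-homlin C
  part₃ contained = reduction (contained {per} per∈VNP)
    where
    reduction : VQP‾ per → graded per ⊴qp-homlin C
    reduction (b , quasi-b , small) = (λ n → reachLength (sourceSize (b n) (1 ℕ.+ ⌊log₂ n ⌋)))
      , like⇒quasi (quasiLike-mono (λ n _ → reachLength-bound (sourceSize (b n) (1 ℕ.+ ⌊log₂ n ⌋)))
          (quasiLike-^ {λ n → sourceSize (b n) (1 ℕ.+ ⌊log₂ n ⌋)} reachExponent (sourceSize-quasiLike {b} (quasi⇒like {b} quasi-b))))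
      , λ n → per⊴C (reachLength (sourceSize (b n) (1 ℕ.+ ⌊log₂ n ⌋))) n (border-formula⇒reachable n (b n) (small n))

  part₄ : graded per ⊴qp-homlin C → VNP ⊆ VQP‾
  part₄ (m , quasi-m , reduces) {f} (b , poly-b , small) = (λ n → formulaBound (k n ℕ.+ m (k n)))
    , like⇒quasi (quasiLike-^ {λ n → k n ℕ.+ m (k n)} formulaExponent (quasiLike-+ {k} {m ∘ k} (polyLike⇒quasiLike {k} (polyLike-mono {k} {b} k≤b (poly⇒like poly-b)))
        (quasiLike-∘ {m} {k} {b} (quasi⇒like {m} quasi-m) (poly⇒like poly-b) k≤b)))
    , λ n → proj₂ (proj₂ (lower n))
    where
    lower : ∀ n → ∃ λ k → k ≤ b n × border formulaSize (PFamily.poly f n) (formulaBound (k ℕ.+ m k))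
    lower n = lower-complexity m reduces (PFamily.poly f n) (b n) (small n)
    k : ℕ → ℕ
    k n = proj₁ (lower n)
    k≤b : ∀ n → k n ≤ b n
    k≤b n = proj₁ (proj₂ (lower n))
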